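{- For $d\ge 1$ let $Q_d$ be the $d$-dimensional Hamming cube and let $\mathcal{F}$ be the set of all maps $f\colon \{0,1\}^d\to\mathbb{Z}$ with $f(\underline{0})=0$ and $|f(u)-f(v)|=1$ whenever $u,v$ are adjacent in $Q_d$. For $i\ge 1$ let $\mathcal{F}_i=\{f\in\mathcal{F}: |\{f(v): v\in\{0,1\}^d\}|=i\}$. Then $$|\mathcal{F}|=(2e\pm e^{ -\Omega(d)})2^{2^{d-1}},\qquad |\mathcal{F}_3|=(2\pm e^{ -\Omega(d)})2^{2^{d-1}},$$ $$|\mathcal{F}_4|=(4\sqrt{e}-4\pm e^{ -\Omega(d)})2^{2^{d-1}},\qquad |\mathcal{F}_5|=(2e-4\sqrt{e}+2\pm e^{ -\Omega(d)})2^{2^{d-1}}.$$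
   Context: $Q_d$ is the graph on $\{0,1\}^d$ in which two strings are adjacent iff they differ in exactly one coordinate; $\underline{0}$ is the all-zero string. The notation $x=(y\pm e^{ -\Omega(d)})z$ means that there is an absolute constant $c>0$ such that $|x-yz|\le e^{ -cd}z$ for all sufficiently large $d$. -}

module Defs where

open import Level using (0ℓ)
open import Data.Bool using (Bool; false; true; if_then_else_)
open import Data.Nat as ℕ using (ℕ; zero; suc)
open import Data.Integer as ℤ using (ℤ; +_)
open import Data.Rational as ℚ using (ℚ; 0ℚ; 1ℚ; _+_; _*_; _-_; _≤_; _<_; ∣_∣)
open import Data.Fin using (Fin)
open import Data.Vec using (Vec; replicate; zipWith; toList)
open import Data.List using (List; map)
open import Data.Nat.ListAction using (sum)
open import Data.Product using (Σ; ∃; _×_)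
import Data.Product
open import Relation.Binary.PropositionalEquality as ≡ using (_≡_)
open import Relation.Binary.Bundles using (Setoid)
open import Function.Bundles using (Inverse)

Vertex : ℕ → Set
Vertex d = Vec Bool d

zeroVertex : (d : ℕ) → Vertex d
zeroVertex d = replicate d false

differ : Bool → Bool → ℕ
differ false false = 0
differ true  true  = 0
differ _     _     = 1

hamming : {d : ℕ} → Vertex d → Vertex d → ℕ
hamming u v = sum (toList (zipWith differ u v))

Adjacent : {d : ℕ} → Vertex d → Vertex d → Set
Adjacent u v = hamming u v ≡ 1

IsHom : (d : ℕ) → (Vertex d → ℤ) → Set
IsHom d f = (f (zeroVertex d) ≡ + 0)
          × (∀ u v → Adjacent u v → ℤ.∣ f u ℤ.- f v ∣ ≡ 1)

HasSize : Setoid 0ℓ 0ℓ → ℕ → Set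
HasSize S n = Inverse (≡.setoid (Fin n)) S

Image : {d : ℕ} → (Vertex d → ℤ) → Setoid 0ℓ 0ℓ
Image {d} f = record
  { Carrier = Σ ℤ λ z → ∃ λ (v : Vertex d) → f v ≡ z
  ; _≈_ = λ a b → Data.Product.proj₁ a ≡ Data.Product.proj₁ b
  ; isEquivalence = record { refl = ≡.refl ; sym = ≡.sym ; trans = ≡.trans }
  }

FSetoid : (d : ℕ) → ((Vertex d → ℤ) → Set) → Setoid 0ℓ 0ℓ
FSetoid d P = record
  { Carrier = Σ (Vertex d → ℤ) (λ f → IsHom d f × P f)
  ; _≈_ = λ f g → ∀ v → Σ.proj₁ f v ≡ Σ.proj₁ g v
  ; isEquivalence = record
    { refl = λ v → ≡.refl
    ; sym = λ p v → ≡.sym (p v)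
    ; trans = λ p q v → ≡.trans (p v) (q v)
    }
  }
  where open Data.Product

𝓕 : ℕ → Setoid 0ℓ 0ℓ
𝓕 d = FSetoid d (λ _ → Data.Unit.⊤)
  where import Data.Unit

𝓕[_] : ℕ → ℕ → Setoid 0ℓ 0ℓ
𝓕[ i ] d = FSetoid d (λ f → HasSize (Image f) i)

infixr 8 _^ℚ_
_^ℚ_ : ℚ → ℕ → ℚ
q ^ℚ zero = 1ℚ
q ^ℚ suc n = q * (q ^ℚ n)

ℕ→ℚ : ℕ → ℚ
ℕ→ℚ n = (+ n) ℚ./ 1

expTerm : ℚ → ℕ → ℚ
expTerm x zero = 1ℚ
expTerm x (suc k) = expTerm x k * x * ((+ 1) ℚ./ suc k)

expPartial : ℚ → ℕ → ℚ
expPartial x zero = 1ℚ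
expPartial x (suc m) = expPartial x m + expTerm x (suc m)

-- Real constants, encoded by explicit rational approximations.
-- A constant c is given by a sequence (c n) with |c n - c| ≤ 8/(n+1).

-- approximations of e and √e : Σ_{k=0}^{n+1} x^k/k!, error ≤ 2/(n+2)! ≤ 1/(n+1)
eApprox : ℕ → ℚ
eApprox n = expPartial 1ℚ (suc n)

sqrteApprox : ℕ → ℚ
sqrteApprox n = expPartial ((+ 1) ℚ./ 2) (suc n)

-- 2e            (error ≤ 2/(n+1))
c𝓕 : ℕ → ℚ
c𝓕 n = ℕ→ℚ 2 * eApprox n

c𝓕₃ : ℕ → ℚ
c𝓕₃ n = ℕ→ℚ 2

-- 4√e - 4       (error ≤ 4/(n+1))
c𝓕₄ : ℕ → ℚ
c𝓕₄ n = ℕ→ℚ 4 * sqrteApprox n - ℕ→ℚ 4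

-- 2e - 4√e + 2  (error ≤ 6/(n+1))
c𝓕₅ : ℕ → ℚ
c𝓕₅ n = ℕ→ℚ 2 * eApprox n - ℕ→ℚ 4 * sqrteApprox n + ℕ→ℚ 2

-- |x - c·z| ≤ ε·z for the real c = lim c n, where |c n - c| ≤ 8/(n+1):
-- equivalent to  ∀ n, |x - c n · z| ≤ (ε + 8/(n+1))·z.
CloseTo : (x : ℕ) (c : ℕ → ℚ) (ε : ℚ) (z : ℕ) → Set
CloseTo x c ε z = ∀ n → ∣ ℕ→ℚ x - c n * ℕ→ℚ z ∣ ≤ (ε + (+ 8) ℚ./ suc n) * ℕ→ℚ z

-- x = (c ± e^{-Ω(d)}) z  along a family indexed by d, where the size of
-- the setoid S d is x.  e^{-cd} is written q^d with rational 0 < q < 1.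
SizeAsymp : (S : ℕ → Setoid 0ℓ 0ℓ) (c : ℕ → ℚ) (z : ℕ → ℕ) → Set
SizeAsymp S c z =
  Σ ℚ λ q → (0ℚ < q) × (q < 1ℚ) ×
  Σ ℕ λ D → ∀ d → D ℕ.≤ d →
    Σ ℕ λ N → HasSize (S d) N × CloseTo N c (q ^ℚ d) (z d)

scale : ℕ → ℕ
scale d = 2 ℕ.^ (2 ℕ.^ (d ℕ.∸ 1))

{-# OPTIONS --safe #-}
-- Reduction mod 3 identifies 𝓕 with the proper 3-colourings χ of Q_d with χ(0) = 0, because a 4-cycle
-- has winding number 0 and so every proper 3-colouring lifts to ℤ.
--
-- Call χ ordered if, for some parity class σ and some colour k, no two vertices of σ of colour ≠ k
-- ("deviations") have a common neighbour.  Up to an e^{-Ω(d)} fraction all proper colourings are ordered: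
-- * Write Q_d = Q_n × Q_m with m ≈ d/12 and view a colouring as a function on Q_n with values in the
--   colourings of Q_m.  Hölder's inequality over the stars of Q_n, with an exponential tilt, shows that
--   there are few edges uv such that the neighbourhoods of u and v are both, or both not, monochromatic.
-- * By the edge-isoperimetric inequality this forces a dominant pair (σ , k) with few deviations.
-- * Clusters of deviations are described by a small set T, found by depth-first search, whose
--   neighbourhood nearly covers that of the cluster.  Recolouring the cluster by k frees its
--   neighbourhood, and a double count with Finner's inequality bounds the colourings for given T.
--
-- For N = 2^(d-1) and L admissible colours other than k on σ, integrating out the other class gives
-- weight 2^d to k and 1 to the others, so there are about 2^N (1 + L/2N)^N ≈ e^(L/2) 2^N ordered
-- colourings with pair (σ , k).  The range of the lift has size 3 plus the number of deviating colours
-- in use; inclusion-exclusion over the six pairs (σ , k) gives the four constants.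
module Submission where

open import Defs
open import Level using (0ℓ)
import Data.Bool as Bool using (Bool; true; false; not; _∧_; _∨_; _xor_; if_then_else_; T; _≟_)
open Bool using (Bool; true; false; not; _∧_; _∨_; _xor_; if_then_else_; T)
import Data.Bool.Properties using (not-involutive; not-injective; not-¬; T?; ∧-comm; ∧-zeroʳ; xor-comm)
open Data.Bool.Properties
open import Data.Empty using (⊥; ⊥-elim)
import Data.Nat using (ℕ; zero; suc; _+_; _*_; _∸_; _^_; _⊔_; _/_; _%_; pred; _≤_; _<_; z≤n; s≤s; s≤s⁻¹; _≤ᵇ_; _≡ᵇ_; _≟_; _≤?_; _<?_; NonZero; nonZero; >-nonZero)
open Data.Nat
import Data.Nat.Properties using (*-assoc; *-cancelʳ-≤; *-cancelˡ-<; *-cancelˡ-≡; *-cancelˡ-≤; *-comm; *-distribʳ-+; *-distribˡ-+; *-identityʳ; *-identityˡ; *-mono-≤; *-monoʳ-≤; *-monoˡ-<; *-monoˡ-≤; *-suc; *-zeroʳ; +-assoc; +-cancelʳ-≤; +-cancelˡ-≤; +-comm; +-identityʳ; +-mono-<; +-mono-≤; +-monoʳ-<; +-monoʳ-≤; +-monoˡ-≤; +-suc; 0≢1+n; 1+n≰n; <⇒≤; <⇒≱; ^-*-assoc; ^-distribˡ-+-*; ^-monoʳ-<; ^-monoʳ-≤; ^-monoˡ-<; ^-monoˡ-≤; ^-zeroˡ; m*n≢0; m+[n∸m]≡n; m^n>0; m^n≡0⇒m≡0; m^n≢0; m∸n+n≡m; m≤m+n; m≤n*m; m≤n+m; n≤0⇒n≡0;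 n≤1+n; suc-injective; suc-pred; ≡ᵇ⇒≡; ≡⇒≡ᵇ; ≤-<-trans; ≤-antisym; ≤-pred; ≤-refl; ≤-reflexive; ≤-total; ≤-trans; ≤ᵇ⇒≤; ≤⇒≤ᵇ; ≮⇒≥; ≰⇒>; module ≤-Reasoning; m≤m⊔n; m≤n⊔m; ⊔-sel)
open Data.Nat.Properties
import Data.Nat.DivMod using (m≡m%n+[m/n]*n; m%n<n; m/n*n≤m)
open Data.Nat.DivMod
import Data.Nat.Tactic.RingSolver as ℕ-Ring using (solve-∀)
open ℕ-Ring
import Data.Integer as ℤ using (ℤ; +_; -[1+_]; 1ℤ; -1ℤ; 0ℤ; _+_; _*_; _-_; -_; ∣_∣)
open ℤ using (ℤ; -[1+_]; 1ℤ; -1ℤ; 0ℤ)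
import Data.Integer.Properties as ℤ using (_≟_; +-assoc; +-identityʳ; pos-*; ∣-i∣≡∣i∣)
import Data.Integer.Tactic.RingSolver as ℤ-Ring using () renaming (solve-∀ to ℤ-solve-∀)
open ℤ-Ring
import Data.Rational as ℚ using (ℚ; 1ℚ; Positive; NonNegative; _+_; _*_; _-_; -_; _/_; _≤_; _<_; ∣_∣)
open ℚ using (ℚ; 1ℚ; Positive; NonNegative)
import Data.Rational.Properties as ℚ using (*-assoc; *-cancelʳ-<-nonNeg; *-cancelʳ-≤-pos; *-cancelˡ-≤-pos; *-distribʳ-+; *-identityˡ; *-monoʳ-≤-nonNeg; +-identityʳ; +-monoʳ-<; +-monoʳ-≤; +-monoˡ-≤; neg-distribʳ-*; nonNeg*nonNeg⇒nonNeg; nonNegative⁻¹; normalize-nonNeg; normalize-pos; pos*pos⇒pos; positive⁻¹; toℚᵘ-fromℚᵘ; toℚᵘ-homo-*; toℚᵘ-homo-+; toℚᵘ-injective; ∣p∣≡p∨∣p∣≡-p; ≤-reflexive; ≤-trans)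
import Data.Rational.Solver using (module +-*-Solver)
open Data.Rational.Solver.+-*-Solver using (solve; _:=_; _:+_; _:*_; _:-_; :-_)
import Data.Rational.Unnormalised using (mkℚᵘ; *≡*)
open Data.Rational.Unnormalised
import Data.Rational.Unnormalised.Properties as ℚᵘ using (*-cong; +-cong; ≃-sym; ≃-trans)
import Data.Fin as Fin using (Fin; zero; suc; _↑ˡ_; _↑ʳ_; _≟_)
open Fin using (Fin; zero; suc)
open import Data.Fin.Patterns using (1F; 2F)
import Data.Fin.Permutation using (↔⇒≡)
open Data.Fin.Permutation
open import Data.Fin.Permutation.Components using (transpose; transpose-inverse)
import Data.Fin.Properties using (all?)
open Data.Fin.Properties
open import Data.Maybe using (Maybe; just; nothing)
import Data.Product using (Σ; ∃; _×_; _,_; proj₁; proj₂)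
open Data.Product
open import Data.Sum using (_⊎_; inj₁; inj₂)
open import Data.Unit using (⊤; tt)
import Data.Vec using (Vec; []; _∷_; lookup; tabulate)
open Data.Vec
import Data.Vec.Properties using (≡-dec; lookup∘tabulate)
open Data.Vec.Properties
import Data.List using (List; []; _∷_; _++_; map; length; filterᵇ; upTo; deduplicate; concatMap; cartesianProduct; lookup)
open Data.List using (List; []; _∷_; _++_; map; length; filterᵇ; upTo; deduplicate; concatMap; cartesianProduct)
import Data.List.Properties using (length-map; length-++; length-upTo; map-cong)
open Data.List.Properties
import Data.List.Membership.Propositional as ∈ using (_∈_; _∉_; find; lose)
open ∈
import Data.List.Membership.Propositional.Properties as ∈ₚ using (∈-++⁺ˡ; ∈-++⁺ʳ; ∈-++⁻; ∈-map⁺; ∈-map⁻; ∈-upTo⁺; ∈-upTo⁻; ∈-lookup; ∈-concatMap⁺; ∈-concatMap⁻; ∈-cartesianProduct⁺; ∈-deduplicate⁺; ∈-deduplicate⁻)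
open ∈ₚ
import Data.List.Membership.Propositional.Properties.WithK as ∈ₖ using (unique∧set⇒bag)
open ∈ₖ
import Data.List.Relation.Binary.BagAndSetEquality as Bag using (∼bag⇒↭)
open Bag
import Data.List.Relation.Binary.Permutation.Propositional as Perm using (_↭_; refl; prep; swap; trans)
open Perm using (_↭_)
import Data.List.Relation.Binary.Permutation.Propositional.Properties as ↭ₚ using (↭-length)
open ↭ₚ
import Data.List.Relation.Unary.All as All using (All; []; _∷_; all?; lookup; tabulate)
open All using (All; []; _∷_)
import Data.List.Relation.Unary.AllPairs as AllPairs using (AllPairs; []; _∷_)
open AllPairs
import Data.List.Relation.Unary.AllPairs.Properties as AllPairsₚ using (concat⁺)
open AllPairsₚ
import Data.List.Relation.Unary.Any as Any using (Any; here; there; index)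
open Any using (Any; here; there)
import Data.List.Relation.Unary.Any.Properties as Anyₚ using (lookup-index)
open Anyₚ
open import Data.List.Relation.Unary.Unique.DecPropositional ℤ._≟_ using (unique?)
open import Data.List.Relation.Unary.Unique.DecPropositional.Properties ℤ._≟_ using (deduplicate-!)
import Data.List.Relation.Unary.Unique.Propositional as Unique using (Unique)
open Unique
import Data.List.Relation.Unary.Unique.Propositional.Properties as Uniqueₚ using (Unique[x∷xs]⇒x∉xs; map⁺; ++⁺; filter⁺)
open Uniqueₚ
import Function using (_∘_; id)
open Function
import Function.Bundles using (mk⇔)
open Function.Bundles
import Function.Construct.Composition as Compose using (inverse)
import Function.Construct.Symmetry as Symmetry using (inverse)
import Relation.Binary.Bundles using (Setoid)
open Relation.Binary.Bundles
import Relation.Binary.PropositionalEquality as ≡ using (_≡_; _≢_; refl; sym; trans; cong; cong₂; subst; subst₂)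
open ≡
import Relation.Nullary using (¬_; Dec; yes; no; does)
open Relation.Nullary
import Relation.Nullary.Decidable as Decidable using (True; from-yes; toWitness; ¬?; _→-dec_)
open Decidable
open ≤-Reasoning hiding (start; strict)

-- All estimates are inequalities in ℕ with roots and denominators cleared. Plain Hölder would only
-- bound the number of colourings; the tilt (1 + 1/(16m))^(bad edges) makes it a large-deviation
-- bound. It is affordable since, in the direction with the most bad edges, each of them costs a
-- factor 3/4, while the tilt returns at most 9/8 per such edge. The main obstacle is the cluster
-- bound. Encoding T costs w bits per vertex, to be paid by the excess of the neighbourhood F of T
-- over the set S that it describes. Isoperimetry makes F several times larger than S for a small
-- cluster, but only a fixed fraction larger for a big one; hence the two regimes. Recolouring
-- compares proper colourings with each other, so this bound is relative to their unknown total, and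
-- an absorption argument makes it absolute. The six pairs (σ , k) overlap, and an ordered colouring
-- might miss one of the expected heights; both require that nearly all neighbours of a fixed vertex
-- share a colour, which is exponentially rare.

-- Finite sums and products of natural numbers over lists.

≡≤ : ∀ {a b c : ℕ} → a ≡ b → b ≤ c → a ≤ c
≡≤ refl h = h

≤≡ : ∀ {a b c : ℕ} → a ≤ b → b ≡ c → a ≤ c
≤≡ h refl = h

≤⇒+ : ∀ {m n} → m ≤ n → ∃ λ e → m + e ≡ n
≤⇒+ {m} {n} h = n ∸ m , m+[n∸m]≡n h

^-distrib-* : ∀ n a b → (a * b) ^ n ≡ a ^ n * b ^ n
^-distrib-* zero a b = refl
^-distrib-* (suc n) a b = trans (cong (a * b *_) (^-distrib-* n a b)) (lem a b (a ^ n) (b ^ n))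
 where
 lem : ∀ a b c d → a * b * (c * d) ≡ a * c * (b * d)
 lem = solve-∀

𝟙 : Bool → ℕ
𝟙 true = 1
𝟙 false = 0

𝟙≤1 : ∀ b → 𝟙 b ≤ 1
𝟙≤1 true = ≤-refl
𝟙≤1 false = z≤n

module _ {A : Set} where

 ∑ ∏ : List A → (A → ℕ) → ℕ
 ∑ [] f = 0
 ∑ (x ∷ xs) f = f x + ∑ xs f
 ∏ [] f = 1
 ∏ (x ∷ xs) f = f x * ∏ xs f

 ∑-mono∈ : ∀ xs {f g : A → ℕ} → (∀ {x} → x ∈ xs → f x ≤ g x) → ∑ xs f ≤ ∑ xs g
 ∑-mono∈ [] h = z≤n
 ∑-mono∈ (x ∷ xs) h = +-mono-≤ (h (here refl)) (∑-mono∈ xs (h ∘ there))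

 ∑-mono : ∀ xs {f g : A → ℕ} → (∀ x → f x ≤ g x) → ∑ xs f ≤ ∑ xs g
 ∑-mono xs h = ∑-mono∈ xs λ {x} _ → h x

 ∑-cong∈ : ∀ xs {f g : A → ℕ} → (∀ {x} → x ∈ xs → f x ≡ g x) → ∑ xs f ≡ ∑ xs g
 ∑-cong∈ [] h = refl
 ∑-cong∈ (x ∷ xs) h = cong₂ _+_ (h (here refl)) (∑-cong∈ xs (h ∘ there))

 ∑-cong : ∀ xs {f g : A → ℕ} → (∀ x → f x ≡ g x) → ∑ xs f ≡ ∑ xs g
 ∑-cong xs h = ∑-cong∈ xs λ {x} _ → h x

 ∏-mono∈ : ∀ xs {f g : A → ℕ} → (∀ {x} → x ∈ xs → f x ≤ g x) → ∏ xs f ≤ ∏ xs g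
 ∏-mono∈ [] h = ≤-refl
 ∏-mono∈ (x ∷ xs) h = *-mono-≤ (h (here refl)) (∏-mono∈ xs (h ∘ there))

 ∏-mono : ∀ xs {f g : A → ℕ} → (∀ x → f x ≤ g x) → ∏ xs f ≤ ∏ xs g
 ∏-mono xs h = ∏-mono∈ xs λ {x} _ → h x

 ∏-cong∈ : ∀ xs {f g : A → ℕ} → (∀ {x} → x ∈ xs → f x ≡ g x) → ∏ xs f ≡ ∏ xs g
 ∏-cong∈ [] h = refl
 ∏-cong∈ (x ∷ xs) h = cong₂ _*_ (h (here refl)) (∏-cong∈ xs (h ∘ there))

 ∏-cong : ∀ xs {f g : A → ℕ} → (∀ x → f x ≡ g x) → ∏ xs f ≡ ∏ xs g
 ∏-cong xs h = ∏-cong∈ xs λ {x} _ → h x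

 ∑-+ : ∀ xs (f g : A → ℕ) → ∑ xs (λ x → f x + g x) ≡ ∑ xs f + ∑ xs g
 ∑-+ [] f g = refl
 ∑-+ (x ∷ xs) f g = trans (cong (f x + g x +_) (∑-+ xs f g)) (lem (f x) (g x) (∑ xs f) (∑ xs g))
  where
  lem : ∀ a b c d → a + b + (c + d) ≡ a + c + (b + d)
  lem = solve-∀

 ∏-* : ∀ xs (f g : A → ℕ) → ∏ xs (λ x → f x * g x) ≡ ∏ xs f * ∏ xs g
 ∏-* [] f g = refl
 ∏-* (x ∷ xs) f g = trans (cong (f x * g x *_) (∏-* xs f g)) (lem (f x) (g x) (∏ xs f) (∏ xs g))
  where
  lem : ∀ a b c d → a * b * (c * d) ≡ a * c * (b * d)
  lem = solve-∀

 ∑-*ˡ : ∀ c xs (f : A → ℕ) → ∑ xs (λ x → c * f x) ≡ c * ∑ xs f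
 ∑-*ˡ c [] f = sym (*-zeroʳ c)
 ∑-*ˡ c (x ∷ xs) f = trans (cong (c * f x +_) (∑-*ˡ c xs f)) (sym (*-distribˡ-+ c (f x) _))

 ∑-*ʳ : ∀ c xs (f : A → ℕ) → ∑ xs (λ x → f x * c) ≡ ∑ xs f * c
 ∑-*ʳ c xs f = trans (∑-cong xs λ x → *-comm (f x) c) (trans (∑-*ˡ c xs f) (*-comm c _))

 ∑-const : ∀ c (xs : List A) → ∑ xs (λ _ → c) ≡ length xs * c
 ∑-const c [] = refl
 ∑-const c (x ∷ xs) = cong (c +_) (∑-const c xs)

 ∏-const : ∀ c (xs : List A) → ∏ xs (λ _ → c) ≡ c ^ length xs
 ∏-const c [] = refl
 ∏-const c (x ∷ xs) = cong (c *_) (∏-const c xs)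

 ∑-zero : ∀ (xs : List A) → ∑ xs (λ _ → 0) ≡ 0
 ∑-zero xs = trans (∑-const 0 xs) (*-zeroʳ (length xs))

 ∏-one : ∀ (xs : List A) → ∏ xs (λ _ → 1) ≡ 1
 ∏-one xs = trans (∏-const 1 xs) (^-zeroˡ (length xs))

 ∑-++ : ∀ xs ys (f : A → ℕ) → ∑ (xs ++ ys) f ≡ ∑ xs f + ∑ ys f
 ∑-++ [] ys f = refl
 ∑-++ (x ∷ xs) ys f = trans (cong (f x +_) (∑-++ xs ys f)) (sym (+-assoc (f x) _ _))

 ∏-++ : ∀ xs ys (f : A → ℕ) → ∏ (xs ++ ys) f ≡ ∏ xs f * ∏ ys f
 ∏-++ [] ys f = sym (*-identityˡ _)
 ∏-++ (x ∷ xs) ys f = trans (cong (f x *_) (∏-++ xs ys f)) (sym (*-assoc (f x) _ _))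

 ∏-^ : ∀ n xs (f : A → ℕ) → ∏ xs (λ x → f x ^ n) ≡ ∏ xs f ^ n
 ∏-^ n [] f = sym (^-zeroˡ n)
 ∏-^ n (x ∷ xs) f = trans (cong (f x ^ n *_) (∏-^ n xs f)) (sym (^-distrib-* n (f x) (∏ xs f)))

 ∏-2^ : ∀ b xs (f : A → ℕ) → ∏ xs (λ x → b ^ f x) ≡ b ^ ∑ xs f
 ∏-2^ b [] f = refl
 ∏-2^ b (x ∷ xs) f = trans (cong (b ^ f x *_) (∏-2^ b xs f)) (sym (^-distribˡ-+-* b (f x) _))

 term≤∑ : ∀ {xs} {x : A} (f : A → ℕ) → x ∈ xs → f x ≤ ∑ xs f
 term≤∑ f (here refl) = m≤m+n _ _
 term≤∑ f (there i) = ≤-trans (term≤∑ f i) (m≤n+m _ _)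

 ∏≡0 : ∀ {xs} {x : A} (f : A → ℕ) → x ∈ xs → f x ≡ 0 → ∏ xs f ≡ 0
 ∏≡0 {xs = y ∷ xs} f (here refl) e = cong (_* ∏ xs f) e
 ∏≡0 {xs = y ∷ xs} f (there i) e = trans (cong (f y *_) (∏≡0 f i e)) (*-zeroʳ (f y))

 ∑-↭ : ∀ {xs ys} (f : A → ℕ) → xs ↭ ys → ∑ xs f ≡ ∑ ys f
 ∑-↭ f Perm.refl = refl
 ∑-↭ f (Perm.prep x p) = cong (f x +_) (∑-↭ f p)
 ∑-↭ f (Perm.swap x y p) = trans (cong (λ t → f x + (f y + t)) (∑-↭ f p)) (lem (f x) (f y) _)
  where
  lem : ∀ a b c → a + (b + c) ≡ b + (a + c)
  lem = solve-∀
 ∑-↭ f (Perm.trans p q) = trans (∑-↭ f p) (∑-↭ f q)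

 ∑-filter : ∀ (p : A → Bool) xs (f : A → ℕ) → ∑ (filterᵇ p xs) f ≡ ∑ xs (λ x → 𝟙 (p x) * f x)
 ∑-filter p [] f = refl
 ∑-filter p (x ∷ xs) f with p x
 ... | true = cong₂ _+_ (sym (+-identityʳ (f x))) (∑-filter p xs f)
 ... | false = ∑-filter p xs f

 ∏-filter-cong : ∀ (p : A → Bool) xs {f g : A → ℕ} → (∀ x → p x ≡ true → f x ≡ g x) →
  ∏ (filterᵇ p xs) f ≡ ∏ (filterᵇ p xs) g
 ∏-filter-cong p [] h = refl
 ∏-filter-cong p (x ∷ xs) h with p x in eq
 ... | true = cong₂ _*_ (h x eq) (∏-filter-cong p xs h)
 ... | false = ∏-filter-cong p xs h

 ∏-split : ∀ (p : A → Bool) xs (f : A → ℕ) →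
  ∏ xs f ≡ ∏ (filterᵇ (not ∘ p) xs) f * ∏ (filterᵇ p xs) f
 ∏-split p [] f = refl
 ∏-split p (x ∷ xs) f with p x
 ... | true = trans (cong (f x *_) (∏-split p xs f)) (lem (f x) (∏ (filterᵇ (not ∘ p) xs) f) _)
  where
  lem : ∀ a b c → a * (b * c) ≡ b * (a * c)
  lem = solve-∀
 ... | false = trans (cong (f x *_) (∏-split p xs f)) (sym (*-assoc (f x) _ _))

module _ {A B : Set} where

 ∑-map : ∀ (g : A → B) xs (f : B → ℕ) → ∑ (map g xs) f ≡ ∑ xs (f ∘ g)
 ∑-map g [] f = refl
 ∑-map g (x ∷ xs) f = cong (f (g x) +_) (∑-map g xs f)

 ∏-map : ∀ (g : A → B) xs (f : B → ℕ) → ∏ (map g xs) f ≡ ∏ xs (f ∘ g)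
 ∏-map g [] f = refl
 ∏-map g (x ∷ xs) f = cong (f (g x) *_) (∏-map g xs f)

 ∑-swap : ∀ xs ys (f : A → B → ℕ) → ∑ xs (λ x → ∑ ys (f x)) ≡ ∑ ys (λ y → ∑ xs (λ x → f x y))
 ∑-swap [] ys f = sym (∑-zero ys)
 ∑-swap (x ∷ xs) ys f = trans (cong (∑ ys (f x) +_) (∑-swap xs ys f)) (sym (∑-+ ys (f x) _))

-- Sums over functions on a finite set.

-- Sums over functions V → X: the values on the listed points range over xs, the other values are
-- those of the base function ρ.
module FunctionSum {V X : Set} (_≟ᵥ_ : (v w : V) → Dec (v ≡ w)) (xs : List X) where

 upd : (V → X) → V → X → V → X
 upd ρ v x w = if does (v ≟ᵥ w) then x else ρ w

 upd-same : ∀ ρ v x → upd ρ v x v ≡ x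
 upd-same ρ v x with v ≟ᵥ v
 ... | yes _ = refl
 ... | no v≢v = ⊥-elim (v≢v refl)

 upd-diff : ∀ ρ {v w} x → v ≢ w → upd ρ v x w ≡ ρ w
 upd-diff ρ {v} {w} x v≢w with v ≟ᵥ w
 ... | yes e = ⊥-elim (v≢w e)
 ... | no _ = refl

 S : List V → ((V → X) → ℕ) → (V → X) → ℕ
 S [] F ρ = F ρ
 S (v ∷ vs) F ρ = ∑ xs λ x → S vs F (upd ρ v x)

 Off : List V → (V → X) → (V → X) → Set
 Off vs ρ ρ' = ∀ w → w ∉ vs → ρ' w ≡ ρ w

 S-mono-off : ∀ vs {F G : (V → X) → ℕ} {ρ} → (∀ ρ' → Off vs ρ ρ' → F ρ' ≤ G ρ') → S vs F ρ ≤ S vs G ρ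
 S-mono-off [] h = h _ λ _ _ → refl
 S-mono-off (v ∷ vs) {ρ = ρ} h = ∑-mono xs λ x → S-mono-off vs λ ρ' off → h ρ' λ w w∉ →
  trans (off w (w∉ ∘ there)) (upd-diff ρ x λ { refl → w∉ (here refl) })

 S-cong-off : ∀ vs {F G : (V → X) → ℕ} {ρ} → (∀ ρ' → Off vs ρ ρ' → F ρ' ≡ G ρ') → S vs F ρ ≡ S vs G ρ
 S-cong-off vs h = ≤-antisym (S-mono-off vs λ ρ' o → ≤-reflexive (h ρ' o))
  (S-mono-off vs λ ρ' o → ≤-reflexive (sym (h ρ' o)))

 S-mono : ∀ vs {F G : (V → X) → ℕ} {ρ} → (∀ ρ' → F ρ' ≤ G ρ') → S vs F ρ ≤ S vs G ρ
 S-mono vs h = S-mono-off vs λ ρ' _ → h ρ'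

 S-cong : ∀ vs {F G : (V → X) → ℕ} {ρ} → (∀ ρ' → F ρ' ≡ G ρ') → S vs F ρ ≡ S vs G ρ
 S-cong vs h = S-cong-off vs λ ρ' _ → h ρ'

 S-++ : ∀ us vs F ρ → S (us ++ vs) F ρ ≡ S us (S vs F) ρ
 S-++ [] vs F ρ = refl
 S-++ (u ∷ us) vs F ρ = ∑-cong xs λ x → S-++ us vs F (upd ρ u x)

 S-+ : ∀ vs F G ρ → S vs (λ r → F r + G r) ρ ≡ S vs F ρ + S vs G ρ
 S-+ [] F G ρ = refl
 S-+ (v ∷ vs) F G ρ = trans (∑-cong xs λ x → S-+ vs F G (upd ρ v x)) (∑-+ xs _ _)

 S-*ˡ : ∀ c vs F ρ → S vs (λ r → c * F r) ρ ≡ c * S vs F ρ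
 S-*ˡ c [] F ρ = refl
 S-*ˡ c (v ∷ vs) F ρ = trans (∑-cong xs λ x → S-*ˡ c vs F (upd ρ v x)) (∑-*ˡ c xs _)

 S-∑ : ∀ {A : Set} vs (as : List A) (F : A → (V → X) → ℕ) ρ →
  S vs (λ r → ∑ as λ a → F a r) ρ ≡ ∑ as λ a → S vs (F a) ρ
 S-∑ [] as F ρ = refl
 S-∑ (v ∷ vs) as F ρ = trans (∑-cong xs λ x → S-∑ vs as F (upd ρ v x)) (∑-swap xs as _)

 -- The summation overwrites the base on `vs`, so of the scope `D` of `F` only the points outside
 -- `vs` still feel the base. This is how factors are recognised as constant in variables outside
 -- their scope.
 S-local : ∀ (D : V → Set) vs {F : (V → X) → ℕ} →
  (∀ ρ ρ' → (∀ w → D w → ρ w ≡ ρ' w) → F ρ ≡ F ρ') →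
  ∀ ρ ρ' → (∀ w → D w → w ∈ vs ⊎ ρ w ≡ ρ' w) → S vs F ρ ≡ S vs F ρ'
 S-local D [] loc ρ ρ' h = loc ρ ρ' λ w d → case (h w d)
  where
  case : ∀ {w} → w ∈ [] ⊎ ρ w ≡ ρ' w → ρ w ≡ ρ' w
  case (inj₂ e) = e
 S-local D (v ∷ vs) {F} loc ρ ρ' h = ∑-cong xs λ x → S-local D vs loc _ _ λ w d → go x w (h w d)
  where
  go : ∀ x w → w ∈ v ∷ vs ⊎ ρ w ≡ ρ' w → w ∈ vs ⊎ upd ρ v x w ≡ upd ρ' v x w
  go x w (inj₁ (here refl)) = inj₂ (trans (upd-same ρ w x) (sym (upd-same ρ' w x)))
  go x w (inj₁ (there i)) = inj₁ i
  go x w (inj₂ e) with v ≟ᵥ w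
  ... | yes _ = inj₂ refl
  ... | no _ = inj₂ e

 -- Functions are compared pointwise throughout, so whatever is to be reindexed must be known to
 -- respect pointwise equality.
 Ext : ((V → X) → ℕ) → Set
 Ext F = ∀ ρ ρ' → (∀ w → ρ w ≡ ρ' w) → F ρ ≡ F ρ'

 S-ext : ∀ vs {F} → Ext F → Ext (S vs F)
 S-ext vs ext ρ ρ' h = S-local (λ _ → ⊤) vs (λ r r' g → ext r r' λ w → g w tt) ρ ρ' λ w _ → inj₂ (h w)

 S-base : ∀ vs {F} → Ext F → (∀ w → w ∈ vs) → ∀ ρ ρ' → S vs F ρ ≡ S vs F ρ'
 S-base vs ext all ρ ρ' = S-local (λ _ → ⊤) vs (λ r r' g → ext r r' λ w → g w tt) ρ ρ' λ w _ → inj₁ (all w)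

 upd-comm : ∀ ρ {u v} x y → u ≢ v → ∀ w → upd (upd ρ u x) v y w ≡ upd (upd ρ v y) u x w
 upd-comm ρ {u} {v} x y u≢v w with v ≟ᵥ w | u ≟ᵥ w
 ... | yes refl | yes refl = ⊥-elim (u≢v refl)
 ... | yes _ | no _ = refl
 ... | no _ | yes _ = refl
 ... | no _ | no _ = refl

 S-↭ : ∀ {us vs F} → Ext F → us ↭ vs → ∀ ρ → S us F ρ ≡ S vs F ρ
 S-↭ ext Perm.refl ρ = refl
 S-↭ ext (Perm.prep v p) ρ = ∑-cong xs λ x → S-↭ ext p (upd ρ v x)
 S-↭ {vs = v ∷ u ∷ vs} {F} ext (Perm.swap u v p) ρ = trans
  (∑-cong xs λ x → ∑-cong xs λ y → S-↭ ext p (upd (upd ρ u x) v y)) (go (u ≟ᵥ v))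
  where
  go : Dec (u ≡ v) → ∑ xs (λ x → ∑ xs λ y → S vs F (upd (upd ρ u x) v y))
   ≡ ∑ xs (λ x → ∑ xs λ y → S vs F (upd (upd ρ v x) u y))
  go (yes refl) = refl
  go (no u≢v) = trans (∑-swap xs xs _) (∑-cong xs λ y → ∑-cong xs λ x → S-ext vs ext _ _ (upd-comm ρ x y u≢v))
 S-↭ ext (Perm.trans p q) ρ = trans (S-↭ ext p ρ) (S-↭ ext q ρ)

 S-∏ : ∀ vs → Unique vs → (g : V → X → ℕ) → ∀ ρ →
  S vs (λ r → ∏ vs λ v → g v (r v)) ρ ≡ ∏ vs λ v → ∑ xs (g v)
 S-∏ [] _ g ρ = refl
 S-∏ (v ∷ vs) u@(_ ∷ uvs) g ρ = trans (∑-cong xs λ x → trans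
  (S-cong-off vs λ ρ' off → cong (λ c → g v c * _) (trans (off v (Unique[x∷xs]⇒x∉xs u)) (upd-same ρ v x)))
  (trans (S-*ˡ (g v x) vs _ (upd ρ v x)) (cong (g v x *_) (S-∏ vs uvs g (upd ρ v x)))))
  (∑-*ʳ _ xs (g v))

-- AM-GM and Hölder's inequality without roots and division.

2xy≤x²+y² : ∀ x y → 2 * (x * y) ≤ x * x + y * y
2xy≤x²+y² x y with ≤-total x y
... | inj₁ x≤y with ≤⇒+ x≤y
...   | (e , refl) = ≤≡ (m≤m+n _ (e * e)) (lem x e)
 where
 lem : ∀ x e → 2 * (x * (x + e)) + e * e ≡ x * x + (x + e) * (x + e)
 lem = solve-∀
2xy≤x²+y² x y | inj₂ y≤x with ≤⇒+ y≤x
...   | (e , refl) = ≤≡ (m≤m+n _ (e * e)) (lem y e)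
 where
 lem : ∀ y e → 2 * ((y + e) * y) + e * e ≡ (y + e) * (y + e) + y * y
 lem = solve-∀

-- The graph of t^(k+1) lies above its tangent at y. In the induction, x times the previous case
-- leaves mixed terms, which 2xy ≤ x² + y² removes.
bernoulli : ∀ k x y → suc k * (x * y ^ k) ≤ x ^ suc k + k * y ^ suc k
bernoulli zero x y = ≤-reflexive (lem x)
 where
 lem : ∀ x → 1 * (x * 1) ≡ x * 1 + 0
 lem = solve-∀
bernoulli (suc k) x y = +-cancelˡ-≤ (suc k * (x * x * y ^ k) + k * (x * y * y ^ k)) _ _ (begin
 suc k * (x * x * y ^ k) + k * (x * y * y ^ k) + suc (suc k) * (x * (y * y ^ k))
  ≡⟨ l₁ k x y (y ^ k) ⟩
 x * (suc k * (x * y ^ k)) + suc k * (2 * (x * y) * y ^ k)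
  ≤⟨ +-mono-≤ (*-monoʳ-≤ x (bernoulli k x y)) (*-monoʳ-≤ (suc k) (*-monoˡ-≤ (y ^ k) (2xy≤x²+y² x y))) ⟩
 x * (x ^ suc k + k * y ^ suc k) + suc k * ((x * x + y * y) * y ^ k)
  ≡⟨ l₂ k x y (y ^ k) (x ^ suc k) ⟩
 suc k * (x * x * y ^ k) + k * (x * y * y ^ k) + (x ^ suc (suc k) + suc k * y ^ suc (suc k)) ∎)
 where
 l₁ : ∀ k x y Y → suc k * (x * x * Y) + k * (x * y * Y) + suc (suc k) * (x * (y * Y))
  ≡ x * (suc k * (x * Y)) + suc k * (2 * (x * y) * Y)
 l₁ = solve-∀
 l₂ : ∀ k x y Y X → x * (X + k * (y * Y)) + suc k * ((x * x + y * y) * Y)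
  ≡ suc k * (x * x * Y) + k * (x * y * Y) + (x * X + suc k * (y * (y * Y)))
 l₂ = solve-∀

-- AM-GM for a and k copies of s/k, the induction step of `amgm`. It is `bernoulli` at x = k(a + s)
-- and y = (k + 1)s, divided by k.
weighted-amgm : ∀ k a s → suc k ^ suc k * (a * s ^ k) ≤ k ^ k * (a + s) ^ suc k
weighted-amgm zero a s = ≤≡ (m≤m+n _ s) (lem a s)
 where
 lem : ∀ a s → 1 * (a * 1) + s ≡ 1 * ((a + s) * 1)
 lem = solve-∀
weighted-amgm k@(suc j) a s = *-cancelˡ-≤ k (+-cancelʳ-≤ (k * y ^ suc k) _ _ (begin
 k * (suc k ^ suc k * (a * s ^ k)) + k * y ^ suc k
  ≡⟨ cong (λ t → k * (suc k ^ suc k * (a * s ^ k)) + k * (y * t)) (^-distrib-* k (suc k) s) ⟩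
 k * (suc k * P * (a * s ^ k)) + k * (y * (P * s ^ k))
  ≡⟨ l₁ k a s P (s ^ k) ⟩
 suc k * (x * (P * s ^ k))
  ≡⟨ cong (λ t → suc k * (x * t)) (sym (^-distrib-* k (suc k) s)) ⟩
 suc k * (x * y ^ k)
  ≤⟨ bernoulli k x y ⟩
 x ^ suc k + k * y ^ suc k
  ≡⟨ cong (_+ k * y ^ suc k) (trans (^-distrib-* (suc k) k (a + s)) (*-assoc k (k ^ k) _)) ⟩
 k * (k ^ k * (a + s) ^ suc k) + k * y ^ suc k ∎))
 where
 x y P : ℕ
 x = k * (a + s)
 y = suc k * s
 P = suc k ^ k
 l₁ : ∀ k a s P Z → k * (suc k * P * (a * Z)) + k * (suc k * s * (P * Z)) ≡ suc k * (k * (a + s) * (P * Z))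
 l₁ = solve-∀

module _ {C : Set} where

 -- the numerator of ∑ A c / D c over the common denominator ∏ D c
 numerator : List C → (C → ℕ) → (C → ℕ) → ℕ
 numerator [] A D = 0
 numerator (c ∷ cs) A D = A c * ∏ cs D + D c * numerator cs A D

 -- AM-GM for the ratios A c / D c, whose sum is `numerator` over ∏ D, multiplied by (∏ D)^n with n
 -- the number of terms.
 amgm : ∀ c cs (A D : C → ℕ) → let k = length cs in
  suc k ^ suc k * (∏ (c ∷ cs) A * ∏ (c ∷ cs) D ^ k) ≤ numerator (c ∷ cs) A D ^ suc k
 amgm c [] A D = ≤-reflexive (lem (A c) (D c))
  where
  lem : ∀ a d → 1 * (a * 1 * 1) ≡ (a * 1 + d * 0) * 1
  lem = solve-∀
 amgm c cs@(c' ∷ cs') A D = *-cancelˡ-≤ (k ^ k) ⦃ m^n≢0 k k ⦄ (begin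
  k ^ k * (suc k ^ suc k * (A c * ∏ cs A * (D c * Q) ^ k))
   ≡⟨ cong (λ t → k ^ k * (suc k ^ suc k * (A c * ∏ cs A * t))) (^-distrib-* k (D c) Q) ⟩
  k ^ k * (suc k ^ suc k * (A c * ∏ cs A * (D c ^ k * (Q * Q ^ k'))))
   ≡⟨ l₁ (k ^ k) (suc k ^ suc k) (A c) (∏ cs A) (D c ^ k) Q (Q ^ k') ⟩
  suc k ^ suc k * (A c * Q * (D c ^ k * (k ^ k * (∏ cs A * Q ^ k'))))
   ≤⟨ *-monoʳ-≤ (suc k ^ suc k) (*-monoʳ-≤ (A c * Q) (*-monoʳ-≤ (D c ^ k) (amgm c' cs' A D))) ⟩
  suc k ^ suc k * (A c * Q * (D c ^ k * X ^ k))
   ≡⟨ cong (λ t → suc k ^ suc k * (A c * Q * t)) (sym (^-distrib-* k (D c) X)) ⟩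
  suc k ^ suc k * (A c * Q * (D c * X) ^ k)
   ≤⟨ weighted-amgm k (A c * Q) (D c * X) ⟩
  k ^ k * (A c * Q + D c * X) ^ suc k ∎)
  where
  k' k Q X : ℕ
  k' = length cs'
  k = suc k'
  Q = ∏ cs D
  X = numerator cs A D
  l₁ : ∀ a b c d e f g → a * (b * (c * d * (e * (f * g)))) ≡ b * (c * f * (e * (a * (d * g))))
  l₁ = solve-∀

 numerator-+ : ∀ cs (A B : C → ℕ) → let D = λ c → A c + B c in
  numerator cs A D + numerator cs B D ≡ length cs * ∏ cs D
 numerator-+ [] A B = refl
 numerator-+ (c ∷ cs) A B = trans (l₁ (A c) (B c) (∏ cs D) (numerator cs A D) (numerator cs B D))
  (trans (cong (λ t → (A c + B c) * (∏ cs D + t)) (numerator-+ cs A B)) (l₂ (A c + B c) (∏ cs D) (length cs)))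
  where
  D : C → ℕ
  D c = A c + B c
  l₁ : ∀ a b q x y → a * q + (a + b) * x + (b * q + (a + b) * y) ≡ (a + b) * (q + (x + y))
  l₁ = solve-∀
  l₂ : ∀ d q k → d * (q + k * q) ≡ suc k * (d * q)
  l₂ = solve-∀

 private
  -- If the mean X/(nQ) of the ratios A/D is at most s/u, then u^n ≤ s^n (nQ/X)^n ≤ K Q by `amgm`.
  -- In the superadditivity below the means for A and B add up to 1, and so do s/(s+t) and t/(s+t);
  -- thus this applies, with u = s + t, to A or to B, and no root is taken.
  half : ∀ c cs (A D : C → ℕ) K s u → let n = suc (length cs) ; X = numerator (c ∷ cs) A D ; Q = ∏ (c ∷ cs) D in
   1 ≤ X → s ^ n ≤ K * ∏ (c ∷ cs) A → u * X ≤ s * (n * Q) → u ^ n ≤ K * Q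
  half c cs A D K s u 1≤X hs hu = *-cancelʳ-≤ _ _ (X ^ n) ⦃ m^n≢0 X n ⦃ >-nonZero 1≤X ⦄ ⦄ (begin
   u ^ n * X ^ n                            ≡⟨ sym (^-distrib-* n u X) ⟩
   (u * X) ^ n                              ≤⟨ ^-monoˡ-≤ n hu ⟩
   (s * (n * Q)) ^ n                        ≡⟨ ^-distrib-* n s (n * Q) ⟩
   s ^ n * (n * Q) ^ n                      ≡⟨ cong (s ^ n *_) (^-distrib-* n n Q) ⟩
   s ^ n * (n ^ n * (Q * Q ^ k))            ≤⟨ *-monoˡ-≤ _ hs ⟩
   K * ∏ (c ∷ cs) A * (n ^ n * (Q * Q ^ k)) ≡⟨ l₁ K (∏ (c ∷ cs) A) (n ^ n) Q (Q ^ k) ⟩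
   K * Q * (n ^ n * (∏ (c ∷ cs) A * Q ^ k)) ≤⟨ *-monoʳ-≤ (K * Q) (amgm c cs A D) ⟩
   K * Q * X ^ n                            ∎)
   where
   k n X Q : ℕ
   k = length cs
   n = suc k
   X = numerator (c ∷ cs) A D
   Q = ∏ (c ∷ cs) D
   l₁ : ∀ K P N Q R → K * P * (N * (Q * R)) ≡ K * Q * (N * (P * R))
   l₁ = solve-∀

  vanish : ∀ c cs (A D : C → ℕ) K s → let n = suc (length cs) in
   1 ≤ ∏ (c ∷ cs) D → numerator (c ∷ cs) A D ≡ 0 → s ^ n ≤ K * ∏ (c ∷ cs) A → s ≡ 0
  vanish c cs A D K s 1≤Q X≡0 hs = m^n≡0⇒m≡0 s n (n≤0⇒n≡0 (≤≡ hs (trans (cong (K *_) P≡0) (*-zeroʳ K))))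
   where
   k n : ℕ
   k = length cs
   n = suc k
   P≡0 : ∏ (c ∷ cs) A ≡ 0
   P≡0 = n≤0⇒n≡0 (*-cancelˡ-≤ (n ^ n * ∏ (c ∷ cs) D ^ k)
    ⦃ m*n≢0 (n ^ n) _ ⦃ m^n≢0 n n ⦄ ⦃ m^n≢0 (∏ (c ∷ cs) D) k ⦃ >-nonZero 1≤Q ⦄ ⦄ ⦄
    (≡≤ (lem (n ^ n) (∏ (c ∷ cs) D ^ k) (∏ (c ∷ cs) A))
    (≤-trans (amgm c cs A D) (≡≤ (cong (_^ n) X≡0) z≤n))))
    where
    lem : ∀ a b c → a * b * c ≡ a * (c * b)
    lem = solve-∀

 -- superadditivity of the geometric mean, without roots
 geomean-superadditive : ∀ c cs (A B : C → ℕ) K s t → let n = suc (length cs) in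
  s ^ n ≤ K * ∏ (c ∷ cs) A → t ^ n ≤ K * ∏ (c ∷ cs) B →
  (s + t) ^ n ≤ K * ∏ (c ∷ cs) (λ c → A c + B c)
 geomean-superadditive c cs A B K s t hs ht = go Q refl X refl Y refl
  where
  n X Y Q : ℕ
  D : C → ℕ
  D c = A c + B c
  n = suc (length cs)
  X = numerator (c ∷ cs) A D
  Y = numerator (c ∷ cs) B D
  Q = ∏ (c ∷ cs) D
  A≤ : ∏ (c ∷ cs) A ≤ Q
  A≤ = ∏-mono (c ∷ cs) λ c → m≤m+n (A c) (B c)
  B≤ : ∏ (c ∷ cs) B ≤ Q
  B≤ = ∏-mono (c ∷ cs) λ c → m≤n+m (B c) (A c)
  s≤ : s ^ n ≤ K * Q
  s≤ = ≤-trans hs (*-monoʳ-≤ K A≤)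
  t≤ : t ^ n ≤ K * Q
  t≤ = ≤-trans ht (*-monoʳ-≤ K B≤)
  zeroCase : ∀ u → u ^ n ≤ K * Q → Q ≡ 0 → u ≡ 0
  zeroCase u h Q≡0 = m^n≡0⇒m≡0 u n (n≤0⇒n≡0 (≤≡ h (trans (cong (K *_) Q≡0) (*-zeroʳ K))))
  s0 : s ≡ 0 → (s + t) ^ n ≤ K * Q
  s0 refl = t≤
  t0 : t ≡ 0 → (s + t) ^ n ≤ K * Q
  t0 refl = ≡≤ (cong (_^ n) (+-identityʳ s)) s≤
  go : ∀ q → Q ≡ q → ∀ x → X ≡ x → ∀ y → Y ≡ y → (s + t) ^ n ≤ K * Q
  go zero eq _ _ _ _ = s0 (zeroCase s s≤ eq)
  go (suc q) eq zero ex _ _ = s0 (vanish c cs A D K s (≤≡ (s≤s z≤n) (sym eq)) ex hs)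
  go (suc q) eq (suc x) ex zero ey = t0 (vanish c cs B D K t (≤≡ (s≤s z≤n) (sym eq)) ey ht)
  go (suc q) eq (suc x) ex (suc y) ey with ≤-total ((s + t) * X) (s * (n * Q))
  ... | inj₁ h = half c cs A D K s (s + t) (≤≡ (s≤s z≤n) (sym ex)) hs h
  ... | inj₂ h = half c cs B D K t (s + t) (≤≡ (s≤s z≤n) (sym ey)) ht
   (+-cancelˡ-≤ (s * (n * Q)) _ _ (begin
    s * (n * Q) + (s + t) * Y   ≤⟨ +-monoˡ-≤ _ h ⟩
    (s + t) * X + (s + t) * Y   ≡⟨ sym (*-distribˡ-+ (s + t) X Y) ⟩
    (s + t) * (X + Y)           ≡⟨ cong ((s + t) *_) (numerator-+ (c ∷ cs) A B) ⟩
    (s + t) * (n * Q)           ≡⟨ *-distribʳ-+ (n * Q) s t ⟩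
    s * (n * Q) + t * (n * Q)   ∎))

 -- Superadditivity of the geometric mean is exactly the step that adds one more point to the list.
 -- `K` collects factors that do not vary with x.
 hölder : ∀ {X : Set} (xs : List X) c cs (A : C → X → ℕ) K (s : X → ℕ) → let n = suc (length cs) in
  (∀ x → s x ^ n ≤ K * ∏ (c ∷ cs) (λ c → A c x)) →
  ∑ xs s ^ n ≤ K * ∏ (c ∷ cs) (λ c → ∑ xs (A c))
 hölder [] c cs A K s h = z≤n
 hölder (x ∷ xs) c cs A K s h =
  geomean-superadditive c cs (λ c → A c x) (λ c → ∑ xs (A c)) K (s x) (∑ xs s) (h x) (hölder xs c cs A K s h)

-- Finner's inequality.

module Finner {V X C : Set} (_≟ᵥ_ : (v w : V) → Dec (v ≡ w)) (xs : List X) where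
 open FunctionSum _≟ᵥ_ xs

 -- Induction on the variables. Factors whose scope misses v go into the constant K of `hölder`; the
 -- remaining ones are exactly k + 1, as many as the exponent.
 finner : ∀ k (R : List C) (W : C → (V → X) → ℕ) (scope : C → V → Bool) →
  (∀ c ρ ρ' → (∀ w → scope c w ≡ true → ρ w ≡ ρ' w) → W c ρ ≡ W c ρ') →
  ∀ vs → (∀ {v} → v ∈ vs → length (filterᵇ (λ c → scope c v) R) ≡ suc k) → ∀ ρ →
  S vs (λ r → ∏ R λ c → W c r) ρ ^ suc k ≤ ∏ R λ c → S (filterᵇ (scope c) vs) (λ r → W c r ^ suc k) ρ
 finner k R W scope loc [] deg ρ = ≤-reflexive (sym (∏-^ (suc k) R _))
 finner k R W scope loc (v ∷ vs) deg ρ = begin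
  ∑ xs (λ x → S vs (λ r → ∏ R λ c → W c r) (upd ρ v x)) ^ suc k
   ≤⟨ main (filterᵇ p R) (deg (here refl)) {K = ∏ (filterᵇ (not ∘ p) R) (λ c → Z c ρ)} {A = λ c x → Z c (upd ρ v x)} (λ x → ≤≡ (finner k R W scope loc vs (deg ∘ there) (upd ρ v x))
    (trans (∏-split p R _) (cong (_* ∏ (filterᵇ p R) (λ c → Z c (upd ρ v x)))
     (∏-filter-cong (not ∘ p) R λ c e → Z-off c e x)))) ⟩
  ∏ (filterᵇ (not ∘ p) R) (λ c → Z c ρ) * ∏ (filterᵇ p R) (λ c → ∑ xs λ x → Z c (upd ρ v x))
   ≡⟨ cong₂ _*_ (∏-filter-cong (not ∘ p) R λ c e → final-off c e) (∏-filter-cong p R final-on) ⟩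
  ∏ (filterᵇ (not ∘ p) R) Z' * ∏ (filterᵇ p R) Z'
   ≡⟨ sym (∏-split p R Z') ⟩
  ∏ R Z' ∎
  where
  p : C → Bool
  p c = scope c v
  Z : C → (V → X) → ℕ
  Z c = S (filterᵇ (scope c) vs) (λ r → W c r ^ suc k)
  Z' : C → ℕ
  Z' c = S (filterᵇ (scope c) (v ∷ vs)) (λ r → W c r ^ suc k) ρ
  Z-off : ∀ c → not (p c) ≡ true → ∀ x → Z c (upd ρ v x) ≡ Z c ρ
  Z-off c e x = S-local (λ w → scope c w ≡ true) (filterᵇ (scope c) vs)
   (λ r r' ag → cong (_^ suc k) (loc c r r' ag)) _ _ λ w sw → inj₂ (upd-diff ρ x λ { refl → absurd sw e })
   where
   absurd : ∀ {b} → b ≡ true → not b ≡ true → ⊥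
   absurd refl ()
  final-on : ∀ c → p c ≡ true → ∑ xs (λ x → Z c (upd ρ v x)) ≡ Z' c
  final-on c e rewrite e = refl
  final-off : ∀ c → not (p c) ≡ true → Z c ρ ≡ Z' c
  final-off c e with scope c v
  ... | false = refl
  main : ∀ (cs : List C) → length cs ≡ suc k → ∀ {s : X → ℕ} {K} {A : C → X → ℕ} →
   (∀ x → s x ^ suc k ≤ K * ∏ cs (λ c → A c x)) → ∑ xs s ^ suc k ≤ K * ∏ cs (λ c → ∑ xs (A c))
  main (c ∷ cs) refl {s} {K} {A} h = hölder xs c cs A K s h

-- Booleans, filtered lists and reindexing.

absurd : ∀ {A : Set} {b} → b ≡ true → b ≡ false → A
absurd refl ()

≡⇒T : ∀ {b} → b ≡ true → T b
≡⇒T refl = tt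

T⇒≡ : ∀ {b} → T b → b ≡ true
T⇒≡ {true} _ = refl

Cases : Bool → Set
Cases b = b ≡ true ⊎ b ≡ false

bool-cases : ∀ b → Cases b
bool-cases true = inj₁ refl
bool-cases false = inj₂ refl

refute : ∀ {b} → (b ≡ true → ⊥) → b ≡ false
refute {true} f = ⊥-elim (f refl)
refute {false} f = refl

∧-true⁻ : ∀ {a b} → a ∧ b ≡ true → a ≡ true × b ≡ true
∧-true⁻ {true} {true} _ = refl , refl

∧-true⁺ : ∀ {a b} → a ≡ true → b ≡ true → a ∧ b ≡ true
∧-true⁺ refl refl = refl

∧ˡ : ∀ {a b} → a ∧ b ≡ true → a ≡ true
∧ˡ e = proj₁ (∧-true⁻ e)

∧ʳ : ∀ {a b} → a ∧ b ≡ true → b ≡ true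
∧ʳ {a} e = proj₂ (∧-true⁻ {a} e)

𝟙-∧ : ∀ a b → 𝟙 (a ∧ b) ≡ 𝟙 a * 𝟙 b
𝟙-∧ true b = sym (+-identityʳ (𝟙 b))
𝟙-∧ false b = refl

𝟙-mono : ∀ {a b} → (a ≡ true → b ≡ true) → 𝟙 a ≤ 𝟙 b
𝟙-mono {false} h = z≤n
𝟙-mono {true} h rewrite h refl = ≤-refl

𝟙-true : ∀ {b} → b ≡ true → 𝟙 b ≡ 1
𝟙-true refl = refl

𝟙≤ : ∀ {b n} → (b ≡ true → 1 ≤ n) → 𝟙 b ≤ n
𝟙≤ {true} h = h refl
𝟙≤ {false} h = z≤n

𝟙-not : ∀ b → 𝟙 b + 𝟙 (not b) ≡ 1
𝟙-not true = refl
𝟙-not false = refl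

module _ {A : Set} where

 ∈-filterᵇ⁺ : ∀ (p : A → Bool) {xs x} → x ∈ xs → p x ≡ true → x ∈ filterᵇ p xs
 ∈-filterᵇ⁺ p {y ∷ xs} (here refl) e rewrite e = here refl
 ∈-filterᵇ⁺ p {y ∷ xs} (there i) e with p y
 ... | true = there (∈-filterᵇ⁺ p i e)
 ... | false = ∈-filterᵇ⁺ p i e

 ∈-filterᵇ⁻ : ∀ (p : A → Bool) xs {x} → x ∈ filterᵇ p xs → x ∈ xs × p x ≡ true
 ∈-filterᵇ⁻ p (y ∷ xs) i with p y in eq
 ∈-filterᵇ⁻ p (y ∷ xs) (here refl) | true = here refl , eq
 ∈-filterᵇ⁻ p (y ∷ xs) (there i) | true = let j , e = ∈-filterᵇ⁻ p xs i in there j , e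
 ... | false = let j , e = ∈-filterᵇ⁻ p xs i in there j , e

 filterᵇ-true : ∀ (p : A → Bool) xs {x} → x ∈ filterᵇ p xs → p x ≡ true
 filterᵇ-true p xs i = proj₂ (∈-filterᵇ⁻ p xs i)

 filterᵇ-unique : ∀ (p : A → Bool) {xs} → Unique xs → Unique (filterᵇ p xs)
 filterᵇ-unique p = filter⁺ (T? ∘ p)

 unique-↭ : ∀ {xs ys : List A} → Unique xs → Unique ys →
  (∀ {x} → x ∈ xs → x ∈ ys) → (∀ {x} → x ∈ ys → x ∈ xs) → xs ↭ ys
 unique-↭ u v f g = ∼bag⇒↭ (unique∧set⇒bag u v (mk⇔ f g))

 filter-partition : ∀ (p : A → Bool) {xs} → Unique xs → xs ↭ filterᵇ p xs ++ filterᵇ (not ∘ p) xs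
 filter-partition p {xs} u = unique-↭ u
  (++⁺ (filterᵇ-unique p u) (filterᵇ-unique (not ∘ p) u)
   λ (i , j) → absurd (filterᵇ-true p xs i) (not-injective (filterᵇ-true (not ∘ p) xs j)))
  to from
  where
  to : ∀ {x} → x ∈ xs → x ∈ filterᵇ p xs ++ filterᵇ (not ∘ p) xs
  to {x} i with bool-cases (p x)
  ... | inj₁ e = ∈-++⁺ˡ (∈-filterᵇ⁺ p i e)
  ... | inj₂ e = ∈-++⁺ʳ (filterᵇ p xs) (∈-filterᵇ⁺ (not ∘ p) i (cong not e))
  from : ∀ {x} → x ∈ filterᵇ p xs ++ filterᵇ (not ∘ p) xs → x ∈ xs
  from i with ∈-++⁻ (filterᵇ p xs) i
  ... | inj₁ j = proj₁ (∈-filterᵇ⁻ p xs j)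
  ... | inj₂ j = proj₁ (∈-filterᵇ⁻ (not ∘ p) xs j)

 length-filterᵇ : ∀ (p : A → Bool) xs → length (filterᵇ p xs) ≡ ∑ xs (𝟙 ∘ p)
 length-filterᵇ p [] = refl
 length-filterᵇ p (x ∷ xs) with p x
 ... | true = cong suc (length-filterᵇ p xs)
 ... | false = length-filterᵇ p xs

 ∑-𝟙-single : ∀ (p : A → Bool) {xs x} → Unique xs → x ∈ xs → p x ≡ true →
  (∀ {y} → p y ≡ true → y ≡ x) → ∑ xs (𝟙 ∘ p) ≡ 1
 ∑-𝟙-single p {xs} {x} u i e only = trans (sym (length-filterᵇ p xs)) (go (filterᵇ p xs)
  (filterᵇ-unique p u) (∈-filterᵇ⁺ p i e) λ j → only (filterᵇ-true p xs j))
  where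
  go : ∀ ys → Unique ys → x ∈ ys → (∀ {y} → y ∈ ys → y ≡ x) → length ys ≡ 1
  go (y ∷ []) _ _ _ = refl
  go (y ∷ z ∷ ys) ((y≢z ∷ _) ∷ _) _ h = ⊥-elim (y≢z (trans (h (here refl)) (sym (h (there (here refl))))))

module Reindex {V V' X : Set} (_≟_ : (v w : V) → Dec (v ≡ w)) (_≟'_ : (v w : V') → Dec (v ≡ w)) (xs : List X) where
 private
  module A = FunctionSum _≟_ xs
  module B = FunctionSum _≟'_ xs

 S-map : ∀ (β : V → V') → (∀ {v w} → β v ≡ β w → v ≡ w) → ∀ L (F : (V → X) → ℕ) → A.Ext F → ∀ ρ →
  B.S (map β L) (λ r → F (r ∘ β)) ρ ≡ A.S L F (ρ ∘ β)
 S-map β inj [] F ext ρ = refl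
 S-map β inj (v ∷ L) F ext ρ = ∑-cong xs λ x → trans (S-map β inj L F ext (B.upd ρ (β v) x))
  (A.S-ext L ext _ _ (agree x))
  where
  agree : ∀ x w → B.upd ρ (β v) x (β w) ≡ A.upd (ρ ∘ β) v x w
  agree x w with β v ≟' β w | v ≟ w
  ... | yes _ | yes _ = refl
  ... | no _ | no _ = refl
  ... | yes e | no ne = ⊥-elim (ne (inj e))
  ... | no ne | yes e = ⊥-elim (ne (cong β e))

-- The cube: vertices, flips and parity classes.

_≟V_ : ∀ {d} (v w : Vertex d) → Dec (v ≡ w)
_≟V_ = ≡-dec Bool._≟_

allV : ∀ d → List (Vertex d)
allV zero = [] ∷ []
allV (suc d) = map (false ∷_) (allV d) ++ map (true ∷_) (allV d)

fins : ∀ d → List (Fin d)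
fins zero = []
fins (suc d) = zero ∷ map suc (fins d)

∷-inj : ∀ {d} {b} {v w : Vertex d} → b Data.Vec.∷ v ≡ b ∷ w → v ≡ w
∷-inj refl = refl

∈-allV : ∀ {d} (v : Vertex d) → v ∈ allV d
∈-allV [] = here refl
∈-allV (false ∷ v) = ∈-++⁺ˡ (∈-map⁺ (false ∷_) (∈-allV v))
∈-allV (true ∷ v) = ∈-++⁺ʳ _ (∈-map⁺ (true ∷_) (∈-allV v))

allV-unique : ∀ d → Unique (allV d)
allV-unique zero = [] ∷ []
allV-unique (suc d) = ++⁺ (map⁺ ∷-inj (allV-unique d)) (map⁺ ∷-inj (allV-unique d)) disj
 where
 disj : ∀ {v} → v ∈ map (false ∷_) (allV d) × v ∈ map (true ∷_) (allV d) → ⊥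
 disj (i , j) with ∈-map⁻ (false ∷_) i | ∈-map⁻ (true ∷_) j
 ... | _ , _ , refl | _ , _ , ()

∈-fins : ∀ {d} (i : Fin d) → i ∈ fins d
∈-fins zero = here refl
∈-fins (suc i) = there (∈-map⁺ suc (∈-fins i))

fins-unique : ∀ d → Unique (fins d)
fins-unique zero = []
fins-unique (suc d) = nz (fins d) ∷ map⁺ suc-inj (fins-unique d)
 where
 suc-inj : ∀ {i j : Fin d} → Fin.suc i ≡ suc j → i ≡ j
 suc-inj refl = refl
 nz : ∀ (is : List (Fin d)) → All (Fin.zero ≢_) (map Fin.suc is)
 nz [] = []
 nz (i ∷ is) = (λ ()) ∷ nz is

length-fins : ∀ d → length (fins d) ≡ d
length-fins zero = refl
length-fins (suc d) = cong suc (trans (length-map suc (fins d)) (length-fins d))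

∑-fins : ∀ d c → ∑ (fins d) (λ _ → c) ≡ d * c
∑-fins d c = trans (∑-const c (fins d)) (cong (_* c) (length-fins d))

∑-allV-suc : ∀ d (f : Vertex (suc d) → ℕ) → ∑ (allV (suc d)) f ≡ ∑ (allV d) (f ∘ (false ∷_)) + ∑ (allV d) (f ∘ (true ∷_))
∑-allV-suc d f = trans (∑-++ (map (false ∷_) (allV d)) _ f) (cong₂ _+_ (∑-map _ (allV d) f) (∑-map _ (allV d) f))

∏-allV-suc : ∀ d (f : Vertex (suc d) → ℕ) → ∏ (allV (suc d)) f ≡ ∏ (allV d) (f ∘ (false ∷_)) * ∏ (allV d) (f ∘ (true ∷_))
∏-allV-suc d f = trans (∏-++ (map (false ∷_) (allV d)) _ f) (cong₂ _*_ (∏-map _ (allV d) f) (∏-map _ (allV d) f))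

length-allV : ∀ d → length (allV d) ≡ 2 ^ d
length-allV zero = refl
length-allV (suc d) = trans (length-++ (map (false ∷_) (allV d)))
 (cong₂ _+_ (trans (length-map _ (allV d)) (length-allV d))
  (trans (trans (length-map _ (allV d)) (length-allV d)) (sym (+-identityʳ _))))

flip : ∀ {d} → Vertex d → Fin d → Vertex d
flip (b ∷ v) zero = not b ∷ v
flip (b ∷ v) (suc i) = b ∷ flip v i

par : ∀ {d} → Vertex d → Bool
par [] = false
par (b ∷ v) = b xor par v

flip-flip : ∀ {d} (v : Vertex d) i → flip (flip v i) i ≡ v
flip-flip (b ∷ v) zero = cong (_∷ v) (not-involutive b)
flip-flip (b ∷ v) (suc i) = cong (b ∷_) (flip-flip v i)

flip-injᵛ : ∀ {d} {v w : Vertex d} i → flip v i ≡ flip w i → v ≡ w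
flip-injᵛ {v = v} {w} i e = trans (sym (flip-flip v i)) (trans (cong (λ t → flip t i) e) (flip-flip w i))

flip-inj : ∀ {d} (v : Vertex d) i j → flip v i ≡ flip v j → i ≡ j
flip-inj (b ∷ v) zero zero e = refl
flip-inj (true ∷ v) zero (suc j) ()
flip-inj (false ∷ v) zero (suc j) ()
flip-inj (true ∷ v) (suc i) zero ()
flip-inj (false ∷ v) (suc i) zero ()
flip-inj (b ∷ v) (suc i) (suc j) e = cong suc (flip-inj v i j (∷-inj e))

not-xor : ∀ a b → not a xor b ≡ not (a xor b)
not-xor true b = sym (not-involutive b)
not-xor false b = refl

xor-not : ∀ a b → a xor not b ≡ not (a xor b)
xor-not true b = refl
xor-not false b = refl

par-flip : ∀ {d} (v : Vertex d) i → par (flip v i) ≡ not (par v)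
par-flip (b ∷ v) zero = not-xor b (par v)
par-flip (b ∷ v) (suc i) = trans (cong (b xor_) (par-flip v i)) (xor-not b (par v))

on : ∀ {d} → Bool → Vertex d → Bool
on σ v = not (σ xor par v)

on-flip : ∀ {d} σ (v : Vertex d) i → on σ (flip v i) ≡ not (on σ v)
on-flip σ v i = cong not (trans (cong (σ xor_) (par-flip v i)) (xor-not σ (par v)))

on-not : ∀ {d} σ (v : Vertex d) → on (not σ) v ≡ not (on σ v)
on-not σ v = cong not (not-xor σ (par v))

∑-flip : ∀ d (i : Fin d) (f : Vertex d → ℕ) → ∑ (allV d) (λ v → f (flip v i)) ≡ ∑ (allV d) f
∑-flip (suc d) zero f = trans (∑-allV-suc d _) (trans (+-comm (∑ (allV d) (f ∘ (true ∷_))) _) (sym (∑-allV-suc d f)))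
∑-flip (suc d) (suc i) f = trans (∑-allV-suc d _) (trans (cong₂ _+_ (∑-flip d i (f ∘ (false ∷_))) (∑-flip d i (f ∘ (true ∷_)))) (sym (∑-allV-suc d f)))

∑-edges : ∀ d (f : Vertex d → Vertex d → ℕ) →
 ∑ (allV d) (λ v → ∑ (fins d) λ i → f v (flip v i)) ≡ ∑ (allV d) (λ v → ∑ (fins d) λ i → f (flip v i) v)
∑-edges d f = trans (∑-swap (allV d) (fins d) _) (trans
 (∑-cong (fins d) λ i → trans (sym (∑-flip d i _)) (∑-cong (allV d) λ v → cong (f (flip v i)) (flip-flip v i)))
 (∑-swap (fins d) (allV d) _))

card : ∀ {d} → (Vertex d → Bool) → ℕ
card {d} P = ∑ (allV d) (𝟙 ∘ P)

card-mono : ∀ {d} (P Q : Vertex d → Bool) → (∀ v → P v ≡ true → Q v ≡ true) → card P ≤ card Q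
card-mono {d} P Q h = ∑-mono (allV d) λ v → 𝟙-mono (h v)

card-not : ∀ {d} (P : Vertex d → Bool) → card P + card (not ∘ P) ≡ 2 ^ d
card-not {d} P = trans (sym (∑-+ (allV d) _ _)) (trans (∑-cong (allV d) λ v → 𝟙-not (P v))
 (trans (∑-const 1 (allV d)) (trans (*-identityʳ _) (length-allV d))))

card-on : ∀ d σ → card {suc d} (on σ) ≡ 2 ^ d
card-on d σ = trans (∑-allV-suc d _) (trans (cong (∑ (allV d) (𝟙 ∘ on σ) +_) (∑-cong (allV d) λ v → cong (𝟙 ∘ not) (xor-not σ (par v))))
 (card-not {d} (on σ)))

-- Edge-isoperimetry in the cube.

-- `I` is twice the number of edges inside P, as both orientations are counted; `∂` counts a
-- boundary edge once, from its end in P.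
I ∂ : ∀ {d} → (Vertex d → Bool) → ℕ
I {d} P = ∑ (allV d) λ v → ∑ (fins d) λ i → 𝟙 (P v ∧ P (flip v i))
∂ {d} P = ∑ (allV d) λ v → ∑ (fins d) λ i → 𝟙 (P v ∧ not (P (flip v i)))

I+∂ : ∀ {d} (P : Vertex d → Bool) → I P + ∂ P ≡ d * card P
I+∂ {d} P = trans (sym (∑-+ (allV d) _ _)) (trans (∑-cong (allV d) λ v → trans (sym (∑-+ (fins d) _ _))
 (trans (∑-cong (fins d) λ i → lem (P v) (P (flip v i))) (∑-fins d _)))
 (∑-*ˡ d (allV d) _))
 where
 lem : ∀ a b → 𝟙 (a ∧ b) + 𝟙 (a ∧ not b) ≡ 𝟙 a
 lem true b = 𝟙-not b
 lem false b = refl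

I-suc : ∀ {d} (P : Vertex (suc d) → Bool) → let P₀ = P ∘ (false ∷_) ; P₁ = P ∘ (true ∷_) in
 I P ≡ I P₀ + I P₁ + 2 * card (λ v → P₀ v ∧ P₁ v)
I-suc {d} P = trans (∑-allV-suc d _) (trans (cong₂ _+_ (half (λ v → 𝟙 (P₀ v ∧ P₁ v)) (λ v i → 𝟙 (P₀ v ∧ P₀ (flip v i))) {e = λ _ _ → refl})
 (half (λ v → 𝟙 (P₁ v ∧ P₀ v)) (λ v i → 𝟙 (P₁ v ∧ P₁ (flip v i))) {e = λ _ _ → refl}))
 (trans (cong (λ t → C + I P₀ + (t + I P₁)) (∑-cong (allV d) λ v → cong 𝟙 (∧-comm (P₁ v) (P₀ v))))
  (lem C (I P₀) (I P₁))))
 where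
 P₀ P₁ : Vertex d → Bool
 P₀ = P ∘ (false ∷_)
 P₁ = P ∘ (true ∷_)
 C : ℕ
 C = card (λ v → P₀ v ∧ P₁ v)
 lem : ∀ c a b → c + a + (c + b) ≡ a + b + 2 * c
 lem = solve-∀
 half : ∀ (g : Vertex d → ℕ) (h : Vertex d → Fin d → ℕ) {k : Vertex d → Fin (suc d) → ℕ} →
  {e : ∀ v i → k v (suc i) ≡ h v i} →
  ∑ (allV d) (λ v → g v + ∑ (map suc (fins d)) (k v)) ≡ ∑ (allV d) g + ∑ (allV d) λ v → ∑ (fins d) (h v)
 half g h {k} {e} = trans (∑-+ (allV d) _ _) (cong (_ +_) (∑-cong (allV d) λ v → trans (∑-map suc (fins d) (k v)) (∑-cong (fins d) (e v))))

-- The induction step of the edge-isoperimetric inequality: between halves with a and b points run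
-- at most min(a, b) edges, each worth a factor 4 in 2^I. For b = a + e the left side is (4ab)^a
-- b^e, and 4ab ≤ (a + b)².
entropy : ∀ {a b} → a ≤ b → a ^ a * b ^ b * 4 ^ a ≤ (a + b) ^ (a + b)
entropy {a} a≤b with ≤⇒+ a≤b
... | e , refl = begin
 a ^ a * (a + e) ^ (a + e) * 4 ^ a
  ≡⟨ cong (λ t → a ^ a * t * 4 ^ a) (^-distribˡ-+-* (a + e) a e) ⟩
 a ^ a * ((a + e) ^ a * (a + e) ^ e) * 4 ^ a
  ≡⟨ l₁ (a ^ a) ((a + e) ^ a) ((a + e) ^ e) (4 ^ a) ⟩
 4 ^ a * (a ^ a * (a + e) ^ a) * (a + e) ^ e
  ≡⟨ cong (_* (a + e) ^ e) (trans (cong (4 ^ a *_) (sym (^-distrib-* a a (a + e)))) (sym (^-distrib-* a 4 _))) ⟩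
 (4 * (a * (a + e))) ^ a * (a + e) ^ e
  ≤⟨ *-mono-≤ (^-monoˡ-≤ a (≤≡ (m≤m+n _ (e * e)) (l₂ a e))) (^-monoˡ-≤ e (m≤n+m (a + e) a)) ⟩
 (s * s) ^ a * s ^ e
  ≡⟨ cong (_* s ^ e) (^-distrib-* a s s) ⟩
 s ^ a * s ^ a * s ^ e
  ≡⟨ trans (*-assoc (s ^ a) _ _) (sym (trans (^-distribˡ-+-* s a (a + e)) (cong (s ^ a *_) (^-distribˡ-+-* s a e)))) ⟩
 s ^ s ∎
 where
 s : ℕ
 s = a + (a + e)
 l₁ : ∀ x y z w → x * (y * z) * w ≡ w * (x * y) * z
 l₁ = solve-∀
 l₂ : ∀ a e → 4 * (a * (a + e)) + e * e ≡ (a + (a + e)) * (a + (a + e))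
 l₂ = solve-∀

-- the edge-isoperimetric inequality of the cube, in the form 2e(P) ≤ |P| log₂ |P|
harper : ∀ {d} (P : Vertex d → Bool) → 2 ^ I P ≤ card P ^ card P
harper {zero} P with P []
... | true = ≤-refl
... | false = ≤-refl
harper {suc d} P = begin
 2 ^ I P
  ≡⟨ cong (2 ^_) (I-suc P) ⟩
 2 ^ (I P₀ + I P₁ + 2 * c)
  ≡⟨ trans (^-distribˡ-+-* 2 (I P₀ + I P₁) _) (cong₂ _*_ (^-distribˡ-+-* 2 (I P₀) _) (sym (^-*-assoc 2 2 c))) ⟩
 2 ^ I P₀ * 2 ^ I P₁ * 4 ^ c
  ≤⟨ *-monoˡ-≤ _ (*-mono-≤ (harper P₀) (harper P₁)) ⟩
 a ^ a * b ^ b * 4 ^ c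
  ≤⟨ combine (≤-total a b) ⟩
 (a + b) ^ (a + b)
  ≡⟨ cong (λ t → t ^ t) (sym (∑-allV-suc d _)) ⟩
 card P ^ card P ∎
 where
 P₀ P₁ : Vertex d → Bool
 P₀ = P ∘ (false ∷_)
 P₁ = P ∘ (true ∷_)
 a b c : ℕ
 a = card P₀
 b = card P₁
 c = card (λ v → P₀ v ∧ P₁ v)
 combine : a ≤ b ⊎ b ≤ a → a ^ a * b ^ b * 4 ^ c ≤ (a + b) ^ (a + b)
 combine (inj₁ a≤b) = ≤-trans (*-monoʳ-≤ (a ^ a * b ^ b) (^-monoʳ-≤ 4 (card-mono (λ v → P₀ v ∧ P₁ v) P₀ λ v e → ∧ˡ e))) (entropy a≤b)
 combine (inj₂ b≤a) = ≤-trans (*-monoʳ-≤ (a ^ a * b ^ b) (^-monoʳ-≤ 4 (card-mono (λ v → P₀ v ∧ P₁ v) P₁ λ v e → ∧ʳ {P₀ v} e)))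
  (≡≤ (cong (_* 4 ^ b) (*-comm (a ^ a) (b ^ b))) (≤≡ (entropy b≤a) (cong (λ t → t ^ t) (+-comm b a))))

2^-cancel-≤ : ∀ {a b} → 2 ^ a ≤ 2 ^ b → a ≤ b
2^-cancel-≤ {a} {b} h with a ≤? b
... | yes p = p
... | no q = ⊥-elim (<⇒≱ (^-monoʳ-< 2 ≤-refl (≰⇒> q)) h)

harper-log : ∀ {d} (P : Vertex d → Bool) L → card P ≤ 2 ^ L → I P ≤ L * card P
harper-log P L h = 2^-cancel-≤ (≤-trans (harper P) (≤≡ (^-monoˡ-≤ (card P) h) (^-*-assoc 2 L (card P))))

∂-not : ∀ {d} (P : Vertex d → Bool) → ∂ (not ∘ P) ≡ ∂ P
∂-not {d} P = trans (∑-edges d λ v w → 𝟙 (not (P v) ∧ not (not (P w)))) (∑-cong (allV d) λ v → ∑-cong (fins d) λ i →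
 cong 𝟙 (trans (cong (not (P (flip v i)) ∧_) (not-involutive (P v))) (∧-comm (not (P (flip v i))) (P v))))

-- A set of at most 2^d points has average inner degree at most d by `harper-log`, so on average one
-- of the d + 1 edges at a point leaves it. A larger set is replaced by its complement, which has
-- the same boundary.
isoperimetry : ∀ {d} (P : Vertex (suc d) → Bool) → card P ≤ ∂ P ⊎ card (not ∘ P) ≤ ∂ P
isoperimetry {d} P with ≤-total (card P) (2 ^ d)
... | inj₁ h = inj₁ (small P h)
 where
 small : ∀ (Q : Vertex (suc d) → Bool) → card Q ≤ 2 ^ d → card Q ≤ ∂ Q
 small Q h = +-cancelˡ-≤ (d * card Q) _ _ (≡≤ (trans (+-comm (d * card Q) _) (sym (I+∂ Q))) (+-monoˡ-≤ _ (harper-log Q d h)))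
... | inj₂ h = inj₂ (≤≡ (small (not ∘ P) (+-cancelˡ-≤ (2 ^ d) _ _ (≤-trans (+-monoˡ-≤ _ h) (≤-reflexive
 (trans (card-not P) (cong (2 ^ d +_) (+-identityʳ _))))))) (∂-not P))
 where
 small : ∀ (Q : Vertex (suc d) → Bool) → card Q ≤ 2 ^ d → card Q ≤ ∂ Q
 small Q h = +-cancelˡ-≤ (d * card Q) _ _ (≡≤ (trans (+-comm (d * card Q) _) (sym (I+∂ Q))) (+-monoˡ-≤ _ (harper-log Q d h)))

-- Sums over all functions on a cube, and currying.

∑-concatMap : ∀ {A B : Set} (g : A → List B) xs (f : B → ℕ) → ∑ (concatMap g xs) f ≡ ∑ xs (λ x → ∑ (g x) f)
∑-concatMap g [] f = refl
∑-concatMap g (x ∷ xs) f = trans (∑-++ (g x) _ f) (cong (∑ (g x) f +_) (∑-concatMap g xs f))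

join : ∀ {d} {X : Set} → (Vertex d → X) → (Vertex d → X) → Vertex (suc d) → X
join f₀ f₁ (false ∷ v) = f₀ v
join f₀ f₁ (true ∷ v) = f₁ v

join-cong : ∀ {d} {X : Set} {f₀ f₁ g₀ g₁ : Vertex d → X} → (∀ v → f₀ v ≡ g₀ v) → (∀ v → f₁ v ≡ g₁ v) →
 ∀ v → join f₀ f₁ v ≡ join g₀ g₁ v
join-cong h₀ h₁ (false ∷ v) = h₀ v
join-cong h₀ h₁ (true ∷ v) = h₁ v

left : ∀ n {m} → Vertex (n + m) → Vertex n
left zero v = []
left (suc n) (b ∷ v) = b ∷ left n v

right : ∀ n {m} → Vertex (n + m) → Vertex m
right zero v = v
right (suc n) (b ∷ v) = right n v

module CubeSum {X : Set} (xs : List X) (x₀ : X) where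

 module _ {d : ℕ} where
  open FunctionSum (_≟V_ {d}) xs public

 Tot : ∀ d → ((Vertex d → X) → ℕ) → ℕ
 Tot d F = S (allV d) F (λ _ → x₀)

 Tot-cong : ∀ d {F G : (Vertex d → X) → ℕ} → (∀ f → F f ≡ G f) → Tot d F ≡ Tot d G
 Tot-cong d h = S-cong (allV d) h

 Tot-mono : ∀ d {F G : (Vertex d → X) → ℕ} → (∀ f → F f ≤ G f) → Tot d F ≤ Tot d G
 Tot-mono d h = S-mono (allV d) h

 Tot-base : ∀ {d} {F : (Vertex d → X) → ℕ} → Ext F → ∀ ρ → S (allV d) F ρ ≡ Tot d F
 Tot-base {d} ext ρ = S-base (allV d) ext ∈-allV ρ _

 Tot-∏ : ∀ {d} (g : Vertex d → X → ℕ) → Tot d (λ f → ∏ (allV d) λ v → g v (f v)) ≡ ∏ (allV d) λ v → ∑ xs (g v)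
 Tot-∏ {d} g = S-∏ (allV d) (allV-unique d) g _

 Tot-filter : ∀ {d} (p : Vertex d → Bool) {F : (Vertex d → X) → ℕ} → Ext F → ∀ ρ →
  Tot d F ≡ S (filterᵇ p (allV d)) (S (filterᵇ (not ∘ p) (allV d)) F) ρ
 Tot-filter {d} p {F} ext ρ = trans (sym (Tot-base ext ρ))
  (trans (S-↭ ext (filter-partition p (allV-unique d)) ρ) (S-++ (filterᵇ p (allV d)) _ F ρ))

 Tot-perm : ∀ {d} (π π' : Vertex d → Vertex d) → (∀ v → π (π' v) ≡ v) → (∀ v → π' (π v) ≡ v) →
  ∀ {F : (Vertex d → X) → ℕ} → Ext F → Tot d (λ f → F (f ∘ π)) ≡ Tot d F
 Tot-perm {d} π π' e e' {F} ext = trans (cong (λ L → S L (λ f → F (f ∘ π)) _) (sym all))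
  (trans (Reindex.S-map _≟V_ _≟V_ xs π (inj π π' e') (map π' (allV d)) F ext _)
  (trans (S-↭ ext (unique-↭ (map⁺ (inj π' π e) (allV-unique d)) (allV-unique d) (λ {v} _ → ∈-allV v)
   λ {v} _ → subst (_∈ map π' (allV d)) (e' v) (∈-map⁺ π' (∈-allV (π v)))) _)
  (Tot-base ext _)))
  where
  inj : ∀ (α β : Vertex d → Vertex d) → (∀ v → β (α v) ≡ v) → ∀ {v w} → α v ≡ α w → v ≡ w
  inj α β h {v} {w} eq = trans (sym (h v)) (trans (cong β eq) (h w))
  all : map π (map π' (allV d)) ≡ allV d
  all = go (allV d)
   where
   go : ∀ L → map π (map π' L) ≡ L
   go [] = refl
   go (v ∷ L) = cong₂ _∷_ (e v) (go L)

 Tot-split : ∀ {d} (Φ : (Vertex d → X) → (Vertex d → X) → ℕ) →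
  (∀ f f' g g' → (∀ v → f v ≡ f' v) → (∀ v → g v ≡ g' v) → Φ f g ≡ Φ f' g') →
  Tot (suc d) (λ f → Φ (f ∘ (false ∷_)) (f ∘ (true ∷_))) ≡ Tot d λ f₀ → Tot d λ f₁ → Φ f₀ f₁
 Tot-split {d} Φ ext = trans (S-++ (map (false ∷_) (allV d)) (map (true ∷_) (allV d)) _ _)
  (trans (S-cong (map (false ∷_) (allV d)) λ r → trans
   (S-cong-off (map (true ∷_) (allV d)) λ r' off → ext (r' ∘ (false ∷_)) (r ∘ (false ∷_)) (r' ∘ (true ∷_)) (r' ∘ (true ∷_)) (λ v → off (false ∷ v) (notin v)) (λ _ → refl))
   (trans (Reindex.S-map _≟V_ _≟V_ xs (true ∷_) ∷-inj (allV d) (Φ (r ∘ (false ∷_))) (λ f f' h → ext (r ∘ (false ∷_)) (r ∘ (false ∷_)) f f' (λ _ → refl) h) r)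
    (Tot-base (λ f f' h → ext (r ∘ (false ∷_)) (r ∘ (false ∷_)) f f' (λ _ → refl) h) _)))
   (Reindex.S-map _≟V_ _≟V_ xs (false ∷_) ∷-inj (allV d) (λ f₀ → Tot d λ f₁ → Φ f₀ f₁)
    (λ f f' h → Tot-cong d λ f₁ → ext f f' f₁ f₁ h (λ _ → refl)) _))
  where
  notin : ∀ v → false ∷ v ∉ map (true ∷_) (allV d)
  notin v i with ∈-map⁻ (true ∷_) i
  ... | _ , _ , ()

 Tot-join : ∀ {d} (F : (Vertex (suc d) → X) → ℕ) → Ext F → Tot (suc d) F ≡ Tot d λ f₀ → Tot d λ f₁ → F (join f₀ f₁)
 Tot-join {d} F ext = trans (Tot-cong (suc d) λ f → ext f (join (f ∘ (false ∷_)) (f ∘ (true ∷_))) λ { (false ∷ v) → refl ; (true ∷ v) → refl })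
  (Tot-split (λ f₀ f₁ → F (join f₀ f₁)) λ f f' g g' h k → ext _ _ (join-cong h k))

 Tot-*ˡ : ∀ d c (F : (Vertex d → X) → ℕ) → Tot d (λ f → c * F f) ≡ c * Tot d F
 Tot-*ˡ d c F = S-*ˡ c (allV d) F _

 Tot-*ʳ : ∀ d c (F : (Vertex d → X) → ℕ) → Tot d (λ f → F f * c) ≡ Tot d F * c
 Tot-*ʳ d c F = trans (Tot-cong d λ f → *-comm (F f) c) (trans (Tot-*ˡ d c F) (*-comm c _))

 Tot-+ : ∀ d (F G : (Vertex d → X) → ℕ) → Tot d (λ f → F f + G f) ≡ Tot d F + Tot d G
 Tot-+ d F G = S-+ (allV d) F G _

 Tot-∑ : ∀ d {A : Set} (as : List A) (F : A → (Vertex d → X) → ℕ) → Tot d (λ f → ∑ as λ a → F a f) ≡ ∑ as λ a → Tot d (F a)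
 Tot-∑ d as F = S-∑ (allV d) as F _

 funs : ∀ {d} → List (Vertex d) → (Vertex d → X) → List (Vertex d → X)
 funs [] ρ = ρ ∷ []
 funs (v ∷ vs) ρ = concatMap (λ x → funs vs (upd ρ v x)) xs

 ∑-funs : ∀ {d} (vs : List (Vertex d)) ρ F → ∑ (funs vs ρ) F ≡ S vs F ρ
 ∑-funs [] ρ F = +-identityʳ (F ρ)
 ∑-funs (v ∷ vs) ρ F = trans (∑-concatMap _ xs F) (∑-cong xs λ x → ∑-funs vs (upd ρ v x) F)

 allF : ∀ d → List (Vertex d → X)
 allF d = funs (allV d) (λ _ → x₀)

 ∑-allF : ∀ d F → ∑ (allF d) F ≡ Tot d F
 ∑-allF d F = ∑-funs (allV d) _ F

Tot-swap : ∀ {X Y : Set} (xs : List X) (ys : List Y) x₀ y₀ d e (F : (Vertex d → X) → (Vertex e → Y) → ℕ) →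
 CubeSum.Tot xs x₀ d (λ f → CubeSum.Tot ys y₀ e (F f)) ≡ CubeSum.Tot ys y₀ e (λ g → CubeSum.Tot xs x₀ d (λ f → F f g))
Tot-swap xs ys x₀ y₀ d e F = trans (A.Tot-cong d λ f → sym (B.∑-allF e (F f)))
 (trans (A.Tot-∑ d (B.allF e) (λ g f → F f g)) (B.∑-allF e _))
 where
 module A = CubeSum xs x₀
 module B = CubeSum ys y₀

module _ {X : Set} (xs : List X) (x₀ : X) (m : ℕ) where
 private
  module A = CubeSum xs x₀
  module B = CubeSum (A.allF m) (λ _ → x₀)

 uncurry : ∀ {n} → (Vertex n → Vertex m → X) → Vertex (n + m) → X
 uncurry {n} Ψ v = Ψ (left n v) (right n v)

 -- The n outer coordinates are peeled off one at a time. A function on the (n+m)-cube becomes a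
 -- function on the n-cube whose values are layers, that is, functions on the m-cube.
 Tot-curry : ∀ n (F : (Vertex (n + m) → X) → ℕ) → A.Ext F → A.Tot (n + m) F ≡ B.Tot n (F ∘ uncurry)
 Tot-curry zero F ext = sym (A.∑-allF m F)
 Tot-curry (suc n) F ext = trans (A.Tot-join F ext)
  (trans (A.Tot-cong (n + m) λ f₀ → Tot-curry n (λ f₁ → F (join f₀ f₁)) λ f f' h → ext (join f₀ f) (join f₀ f') (join-cong (λ _ → refl) h))
  (trans (Tot-curry n (λ f₀ → B.Tot n λ Ψ₁ → F (join f₀ (uncurry Ψ₁)))
   λ f f' h → B.Tot-cong n λ Ψ₁ → ext (join f (uncurry Ψ₁)) (join f' (uncurry Ψ₁)) (join-cong h λ _ → refl))
  (trans (sym (B.Tot-split (λ Ψ₀ Ψ₁ → F (join (uncurry Ψ₀) (uncurry Ψ₁))) λ f f' g g' h k →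
   ext _ _ (join-cong (λ v → cong (λ φ → φ (right n v)) (h (left n v))) (λ v → cong (λ φ → φ (right n v)) (k (left n v))))))
  (B.Tot-cong (suc n) λ Ψ → ext (join (uncurry (Ψ ∘ (false ∷_))) (uncurry (Ψ ∘ (true ∷_)))) (uncurry Ψ) λ { (false ∷ v) → refl ; (true ∷ v) → refl }))))

-- Labels of stars of layers, and the bound per edge.

cols : List (Fin 3)
cols = zero ∷ 1F ∷ 2F ∷ []

∈-cols : ∀ k → k ∈ cols
∈-cols zero = here refl
∈-cols 1F = there (here refl)
∈-cols 2F = there (there (here refl))

eqc : Fin 3 → Fin 3 → Bool
eqc a b = does (a Fin.≟ b)

module Colour = CubeSum cols zero
open Colour using (Tot; Tot-*ʳ; Tot-*ˡ; Tot-+; Tot-base; Tot-cong; Tot-mono; Tot-perm; Tot-split; Tot-∏; Tot-∑)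

-- A label (b , K) of a point x of the m-cube describes a pair of adjacent families of layers at x:
-- for b = true the first family is constantly K, for b = false the second one is.
Label : Set
Label = Bool × Fin 3

labels : List Label
labels = map (true ,_) cols ++ map (false ,_) cols

∈-labels : ∀ l → l ∈ labels
∈-labels (true , c) = ∈-++⁺ˡ (∈-map⁺ (true ,_) (∈-cols c))
∈-labels (false , c) = ∈-++⁺ʳ (map (true ,_) cols) (∈-map⁺ (false ,_) (∈-cols c))

∀label : ∀ {P : Label → Set} → All P labels → ∀ l → P l
∀label ps l = All.lookup ps (∈-labels l)

decide₂ : ∀ {P : Label → Label → Set} (P? : ∀ l l' → Dec (P l l')) → {True (All.all? (λ l → All.all? (P? l) labels) labels)} → ∀ l l' → P l l'
decide₂ P? {t} l l' = ∀label (∀label (toWitness t) l) l'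

module Labels = CubeSum labels (true , zero)

-- Colours allowed at a point with the given label: `fOK` for the layers around the centre of a
-- star, `hOK` for the layer at the centre. Negating the Boolean of the label exchanges the two.
fOK hOK : Label → Fin 3 → Bool
fOK (true , K) a = eqc a K
fOK (false , K) a = not (eqc a K)
hOK (true , K) a = not (eqc a K)
hOK (false , K) a = eqc a K

good : Label → Label → Bool
good (b , K) (b' , K') = (b xor b') ∧ eqc K K'

edgeSum : (Label → Fin 3 → Bool) → Label → Label → ℕ
edgeSum κ l l' = ∑ cols λ a → ∑ cols λ b → 𝟙 (κ l a) * 𝟙 (κ l' b) * 𝟙 (not (eqc a b))

-- A good edge has two proper pairs for each of the two families, hence product 4; on a bad edge the
-- product is at most 3. This loss of 3/4 per bad edge drives the large-deviation bound. It is a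
-- check of 36 cases.
edge-bound : ∀ l l' → edgeSum fOK l l' * edgeSum hOK l l' * 4 ^ 𝟙 (not (good l l')) ≤ 4 * 3 ^ 𝟙 (not (good l l'))
edge-bound = decide₂ λ l l' → _ ≤? _

proper : ∀ {d} → (Vertex d → Fin 3) → ℕ
proper {d} f = ∏ (allV d) λ v → ∏ (fins d) λ i → 𝟙 (not (eqc (f v) (f (flip v i))))

∏≤1 : ∀ {A : Set} (xs : List A) (f : A → ℕ) → (∀ x → f x ≤ 1) → ∏ xs f ≤ 1
∏≤1 xs f h = ≤≡ (∏-mono xs h) (∏-one xs)

proper≤1 : ∀ {d} (f : Vertex d → Fin 3) → proper f ≤ 1
proper≤1 {d} f = ∏≤1 (allV d) _ λ v → ∏≤1 (fins d) _ λ i → 𝟙≤1 _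

module _ {d} (f : Vertex (suc d) → Fin 3) where
 private
  f₀ f₁ : Vertex d → Fin 3
  f₀ = f ∘ (false ∷_)
  f₁ = f ∘ (true ∷_)
  row : Bool → ∀ v → ∏ (fins (suc d)) (λ i → 𝟙 (not (eqc (f (false ∷ v)) (f (flip (false ∷ v) i))))) ≡
   𝟙 (not (eqc (f₀ v) (f₁ v))) * ∏ (fins d) (λ i → 𝟙 (not (eqc (f₀ v) (f₀ (flip v i)))))
  row b v = cong (𝟙 (not (eqc (f₀ v) (f₁ v))) *_) (∏-map suc (fins d) _)

 proper≤cross : proper f ≤ ∏ (allV d) λ v → 𝟙 (not (eqc (f₀ v) (f₁ v)))
 proper≤cross = ≡≤ (∏-allV-suc d _) (≤≡ (*-mono-≤
  (∏-mono (allV d) λ v → ≡≤ (row false v) (≤≡ (*-monoʳ-≤ (𝟙 (not (eqc (f₀ v) (f₁ v)))) (∏≤1 (fins d) _ λ i → 𝟙≤1 (not (eqc (f₀ v) (f₀ (flip v i)))))) (*-identityʳ _)))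
  (∏≤1 (allV d) _ λ v → ∏≤1 (fins (suc d)) _ λ i → 𝟙≤1 (not (eqc (f₁ v) (f (flip (true ∷ v) i)))))) (*-identityʳ _))

 proper≤halves : proper f ≤ proper f₀ * proper f₁
 proper≤halves = ≡≤ (∏-allV-suc d _) (*-mono-≤
  (∏-mono (allV d) λ v → drop (not (eqc (f₀ v) (f₁ v))) (≤-reflexive (∏-map suc (fins d) _)))
  (∏-mono (allV d) λ v → drop (not (eqc (f₁ v) (f₀ v))) (≤-reflexive (∏-map suc (fins d) _))))
  where
  drop : ∀ b {x y} → x ≤ y → 𝟙 b * x ≤ y
  drop b h = ≤-trans (*-monoˡ-≤ _ (𝟙≤1 b)) (≡≤ (*-identityˡ _) h)

proper-ext : ∀ {d} → Colour.Ext (proper {d})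
proper-ext {d} f g h = ∏-cong (allV d) λ v → ∏-cong (fins d) λ i → cong₂ (λ a b → 𝟙 (not (eqc a b))) (h v) (h (flip v i))

module _ (κ : Label → Fin 3 → Bool) where

 weight : ∀ {m} → (Vertex m → Label) → (Vertex m → Fin 3) → ℕ
 weight {m} l f = ∏ (allV m) (λ v → 𝟙 (κ (l v) (f v))) * proper f

 weight-ext : ∀ {m} (l : Vertex m → Label) → Colour.Ext (weight l)
 weight-ext {m} l f g h = cong₂ _*_ (∏-cong (allV m) λ v → cong (λ a → 𝟙 (κ (l v) a)) (h v)) (proper-ext f g h)

 Cnt : ∀ {m} → (Vertex m → Label) → ℕ
 Cnt {m} l = Tot m (weight l)

 -- The count that remains when propriety is required only along one direction. Those edges form a
 -- perfect matching, so it is a product over edges.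
 Edir : ∀ {m} → Fin m → (Vertex m → Label) → ℕ
 Edir {suc m} zero l = ∏ (allV m) λ v → edgeSum κ (l (false ∷ v)) (l (true ∷ v))
 Edir (suc i) l = Edir i (l ∘ (false ∷_)) * Edir i (l ∘ (true ∷_))

 Cnt≤Edir : ∀ {m} (i : Fin m) l → Cnt l ≤ Edir i l
 Cnt≤Edir {suc m} zero l = begin
  Cnt l
   ≤⟨ Tot-mono (suc m) (λ f → bound f) ⟩
  Tot (suc m) (λ f → Φ (f ∘ (false ∷_)) (f ∘ (true ∷_)))
   ≡⟨ Tot-split Φ (λ f f' g g' h k → ∏-cong (allV m) λ v → cong₂ (φ v) (h v) (k v)) ⟩
  Tot m (λ f₀ → Tot m λ f₁ → ∏ (allV m) λ v → φ v (f₀ v) (f₁ v))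
   ≡⟨ Tot-cong m (λ f₀ → Tot-∏ λ v b → φ v (f₀ v) b) ⟩
  Tot m (λ f₀ → ∏ (allV m) λ v → ∑ cols (φ v (f₀ v)))
   ≡⟨ Tot-∏ (λ v a → ∑ cols (φ v a)) ⟩
  Edir zero l ∎
  where
  φ : Vertex m → Fin 3 → Fin 3 → ℕ
  φ v a b = 𝟙 (κ (l (false ∷ v)) a) * 𝟙 (κ (l (true ∷ v)) b) * 𝟙 (not (eqc a b))
  Φ : (Vertex m → Fin 3) → (Vertex m → Fin 3) → ℕ
  Φ f g = ∏ (allV m) λ v → φ v (f v) (g v)
  bound : ∀ f → weight l f ≤ Φ (f ∘ (false ∷_)) (f ∘ (true ∷_))
  bound f = ≤≡ (*-mono-≤ (≤-reflexive (trans (∏-allV-suc m _) (sym (∏-* (allV m) _ _)))) (proper≤cross f))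
   (sym (∏-* (allV m) _ _))
 Cnt≤Edir {suc m} (suc i) l = begin
  Cnt l
   ≤⟨ Tot-mono (suc m) (λ f → bound f) ⟩
  Tot (suc m) (λ f → weight l₀ (f ∘ (false ∷_)) * weight l₁ (f ∘ (true ∷_)))
   ≡⟨ Tot-split (λ f g → weight l₀ f * weight l₁ g) (λ f f' g g' h k → cong₂ _*_ (weight-ext l₀ f f' h) (weight-ext l₁ g g' k)) ⟩
  Tot m (λ f → Tot m λ g → weight l₀ f * weight l₁ g)
   ≡⟨ trans (Tot-cong m λ f → Tot-*ˡ m (weight l₀ f) (weight l₁)) (Tot-*ʳ m (Cnt l₁) (weight l₀)) ⟩
  Cnt l₀ * Cnt l₁
   ≤⟨ *-mono-≤ (Cnt≤Edir i l₀) (Cnt≤Edir i l₁) ⟩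
  Edir (suc i) l ∎
  where
  l₀ l₁ : Vertex m → Label
  l₀ = l ∘ (false ∷_)
  l₁ = l ∘ (true ∷_)
  bound : ∀ f → weight l f ≤ weight l₀ (f ∘ (false ∷_)) * weight l₁ (f ∘ (true ∷_))
  bound f = ≤≡ (*-mono-≤ (≤-reflexive (∏-allV-suc m _)) (proper≤halves f)) (lem (∏ (allV m) _) _ _ _)
   where
   lem : ∀ a b c d → a * b * (c * d) ≡ a * c * (b * d)
   lem = solve-∀

-- The number of bad edges in one direction, with the recursion of `Edir` so that the two can be
-- compared factor by factor.
wd : ∀ {m} → Fin m → (Vertex m → Label) → ℕ
wd {suc m} zero l = ∑ (allV m) λ v → 𝟙 (not (good (l (false ∷ v)) (l (true ∷ v))))
wd (suc i) l = wd i (l ∘ (false ∷_)) + wd i (l ∘ (true ∷_))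

Edir-bound : ∀ {m} (i : Fin (suc m)) l → Edir fOK i l * Edir hOK i l * 4 ^ wd i l ≤ 4 ^ (2 ^ m) * 3 ^ wd i l
Edir-bound {m} zero l = begin
 ∏ (allV m) (λ v → edgeSum fOK (l₀ v) (l₁ v)) * ∏ (allV m) (λ v → edgeSum hOK (l₀ v) (l₁ v)) * 4 ^ wd zero l
  ≡⟨ cong₂ _*_ (sym (∏-* (allV m) _ _)) (sym (∏-2^ 4 (allV m) _)) ⟩
 ∏ (allV m) (λ v → edgeSum fOK (l₀ v) (l₁ v) * edgeSum hOK (l₀ v) (l₁ v)) * ∏ (allV m) (λ v → 4 ^ bad v)
  ≡⟨ sym (∏-* (allV m) _ _) ⟩
 ∏ (allV m) (λ v → edgeSum fOK (l₀ v) (l₁ v) * edgeSum hOK (l₀ v) (l₁ v) * 4 ^ bad v)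
  ≤⟨ ∏-mono (allV m) (λ v → edge-bound (l₀ v) (l₁ v)) ⟩
 ∏ (allV m) (λ v → 4 * 3 ^ bad v)
  ≡⟨ trans (∏-* (allV m) _ _) (cong₂ _*_ (trans (∏-const 4 (allV m)) (cong (4 ^_) (length-allV m))) (∏-2^ 3 (allV m) _)) ⟩
 4 ^ (2 ^ m) * 3 ^ wd zero l ∎
 where
 l₀ l₁ : Vertex m → Label
 l₀ = l ∘ (false ∷_)
 l₁ = l ∘ (true ∷_)
 bad : Vertex m → ℕ
 bad v = 𝟙 (not (good (l₀ v) (l₁ v)))
Edir-bound {suc m} (suc i) l = begin
 f₀ * f₁ * (h₀ * h₁) * 4 ^ (w₀ + w₁)
  ≡⟨ trans (cong (f₀ * f₁ * (h₀ * h₁) *_) (^-distribˡ-+-* 4 w₀ w₁)) (l₁ f₀ f₁ h₀ h₁ (4 ^ w₀) (4 ^ w₁)) ⟩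
 f₀ * h₀ * 4 ^ w₀ * (f₁ * h₁ * 4 ^ w₁)
  ≤⟨ *-mono-≤ (Edir-bound i (l ∘ (false ∷_))) (Edir-bound i (l ∘ (true ∷_))) ⟩
 4 ^ (2 ^ m) * 3 ^ w₀ * (4 ^ (2 ^ m) * 3 ^ w₁)
  ≡⟨ trans (l₂ (4 ^ (2 ^ m)) (3 ^ w₀) (3 ^ w₁)) (cong₂ _*_ (trans (sym (^-distribˡ-+-* 4 (2 ^ m) _)) (cong (λ t → 4 ^ (2 ^ m + t)) (sym (+-identityʳ (2 ^ m)))))
   (sym (^-distribˡ-+-* 3 w₀ w₁))) ⟩
 4 ^ (2 ^ suc m) * 3 ^ (w₀ + w₁) ∎
 where
 f₀ f₁ h₀ h₁ w₀ w₁ : ℕ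
 f₀ = Edir fOK i (l ∘ (false ∷_))
 f₁ = Edir fOK i (l ∘ (true ∷_))
 h₀ = Edir hOK i (l ∘ (false ∷_))
 h₁ = Edir hOK i (l ∘ (true ∷_))
 w₀ = wd i (l ∘ (false ∷_))
 w₁ = wd i (l ∘ (true ∷_))
 l₁ : ∀ a b c d e f → a * b * (c * d) * (e * f) ≡ a * c * e * (b * d * f)
 l₁ = solve-∀
 l₂ : ∀ a b c → a * b * (a * c) ≡ a * a * (b * c)
 l₂ = solve-∀

-- Good edges of spanning trees and the sum over labellings.

-- Γ counts good edges of a spanning tree of the m-cube: all edges in the first direction, and then
-- recursively those of the better of the two halves.
Γ : ∀ {m} → (Vertex m → Label) → ℕ
Γ {zero} l = 0
Γ {suc m} l = ∑ (allV m) (λ v → 𝟙 (good (l (false ∷ v)) (l (true ∷ v)))) + (Γ (l ∘ (false ∷_)) ⊔ Γ (l ∘ (true ∷_)))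

Γ-ext : ∀ {m} (l l' : Vertex m → Label) → (∀ v → l v ≡ l' v) → Γ l ≡ Γ l'
Γ-ext {zero} l l' h = refl
Γ-ext {suc m} l l' h = cong₂ _+_ (∑-cong (allV m) λ v → cong₂ (λ a b → 𝟙 (good a b)) (h _) (h _))
 (cong₂ _⊔_ (Γ-ext _ _ λ v → h (false ∷ v)) (Γ-ext _ _ λ v → h (true ∷ v)))

treeSize : ℕ → ℕ
treeSize zero = 0
treeSize (suc m) = 2 ^ m + treeSize m

weightedSum : ∀ m → (Fin m → ℕ) → ℕ
weightedSum zero w = 0
weightedSum (suc m) w = 2 ^ suc m * w zero + weightedSum m (w ∘ suc)

weightedSum-+ : ∀ m (w w' : Fin m → ℕ) → weightedSum m (λ i → w i + w' i) ≡ weightedSum m w + weightedSum m w'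
weightedSum-+ zero w w' = refl
weightedSum-+ (suc m) w w' = trans (cong₂ _+_ (*-distribˡ-+ (2 ^ suc m) (w zero) (w' zero)) (weightedSum-+ m (w ∘ suc) (w' ∘ suc)))
 (lem (2 ^ suc m * w zero) (2 ^ suc m * w' zero) (weightedSum m (w ∘ suc)) (weightedSum m (w' ∘ suc)))
 where
 lem : ∀ a b c d → a + b + (c + d) ≡ a + c + (b + d)
 lem = solve-∀

weightedSum-≤ : ∀ m {w : Fin m → ℕ} {c} → (∀ i → w i ≤ c) → weightedSum m w ≤ 2 ^ suc m * c
weightedSum-≤ zero h = z≤n
weightedSum-≤ (suc m) {w} {c} h = ≤≡ (+-mono-≤ (*-monoʳ-≤ (2 ^ suc m) (h zero)) (weightedSum-≤ m (h ∘ suc)))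
 (lem (2 ^ suc m) c)
 where
 lem : ∀ x c → x * c + x * c ≡ 2 * x * c
 lem = solve-∀

-- If the halves in `Γ` were chosen at random, a bad edge of direction i would enter the tree with
-- probability 2^-i; `weightedSum` is 2^m times the expected number of bad edges. The maximum does
-- at least as well as the average.
tree-average : ∀ {m} (l : Vertex m → Label) → 2 ^ m * treeSize m ≤ 2 ^ m * Γ l + weightedSum m (λ i → wd i l)
tree-average {zero} l = z≤n
tree-average {suc m} l = begin
 2 * p * (p + treeSize m)
  ≡⟨ trans (cong (λ t → 2 * p * (t + treeSize m)) (sym split)) (l₁ p g w (treeSize m)) ⟩
 2 * p * g + 2 * p * w + (p * treeSize m + p * treeSize m)
  ≤⟨ +-monoʳ-≤ (2 * p * g + 2 * p * w) (+-mono-≤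
   (≤-trans (tree-average l₀) (+-monoˡ-≤ _ (*-monoʳ-≤ p (m≤m⊔n (Γ l₀) (Γ l₁')))))
   (≤-trans (tree-average l₁') (+-monoˡ-≤ _ (*-monoʳ-≤ p (m≤n⊔m (Γ l₀) (Γ l₁')))))) ⟩
 2 * p * g + 2 * p * w + (p * M + s₀ + (p * M + s₁))
  ≡⟨ l₂ p g w M s₀ s₁ ⟩
 2 * p * (g + M) + (2 * p * w + (s₀ + s₁))
  ≡⟨ cong (λ t → 2 * p * (g + M) + (2 * p * w + t)) (sym (weightedSum-+ m _ _)) ⟩
 2 ^ suc m * Γ l + weightedSum (suc m) (λ i → wd i l) ∎
 where
 l₀ l₁' : Vertex m → Label
 l₀ = l ∘ (false ∷_)
 l₁' = l ∘ (true ∷_)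
 p g w M s₀ s₁ : ℕ
 p = 2 ^ m
 g = ∑ (allV m) (λ v → 𝟙 (good (l (false ∷ v)) (l (true ∷ v))))
 w = wd zero l
 M = Γ l₀ ⊔ Γ l₁'
 s₀ = weightedSum m (λ i → wd i l₀)
 s₁ = weightedSum m (λ i → wd i l₁')
 split : g + w ≡ p
 split = trans (sym (∑-+ (allV m) _ _)) (trans (∑-cong (allV m) λ v → 𝟙-not (good (l (false ∷ v)) (l (true ∷ v))))
  (trans (∑-const 1 (allV m)) (trans (*-identityʳ _) (length-allV m))))
 l₁ : ∀ p g w t → 2 * p * (g + w + t) ≡ 2 * p * g + 2 * p * w + (p * t + p * t)
 l₁ = solve-∀
 l₂ : ∀ p g w M s t → 2 * p * g + 2 * p * w + (p * M + s + (p * M + t)) ≡ 2 * p * (g + M) + (2 * p * w + (s + t))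
 l₂ = solve-∀

treeSize≤ : ∀ {m} (l : Vertex m → Label) {c} → (∀ i → wd i l ≤ c) → treeSize m ≤ Γ l + 2 * c
treeSize≤ {m} l {c} h = *-cancelˡ-≤ (2 ^ m) ⦃ m^n≢0 2 m ⦄ (≤-trans (tree-average l)
 (≤≡ (+-monoʳ-≤ (2 ^ m * Γ l) (weightedSum-≤ m h)) (lem (2 ^ m) (Γ l) c)))
 where
 lem : ∀ p g c → p * g + 2 * p * c ≡ p * (g + 2 * c)
 lem = solve-∀

module _ (K : ℕ) (1≤K : 1 ≤ K) where
 private
  instance
   K≢0 : NonZero K
   K≢0 = >-nonZero 1≤K
  k : Label → Label → ℕ
  k l l' = K ^ 𝟙 (good l l')

 -- Goodness matches each of the six labels with exactly one other, so summing K to the number of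
 -- good edges over one end of an edge gives K + 5.
 degree : ∀ l → ∑ labels (λ l' → 𝟙 (good l l')) ≡ 1 × ∑ labels (λ l' → 𝟙 (good l' l)) ≡ 1
 degree = ∀label ((refl , refl) ∷ (refl , refl) ∷ (refl , refl) ∷ (refl , refl) ∷ (refl , refl) ∷ (refl , refl) ∷ [])

 private
  pow-𝟙 : ∀ b → K ^ 𝟙 b ≡ 1 + (K ∸ 1) * 𝟙 b
  pow-𝟙 true = trans (*-identityʳ K) (trans (sym (m+[n∸m]≡n 1≤K)) (cong (1 +_) (sym (*-identityʳ _))))
  pow-𝟙 false = cong suc (sym (*-zeroʳ (K ∸ 1)))

  sum-pow : ∀ (g : Label → Bool) → ∑ labels (𝟙 ∘ g) ≡ 1 → ∑ labels (λ l → K ^ 𝟙 (g l)) ≡ K + 5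
  sum-pow g e = trans (∑-cong labels λ l → pow-𝟙 (g l)) (trans (∑-+ labels (λ _ → 1) (λ l → (K ∸ 1) * 𝟙 (g l)))
   (trans (cong (6 +_) (trans (∑-*ˡ (K ∸ 1) labels (𝟙 ∘ g)) (trans (cong ((K ∸ 1) *_) e) (*-identityʳ _))))
   (trans (+-comm 6 (K ∸ 1)) (trans (lem (K ∸ 1)) (cong (_+ 5) (m+[n∸m]≡n 1≤K))))))
   where
   lem : ∀ x → x + 6 ≡ 1 + x + 5
   lem = solve-∀

 -- Bounding the maximum in `Γ` by the sum over both halves costs a factor 2 per dimension. For a
 -- given choice, each label of the discarded half is summed out against its partner and gives K +
 -- 5; the last remaining label gives 6.
 label-sum : ∀ m → Labels.Tot m (λ l → K ^ Γ l) ≤ 6 * (2 ^ m * (K + 5) ^ treeSize m)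
 label-sum zero = ≤-refl
 label-sum (suc m) = begin
  Labels.Tot (suc m) (λ l → K ^ Γ l)
   ≤⟨ Labels.Tot-mono (suc m) bound ⟩
  Labels.Tot (suc m) (λ l → Φ (l ∘ (false ∷_)) (l ∘ (true ∷_)))
   ≡⟨ Labels.Tot-split Φ (λ f f' g g' h h' → cong₂ _*_ (∏-cong (allV m) λ v → cong₂ k (h v) (h' v))
    (cong₂ _+_ (cong (K ^_) (Γ-ext f f' h)) (cong (K ^_) (Γ-ext g g' h')))) ⟩
  Labels.Tot m (λ l₀ → Labels.Tot m λ l₁ → Φ l₀ l₁)
   ≡⟨ trans (Labels.Tot-cong m λ l₀ → trans (Labels.Tot-cong m λ l₁ → *-distribˡ-+ (∏k l₀ l₁) (K ^ Γ l₀) (K ^ Γ l₁)) (Labels.Tot-+ m _ _)) (Labels.Tot-+ m _ _) ⟩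
  Labels.Tot m (λ l₀ → Labels.Tot m λ l₁ → ∏k l₀ l₁ * K ^ Γ l₀) + Labels.Tot m (λ l₀ → Labels.Tot m λ l₁ → ∏k l₀ l₁ * K ^ Γ l₁)
   ≡⟨ cong₂ _+_ first (trans (Tot-swap labels labels (true , zero) (true , zero) m m λ l₀ l₁ → ∏k l₀ l₁ * K ^ Γ l₁) second) ⟩
  Q * A + Q * A
   ≤⟨ +-mono-≤ (*-monoʳ-≤ Q (label-sum m)) (*-monoʳ-≤ Q (label-sum m)) ⟩
  Q * (6 * (2 ^ m * R)) + Q * (6 * (2 ^ m * R))
   ≡⟨ trans (lem Q (2 ^ m) R) (cong (λ t → 6 * (2 ^ suc m * t)) (sym (^-distribˡ-+-* (K + 5) (2 ^ m) _))) ⟩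
  6 * (2 ^ suc m * (K + 5) ^ treeSize (suc m)) ∎
  where
  A Q R : ℕ
  A = Labels.Tot m (λ l → K ^ Γ l)
  Q = (K + 5) ^ (2 ^ m)
  R = (K + 5) ^ treeSize m
  ∏k : (Vertex m → Label) → (Vertex m → Label) → ℕ
  ∏k l₀ l₁ = ∏ (allV m) λ v → k (l₀ v) (l₁ v)
  Φ : (Vertex m → Label) → (Vertex m → Label) → ℕ
  Φ l₀ l₁ = ∏k l₀ l₁ * (K ^ Γ l₀ + K ^ Γ l₁)
  lem : ∀ q p r → q * (6 * (p * r)) + q * (6 * (p * r)) ≡ 6 * (2 * p * (q * r))
  lem = solve-∀
  constQ : ∏ (allV m) (λ _ → K + 5) ≡ Q
  constQ = trans (∏-const (K + 5) (allV m)) (cong ((K + 5) ^_) (length-allV m))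
  first : Labels.Tot m (λ l₀ → Labels.Tot m λ l₁ → ∏k l₀ l₁ * K ^ Γ l₀) ≡ Q * A
  first = trans (Labels.Tot-cong m λ l₀ → trans (Labels.Tot-*ʳ m (K ^ Γ l₀) (∏k l₀)) (cong (_* K ^ Γ l₀)
   (trans (Labels.Tot-∏ λ v l → k (l₀ v) l) (trans (∏-cong (allV m) λ v → sum-pow (good (l₀ v)) (proj₁ (degree (l₀ v)))) constQ))))
   (Labels.Tot-*ˡ m Q _)
  second : Labels.Tot m (λ l₁ → Labels.Tot m λ l₀ → ∏k l₀ l₁ * K ^ Γ l₁) ≡ Q * A
  second = trans (Labels.Tot-cong m λ l₁ → trans (Labels.Tot-*ʳ m (K ^ Γ l₁) (λ l₀ → ∏k l₀ l₁)) (cong (_* K ^ Γ l₁)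
   (trans (Labels.Tot-∏ λ v l → k l (l₁ v)) (trans (∏-cong (allV m) λ v → sum-pow (λ l → good l (l₁ v)) (proj₂ (degree (l₁ v)))) constQ))))
   (Labels.Tot-*ˡ m Q _)
  bound : ∀ l → K ^ Γ l ≤ Φ (l ∘ (false ∷_)) (l ∘ (true ∷_))
  bound l = ≡≤ (^-distribˡ-+-* K (∑ (allV m) λ v → 𝟙 (good (l (false ∷ v)) (l (true ∷ v)))) (Γ (l ∘ (false ∷_)) ⊔ Γ (l ∘ (true ∷_)))) (*-mono-≤
   (≤-reflexive (sym (∏-2^ K (allV m) λ v → 𝟙 (good (l (false ∷ v)) (l (true ∷ v)))))) (max (Γ (l ∘ (false ∷_))) (Γ (l ∘ (true ∷_)))))
   where
   max : ∀ a b → K ^ (a ⊔ b) ≤ K ^ a + K ^ b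
   max a b with ⊔-sel a b
   ... | inj₁ e rewrite e = m≤m+n _ _
   ... | inj₂ e rewrite e = m≤n+m _ _

-- Elementary estimates for powers.

-- This is (1 + c/K)^j ≤ 1/(1 - cj/K), with e = K - cj. The induction uses (K + c) e ≤ K (c + e),
-- which holds as e ≤ K.
pow-ratio : ∀ K c j e → c * j + e ≡ K → (K + c) ^ j * e ≤ K ^ j * K
pow-ratio K c zero e eq = ≡≤ (*-identityˡ e) (≤≡ (m≤n+m e (c * 0)) (trans eq (sym (*-identityˡ K))))
pow-ratio K c (suc j) e eq = begin
 (K + c) * (K + c) ^ j * e        ≡⟨ l₁ (K + c) ((K + c) ^ j) e ⟩
 (K + c) ^ j * ((K + c) * e)      ≤⟨ *-monoʳ-≤ ((K + c) ^ j) step ⟩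
 (K + c) ^ j * (K * (c + e))      ≡⟨ l₂ ((K + c) ^ j) K (c + e) ⟩
 K * ((K + c) ^ j * (c + e))      ≤⟨ *-monoʳ-≤ K (pow-ratio K c j (c + e) (trans (l₃ c j e) eq)) ⟩
 K * (K ^ j * K)                  ≡⟨ sym (*-assoc K (K ^ j) K) ⟩
 K * K ^ j * K                    ∎
 where
 l₁ : ∀ a b e → a * b * e ≡ b * (a * e)
 l₁ = solve-∀
 l₂ : ∀ a b e → a * (b * e) ≡ b * (a * e)
 l₂ = solve-∀
 l₃ : ∀ c j e → c * j + (c + e) ≡ c * suc j + e
 l₃ = solve-∀
 l₄ : ∀ K c e → (K + c) * e ≡ K * e + c * e
 l₄ = solve-∀
 step : (K + c) * e ≤ K * (c + e)
 step = ≡≤ (l₄ K c e) (≤≡ (+-monoʳ-≤ (K * e) (*-monoʳ-≤ c (≤≡ (m≤n+m e (c * suc j)) eq)))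
  (l₅ K c e))
  where
  l₅ : ∀ K c e → K * e + c * K ≡ K * (c + e)
  l₅ = solve-∀

^-cancelˡ-≤ : ∀ n {x y} → x ^ suc n ≤ y ^ suc n → x ≤ y
^-cancelˡ-≤ n {x} {y} h with x ≤? y
... | yes p = p
... | no q = ⊥-elim (<⇒≱ (^-monoˡ-< (suc n) (≰⇒> q)) h)

double-power : ∀ a → 1 ≤ a → 2 * a ^ a ≤ (a + 1) ^ a
double-power (suc b) _ = +-cancelʳ-≤ (b * a ^ a) _ _ (≡≤ (lem b (a ^ b)) (≤-trans (bernoulli b (a + 1) a)
 ≤-refl))
 where
 a : ℕ
 a = suc b
 lem : ∀ b x → 2 * (suc b * x) + b * (suc b * x) ≡ suc b * ((suc b + 1) * x)
 lem = solve-∀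

argmax : ∀ {m} (w : Fin (suc m) → ℕ) → ∃ λ i → ∀ j → w j ≤ w i
argmax {zero} w = zero , λ { zero → ≤-refl }
argmax {suc m} w with argmax (w ∘ suc)
... | i , h with ≤-total (w zero) (w (suc i))
...   | inj₁ le = suc i , λ { zero → le ; (suc j) → h j }
...   | inj₂ ge = zero , λ { zero → ≤-refl ; (suc j) → ≤-trans (h j) ge }

wd-≤ : ∀ {m} (i : Fin (suc m)) l → wd i l ≤ 2 ^ m
wd-≤ {m} zero l = ≤≡ (∑-mono (allV m) λ v → 𝟙≤1 _) (trans (∑-const 1 (allV m)) (trans (*-identityʳ _) (length-allV m)))
wd-≤ {suc m} (suc i) l = ≤≡ (+-mono-≤ (wd-≤ i _) (wd-≤ i _)) (cong (2 ^ m +_) (sym (+-identityʳ _)))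

wd-ext : ∀ {m} (i : Fin m) (l l' : Vertex m → Label) → (∀ v → l v ≡ l' v) → wd i l ≡ wd i l'
wd-ext {suc m} zero l l' h = ∑-cong (allV m) λ v → cong₂ (λ a b → 𝟙 (not (good a b))) (h _) (h _)
wd-ext (suc i) l l' h = cong₂ _+_ (wd-ext i _ _ λ v → h (false ∷ v)) (wd-ext i _ _ λ v → h (true ∷ v))

treeSize≤2^ : ∀ m → treeSize m ≤ 2 ^ m
treeSize≤2^ zero = z≤n
treeSize≤2^ (suc m) = +-monoʳ-≤ (2 ^ m) (≤≡ (treeSize≤2^ m) (sym (+-identityʳ _)))

-- The tilted weight of a labelling and its n-th moment.

module Tilt (m' : ℕ) where

 m P E a : ℕ
 m = suc m'
 P = 2 ^ m'
 E = m * P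
 -- If every direction has at most w bad edges, the tilt is at most (1 + 1/(16m))^(mw) ≤ (9/8)^w.
 -- Against the (3/4)^w of `edge-bound` this leaves (27/32)^w.
 a = 16 * m

 bads : (Vertex m → Label) → ℕ
 bads l = ∑ (fins m) λ i → wd i l

 bads-ext : ∀ l l' → (∀ v → l v ≡ l' v) → bads l ≡ bads l'
 bads-ext l l' h = ∑-cong (fins m) λ i → wd-ext i l l' h

 bads≤ : ∀ l {c} → (∀ i → wd i l ≤ c) → bads l ≤ m * c
 bads≤ l {c} h = ≤≡ (∑-mono (fins m) h) (trans (∑-const c (fins m)) (cong (_* c) (length-fins m)))

 -- the weight (1 + 1/a) ^ bads, with its denominator cleared
 tilt : (Vertex m → Label) → ℕ
 tilt l = (a + 1) ^ bads l * a ^ (E ∸ bads l)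

 tilt-eq : ∀ l → tilt l * a ^ bads l ≡ (a + 1) ^ bads l * a ^ E
 tilt-eq l = trans (*-assoc ((a + 1) ^ bads l) _ _) (cong ((a + 1) ^ bads l *_)
  (trans (sym (^-distribˡ-+-* a (E ∸ bads l) (bads l))) (cong (a ^_) (m∸n+n≡m (bads≤ l λ i → wd-≤ i l)))))

 private
  instance
   a≢0 : NonZero a
   a≢0 = _

 tilt-step : (a + 1) ^ m * 8 ≤ 9 * a ^ m
 tilt-step = *-cancelʳ-≤ _ _ (15 * m) (begin
  (a + 1) ^ m * 8 * (15 * m)   ≡⟨ l₁ ((a + 1) ^ m) m ⟩
  8 * ((a + 1) ^ m * (15 * m)) ≤⟨ *-monoʳ-≤ 8 (pow-ratio a 1 m (15 * m) (l₂ m)) ⟩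
  8 * (a ^ m * a)              ≤⟨ m≤m+n _ (7 * (a ^ m * m)) ⟩
  8 * (a ^ m * a) + 7 * (a ^ m * m) ≡⟨ l₃ (a ^ m) m ⟩
  9 * a ^ m * (15 * m)         ∎)
  where
  l₁ : ∀ x m → x * 8 * (15 * m) ≡ 8 * (x * (15 * m))
  l₁ = solve-∀
  l₂ : ∀ m → 1 * m + 15 * m ≡ 16 * m
  l₂ = solve-∀
  l₃ : ∀ x m → 8 * (x * (16 * m)) + 7 * (x * m) ≡ 9 * x * (15 * m)
  l₃ = solve-∀

 tilt-bound : ∀ l {w} → (∀ i → wd i l ≤ w) → tilt l * 8 ^ w ≤ 9 ^ w * a ^ E
 tilt-bound l {w} h with ≤⇒+ (bads≤ l h)
 ... | e , eq = *-cancelʳ-≤ _ _ (a ^ (m * w)) ⦃ m^n≢0 a (m * w) ⦄ (begin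
  tilt l * 8 ^ w * a ^ (m * w)
   ≡⟨ cong (λ t → tilt l * 8 ^ w * a ^ t) (sym eq) ⟩
  tilt l * 8 ^ w * a ^ (b + e)
   ≡⟨ trans (cong (tilt l * 8 ^ w *_) (^-distribˡ-+-* a b e)) (l₁ (tilt l) (8 ^ w) (a ^ b) (a ^ e)) ⟩
  tilt l * a ^ b * (8 ^ w * a ^ e)
   ≡⟨ cong (_* (8 ^ w * a ^ e)) (tilt-eq l) ⟩
  (a + 1) ^ b * a ^ E * (8 ^ w * a ^ e)
   ≤⟨ *-monoʳ-≤ ((a + 1) ^ b * a ^ E) (*-monoʳ-≤ (8 ^ w) (^-monoˡ-≤ e (m≤m+n a 1))) ⟩
  (a + 1) ^ b * a ^ E * (8 ^ w * (a + 1) ^ e)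
   ≡⟨ trans (l₂ ((a + 1) ^ b) (a ^ E) (8 ^ w) ((a + 1) ^ e)) (cong (λ t → t * 8 ^ w * a ^ E) (sym (^-distribˡ-+-* (a + 1) b e))) ⟩
  (a + 1) ^ (b + e) * 8 ^ w * a ^ E
   ≡⟨ cong (λ t → t * 8 ^ w * a ^ E) (trans (cong ((a + 1) ^_) eq) (sym (^-*-assoc (a + 1) m w))) ⟩
  ((a + 1) ^ m) ^ w * 8 ^ w * a ^ E
   ≡⟨ cong (_* a ^ E) (sym (^-distrib-* w ((a + 1) ^ m) 8)) ⟩
  ((a + 1) ^ m * 8) ^ w * a ^ E
   ≤⟨ *-monoˡ-≤ (a ^ E) (^-monoˡ-≤ w tilt-step) ⟩
  (9 * a ^ m) ^ w * a ^ E
   ≡⟨ trans (cong (_* a ^ E) (trans (^-distrib-* w 9 (a ^ m)) (cong (9 ^ w *_) (^-*-assoc a m w)))) (l₃ (9 ^ w) (a ^ (m * w)) (a ^ E)) ⟩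
  9 ^ w * a ^ E * a ^ (m * w) ∎)
  where
  b : ℕ
  b = bads l
  l₁ : ∀ t x y z → t * x * (y * z) ≡ t * y * (x * z)
  l₁ = solve-∀
  l₂ : ∀ x y z w → x * y * (z * w) ≡ x * w * z * y
  l₂ = solve-∀
  l₃ : ∀ x y z → x * y * z ≡ x * z * y
  l₃ = solve-∀

 A : ℕ
 A = a ^ E * 4 ^ P

 module _ (n K : ℕ) (1≤K : 1 ≤ K) (gap : K * K * 27 ^ n ≤ 32 ^ n) (10T≤K : 10 * treeSize m ≤ K) where

  Y : (Vertex m → Label) → ℕ
  Y l = tilt l * (Cnt fOK l * Cnt hOK l)

  -- Let w be the largest number of bad edges in one direction. The matching bound in that direction
  -- gives Y ≤ A (27/32)^w, while the best tree has at most 2w bad edges. The resulting loss K^(2w)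
  -- is paid by the n-th power through `gap`.
  Y-bound : ∀ l → Y l ^ n * K ^ treeSize m ≤ A ^ n * K ^ Γ l
  Y-bound l with argmax (λ i → wd i l)
  ... | i , h = begin
   Y l ^ n * K ^ treeSize m
    ≤⟨ *-monoʳ-≤ (Y l ^ n) (≤≡ (^-monoʳ-≤ K ⦃ >-nonZero 1≤K ⦄ (treeSize≤ l h)) (trans (^-distribˡ-+-* K (Γ l) (2 * w)) (*-comm (K ^ Γ l) _))) ⟩
   Y l ^ n * (K ^ (2 * w) * K ^ Γ l)
    ≡⟨ sym (*-assoc (Y l ^ n) _ _) ⟩
   Y l ^ n * K ^ (2 * w) * K ^ Γ l
    ≤⟨ *-monoˡ-≤ (K ^ Γ l) core ⟩
   A ^ n * K ^ Γ l ∎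
   where
   w : ℕ
   w = wd i l
   FH : ℕ
   FH = Cnt fOK l * Cnt hOK l
   l₁ : ∀ t f x y → t * f * (x * y) ≡ t * x * (f * y)
   l₁ = solve-∀
   l₂ : ∀ x y z w → x * y * (z * w) ≡ x * w * (y * z)
   l₂ = solve-∀
   base : Y l * 32 ^ w ≤ 27 ^ w * A
   base = begin
    tilt l * FH * 32 ^ w
     ≡⟨ trans (cong (tilt l * FH *_) (^-distrib-* w 8 4)) (l₁ (tilt l) FH (8 ^ w) (4 ^ w)) ⟩
    tilt l * 8 ^ w * (FH * 4 ^ w)
     ≤⟨ *-mono-≤ (tilt-bound l h) (≤-trans (*-monoˡ-≤ (4 ^ w) (*-mono-≤ (Cnt≤Edir fOK i l) (Cnt≤Edir hOK i l))) (Edir-bound i l)) ⟩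
    9 ^ w * a ^ E * (4 ^ P * 3 ^ w)
     ≡⟨ trans (l₂ (9 ^ w) (a ^ E) (4 ^ P) (3 ^ w)) (cong (_* A) (sym (^-distrib-* w 9 3))) ⟩
    27 ^ w * A ∎
   swapPow : ∀ x y z → (x ^ y) ^ z ≡ (x ^ z) ^ y
   swapPow x y z = trans (^-*-assoc x y z) (trans (cong (x ^_) (*-comm y z)) (sym (^-*-assoc x z y)))
   K²w : K ^ (2 * w) ≡ (K * K) ^ w
   K²w = trans (sym (^-*-assoc K 2 w)) (cong (λ t → (K * t) ^ w) (*-identityʳ K))
   core : Y l ^ n * K ^ (2 * w) ≤ A ^ n
   core = *-cancelʳ-≤ _ _ ((27 ^ n) ^ w) ⦃ m^n≢0 (27 ^ n) w ⦃ m^n≢0 27 n ⦄ ⦄ (begin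
    Y l ^ n * K ^ (2 * w) * (27 ^ n) ^ w
     ≡⟨ trans (*-assoc (Y l ^ n) _ _) (cong (λ t → Y l ^ n * t) (trans (cong (_* (27 ^ n) ^ w) K²w) (sym (^-distrib-* w (K * K) (27 ^ n))))) ⟩
    Y l ^ n * (K * K * 27 ^ n) ^ w
     ≤⟨ *-monoʳ-≤ (Y l ^ n) (^-monoˡ-≤ w gap) ⟩
    Y l ^ n * (32 ^ n) ^ w
     ≡⟨ trans (cong (Y l ^ n *_) (swapPow 32 n w)) (sym (^-distrib-* n (Y l) (32 ^ w))) ⟩
    (Y l * 32 ^ w) ^ n
     ≤⟨ ^-monoˡ-≤ n base ⟩
    (27 ^ w * A) ^ n
     ≡⟨ trans (^-distrib-* n (27 ^ w) A) (trans (cong (_* A ^ n) (swapPow 27 w n)) (*-comm _ (A ^ n))) ⟩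
    A ^ n * (27 ^ n) ^ w ∎)

  -- After `Y-bound` the sum over labellings loses only (1 + 5/K)^treeSize, at most 2 because K ≥ 10
  -- treeSize; 12 is 6 · 2 with the 6 of `label-sum`.
  Y-sum : Labels.Tot m (λ l → Y l ^ n) ≤ A ^ n * (12 * 2 ^ m)
  Y-sum = *-cancelʳ-≤ _ _ (K ^ M) ⦃ m^n≢0 K M ⦃ >-nonZero 1≤K ⦄ ⦄ (begin
   Labels.Tot m (λ l → Y l ^ n) * K ^ M
    ≡⟨ sym (Labels.Tot-*ʳ m (K ^ M) _) ⟩
   Labels.Tot m (λ l → Y l ^ n * K ^ M)
    ≤⟨ Labels.Tot-mono m Y-bound ⟩
   Labels.Tot m (λ l → A ^ n * K ^ Γ l)
    ≡⟨ Labels.Tot-*ˡ m (A ^ n) _ ⟩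
   A ^ n * Labels.Tot m (λ l → K ^ Γ l)
    ≤⟨ *-monoʳ-≤ (A ^ n) (≤-trans (label-sum K 1≤K m) (*-monoʳ-≤ 6 (*-monoʳ-≤ (2 ^ m) pow))) ⟩
   A ^ n * (6 * (2 ^ m * (2 * K ^ M)))
    ≡⟨ lem (A ^ n) (2 ^ m) (K ^ M) ⟩
   A ^ n * (12 * 2 ^ m) * K ^ M ∎)
   where
   M : ℕ
   M = treeSize m
   lem : ∀ x y z → x * (6 * (y * (2 * z))) ≡ x * (12 * y) * z
   lem = solve-∀
   pow : (K + 5) ^ M ≤ 2 * K ^ M
   pow with ≤⇒+ 10T≤K
   ... | e , eq = *-cancelʳ-≤ _ _ K ⦃ >-nonZero 1≤K ⦄ (begin
    (K + 5) ^ M * K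
     ≤⟨ *-monoʳ-≤ ((K + 5) ^ M) (≡≤ (sym eq) (≤≡ (m≤m+n _ e) (l₁ M e))) ⟩
    (K + 5) ^ M * (2 * (5 * M + e))
     ≡⟨ l₂ ((K + 5) ^ M) (5 * M + e) ⟩
    2 * ((K + 5) ^ M * (5 * M + e))
     ≤⟨ *-monoʳ-≤ 2 (pow-ratio K 5 M (5 * M + e) (trans (l₃ M e) eq)) ⟩
    2 * (K ^ M * K)
     ≡⟨ sym (*-assoc 2 (K ^ M) K) ⟩
    2 * K ^ M * K ∎)
    where
    l₁ : ∀ M e → 10 * M + e + e ≡ 2 * (5 * M + e)
    l₁ = solve-∀
    l₂ : ∀ x y → x * (2 * y) ≡ 2 * (x * y)
    l₂ = solve-∀
    l₃ : ∀ M e → 5 * M + (5 * M + e) ≡ 10 * M + e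
    l₃ = solve-∀

-- Finite quantifiers, proper colourings and the label of a star.

allL anyL : ∀ {A : Set} → List A → (A → Bool) → Bool
allL [] q = true
allL (x ∷ xs) q = q x ∧ allL xs q
anyL xs q = not (allL xs (not ∘ q))

allL⁻ : ∀ {A : Set} {xs} {q : A → Bool} → allL xs q ≡ true → ∀ {x} → x ∈ xs → q x ≡ true
allL⁻ e (here refl) = ∧ˡ e
allL⁻ {xs = y ∷ ys} {q} e (there i) = allL⁻ (∧ʳ {q y} e) i

allL⁺ : ∀ {A : Set} xs {q : A → Bool} → (∀ {x} → x ∈ xs → q x ≡ true) → allL xs q ≡ true
allL⁺ [] h = refl
allL⁺ (x ∷ xs) h = ∧-true⁺ (h (here refl)) (allL⁺ xs (h ∘ there))

allL-false : ∀ {A : Set} xs {q : A → Bool} → allL xs q ≡ false → ∃ λ x → x ∈ xs × q x ≡ false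
allL-false (x ∷ xs) {q} e with q x in eq
... | false = x , here refl , eq
... | true with allL-false xs e
...   | y , i , e' = y , there i , e'

anyL⁺ : ∀ {A : Set} {xs} {q : A → Bool} {x} → x ∈ xs → q x ≡ true → anyL xs q ≡ true
anyL⁺ {xs = xs} {q} i e with bool-cases (allL xs (not ∘ q))
... | inj₂ f = cong not f
... | inj₁ f = absurd e (not-injective (allL⁻ f i))

anyL⁻ : ∀ {A : Set} xs {q : A → Bool} → anyL xs q ≡ true → ∃ λ x → x ∈ xs × q x ≡ true
anyL⁻ xs e with allL-false xs (not-injective e)
... | x , i , f = x , i , not-injective f

allL-cong : ∀ {A : Set} (xs : List A) {q q' : A → Bool} → (∀ x → q x ≡ q' x) → allL xs q ≡ allL xs q'
allL-cong [] h = refl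
allL-cong (x ∷ xs) h = cong₂ _∧_ (h x) (allL-cong xs h)

∏𝟙-cases : ∀ {A : Set} (xs : List A) (q : A → Bool) →
 ((∀ {x} → x ∈ xs → q x ≡ true) × ∏ xs (𝟙 ∘ q) ≡ 1) ⊎ ((∃ λ x → x ∈ xs × q x ≡ false) × ∏ xs (𝟙 ∘ q) ≡ 0)
∏𝟙-cases xs q with bool-cases (allL xs q)
... | inj₁ e = inj₁ (allL⁻ e , trans (∏-cong∈ xs λ i → 𝟙-true (allL⁻ e i)) (∏-one xs))
... | inj₂ e with allL-false xs e
...   | x , i , f = inj₂ ((x , i , f) , ∏≡0 (𝟙 ∘ q) i (cong 𝟙 f))

eqc-refl : ∀ a → eqc a a ≡ true
eqc-refl a with a Fin.≟ a
... | yes _ = refl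
... | no ne = ⊥-elim (ne refl)

eqc-≡ : ∀ {a b} → eqc a b ≡ true → a ≡ b
eqc-≡ {a} {b} e with a Fin.≟ b
... | yes p = p

eqc-≢ : ∀ {a b} → a ≢ b → eqc a b ≡ false
eqc-≢ {a} {b} ne with a Fin.≟ b
... | yes p = ⊥-elim (ne p)
... | no _ = refl

eqc-≢⁻ : ∀ a b → eqc a b ≡ false → a ≢ b
eqc-≢⁻ a b e refl = absurd (eqc-refl a) e

third-colour : ∀ (h K a b : Fin 3) → h ≢ a → h ≢ b → K ≢ a → K ≢ b → a ≢ b → h ≡ K
third-colour = from-yes (all? λ (h : Fin 3) → all? λ K → all? λ a → all? λ b → ¬? (h Fin.≟ a) →-dec (¬? (h Fin.≟ b) →-dec (¬? (K Fin.≟ a) →-dec (¬? (K Fin.≟ b) →-dec (¬? (a Fin.≟ b) →-dec (h Fin.≟ K))))))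

proper⁻ : ∀ {d} (f : Vertex d → Fin 3) → 1 ≤ proper f → ∀ v i → f v ≢ f (flip v i)
proper⁻ {d} f h v i e = 1+n≰n (≤≡ h (∏≡0 _ (∈-allV v)
 (∏≡0 (λ j → 𝟙 (not (eqc (f v) (f (flip v j))))) (∈-fins i) (cong (𝟙 ∘ not) (trans (cong (eqc (f v)) (sym e)) (eqc-refl (f v)))))))

proper⁺ : ∀ {d} (f : Vertex d → Fin 3) → (∀ v i → f v ≢ f (flip v i)) → proper f ≡ 1
proper⁺ {d} f h = trans (∏-cong (allV d) λ v → trans (∏-cong (fins d) λ i → cong (𝟙 ∘ not) (eqc-≢ (h v i))) (∏-one (fins d))) (∏-one (allV d))

app : ∀ {n m} → Vertex n → Vertex m → Vertex (n + m)
app [] x = x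
app (b ∷ s) x = b ∷ app s x

left-app : ∀ {n m} (s : Vertex n) (x : Vertex m) → left n (app s x) ≡ s
left-app [] x = refl
left-app (b ∷ s) x = cong (b ∷_) (left-app s x)

right-app : ∀ {n m} (s : Vertex n) (x : Vertex m) → right n (app s x) ≡ x
right-app [] x = refl
right-app (b ∷ s) x = right-app s x

flip-appˡ : ∀ {n m} (s : Vertex n) (x : Vertex m) i → flip (app s x) (i Fin.↑ˡ m) ≡ app (flip s i) x
flip-appˡ (b ∷ s) x zero = refl
flip-appˡ (b ∷ s) x (suc i) = cong (b ∷_) (flip-appˡ s x i)

flip-appʳ : ∀ {n m} (s : Vertex n) (x : Vertex m) i → flip (app s x) (n Fin.↑ʳ i) ≡ app s (flip x i)
flip-appʳ [] x i = refl
flip-appʳ (b ∷ s) x i = cong (b ∷_) (flip-appʳ s x i)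

adj : ∀ {n} → Vertex n → Vertex n → Bool
adj {n} r s = anyL (fins n) λ j → does (flip r j ≟V s)

does-≡ : ∀ {n} {r s : Vertex n} → does (r ≟V s) ≡ true → r ≡ s
does-≡ {r = r} {s} e with r ≟V s
... | yes p = p

does-refl : ∀ {n} (r : Vertex n) → does (r ≟V r) ≡ true
does-refl r with r ≟V r
... | yes p = refl
... | no q = ⊥-elim (q refl)

adj-flip : ∀ {n} (r : Vertex n) j → adj r (flip r j) ≡ true
adj-flip r j = anyL⁺ (∈-fins j) (does-refl (flip r j))

adj⁻ : ∀ {n} {r s : Vertex n} → adj r s ≡ true → ∃ λ j → flip r j ≡ s
adj⁻ {n} e with anyL⁻ (fins n) e
... | j , _ , e' = j , does-≡ e'

neighbours-unique : ∀ {n} (r : Vertex n) → Unique (map (flip r) (fins n))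
neighbours-unique {n} r = map⁺ (λ {i} {j} → flip-inj r i j) (fins-unique n)

-- The least colour not among the `t j`. The last branch does not test 2F, so the value is
-- meaningful only if some colour is missing.
avoid : ∀ {n} → (Fin n → Fin 3) → Fin 3
avoid {n} t = if allL (fins n) (λ j → not (eqc (t j) zero)) then zero
 else if allL (fins n) (λ j → not (eqc (t j) 1F)) then 1F else 2F

avoid-spec : ∀ {n} (t : Fin n → Fin 3) {h} → (∀ j → h ≢ t j) → ∀ j → avoid t ≢ t j
avoid-spec {n} t {h} a j with bool-cases (allL (fins n) (λ j → not (eqc (t j) zero)))
... | inj₁ e rewrite e = λ z → absurd (trans (cong (eqc (t j)) z) (eqc-refl (t j))) (not-injective (allL⁻ e (∈-fins j)))
... | inj₂ e rewrite e with bool-cases (allL (fins n) (λ j → not (eqc (t j) 1F)))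
...   | inj₁ e' rewrite e' = λ z → absurd (trans (cong (eqc (t j)) z) (eqc-refl (t j))) (not-injective (allL⁻ e' (∈-fins j)))
...   | inj₂ e' rewrite e' with allL-false (fins n) e | allL-false (fins n) e'
...     | j₀ , _ , f₀ | j₁ , _ , f₁ = subst (_≢ t j) (h≡2 h (λ z → a j₀ (trans z (sym (eqc-≡ (not-injective f₀))))) λ z → a j₁ (trans z (sym (eqc-≡ (not-injective f₁))))) (a j)
 where
 h≡2 : ∀ (h : Fin 3) → h ≢ zero → h ≢ 1F → h ≡ 2F
 h≡2 zero a b = ⊥-elim (a refl)
 h≡2 1F a b = ⊥-elim (b refl)
 h≡2 2F a b = refl

-- If the centre has a colour different from all `t j`, these take one or two colours; with two, the
-- colour of the centre is forced to be the third.
lab : ∀ {k} → (Fin (suc k) → Fin 3) → Label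
lab {k} t = if allL (fins (suc k)) (λ j → eqc (t j) (t zero)) then (true , t zero) else (false , avoid t)

lab-h : ∀ {k} (t : Fin (suc k) → Fin 3) h → (∀ j → h ≢ t j) → hOK (lab t) h ≡ true
lab-h {k} t h a with bool-cases (allL (fins (suc k)) (λ j → eqc (t j) (t zero)))
... | inj₁ e rewrite e = cong not (eqc-≢ (a zero))
... | inj₂ e rewrite e with allL-false (fins (suc k)) e
...   | j , _ , f = trans (cong (λ z → eqc z (avoid t)) (third-colour h (avoid t) (t j) (t zero) (a j) (a zero)
 (avoid-spec t a j) (avoid-spec t a zero) (eqc-≢⁻ (t j) (t zero) f))) (eqc-refl (avoid t))

lab-f : ∀ {k} (t : Fin (suc k) → Fin 3) h → (∀ j → h ≢ t j) → ∀ j → fOK (lab t) (t j) ≡ true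
lab-f {k} t h a j with bool-cases (allL (fins (suc k)) (λ j → eqc (t j) (t zero)))
... | inj₁ e rewrite e = allL⁻ e (∈-fins j)
... | inj₂ e rewrite e = cong not (eqc-≢ (avoid-spec t a j ∘ sym))

lab-ext : ∀ {k} (t t' : Fin (suc k) → Fin 3) → (∀ j → t j ≡ t' j) → lab t ≡ lab t'
lab-ext {k} t t' h = cong₂ (λ b p → if b then (true , proj₁ p) else (false , proj₂ p))
 (allL-cong (fins (suc k)) λ j → cong₂ eqc (h j) (h zero)) (cong₂ _,_ (h zero) avoid-ext)
 where
 avoid-ext : avoid t ≡ avoid t'
 avoid-ext = cong₂ (λ a b → if a then zero else if b then 1F else 2F)
  (allL-cong (fins (suc k)) λ j → cong (λ z → not (eqc z zero)) (h j))
  (allL-cong (fins (suc k)) λ j → cong (λ z → not (eqc z 1F)) (h j))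

eqL : Label → Label → Bool
eqL (b , K) (b' , K') = not (b xor b') ∧ eqc K K'

eqL-sum : ∀ l → ∑ labels (𝟙 ∘ eqL l) ≡ 1
eqL-sum = ∀label (refl ∷ refl ∷ refl ∷ refl ∷ refl ∷ refl ∷ [])

eqL-≡ : ∀ {l l'} → eqL l l' ≡ true → l ≡ l'
eqL-≡ {true , K} {true , K'} e = cong (true ,_) (eqc-≡ e)
eqL-≡ {false , K} {false , K'} e = cong (false ,_) (eqc-≡ e)

x^suc≤x : ∀ k {x} → x ≤ 1 → x ^ suc k ≤ x
x^suc≤x k {zero} h = z≤n
x^suc≤x k {suc zero} h = ≤-reflexive (^-zeroˡ (suc k))
x^suc≤x k {suc (suc x)} (s≤s ())

-- Hölder over the stars of Q_n.

module Stars (m' k : ℕ) (p : Bool) where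
 open Tilt m' public

 n : ℕ
 n = suc k

 X : Set
 X = Vertex m → Fin 3

 XS : List X
 XS = Colour.allF m

 module B = CubeSum XS (λ _ → zero)

 centres variables : List (Vertex n)
 centres = filterᵇ (not ∘ on p) (allV n)
 variables = filterᵇ (on p) (allV n)

 labs : Vertex n → (Vertex n → X) → Vertex m → Label
 labs r Ψ x = lab λ j → Ψ (flip r j) x

 -- Equals 1 if h is a possible layer at the centre r, given the layers at its neighbours, and 0
 -- otherwise.
 okh : Vertex n → (Vertex n → X) → X → ℕ
 okh r Ψ h = proper h * ∏ (allV m) λ x → ∏ (fins n) λ j → 𝟙 (not (eqc (h x) (Ψ (flip r j) x)))

 layer : Vertex n → (Vertex n → X) → ℕ
 layer r Ψ = (∏ (fins n) λ j → proper (Ψ (flip r j))) * tilt (labs r Ψ)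

 Wt : Vertex n → (Vertex n → X) → ℕ
 Wt r Ψ = layer r Ψ * ∑ XS (okh r Ψ)

 private
  okh-local : ∀ r Ψ Ψ' h → (∀ j → Ψ (flip r j) ≡ Ψ' (flip r j)) → okh r Ψ h ≡ okh r Ψ' h
  okh-local r Ψ Ψ' h e = cong (proper h *_) (∏-cong (allV m) λ x → ∏-cong (fins n) λ j → cong (λ g → 𝟙 (not (eqc (h x) (g x)))) (e j))

  labs-local : ∀ r Ψ Ψ' → (∀ j → Ψ (flip r j) ≡ Ψ' (flip r j)) → ∀ x → labs r Ψ x ≡ labs r Ψ' x
  labs-local r Ψ Ψ' e x = lab-ext _ _ λ j → cong (λ g → g x) (e j)

  tilt-ext : ∀ l l' → (∀ x → l x ≡ l' x) → tilt l ≡ tilt l'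
  tilt-ext l l' h = cong (λ b → (a + 1) ^ b * a ^ (E ∸ b)) (bads-ext l l' h)

  layer-local : ∀ r Ψ Ψ' → (∀ j → Ψ (flip r j) ≡ Ψ' (flip r j)) → layer r Ψ ≡ layer r Ψ'
  layer-local r Ψ Ψ' e = cong₂ _*_ (∏-cong (fins n) λ j → cong proper (e j)) (tilt-ext _ _ (labs-local r Ψ Ψ' e))

  Wt-local : ∀ r Ψ Ψ' → (∀ j → Ψ (flip r j) ≡ Ψ' (flip r j)) → Wt r Ψ ≡ Wt r Ψ'
  Wt-local r Ψ Ψ' e = cong₂ _*_ (layer-local r Ψ Ψ' e) (∑-cong XS λ h → okh-local r Ψ Ψ' h e)

  okh⁻ : ∀ r Ψ h → 1 ≤ okh r Ψ h → ∀ x j → h x ≢ Ψ (flip r j) x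
  okh⁻ r Ψ h q x j e = 1+n≰n (≤≡ q (trans (cong (proper h *_) (∏≡0 _ (∈-allV x)
   (∏≡0 (λ j → 𝟙 (not (eqc (h x) (Ψ (flip r j) x)))) (∈-fins j) (cong (𝟙 ∘ not) (trans (cong (eqc (h x)) (sym e)) (eqc-refl (h x)))))))
   (*-zeroʳ (proper h))))

  okh≤weight : ∀ r Ψ h → okh r Ψ h ≤ weight hOK (labs r Ψ) h
  okh≤weight r Ψ h = ≡≤ (*-comm (proper h) _) (*-monoˡ-≤ (proper h) (∏-mono (allV m) λ x → go x))
   where
   go : ∀ x → ∏ (fins n) (λ j → 𝟙 (not (eqc (h x) (Ψ (flip r j) x)))) ≤ 𝟙 (hOK (labs r Ψ x) (h x))
   go x with ∏𝟙-cases (fins n) (λ j → not (eqc (h x) (Ψ (flip r j) x)))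
   ... | inj₁ (all , e) = ≡≤ e (≤-reflexive (sym (𝟙-true (lab-h _ (h x) λ j → eqc-≢⁻ (h x) (Ψ (flip r j) x) (not-injective (all (∈-fins j)))))))
   ... | inj₂ (_ , e) = ≡≤ e z≤n

  G : Vertex n → (Vertex m → Label) → (Vertex n → X) → ℕ
  G r l Ψ = (tilt l * Cnt hOK l) ^ n * ∏ (fins n) λ j → weight fOK l (Ψ (flip r j))

  indicator : ∀ (l : Vertex m → Label) → Labels.Tot m (λ l' → ∏ (allV m) λ x → 𝟙 (eqL (l x) (l' x))) ≡ 1
  indicator l = trans (Labels.Tot-∏ λ x l' → 𝟙 (eqL (l x) l')) (trans (∏-cong (allV m) λ x → eqL-sum (l x)) (∏-one (allV m)))

  weight-label : ∀ κ (l l' : Vertex m → Label) → (∀ x → l x ≡ l' x) → ∀ f → weight κ l f ≡ weight κ l' f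
  weight-label κ l l' h f = cong (_* proper f) (∏-cong (allV m) λ x → cong (λ z → 𝟙 (κ z (f x))) (h x))

  -- Given the label, there are at most `Cnt hOK` layers for the centre, and `Wt` vanishes if a
  -- neighbouring layer violates `fOK`. The factors `proper` are 0 or 1, so their n-th power may be
  -- lowered to the first; then `G` is a product over the n neighbouring layers.
  Wt-pointwise : ∀ r Ψ → Wt r Ψ ^ n ≤ G r (labs r Ψ) Ψ
  Wt-pointwise r Ψ with bool-cases (allL (allV m) λ x → allL (fins n) λ j → fOK (labs r Ψ x) (Ψ (flip r j) x))
  ... | inj₂ bad = ≡≤ (trans (cong (_^ n) (trans (cong (layer r Ψ *_) (trans (∑-cong XS zero!) (∑-zero XS))) (*-zeroʳ (layer r Ψ)))) refl) z≤n
   where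
   zero! : ∀ h → okh r Ψ h ≡ 0
   zero! h with okh r Ψ h in eq
   ... | zero = refl
   ... | suc _ with allL-false (allV m) bad
   ...   | x , _ , bx with allL-false (fins n) bx
   ...     | j , _ , bj = absurd (lab-f _ (h x) (okh⁻ r Ψ h (≤≡ (s≤s z≤n) (sym eq)) x) j) bj
  ... | inj₁ ok = begin
   (∏ (fins n) (λ j → proper (Ψ (flip r j))) * tilt l * ∑ XS (okh r Ψ)) ^ n
    ≤⟨ ^-monoˡ-≤ n (*-monoʳ-≤ (layer r Ψ) (≤≡ (∑-mono XS (okh≤weight r Ψ)) (Colour.∑-allF m _))) ⟩
   (∏ (fins n) (λ j → proper (Ψ (flip r j))) * tilt l * Cnt hOK l) ^ n
    ≡⟨ trans (cong (_^ n) (trans (*-assoc Π (tilt l) _) (*-comm Π _))) (^-distrib-* n (tilt l * Cnt hOK l) Π) ⟩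
   (tilt l * Cnt hOK l) ^ n * Π ^ n
    ≤⟨ *-monoʳ-≤ ((tilt l * Cnt hOK l) ^ n) (x^suc≤x k (∏≤1 (fins n) _ λ j → proper≤1 (Ψ (flip r j)))) ⟩
   (tilt l * Cnt hOK l) ^ n * Π
    ≡⟨ cong ((tilt l * Cnt hOK l) ^ n *_) (∏-cong (fins n) λ j → sym (trans (cong (_* proper (Ψ (flip r j)))
     (trans (∏-cong (allV m) λ x → 𝟙-true (allL⁻ (allL⁻ ok (∈-allV x)) (∈-fins j))) (∏-one (allV m)))) (*-identityˡ _))) ⟩
   G r l Ψ ∎
   where
   l : Vertex m → Label
   l = labs r Ψ
   Π : ℕ
   Π = ∏ (fins n) λ j → proper (Ψ (flip r j))

  Cnt-ext : ∀ κ (l l' : Vertex m → Label) → (∀ x → l x ≡ l' x) → Cnt κ l ≡ Cnt κ l'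
  Cnt-ext κ l l' h = Tot-cong m (weight-label κ l l' h)

  -- Passing from the actual label to the sum over all labellings decouples the layers: for fixed l
  -- each of them is summed on its own in `scope-sum`.
  Wt-labels : ∀ r Ψ → Wt r Ψ ^ n ≤ Labels.Tot m (λ l → G r l Ψ)
  Wt-labels r Ψ = ≡≤ (trans (sym (trans (cong (Wt r Ψ ^ n *_) (indicator (labs r Ψ))) (*-identityʳ _)))
   (sym (Labels.Tot-*ˡ m (Wt r Ψ ^ n) _))) (Labels.Tot-mono m go)
   where
   go : ∀ l → Wt r Ψ ^ n * ∏ (allV m) (λ x → 𝟙 (eqL (labs r Ψ x) (l x))) ≤ G r l Ψ
   go l with ∏𝟙-cases (allV m) (λ x → eqL (labs r Ψ x) (l x))
   ... | inj₂ (_ , e) = ≡≤ (trans (cong (Wt r Ψ ^ n *_) e) (*-zeroʳ (Wt r Ψ ^ n))) z≤n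
   ... | inj₁ (all , e) = ≡≤ (trans (cong (Wt r Ψ ^ n *_) e) (*-identityʳ _)) (≤≡ (Wt-pointwise r Ψ)
    (cong₂ _*_ (cong (_^ n) (cong₂ _*_ (tilt-ext _ _ h) (Cnt-ext hOK _ _ h))) (∏-cong (fins n) λ j → weight-label fOK _ _ h (Ψ (flip r j)))))
    where
    h : ∀ x → labs r Ψ x ≡ l x
    h x = eqL-≡ (all (∈-allV x))

  scope↭ : ∀ {r} → not (on p r) ≡ true → filterᵇ (adj r) variables ↭ map (flip r) (fins n)
  scope↭ {r} off = unique-↭ (filterᵇ-unique (adj r) (filterᵇ-unique (on p) (allV-unique n))) (neighbours-unique r) to from
   where
   to : ∀ {s} → s ∈ filterᵇ (adj r) variables → s ∈ map (flip r) (fins n)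
   to i with adj⁻ {r = r} (filterᵇ-true (adj r) variables i)
   ... | j , refl = ∈-map⁺ (flip r) (∈-fins j)
   from : ∀ {s} → s ∈ map (flip r) (fins n) → s ∈ filterᵇ (adj r) variables
   from i with ∈-map⁻ (flip r) i
   ... | j , _ , refl = ∈-filterᵇ⁺ (adj r) (∈-filterᵇ⁺ (on p) (∈-allV _) (trans (on-flip p r j) off)) (adj-flip r j)

  centre-degree : ∀ {v} → v ∈ variables → length (filterᵇ (λ r → adj r v) centres) ≡ n
  centre-degree {v} i = trans (↭-length (unique-↭ (filterᵇ-unique _ (filterᵇ-unique _ (allV-unique n))) (neighbours-unique v) to from))
   (trans (length-map (flip v) (fins n)) (length-fins n))
   where
   to : ∀ {r} → r ∈ filterᵇ (λ r → adj r v) centres → r ∈ map (flip v) (fins n)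
   to {r} i with adj⁻ {r = r} (filterᵇ-true (λ r → adj r v) centres i)
   ... | j , refl = subst (_∈ map (flip (flip r j)) (fins n)) (flip-flip r j) (∈-map⁺ (flip (flip r j)) (∈-fins j))
   from : ∀ {r} → r ∈ map (flip v) (fins n) → r ∈ filterᵇ (λ r → adj r v) centres
   from i' with ∈-map⁻ (flip v) i'
   ... | j , _ , refl = ∈-filterᵇ⁺ (λ r → adj r v) (∈-filterᵇ⁺ (not ∘ on p) (∈-allV _)
    (trans (cong not (on-flip p v j)) (trans (not-involutive _) (filterᵇ-true (on p) (allV n) i))))
    (subst (λ w → adj (flip v j) w ≡ true) (flip-flip v j) (adj-flip (flip v j) j))

  scope-sum : ∀ {r} → not (on p r) ≡ true → ∀ ρ → B.S (filterᵇ (adj r) variables) (λ Ψ → Wt r Ψ ^ n) ρ ≤ Labels.Tot m (λ l → (tilt l * (Cnt fOK l * Cnt hOK l)) ^ n)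
  scope-sum {r} off ρ = begin
   B.S vs (λ Ψ → Wt r Ψ ^ n) ρ
    ≤⟨ B.S-mono vs (λ Ψ → ≤≡ (Wt-labels r Ψ) (sym (Labels.∑-allF m _))) ⟩
   B.S vs (λ Ψ → ∑ (Labels.allF m) λ l → G r l Ψ) ρ
    ≡⟨ trans (B.S-∑ vs (Labels.allF m) (λ l → G r l) ρ) (Labels.∑-allF m _) ⟩
   Labels.Tot m (λ l → B.S vs (G r l) ρ)
    ≡⟨ Labels.Tot-cong m each ⟩
   Labels.Tot m (λ l → (tilt l * (Cnt fOK l * Cnt hOK l)) ^ n) ∎
   where
   vs : List (Vertex n)
   vs = filterᵇ (adj r) variables
   Φ : (Vertex m → Label) → (Vertex n → X) → ℕ
   Φ l Ψ = ∏ (fins n) λ j → weight fOK l (Ψ (flip r j))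
   each : ∀ l → B.S vs (G r l) ρ ≡ (tilt l * (Cnt fOK l * Cnt hOK l)) ^ n
   each l = trans (B.S-*ˡ c vs (Φ l) ρ) (trans (cong (c *_) (trans (B.S-↭ (λ Ψ Ψ' h → ∏-cong (fins n) λ j → cong (weight fOK l) (h (flip r j))) (scope↭ off) ρ)
    (trans (B.S-cong (map (flip r) (fins n)) λ Ψ → sym (∏-map (flip r) (fins n) λ s → weight fOK l (Ψ s)))
    (trans (B.S-∏ (map (flip r) (fins n)) (neighbours-unique r) (λ _ → weight fOK l) ρ)
    (trans (∏-const (∑ XS (weight fOK l)) (map (flip r) (fins n))) (cong₂ _^_ (Colour.∑-allF m _) (trans (length-map (flip r) (fins n)) (length-fins n))))))))
    (trans (sym (^-distrib-* n (tilt l * Cnt hOK l) (Cnt fOK l))) (cong (_^ n) (lem (tilt l) (Cnt hOK l) (Cnt fOK l)))))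
    where
    c : ℕ
    c = (tilt l * Cnt hOK l) ^ n
    lem : ∀ x y z → x * y * z ≡ x * (z * y)
    lem = solve-∀

 total : ((Vertex n → X) → ℕ)
 total Ψ = proper (uncurry cols zero m Ψ) * ∏ centres λ r → tilt (labs r Ψ)

 private
  total-ext : B.Ext total
  total-ext Ψ Ψ' h = cong₂ _*_ (proper-ext _ _ λ v → cong (λ f → f (right n v)) (h (left n v)))
   (∏-cong centres λ r → tilt-ext _ _ (labs-local r Ψ Ψ' λ j → h (flip r j)))

  proper-pieces : ∀ Ψ → proper (uncurry cols zero m Ψ) ≤ ∏ centres λ r → (∏ (fins n) λ j → proper (Ψ (flip r j))) * okh r Ψ (Ψ r)
  proper-pieces Ψ with proper (uncurry cols zero m Ψ) in eq
  ... | zero = z≤n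
  ... | suc zero = ≤-reflexive (sym (trans (∏-cong centres piece) (∏-one centres)))
   where
   pr : ∀ v i → uncurry cols zero m Ψ v ≢ uncurry cols zero m Ψ (flip v i)
   pr = proper⁻ (uncurry cols zero m Ψ) (≤-reflexive (sym eq))
   at : ∀ s x → uncurry cols zero m Ψ (app s x) ≡ Ψ s x
   at s x = cong₂ Ψ (left-app s x) (right-app s x)
   layer-proper : ∀ s → proper (Ψ s) ≡ 1
   layer-proper s = proper⁺ (Ψ s) λ x i e → pr (app s x) (n Fin.↑ʳ i) (trans (at s x) (trans e (sym (trans (cong (uncurry cols zero m Ψ) (flip-appʳ s x i)) (at s (flip x i))))))
   piece : ∀ r → (∏ (fins n) λ j → proper (Ψ (flip r j))) * okh r Ψ (Ψ r) ≡ 1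
   piece r = cong₂ _*_ (trans (∏-cong (fins n) λ j → layer-proper (flip r j)) (∏-one (fins n)))
    (cong₂ _*_ (layer-proper r) (trans (∏-cong (allV m) λ x → trans (∏-cong (fins n) λ j → cong (𝟙 ∘ not) (eqc-≢ λ e →
     pr (app r x) (j Fin.↑ˡ m) (trans (at r x) (trans e (sym (trans (cong (uncurry cols zero m Ψ) (flip-appˡ r x j)) (at (flip r j) x)))))))
     (∏-one (fins n))) (∏-one (allV m))))
  ... | suc (suc x) = ⊥-elim (1+n≰n (≤-trans (s≤s (s≤s z≤n)) (≡≤ (sym eq) (proper≤1 (uncurry cols zero m Ψ)))))

 length-centres : length centres ≡ 2 ^ k
 length-centres = trans (length-filterᵇ (not ∘ on p) (allV n)) (trans (∑-cong (allV n) λ v → cong 𝟙 (sym (on-not p v))) (card-on k (not p)))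

 -- Given the layers on one parity class of Q_n, those on the other class are independent, and
 -- summing them out leaves a product of `Wt` over stars. Each remaining layer lies in n stars,
 -- which is the exponent in Finner's inequality. A star contributes at most (2A)^n, by `Y-sum` and
 -- 12 · 2^m ≤ 2^n.
 star-bound : ∀ K → 1 ≤ K → K * K * 27 ^ n ≤ 32 ^ n → 10 * treeSize m ≤ K → 12 * 2 ^ m ≤ 2 ^ n →
  B.Tot n total ≤ (A * 2) ^ 2 ^ k
 star-bound K 1≤K gap 10T≤K small = ^-cancelˡ-≤ k (begin
  B.Tot n total ^ n
   ≤⟨ ^-monoˡ-≤ n (≡≤ (B.Tot-filter (on p) total-ext ρ₀) (B.S-mono variables inner)) ⟩
  B.S variables (λ Ψ → ∏ centres λ r → Wt r Ψ) ρ₀ ^ n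
   ≤⟨ Finner.finner _≟V_ XS k centres Wt adj (λ r Ψ Ψ' h → Wt-local r Ψ Ψ' λ j → h (flip r j) (adj-flip r j)) variables centre-degree ρ₀ ⟩
  ∏ centres (λ r → B.S (filterᵇ (adj r) variables) (λ Ψ → Wt r Ψ ^ n) ρ₀)
   ≤⟨ ∏-mono∈ centres (λ {r} i → ≤-trans (scope-sum (filterᵇ-true (not ∘ on p) (allV n) i) ρ₀)
    (≤-trans (Y-sum n K 1≤K gap 10T≤K) (≤≡ (*-monoʳ-≤ (A ^ n) small) (sym (^-distrib-* n A 2))))) ⟩
  ∏ centres (λ _ → (A * 2) ^ n)
   ≡⟨ trans (∏-const _ centres) (trans (cong (λ t → ((A * 2) ^ n) ^ t) length-centres)
    (trans (^-*-assoc (A * 2) n (2 ^ k)) (trans (cong ((A * 2) ^_) (*-comm n (2 ^ k))) (sym (^-*-assoc (A * 2) (2 ^ k) n))))) ⟩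
  ((A * 2) ^ 2 ^ k) ^ n ∎)
  where
  ρ₀ : Vertex n → X
  ρ₀ _ _ = zero
  flip∉ : ∀ {r} → r ∈ centres → ∀ j → flip r j ∉ centres
  flip∉ {r} i j i' = absurd (filterᵇ-true (not ∘ on p) (allV n) i')
   (trans (cong not (on-flip p r j)) (cong not (filterᵇ-true (not ∘ on p) (allV n) i)))
  inner : ∀ Ψ → B.S centres total Ψ ≤ ∏ centres λ r → Wt r Ψ
  inner Ψ = begin
   B.S centres total Ψ
    ≤⟨ B.S-mono centres (λ Ψ' → ≤≡ (*-monoˡ-≤ _ (proper-pieces Ψ')) (sym (∏-* centres _ _))) ⟩
   B.S centres (λ Ψ' → ∏ centres λ r → (∏ (fins n) λ j → proper (Ψ' (flip r j))) * okh r Ψ' (Ψ' r) * tilt (labs r Ψ')) Ψ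
    ≡⟨ B.S-cong-off centres (λ Ψ' off → ∏-cong∈ centres λ {r} i → trans (lem (∏ (fins n) λ j → proper (Ψ' (flip r j))) _ _)
     (cong₂ _*_ (layer-local r Ψ' Ψ λ j → off (flip r j) (flip∉ i j)) (okh-local r Ψ' Ψ (Ψ' r) λ j → off (flip r j) (flip∉ i j)))) ⟩
   B.S centres (λ Ψ' → ∏ centres λ r → layer r Ψ * okh r Ψ (Ψ' r)) Ψ
    ≡⟨ B.S-∏ centres (filterᵇ-unique _ (allV-unique n)) (λ r h → layer r Ψ * okh r Ψ h) Ψ ⟩
   ∏ centres (λ r → ∑ XS λ h → layer r Ψ * okh r Ψ h)
    ≡⟨ ∏-cong centres (λ r → ∑-*ˡ (layer r Ψ) XS _) ⟩
   ∏ centres (λ r → Wt r Ψ) ∎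
   where
   lem : ∀ x y z → x * y * z ≡ x * z * y
   lem = solve-∀

-- Markov's inequality: few edges whose ends have the same type.

≤ᵇ-≤ : ∀ {x y} → (x ≤ᵇ y) ≡ true → x ≤ y
≤ᵇ-≤ {x} {y} e = ≤ᵇ⇒≤ x y (≡⇒T e)

≤-≤ᵇ : ∀ {x y} → x ≤ y → (x ≤ᵇ y) ≡ true
≤-≤ᵇ h = T⇒≡ (≤⇒≤ᵇ h)

wd-count : ∀ {m} (i : Fin m) (l : Vertex m → Label) → ∑ (allV m) (λ x → 𝟙 (not (good (l x) (l (flip x i))))) ≡ 2 * wd i l
wd-count {suc m} zero l = trans (∑-allV-suc m _) (trans (cong (wd zero l +_) (trans (∑-cong (allV m) λ x →
 cong (𝟙 ∘ not) (good-sym (l (true ∷ x)) (l (false ∷ x)))) (sym (+-identityʳ _)))) refl)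
 where
 eqc-sym : ∀ a b → eqc a b ≡ eqc b a
 eqc-sym a b with bool-cases (eqc a b)
 ... | inj₁ e rewrite eqc-≡ {a} {b} e = refl
 ... | inj₂ e = trans e (sym (eqc-≢ (eqc-≢⁻ a b e ∘ sym)))
 good-sym : ∀ l l' → good l l' ≡ good l' l
 good-sym (b , K) (b' , K') = cong₂ _∧_ (xor-comm b b') (eqc-sym K K')
wd-count {suc m} (suc i) l = trans (∑-allV-suc m _) (trans (cong₂ _+_ (wd-count i (l ∘ (false ∷_))) (wd-count i (l ∘ (true ∷_))))
 (sym (*-distribˡ-+ 2 (wd i (l ∘ (false ∷_))) _)))

cst : ∀ {d} → (Vertex d → Fin 3) → Vertex d → Bool
cst {d} χ v = allL (fins d) λ i → allL (fins d) λ j → eqc (χ (flip v i)) (χ (flip v j))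

cst⁻ : ∀ {d} (χ : Vertex d → Fin 3) v → cst χ v ≡ true → ∀ i j → χ (flip v i) ≡ χ (flip v j)
cst⁻ χ v e i j = eqc-≡ (allL⁻ (allL⁻ e (∈-fins i)) (∈-fins j))

cst⁺ : ∀ {d} (χ : Vertex d → Fin 3) v → (∀ i j → χ (flip v i) ≡ χ (flip v j)) → cst χ v ≡ true
cst⁺ {d} χ v h = allL⁺ (fins d) λ {i} _ → allL⁺ (fins d) λ {j} _ → trans (cong (λ c → eqc c (χ (flip v j))) (h i j)) (eqc-refl (χ (flip v j)))

same : ∀ {d} → (Vertex d → Fin 3) → Fin d → Vertex d → Bool
same χ e v = not (cst χ v xor cst χ (flip v e))

sames : ∀ {d} → (Vertex d → Fin 3) → Fin d → ℕ
sames {d} χ e = card (same χ e)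

≡-from-⇔ : ∀ {a b} → (a ≡ true → b ≡ true) → (b ≡ true → a ≡ true) → a ≡ b
≡-from-⇔ {true} {true} f g = refl
≡-from-⇔ {true} {false} f g = sym (f refl)
≡-from-⇔ {false} {true} f g = g refl
≡-from-⇔ {false} {false} f g = refl

cst-ext : ∀ {d} (χ χ' : Vertex d → Fin 3) → (∀ v → χ v ≡ χ' v) → ∀ v → cst χ v ≡ cst χ' v
cst-ext {d} χ χ' h v = allL-cong (fins d) λ i → allL-cong (fins d) λ j → cong₂ eqc (h _) (h _)

sames-ext : ∀ {d} e (χ χ' : Vertex d → Fin 3) → (∀ v → χ v ≡ χ' v) → sames χ e ≡ sames χ' e
sames-ext {d} e χ χ' h = ∑-cong (allV d) λ v → cong₂ (λ a b → 𝟙 (not (a xor b))) (cst-ext χ χ' h v) (cst-ext χ χ' h (flip v e))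

dir-cases : ∀ n {m} (e : Fin (n + m)) → (∃ λ j → e ≡ j Fin.↑ˡ m) ⊎ (∃ λ i → e ≡ n Fin.↑ʳ i)
dir-cases zero e = inj₂ (e , refl)
dir-cases (suc n) zero = inj₁ (zero , refl)
dir-cases (suc n) (suc e) with dir-cases n e
... | inj₁ (j , refl) = inj₁ (suc j , refl)
... | inj₂ (i , refl) = inj₂ (i , refl)

∑-app : ∀ n {m} (f : Vertex (n + m) → ℕ) → ∑ (allV (n + m)) f ≡ ∑ (allV n) λ s → ∑ (allV m) λ x → f (app s x)
∑-app zero f = sym (+-identityʳ _)
∑-app (suc n) {m} f = trans (∑-allV-suc (n + m) f) (trans (cong₂ _+_ (∑-app n (f ∘ (false ∷_))) (∑-app n (f ∘ (true ∷_))))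
 (sym (∑-allV-suc n _)))

module Markov (m' k : ℕ) where
 private
  module S₊ = Stars m' k true
  module S₋ = Stars m' k false
 open Tilt m'

 n : ℕ
 n = suc k

 R : ℕ
 R = 2 ^ k

 module _ (K : ℕ) (1≤K : 1 ≤ K) (gap : K * K * 27 ^ n ≤ 32 ^ n) (10T≤K : 10 * treeSize m ≤ K) (small : 12 * 2 ^ m ≤ 2 ^ n) where

  module _ (p : Bool) where
   open Stars m' k p using (X; XS; labs; centres; total; length-centres; star-bound; module B)

   bsum : (Vertex n → X) → ℕ
   bsum Ψ = ∑ centres λ r → bads (labs r Ψ)

   private
    instance
     a≢0 : NonZero a
     a≢0 = _

    prod-eq : ∀ Ψ → ∏ centres (λ r → tilt (labs r Ψ)) * a ^ bsum Ψ ≡ (a + 1) ^ bsum Ψ * (a ^ E) ^ R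
    prod-eq Ψ = trans (cong (∏ centres (λ r → tilt (labs r Ψ)) *_) (sym (∏-2^ a centres _))) (trans (sym (∏-* centres _ _))
     (trans (∏-cong centres λ r → tilt-eq (labs r Ψ)) (trans (∏-* centres _ _) (cong₂ _*_ (∏-2^ (a + 1) centres _)
      (trans (∏-const _ centres) (cong ((a ^ E) ^_) length-centres))))))

    large : ∀ Ψ → 3 * a * R ≤ bsum Ψ → 8 ^ R * (a ^ E) ^ R ≤ ∏ centres λ r → tilt (labs r Ψ)
    large Ψ h with ≤⇒+ h
    ... | e , eq = *-cancelʳ-≤ _ _ (a ^ bsum Ψ) ⦃ m^n≢0 a (bsum Ψ) ⦄ (begin
     8 ^ R * (a ^ E) ^ R * a ^ bsum Ψ
      ≡⟨ cong (λ t → 8 ^ R * (a ^ E) ^ R * a ^ t) (sym eq) ⟩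
     8 ^ R * (a ^ E) ^ R * a ^ (3 * a * R + e)
      ≡⟨ trans (cong (8 ^ R * (a ^ E) ^ R *_) (trans (^-distribˡ-+-* a (3 * a * R) e) (cong (_* a ^ e) (pw a))))
       (l₁ (8 ^ R) ((a ^ E) ^ R) ((a ^ a) ^ (3 * R)) (a ^ e)) ⟩
     8 ^ R * (a ^ a) ^ (3 * R) * a ^ e * (a ^ E) ^ R
      ≡⟨ cong (λ t → t * (a ^ a) ^ (3 * R) * a ^ e * (a ^ E) ^ R) (^-*-assoc 2 3 R) ⟩
     2 ^ (3 * R) * (a ^ a) ^ (3 * R) * a ^ e * (a ^ E) ^ R
      ≡⟨ cong (λ t → t * a ^ e * (a ^ E) ^ R) (sym (^-distrib-* (3 * R) 2 (a ^ a))) ⟩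
     (2 * a ^ a) ^ (3 * R) * a ^ e * (a ^ E) ^ R
      ≤⟨ *-monoˡ-≤ ((a ^ E) ^ R) (*-mono-≤ (^-monoˡ-≤ (3 * R) (double-power a (s≤s z≤n))) (^-monoˡ-≤ e (m≤m+n a 1))) ⟩
     ((a + 1) ^ a) ^ (3 * R) * (a + 1) ^ e * (a ^ E) ^ R
      ≡⟨ cong (_* (a ^ E) ^ R) (trans (cong (_* (a + 1) ^ e) (sym (pw (a + 1)))) (trans (sym (^-distribˡ-+-* (a + 1) (3 * a * R) e)) (cong ((a + 1) ^_) eq))) ⟩
     (a + 1) ^ bsum Ψ * (a ^ E) ^ R
      ≡⟨ sym (prod-eq Ψ) ⟩
     ∏ centres (λ r → tilt (labs r Ψ)) * a ^ bsum Ψ ∎)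
     where
     l₁ : ∀ x y z w → x * y * (z * w) ≡ x * z * w * y
     l₁ = solve-∀
     l₂ : ∀ x y → 3 * x * y ≡ x * (3 * y)
     l₂ = solve-∀
     pw : ∀ b → b ^ (3 * a * R) ≡ (b ^ a) ^ (3 * R)
     pw b = trans (cong (b ^_) (l₂ a R)) (sym (^-*-assoc b a (3 * R)))

   -- In units of (a^E)^R the tilt of a colouring with `bsum` ≥ 3aR is at least (1 + 1/a)^(3aR) ≥
   -- 8^R, while the tilted total is at most (2 · 4^P)^R. The quotient leaves the gain 4^R.
   markov : B.Tot n (λ Ψ → proper (uncurry cols zero m Ψ) * 𝟙 (3 * a * R ≤ᵇ bsum Ψ)) * 4 ^ R ≤ (4 ^ P) ^ R
   markov = *-cancelʳ-≤ _ _ (2 ^ R * (a ^ E) ^ R) ⦃ m*n≢0 _ _ ⦃ m^n≢0 2 R ⦄ ⦃ m^n≢0 (a ^ E) R ⦃ m^n≢0 a E ⦄ ⦄ ⦄ (begin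
    B.Tot n bad * 4 ^ R * (2 ^ R * (a ^ E) ^ R)
     ≡⟨ trans (l₁ (B.Tot n bad) (4 ^ R) (2 ^ R) ((a ^ E) ^ R)) (cong (λ t → B.Tot n bad * (t * (a ^ E) ^ R)) (sym (^-distrib-* R 4 2))) ⟩
    B.Tot n bad * (8 ^ R * (a ^ E) ^ R)
     ≡⟨ sym (B.Tot-*ʳ n (8 ^ R * (a ^ E) ^ R) bad) ⟩
    B.Tot n (λ Ψ → bad Ψ * (8 ^ R * (a ^ E) ^ R))
     ≤⟨ B.Tot-mono n pointwise ⟩
    B.Tot n total
     ≤⟨ star-bound K 1≤K gap 10T≤K small ⟩
    (a ^ E * 4 ^ P * 2) ^ R
     ≡⟨ trans (^-distrib-* R (a ^ E * 4 ^ P) 2) (trans (cong (_* 2 ^ R) (^-distrib-* R (a ^ E) (4 ^ P))) (l₂ ((a ^ E) ^ R) ((4 ^ P) ^ R) (2 ^ R))) ⟩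
    (4 ^ P) ^ R * (2 ^ R * (a ^ E) ^ R) ∎)
    where
    bad : (Vertex n → X) → ℕ
    bad Ψ = proper (uncurry cols zero m Ψ) * 𝟙 (3 * a * R ≤ᵇ bsum Ψ)
    l₁ : ∀ x y z w → x * y * (z * w) ≡ x * (y * z * w)
    l₁ = solve-∀
    l₂ : ∀ x y z → x * y * z ≡ y * (z * x)
    l₂ = solve-∀
    pointwise : ∀ Ψ → bad Ψ * (8 ^ R * (a ^ E) ^ R) ≤ total Ψ
    pointwise Ψ = ≡≤ (*-assoc (proper (uncurry cols zero m Ψ)) _ _) (*-monoʳ-≤ (proper (uncurry cols zero m Ψ)) (go (3 * a * R ≤ᵇ bsum Ψ) refl))
     where
     go : ∀ b → (3 * a * R ≤ᵇ bsum Ψ) ≡ b → 𝟙 b * (8 ^ R * (a ^ E) ^ R) ≤ ∏ centres λ r → tilt (labs r Ψ)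
     go true e = ≡≤ (+-identityʳ _) (large Ψ (≤ᵇ-≤ e))
     go false e = z≤n

   private
    module _ (Ψ : Vertex n → X) (pr : 1 ≤ proper (uncurry cols zero m Ψ)) where
     χ : Vertex (n + m) → Fin 3
     χ = uncurry cols zero m Ψ

     at : ∀ s x → χ (app s x) ≡ Ψ s x
     at s x = cong₂ Ψ (left-app s x) (right-app s x)

     allGood : Vertex n → Vertex m → Set
     allGood r x = ∀ i → good (labs r Ψ x) (labs r Ψ (flip x i)) ≡ true

     goodᵇ : Vertex n → Vertex m → Bool
     goodᵇ r x = allL (fins m) λ i → good (labs r Ψ x) (labs r Ψ (flip x i))

     nbrˡ : ∀ r x j → χ (flip (app r x) (j Fin.↑ˡ m)) ≡ Ψ (flip r j) x
     nbrˡ r x j = trans (cong χ (flip-appˡ r x j)) (at (flip r j) x)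

     nbrʳ : ∀ r x i → χ (flip (app r x) (n Fin.↑ʳ i)) ≡ Ψ r (flip x i)
     nbrʳ r x i = trans (cong χ (flip-appʳ r x i)) (at r (flip x i))

     avoids : ∀ r x → hOK (labs r Ψ x) (Ψ r x) ≡ true
     avoids r x = lab-h _ (Ψ r x) λ j e → proper⁻ χ pr (app r x) (j Fin.↑ˡ m) (trans (at r x) (trans e (sym (nbrˡ r x j))))

     -- If x has label (true , Q), its neighbours in the Q_n directions have colour Q. Goodness
     -- gives the neighbours of x in Q_m the label (false , Q), and then the centre layer has colour
     -- Q there too. If the Boolean is false, two neighbours in the Q_n directions already differ.
     cst-label : ∀ r x → allGood r x → cst χ (app r x) ≡ proj₁ (labs r Ψ x)
     cst-label r x g with bool-cases (allL (fins n) λ j → eqc (Ψ (flip r j) x) (Ψ (flip r zero) x))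
     ... | inj₂ e = ≡-from-⇔ (λ c → absurd (allL⁺ (fins n) λ {j} _ → trans (cong (λ z → eqc z (Ψ (flip r zero) x))
      (trans (sym (nbrˡ r x j)) (trans (cst⁻ χ (app r x) c _ _) (nbrˡ r x zero)))) (eqc-refl (Ψ (flip r zero) x))) e) (λ c → absurd (trans (sym lx) c) refl)
      where
      lx : proj₁ (labs r Ψ x) ≡ false
      lx rewrite e = refl
     ... | inj₁ e = trans (cst⁺ χ (app r x) λ i j → trans (all i) (sym (all j))) (sym (cong proj₁ lx))
      where
      Q : Fin 3
      Q = Ψ (flip r zero) x
      lx : labs r Ψ x ≡ (true , Q)
      lx rewrite e = refl
      other : ∀ l → good (true , Q) l ≡ true → ∀ h → hOK l h ≡ true → h ≡ Q
      other (false , K') g h ho = trans (eqc-≡ ho) (sym (eqc-≡ g))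
      all : ∀ dir → χ (flip (app r x) dir) ≡ Q
      all dir with dir-cases n dir
      ... | inj₁ (j , refl) = trans (nbrˡ r x j) (eqc-≡ (allL⁻ e (∈-fins j)))
      ... | inj₂ (i , refl) = trans (nbrʳ r x i) (other (labs r Ψ (flip x i))
       (subst (λ l → good l (labs r Ψ (flip x i)) ≡ true) lx (g i)) _ (avoids r (flip x i)))

     dir : Fin (n + m)
     dir = n Fin.↑ʳ zero

     good-flips : ∀ {l l'} → good l l' ≡ true → (proj₁ l xor proj₁ l') ≡ true
     good-flips {l} {l'} e = ∧ˡ e

     at-good : ∀ r x → goodᵇ r x ≡ true → allGood r x
     at-good r x g i = allL⁻ {xs = fins m} {λ i → good (labs r Ψ x) (labs r Ψ (flip x i))} g (∈-fins i)

     -- A good edge flips the Boolean of the label, hence by `cst-label` the type of the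
     -- neighbourhood.
     same⇒bad : ∀ r x → same χ dir (app r x) ≡ true → goodᵇ r x ≡ true → goodᵇ r (flip x zero) ≡ true → ⊥
     same⇒bad r x s g g' = absurd (good-flips {labs r Ψ x} {labs r Ψ (flip x zero)} (at-good r x g zero))
      (trans (cong₂ _xor_ (sym (cst-label r x (at-good r x g)))
       (sym (trans (cong (cst χ) (flip-appʳ r x zero)) (cst-label r (flip x zero) (at-good r (flip x zero) g')))))
       (not-injective s))

     badAt : Vertex n → Vertex m → ℕ
     badAt r x = ∑ (fins m) λ i → 𝟙 (not (good (labs r Ψ x) (labs r Ψ (flip x i))))

     not-good : ∀ r x → goodᵇ r x ≡ false → 1 ≤ badAt r x
     not-good r x e with allL-false (fins m) e
     ... | i , _ , b = ≡≤ (sym (cong (𝟙 ∘ not) b)) (term≤∑ (λ i → 𝟙 (not (good (labs r Ψ x) (labs r Ψ (flip x i))))) (∈-fins i))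

     same≤ : ∀ r x → 𝟙 (same χ dir (app r x)) ≤ badAt r x + badAt r (flip x zero)
     same≤ r x = 𝟙≤ λ s → go s (bool-cases (goodᵇ r x)) (bool-cases (goodᵇ r (flip x zero)))
      where
      go : same χ dir (app r x) ≡ true → Cases (goodᵇ r x) →
       Cases (goodᵇ r (flip x zero)) → 1 ≤ badAt r x + badAt r (flip x zero)
      go s (inj₂ e) _ = ≤-trans (not-good r x e) (m≤m+n (badAt r x) (badAt r (flip x zero)))
      go s (inj₁ _) (inj₂ e) = ≤-trans (not-good r (flip x zero) e) (m≤n+m (badAt r (flip x zero)) (badAt r x))
      go s (inj₁ g) (inj₁ g') = ⊥-elim (same⇒bad r x s g g')

     copy-sames : ∀ r → ∑ (allV m) (λ x → 𝟙 (same χ dir (app r x))) ≤ 4 * bads (labs r Ψ)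
     copy-sames r = ≤-trans (∑-mono (allV m) (same≤ r)) (≡≤ (trans (∑-+ (allV m) _ _)
      (trans (cong₂ _+_ once (trans (∑-flip m zero (badAt r)) once)) (lem (bads (labs r Ψ))))) ≤-refl)
      where
      once : ∑ (allV m) (badAt r) ≡ 2 * bads (labs r Ψ)
      once = trans (∑-swap (allV m) (fins m) _) (trans (∑-cong (fins m) λ i → wd-count i (labs r Ψ)) (∑-*ˡ 2 (fins m) λ i → wd i (labs r Ψ)))
      lem : ∀ b → 2 * b + 2 * b ≡ 4 * b
      lem = solve-∀

   half-sames : ∀ Ψ → 1 ≤ proper (uncurry cols zero m Ψ) →
    ∑ centres (λ r → ∑ (allV m) λ x → 𝟙 (same (uncurry cols zero m Ψ) (n Fin.↑ʳ zero) (app r x))) ≤ 4 * bsum Ψ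
   half-sames Ψ pr = ≤≡ (∑-mono centres (copy-sames Ψ pr)) (∑-*ˡ 4 centres _)

  -- The star centred at r controls only the points over r, so both parity classes of Q_n have to
  -- serve as centres.
  all-sames : ∀ Ψ → 1 ≤ proper (uncurry cols zero m Ψ) → sames (uncurry cols zero m Ψ) (n Fin.↑ʳ zero) ≤ 4 * (bsum true Ψ + bsum false Ψ)
  all-sames Ψ pr = ≡≤ (trans (∑-app n {m} (λ v → 𝟙 (same χ e v))) split)
   (≤≡ (+-mono-≤ (half-sames true Ψ pr) (half-sames false Ψ pr)) (sym (*-distribˡ-+ 4 (bsum true Ψ) _)))
   where
   χ : Vertex (n + m) → Fin 3
   χ = uncurry cols zero m Ψ
   e : Fin (n + m)
   e = n Fin.↑ʳ zero
   f : Vertex n → ℕ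
   f r = ∑ (allV m) λ x → 𝟙 (same χ e (app r x))
   lem : ∀ b x → x ≡ 𝟙 (not b) * x + 𝟙 (not (not b)) * x
   lem true x = sym (+-identityʳ x)
   lem false x = sym (trans (+-identityʳ _) (+-identityʳ x))
   split : ∑ (allV n) f ≡ ∑ (filterᵇ (not ∘ on true) (allV n)) f + ∑ (filterᵇ (not ∘ on false) (allV n)) f
   split = trans (∑-cong (allV n) λ r → trans (lem (on true r) (f r)) (cong (λ b → 𝟙 (not (on true r)) * f r + 𝟙 (not b) * f r) (sym (on-not true r))))
    (trans (∑-+ (allV n) _ _) (cong₂ _+_ (sym (∑-filter (not ∘ on true) (allV n) f)) (sym (∑-filter (not ∘ on false) (allV n) f))))

  -- The threshold is 4 (3aR + 3aR): beyond it, `all-sames` forces the event of `markov` for one of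
  -- the two classes of centres.
  few-sames : Tot (n + m) (λ χ → proper χ * 𝟙 (24 * a * R ≤ᵇ sames χ (n Fin.↑ʳ zero))) * 4 ^ R ≤ 2 * (4 ^ P) ^ R
  few-sames = begin
   Tot (n + m) F * 4 ^ R
    ≡⟨ cong (_* 4 ^ R) (Tot-curry cols zero m n F F-ext) ⟩
   B'.Tot n (F ∘ uncurry cols zero m) * 4 ^ R
    ≤⟨ *-monoˡ-≤ (4 ^ R) (≤≡ (B'.Tot-mono n pointwise) (B'.Tot-+ n (G true) (G false))) ⟩
   (B'.Tot n (G true) + B'.Tot n (G false)) * 4 ^ R
    ≡⟨ *-distribʳ-+ (4 ^ R) (B'.Tot n (G true)) _ ⟩
   B'.Tot n (G true) * 4 ^ R + B'.Tot n (G false) * 4 ^ R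
    ≤⟨ +-mono-≤ (markov true) (markov false) ⟩
   (4 ^ P) ^ R + (4 ^ P) ^ R
    ≡⟨ cong ((4 ^ P) ^ R +_) (sym (+-identityʳ _)) ⟩
   2 * (4 ^ P) ^ R ∎
   where
   module B' = CubeSum (Colour.allF m) (λ _ → zero)
   F : (Vertex (n + m) → Fin 3) → ℕ
   F χ = proper χ * 𝟙 (24 * a * R ≤ᵇ sames χ (n Fin.↑ʳ zero))
   F-ext : Colour.Ext F
   F-ext χ χ' h = cong₂ _*_ (proper-ext χ χ' h) (cong (λ t → 𝟙 (24 * a * R ≤ᵇ t)) (sames-ext (n Fin.↑ʳ zero) χ χ' h))
   G : Bool → (Vertex n → Vertex m → Fin 3) → ℕ
   G p Ψ = proper (uncurry cols zero m Ψ) * 𝟙 (3 * a * R ≤ᵇ bsum p Ψ)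
   pointwise : ∀ Ψ → F (uncurry cols zero m Ψ) ≤ G true Ψ + G false Ψ
   pointwise Ψ with proper (uncurry cols zero m Ψ) in eq
   ... | zero = z≤n
   ... | suc q = ≤≡ (*-monoʳ-≤ (suc q) (𝟙≤ λ e → go (≤ᵇ-≤ e))) (*-distribˡ-+ (suc q) (𝟙 (3 * a * R ≤ᵇ bsum true Ψ)) _)
    where
    l₁ : ∀ x → 24 * a * x ≡ 4 * (3 * a * x + 3 * a * x)
    l₁ x = l (a) x
     where
     l : ∀ y x → 24 * y * x ≡ 4 * (3 * y * x + 3 * y * x)
     l = solve-∀
    go : 24 * a * R ≤ sames (uncurry cols zero m Ψ) (n Fin.↑ʳ zero) → 1 ≤ 𝟙 (3 * a * R ≤ᵇ bsum true Ψ) + 𝟙 (3 * a * R ≤ᵇ bsum false Ψ)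
    go h with 3 * a * R ≤? bsum true Ψ | 3 * a * R ≤? bsum false Ψ
    ... | yes p | _ rewrite ≤-≤ᵇ p = s≤s z≤n
    ... | no _ | yes p rewrite ≤-≤ᵇ p = m≤n+m 1 _
    ... | no p | no p' = ⊥-elim (<⇒≱ (+-mono-< (≰⇒> p) (≰⇒> p')) (*-cancelˡ-≤ 4 (≡≤ (sym (l₁ R))
     (≤-trans h (all-sames Ψ (≤≡ (s≤s z≤n) (sym eq)))))))

-- Symmetry under permutations of the coordinates.

vec-ext : ∀ {d} {v w : Vertex d} → (∀ i → lookup v i ≡ lookup w i) → v ≡ w
vec-ext {v = []} {[]} h = refl
vec-ext {v = a ∷ v} {b ∷ w} h = cong₂ _∷_ (h zero) (vec-ext (h ∘ suc))

lookup-flip-same : ∀ {d} (v : Vertex d) i → lookup (flip v i) i ≡ not (lookup v i)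
lookup-flip-same (b ∷ v) zero = refl
lookup-flip-same (b ∷ v) (suc i) = lookup-flip-same v i

lookup-flip-diff : ∀ {d} (v : Vertex d) {i j} → i ≢ j → lookup (flip v i) j ≡ lookup v j
lookup-flip-diff (b ∷ v) {zero} {zero} ne = ⊥-elim (ne refl)
lookup-flip-diff (b ∷ v) {zero} {suc j} ne = refl
lookup-flip-diff (b ∷ v) {suc i} {zero} ne = refl
lookup-flip-diff (b ∷ v) {suc i} {suc j} ne = lookup-flip-diff v (ne ∘ cong suc)

module Relabel {d} (τ τ' : Fin d → Fin d) (ττ' : ∀ i → τ (τ' i) ≡ i) (τ'τ : ∀ i → τ' (τ i) ≡ i) where

 relabel relabel' : Vertex d → Vertex d
 relabel v = tabulate (lookup v ∘ τ)
 relabel' v = tabulate (lookup v ∘ τ')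

 relabel-inv : ∀ v → relabel (relabel' v) ≡ v
 relabel-inv v = vec-ext λ i → trans (lookup∘tabulate _ i) (trans (lookup∘tabulate _ (τ i)) (cong (lookup v) (τ'τ i)))

 relabel'-inv : ∀ v → relabel' (relabel v) ≡ v
 relabel'-inv v = vec-ext λ i → trans (lookup∘tabulate _ i) (trans (lookup∘tabulate _ (τ' i)) (cong (lookup v) (ττ' i)))

 relabel-flip : ∀ v i → relabel (flip v (τ i)) ≡ flip (relabel v) i
 relabel-flip v i = vec-ext go
  where
  go : ∀ j → lookup (relabel (flip v (τ i))) j ≡ lookup (flip (relabel v) i) j
  go j with i Fin.≟ j
  ... | yes refl = trans (lookup∘tabulate _ i) (trans (lookup-flip-same v (τ i)) (sym (trans (lookup-flip-same (relabel v) i) (cong not (lookup∘tabulate _ i)))))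
  ... | no ne = trans (lookup∘tabulate _ j) (trans (lookup-flip-diff v λ e → ne (trans (sym (τ'τ i)) (trans (cong τ' e) (τ'τ j))))
   (sym (trans (lookup-flip-diff (relabel v) ne) (lookup∘tabulate _ j))))

 relabel-flip' : ∀ v i → relabel (flip v i) ≡ flip (relabel v) (τ' i)
 relabel-flip' v i = trans (cong (λ t → relabel (flip v t)) (sym (ττ' i))) (relabel-flip v (τ' i))

 cst-relabel : ∀ (χ : Vertex d → Fin 3) v → cst (χ ∘ relabel) v ≡ cst χ (relabel v)
 cst-relabel χ v = ≡-from-⇔
  (λ e → cst⁺ χ (relabel v) λ i j → trans (cong χ (sym (relabel-flip v i))) (trans (cst⁻ (χ ∘ relabel) v e (τ i) (τ j)) (cong χ (relabel-flip v j))))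
  (λ e → cst⁺ (χ ∘ relabel) v λ i j → trans (cong χ (relabel-flip' v i)) (trans (cst⁻ χ (relabel v) e _ _) (cong χ (sym (relabel-flip' v j)))))

 ∑-relabel : ∀ (f : Vertex d → ℕ) → ∑ (allV d) (f ∘ relabel) ≡ ∑ (allV d) f
 ∑-relabel f = trans (sym (∑-map relabel (allV d) f)) (∑-↭ f (unique-↭ (map⁺ (λ {v} {w} e → trans (sym (relabel'-inv v)) (trans (cong relabel' e) (relabel'-inv w))) (allV-unique d)) (allV-unique d)
  (λ {v} _ → ∈-allV v) λ {v} _ → subst (_∈ map relabel (allV d)) (relabel-inv v) (∈-map⁺ relabel (∈-allV (relabel' v)))))

 sames-relabel : ∀ χ i → sames (χ ∘ relabel) (τ i) ≡ sames χ i
 sames-relabel χ i = trans (∑-cong (allV d) λ v → cong (𝟙 ∘ not) (cong₂ _xor_ (cst-relabel χ v) (trans (cst-relabel χ (flip v (τ i))) (cong (cst χ) (relabel-flip v i)))))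
  (∑-relabel λ v → 𝟙 (same χ i v))

 proper-relabel : ∀ χ → proper (χ ∘ relabel) ≡ proper χ
 proper-relabel χ with proper χ in e | proper (χ ∘ relabel) in e'
 ... | zero | zero = refl
 ... | zero | suc q = trans (trans (sym e') (proper⁺ (χ ∘ relabel) pr')) (trans (sym (proper⁺ χ pr)) e)
  where
  pr' : ∀ v i → χ (relabel v) ≢ χ (relabel (flip v i))
  pr' = proper⁻ (χ ∘ relabel) (≤≡ (s≤s z≤n) (sym e'))
  pr : ∀ v i → χ v ≢ χ (flip v i)
  pr v i = subst (λ w → χ w ≢ χ (flip w i)) (relabel-inv v) (subst (λ w → χ (relabel (relabel' v)) ≢ χ w) (relabel-flip (relabel' v) i) (pr' (relabel' v) (τ i)))
 ... | suc q | _ = trans (sym e') (trans (proper⁺ (χ ∘ relabel) (λ v i → subst (λ w → χ (relabel v) ≢ χ w) (sym (relabel-flip' v i)) (pr (relabel v) (τ' i))))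
  (trans (sym (proper⁺ χ pr)) e))
  where
  pr : ∀ v i → χ v ≢ χ (flip v i)
  pr = proper⁻ χ (≤≡ (s≤s z≤n) (sym e))

-- `few-sames` treats a single direction; exchanging two coordinates carries it to all others.
few-sames-direction : ∀ {d} B (i j : Fin d) → Tot d (λ χ → proper χ * 𝟙 (B ≤ᵇ sames χ i)) ≡ Tot d (λ χ → proper χ * 𝟙 (B ≤ᵇ sames χ j))
few-sames-direction {d} B i j = trans (sym (Tot-perm relabel relabel' relabel-inv relabel'-inv F-ext))
 (Tot-cong d λ χ → cong₂ _*_ (proper-relabel χ) (cong (λ t → 𝟙 (B ≤ᵇ t)) (trans (cong (sames (χ ∘ relabel)) (sym (transpose-matchˡ))) (sames-relabel χ j))))
 where
 open Relabel (transpose j i) (transpose i j) (λ k → transpose-inverse j i) (λ k → transpose-inverse i j)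
 F-ext : Colour.Ext (λ χ → proper χ * 𝟙 (B ≤ᵇ sames χ i))
 F-ext χ χ' h = cong₂ _*_ (proper-ext χ χ' h) (cong (λ t → 𝟙 (B ≤ᵇ t)) (sames-ext i χ χ' h))
 transpose-matchˡ : transpose j i j ≡ i
 transpose-matchˡ with j Fin.≟ j
 ... | yes _ = refl
 ... | no ne = ⊥-elim (ne refl)

-- The dominant class and colour.

dev : ∀ {d} → Bool → Fin 3 → (Vertex d → Fin 3) → Vertex d → Bool
dev σ k χ v = on σ v ∧ not (eqc (χ v) k)

∨-cases : ∀ {a b} → a ∨ b ≡ true → a ≡ true ⊎ b ≡ true
∨-cases {true} e = inj₁ refl
∨-cases {false} e = inj₂ e

module Phase {d' : ℕ} (χ : Vertex (suc d') → Fin 3) (B : ℕ) (few : ∀ i → sames χ i ≤ B) where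

 private
  d : ℕ
  d = suc d'

  -- Parity changes along every edge, so this set changes exactly where `cst` does not: its boundary
  -- consists of `same` edges.
  Sᵢ : Vertex d → Bool
  Sᵢ v = cst χ v xor on true v

  ∂S : ∂ Sᵢ ≤ d * B
  ∂S = ≤-trans (∑-mono (allV d) λ v → ∑-mono (fins d) λ i → 𝟙-mono λ e → step v i e)
   (≡≤ (∑-swap (allV d) (fins d) λ v i → 𝟙 (same χ i v))
   (≤≡ (∑-mono (fins d) few) (∑-fins d B)))
   where
   logic : ∀ a b c → (a xor b) ∧ not (c xor not b) ≡ true → not (a xor c) ≡ true
   logic true false true e = refl
   logic false true false e = refl
   step : ∀ v i → Sᵢ v ∧ not (Sᵢ (flip v i)) ≡ true → same χ i v ≡ true
   step v i e = logic (cst χ v) (on true v) (cst χ (flip v i)) (trans (cong (λ t → Sᵢ v ∧ not (cst χ (flip v i) xor t)) (sym (on-flip true v i))) e)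

  irregular : Bool → Vertex d → Bool
  irregular σ v = not (on σ v) ∧ not (cst χ v)

  -- By isoperimetry `Sᵢ` or its complement has at most d B points. Up to these, the vertices with
  -- monochromatic neighbourhood form one parity class, and σ is the other class.
  regular-side : ∃ λ σ → card (irregular σ) ≤ d * B
  regular-side with isoperimetry Sᵢ
  ... | inj₁ h = false , ≤-trans (card-mono (irregular false) Sᵢ λ v e → l₁ (cst χ v) (on true v) (subst (λ t → not t ∧ not (cst χ v) ≡ true) (on-not true v) e)) (≤-trans h ∂S)
   where
   l₁ : ∀ a b → not (not b) ∧ not a ≡ true → a xor b ≡ true
   l₁ false true e = refl
  ... | inj₂ h = true , ≤-trans (card-mono (irregular true) (not ∘ Sᵢ) λ v e → l₂ (cst χ v) (on true v) e) (≤-trans h ∂S)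
   where
   l₂ : ∀ a b → not b ∧ not a ≡ true → not (a xor b) ≡ true
   l₂ false false e = refl

  module _ (σ : Bool) (reg : card (irregular σ) ≤ d * B) where

   -- Adding to a colour class on σ the vertices whose neighbourhoods it fills gives a set that can
   -- only be left through an irregular vertex; hence its boundary is small.
   level : Fin 3 → Vertex d → Bool
   level k v = if on σ v then eqc (χ v) k else cst χ v ∧ eqc (χ (flip v zero)) k

   level-on : ∀ k v → on σ v ≡ true → level k v ≡ eqc (χ v) k
   level-on k v e rewrite e = refl

   level-off : ∀ k v → on σ v ≡ false → level k v ≡ cst χ v ∧ eqc (χ (flip v zero)) k
   level-off k v e rewrite e = refl

   step : ∀ k v i → level k v ∧ not (level k (flip v i)) ≡ true → irregular σ (flip v i) ≡ true
   step k v i e with ∧-true⁻ {level k v} e | bool-cases (on σ v)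
   ... | lv , lw | inj₂ off = absurd (trans (level-on k (flip v i) (trans (on-flip σ v i) (cong not off)))
    (trans (cong (λ c → eqc c k) (trans (cst⁻ χ v (proj₁ c) i zero) (eqc-≡ (proj₂ c)))) (eqc-refl k))) (not-injective lw)
    where
    c : cst χ v ≡ true × eqc (χ (flip v zero)) k ≡ true
    c = ∧-true⁻ (trans (sym (level-off k v off)) lv)
   ... | lv , lw | inj₁ o = ∧-true⁺ (cong not off) (cong not (refute λ c → absurd (trans (level-off k (flip v i) off)
    (∧-true⁺ c (trans (cong (λ z → eqc z k) (trans (cst⁻ χ (flip v i) c zero i) (trans (cong χ (flip-flip v i)) (eqc-≡ (trans (sym (level-on k v o)) lv))))) (eqc-refl k)))) (not-injective lw)))
    where
    off : on σ (flip v i) ≡ false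
    off = trans (on-flip σ v i) (cong not o)

   ∂level : ∀ k → ∂ (level k) ≤ d * (d * B)
   ∂level k = ≤-trans (∑-mono (allV d) λ v → ∑-mono (fins d) λ i → 𝟙-mono (step k v i))
    (≡≤ (trans (∑-swap (allV d) (fins d) λ v i → 𝟙 (irregular σ (flip v i)))
     (trans (∑-cong (fins d) λ i → ∑-flip d i (𝟙 ∘ irregular σ)) (∑-fins d (card (irregular σ)))))
     (*-monoʳ-≤ d reg))

   covered : ∀ v → on σ v ≡ true → 1 ≤ 𝟙 (level zero v) + (𝟙 (level 1F v) + 𝟙 (level 2F v))
   covered v o = ≤≡ (three (χ v)) (sym (cong₂ _+_ (cong 𝟙 (level-on zero v o)) (cong₂ _+_ (cong 𝟙 (level-on 1F v o)) (cong 𝟙 (level-on 2F v o)))))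
    where
    three : ∀ c → 1 ≤ 𝟙 (eqc c zero) + (𝟙 (eqc c 1F) + 𝟙 (eqc c 2F))
    three zero = s≤s z≤n
    three 1F = s≤s z≤n
    three 2F = s≤s z≤n

   big : ∀ k → card (not ∘ level k) ≤ ∂ (level k) → card (dev σ k χ) ≤ d * (d * B)
   big k q = ≤-trans (card-mono (dev σ k χ) (not ∘ level k) λ v e → trans (cong not (level-on k v (∧ˡ e))) (∧ʳ {on σ v} e)) (≤-trans q (∂level k))

   -- The three level sets cover class σ, so they cannot all be small. One of them therefore has a
   -- small complement, and that complement contains its deviations.
   dominant : 3 * (d * (d * B)) < 2 ^ d' → ∃ λ k → card (dev σ k χ) ≤ d * (d * B)
   dominant h with isoperimetry (level zero) | isoperimetry (level 1F) | isoperimetry (level 2F)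
   ... | inj₂ q | _ | _ = zero , big zero q
   ... | _ | inj₂ q | _ = 1F , big 1F q
   ... | _ | _ | inj₂ q = 2F , big 2F q
   ... | inj₁ p | inj₁ q | inj₁ r = ⊥-elim (<⇒≱ h (begin
    2 ^ d'
     ≡⟨ sym (card-on d' σ) ⟩
    card {d} (on σ)
     ≤⟨ ∑-mono (allV d) (λ v → 𝟙≤ (covered v)) ⟩
    ∑ (allV d) (λ v → 𝟙 (level zero v) + (𝟙 (level 1F v) + 𝟙 (level 2F v)))
     ≡⟨ trans (∑-+ (allV d) _ _) (cong (card (level zero) +_) (∑-+ (allV d) _ _)) ⟩
    card (level zero) + (card (level 1F) + card (level 2F))
     ≤⟨ +-mono-≤ (≤-trans p (∂level zero)) (+-mono-≤ (≤-trans q (∂level 1F)) (≤-trans r (∂level 2F))) ⟩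
    d * (d * B) + (d * (d * B) + d * (d * B))
     ≡⟨ cong (λ t → d * (d * B) + (d * (d * B) + t)) (sym (+-identityʳ _)) ⟩
    3 * (d * (d * B)) ∎))


 phase : 3 * (d * (d * B)) < 2 ^ d' → ∃ λ σ → ∃ λ k → card (dev σ k χ) ≤ d * (d * B)
 phase h with regular-side
 ... | σ , reg = σ , dominant σ reg h

-- Counting colours and neighbours.

∏𝟙-true : ∀ {A : Set} (xs : List A) (q : A → Bool) → 1 ≤ ∏ xs (𝟙 ∘ q) → ∀ {x} → x ∈ xs → q x ≡ true
∏𝟙-true xs q h i with ∏𝟙-cases xs q
... | inj₁ (all , _) = all i
... | inj₂ (_ , e) = ⊥-elim (1+n≰n (≤≡ h e))

∏𝟙-one : ∀ {A : Set} (xs : List A) (q : A → Bool) → (∀ {x} → x ∈ xs → q x ≡ true) → ∏ xs (𝟙 ∘ q) ≡ 1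
∏𝟙-one xs q h = trans (∏-cong∈ xs λ i → 𝟙-true (h i)) (∏-one xs)

∑-filter-≤ : ∀ {A : Set} (p : A → Bool) xs (f : A → ℕ) → ∑ (filterᵇ p xs) f ≤ ∑ xs f
∑-filter-≤ p xs f = ≡≤ (∑-filter p xs f) (∑-mono xs λ x → ≤≡ (*-monoˡ-≤ (f x) (𝟙≤1 (p x))) (*-identityˡ (f x)))

count-eqc : ∀ a → ∑ cols (λ c → 𝟙 (eqc c a)) ≡ 1
count-eqc zero = refl
count-eqc 1F = refl
count-eqc 2F = refl

count-neq : ∀ a → ∑ cols (λ c → 𝟙 (not (eqc c a))) ≡ 2
count-neq zero = refl
count-neq 1F = refl
count-neq 2F = refl

eqc-sym : ∀ a b → eqc a b ≡ eqc b a
eqc-sym a b = ≡-from-⇔ (λ e → trans (cong (eqc b) (eqc-≡ e)) (eqc-refl b)) (λ e → trans (cong (eqc a) (eqc-≡ e)) (eqc-refl a))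

other₁ other₂ : Fin 3 → Fin 3
other₁ zero = 1F
other₁ 1F = zero
other₁ 2F = zero
other₂ zero = 2F
other₂ 1F = 2F
other₂ 2F = 1F

others : ∀ l (f : Fin 3 → ℕ) → ∑ cols f ≡ f l + (f (other₁ l) + f (other₂ l))
others zero f = cong (λ t → f zero + (f 1F + t)) (+-identityʳ _)
others 1F f = lem (f zero) (f 1F) (f 2F)
 where
 lem : ∀ a b c → a + (b + (c + 0)) ≡ b + (a + c)
 lem = solve-∀
others 2F f = lem (f zero) (f 1F) (f 2F)
 where
 lem : ∀ a b c → a + (b + (c + 0)) ≡ c + (a + b)
 lem = solve-∀

not-others : ∀ l x → x ≢ other₁ l → x ≢ other₂ l → x ≡ l
not-others = from-yes (all? λ l → all? λ x → ¬? (x Fin.≟ other₁ l) →-dec (¬? (x Fin.≟ other₂ l) →-dec (x Fin.≟ l)))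

off-degree : ∀ {d} σ (y : Vertex d) → on σ y ≡ true → length (filterᵇ (λ v → adj v y) (filterᵇ (not ∘ on σ) (allV d))) ≡ d
off-degree {d} σ y o = trans (↭-length (unique-↭ (filterᵇ-unique _ (filterᵇ-unique _ (allV-unique d))) (neighbours-unique y) to from))
 (trans (length-map (flip y) (fins d)) (length-fins d))
 where
 to : ∀ {v} → v ∈ filterᵇ (λ v → adj v y) (filterᵇ (not ∘ on σ) (allV d)) → v ∈ map (flip y) (fins d)
 to {v} i with adj⁻ {r = v} (filterᵇ-true (λ v → adj v y) (filterᵇ (not ∘ on σ) (allV d)) i)
 ... | j , refl = subst (_∈ map (flip (flip v j)) (fins d)) (flip-flip v j) (∈-map⁺ (flip (flip v j)) (∈-fins j))
 from : ∀ {v} → v ∈ map (flip y) (fins d) → v ∈ filterᵇ (λ v → adj v y) (filterᵇ (not ∘ on σ) (allV d))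
 from i with ∈-map⁻ (flip y) i
 ... | j , _ , refl = ∈-filterᵇ⁺ (λ v → adj v y) (∈-filterᵇ⁺ (not ∘ on σ) (∈-allV _)
  (trans (cong not (on-flip σ y j)) (trans (not-involutive _) o)))
  (subst (λ w → adj (flip y j) w ≡ true) (flip-flip y j) (adj-flip (flip y j) j))

-- Recolouring a cluster of deviations.

module Container {d' : ℕ} (σ : Bool) (k : Fin 3) (inS : Vertex (suc d') → Bool) (inS-on : ∀ {y} → inS y ≡ true → on σ y ≡ true) where

 d : ℕ
 d = suc d'

 Colouring : Set
 Colouring = Vertex d → Fin 3

 open Colour

 NS : Vertex d → Bool
 NS v = anyL (fins d) λ i → inS (flip v i)

 A₁ G₁ : Colouring → Vertex d → Bool
 A₁ χ y = dev σ k χ y ∧ inS y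
 G₁ χ v = anyL (fins d) λ i → A₁ χ (flip v i)

 -- Deviations with a common neighbour belong to the same cluster; this says that a cluster meeting
 -- S stays inside S.
 Closed : Colouring → Set
 Closed χ = ∀ a i j → A₁ χ a ≡ true → dev σ k χ (flip (flip a i) j) ≡ true → inS (flip (flip a i) j) ≡ true

 private
  A₁-on : ∀ χ {y} → A₁ χ y ≡ true → on σ y ≡ true
  A₁-on χ {y} e = ∧ˡ (∧ˡ {dev σ k χ y} e)

  G₁⁻ : ∀ χ v → G₁ χ v ≡ true → ∃ λ i → A₁ χ (flip v i) ≡ true
  G₁⁻ χ v e with anyL⁻ (fins d) e
  ... | i , _ , h = i , h

  G₁⁺ : ∀ χ v i → A₁ χ (flip v i) ≡ true → G₁ χ v ≡ true
  G₁⁺ χ v i h = anyL⁺ {xs = fins d} {λ i → A₁ χ (flip v i)} (∈-fins i) h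

  on-flip-true : ∀ (v : Vertex d) i → on σ (flip v i) ≡ true → on σ v ≡ false
  on-flip-true v i e = not-injective (trans (sym (on-flip σ v i)) e)

  G₁-off : ∀ χ v → G₁ χ v ≡ true → on σ v ≡ false
  G₁-off χ v e with G₁⁻ χ v e
  ... | i , h = on-flip-true v i (A₁-on χ h)

  -- the colours allowed in the recolouring of A₁ by k and of G₁ by colours other than k
  surg : Bool → Bool → Bool → Fin 3 → Fin 3 → Bool
  surg o a g x c = if o then (if a then eqc c k else eqc c x) else (if g then not (eqc c k) else eqc c x)

  surgery : Colouring → Vertex d → Fin 3 → Bool
  surgery χ v c = surg (on σ v) (A₁ χ v) (G₁ χ v) (χ v) c

  surg-count : ∀ o a g x → (g ≡ true → o ≡ false) → ∑ cols (λ c → 𝟙 (surg o a g x c)) ≡ 2 ^ 𝟙 g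
  surg-count true a true x h = absurd refl (h refl)
  surg-count true true false x h = count-eqc k
  surg-count true false false x h = count-eqc x
  surg-count false a true x h = count-neq k
  surg-count false a false x h = count-eqc x

  -- The relation of the double count: each χ has 2^|G₁| partners χ', and `fibre` bounds the
  -- partners of a given χ'.
  rel : Colouring → Colouring → ℕ
  rel χ χ' = ∏ (allV d) λ v → 𝟙 (surgery χ v (χ' v))

  rel-sum : ∀ χ → Tot d (rel χ) ≡ 2 ^ card (G₁ χ)
  rel-sum χ = trans (Tot-∏ λ v c → 𝟙 (surgery χ v c))
   (trans (∏-cong (allV d) λ v → surg-count (on σ v) (A₁ χ v) (G₁ χ v) (χ v) (G₁-off χ v)) (∏-2^ 2 (allV d) (𝟙 ∘ G₁ χ)))

  module _ (χ χ' : Colouring) (pr : 1 ≤ proper χ) (cl : Closed χ) (rl : 1 ≤ rel χ χ') where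

   loc : ∀ v → surgery χ v (χ' v) ≡ true
   loc v = ∏𝟙-true (allV d) (λ v → surgery χ v (χ' v)) rl (∈-allV v)

   loc-A : ∀ y → A₁ χ y ≡ true → χ' y ≡ k
   loc-A y e = eqc-≡ (trans (sym (cong₂ (λ o a → surg o a (G₁ χ y) (χ y) (χ' y)) (A₁-on χ e) e)) (loc y))

   loc-on : ∀ y → on σ y ≡ true → A₁ χ y ≡ false → χ' y ≡ χ y
   loc-on y o e = eqc-≡ (trans (sym (cong₂ (λ o a → surg o a (G₁ χ y) (χ y) (χ' y)) o e)) (loc y))

   loc-G : ∀ v → G₁ χ v ≡ true → χ' v ≢ k
   loc-G v e = eqc-≢⁻ (χ' v) k (not-injective (trans (sym (cong₂ (λ o g → surg o (A₁ χ v) g (χ v) (χ' v)) (G₁-off χ v e) e)) (loc v)))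

   loc-off : ∀ v → on σ v ≡ false → G₁ χ v ≡ false → χ' v ≡ χ v
   loc-off v o e = eqc-≡ (trans (sym (cong₂ (λ o g → surg o (A₁ χ v) g (χ v) (χ' v)) o e)) (loc v))

   -- A vertex of class σ next to `G₁` is at distance at most 2 from `A₁`, so closedness leaves no
   -- third possibility.
   outside : ∀ w i → G₁ χ w ≡ true → on σ (flip w i) ≡ true → (A₁ χ (flip w i) ≡ true) ⊎ (χ (flip w i) ≡ k)
   outside w i g o with bool-cases (dev σ k χ (flip w i))
   ... | inj₂ e = inj₂ (eqc-≡ (not-injective (trans (cong (_∧ not (eqc (χ (flip w i)) k)) (sym o)) e)))
   ... | inj₁ e with G₁⁻ χ w g
   ...   | j , a = inj₁ (∧-true⁺ e (subst (λ t → inS (flip t i) ≡ true) (flip-flip w j)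
    (cl (flip w j) j i a (subst (λ t → dev σ k χ (flip t i) ≡ true) (sym (flip-flip w j)) e))))

   edge : ∀ w i → on σ (flip w i) ≡ true → χ' (flip w i) ≢ χ' w
   edge w i o with bool-cases (A₁ χ (flip w i)) | bool-cases (G₁ χ w)
   ... | inj₁ a | _ = λ e → loc-G w (G₁⁺ χ w i a) (trans (sym e) (loc-A (flip w i) a))
   ... | inj₂ a | inj₂ g = λ e → proper⁻ χ pr w i (trans (sym (loc-off w (on-flip-true w i o) g)) (trans (sym e) (loc-on (flip w i) o a)))
   ... | inj₂ a | inj₁ g with outside w i g o
   ...   | inj₁ a' = absurd a' a
   ...   | inj₂ kk = λ e → loc-G w g (trans (sym e) (trans (loc-on (flip w i) o a) kk))

   rel-proper : proper χ' ≡ 1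
   rel-proper = proper⁺ χ' go
    where
    go : ∀ v i → χ' v ≢ χ' (flip v i)
    go v i with bool-cases (on σ (flip v i))
    ... | inj₁ o = λ e → edge v i o (sym e)
    ... | inj₂ o = λ e → edge (flip v i) i (trans (cong (on σ) (flip-flip v i)) (not-injective (trans (sym (on-flip σ v i)) o)))
     (trans (cong χ' (flip-flip v i)) e)

  -- Makes the bound depend only on the values of χ in S: by `outside`, the neighbours of `G₁`
  -- outside S on class σ have colour k.
  base : Colouring → Vertex d → Fin 3
  base χ y = if inS y then χ y else k

  -- What χ' and the values of χ in S leave open about χ at v: off `G₁` the colour is that of χ', on
  -- `G₁` it only has to fit the neighbours.
  wb : Colouring → Colouring → Vertex d → Fin 3 → Bool
  wb χ' χ v c = if G₁ χ v then allL (fins d) (λ i → not (eqc c (base χ (flip v i)))) else eqc c (χ' v)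

  onL offL varL restL : List (Vertex d)
  onL = filterᵇ (on σ) (allV d)
  offL = filterᵇ (not ∘ on σ) (allV d)
  varL = filterᵇ inS onL
  restL = filterᵇ (not ∘ inS) onL

  W : Colouring → Colouring → Vertex d → ℕ
  W χ' χ v = ∑ cols λ c → 𝟙 (wb χ' χ v c)

  A₁-local : ∀ χ χ₂ y → (inS y ≡ true → χ y ≡ χ₂ y) → A₁ χ y ≡ A₁ χ₂ y
  A₁-local χ χ₂ y h with inS y
  ... | true = cong (λ c → (on σ y ∧ not (eqc c k)) ∧ true) (h refl)
  ... | false = trans (∧-zeroʳ (dev σ k χ y)) (sym (∧-zeroʳ (dev σ k χ₂ y)))

  G₁-local : ∀ χ χ₂ v → (∀ i → inS (flip v i) ≡ true → χ (flip v i) ≡ χ₂ (flip v i)) → G₁ χ v ≡ G₁ χ₂ v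
  G₁-local χ χ₂ v h = cong not (allL-cong (fins d) λ i → cong not (A₁-local χ χ₂ (flip v i) (h i)))

  wb-local : ∀ χ' χ χ₂ v c → (∀ i → inS (flip v i) ≡ true → χ (flip v i) ≡ χ₂ (flip v i)) → wb χ' χ v c ≡ wb χ' χ₂ v c
  wb-local χ' χ χ₂ v c h = cong₂ (λ g b → if g then b else eqc c (χ' v)) (G₁-local χ χ₂ v h)
   (allL-cong (fins d) λ i → cong (λ z → not (eqc c z)) (base-local i (bool-cases (inS (flip v i)))))
   where
   base-local : ∀ i → Cases (inS (flip v i)) → base χ (flip v i) ≡ base χ₂ (flip v i)
   base-local i (inj₁ e) = trans (cong (λ b → if b then χ (flip v i) else k) e) (trans (h i e) (sym (cong (λ b → if b then χ₂ (flip v i) else k) e)))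
   base-local i (inj₂ e) = trans (cong (λ b → if b then χ (flip v i) else k) e) (sym (cong (λ b → if b then χ₂ (flip v i) else k) e))

  W-local : ∀ χ' χ χ₂ v → (∀ i → inS (flip v i) ≡ true → χ (flip v i) ≡ χ₂ (flip v i)) → W χ' χ v ≡ W χ' χ₂ v
  W-local χ' χ χ₂ v h = ∑-cong cols λ c → cong 𝟙 (wb-local χ' χ χ₂ v c h)

  dominate : ∀ χ' χ → 1 ≤ proper χ → Closed χ →
   rel χ χ' ≤ ∏ onL (λ y → 𝟙 (inS y ∨ eqc (χ y) (χ' y))) * ∏ offL (λ v → 𝟙 (wb χ' χ v (χ v)))
  dominate χ' χ pr cl with rel χ χ' in eq
  ... | zero = z≤n
  ... | suc z = ≤≡ (≡≤ (sym eq) (∏≤1 (allV d) _ λ v → 𝟙≤1 (surgery χ v (χ' v))))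
   (sym (cong₂ _*_ (∏𝟙-one onL _ (λ {y} i → ub y (filterᵇ-true (on σ) (allV d) i)))
    (∏𝟙-one offL _ (λ {v} i → wbt v (not-injective (filterᵇ-true (not ∘ on σ) (allV d) i))))))
   where
   rl : 1 ≤ rel χ χ'
   rl = ≤≡ (s≤s z≤n) (sym eq)
   ub : ∀ y → on σ y ≡ true → inS y ∨ eqc (χ y) (χ' y) ≡ true
   ub y o with inS y in es
   ... | true = refl
   ... | false = trans (cong (eqc (χ y)) (loc-on χ χ' pr cl rl y o (trans (cong (dev σ k χ y ∧_) es) (∧-zeroʳ _)))) (eqc-refl (χ y))
   wbt : ∀ v → on σ v ≡ false → wb χ' χ v (χ v) ≡ true
   wbt v o with G₁ χ v in eg
   ... | false = trans (cong (eqc (χ v)) (loc-off χ χ' pr cl rl v o eg)) (eqc-refl (χ v))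
   ... | true = allL⁺ (fins d) λ {i} _ → cong not (eqc-≢ (nb i))
    where
    nb : ∀ i → χ v ≢ base χ (flip v i)
    nb i with inS (flip v i) in es
    ... | true = proper⁻ χ pr v i
    ... | false with outside χ χ' pr cl rl v i eg (trans (on-flip σ v i) (cong not o))
    ...   | inj₁ a = absurd (∧ʳ {dev σ k χ (flip v i)} a) es
    ...   | inj₂ kk = λ e → proper⁻ χ pr v i (trans e (sym kk))

  -- Class σ outside S is copied from χ', and once class σ is fixed the other vertices are
  -- independent. Only the sum over the values in S remains.
  reduce : ∀ χ' → Tot d (λ χ → ∏ onL (λ y → 𝟙 (inS y ∨ eqc (χ y) (χ' y))) * ∏ offL (λ v → 𝟙 (wb χ' χ v (χ v))))
   ≤ S varL (λ χ → ∏ offL (W χ' χ)) (λ _ → zero)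
  reduce χ' = begin
   Tot d Φ
    ≡⟨ Tot-filter (on σ) Φ-ext ρ₀ ⟩
   S onL (S offL Φ) ρ₀
    ≤⟨ S-mono onL (λ χ → ≤-reflexive (inner χ)) ⟩
   S onL (λ χ → ∏ onL (λ y → 𝟙 (inS y ∨ eqc (χ y) (χ' y))) * ∏ offL (W χ' χ)) ρ₀
    ≤⟨ S-mono onL (λ χ → *-monoˡ-≤ (∏ offL (W χ' χ)) (dropS χ)) ⟩
   S onL Ψ ρ₀
    ≡⟨ trans (S-↭ Ψ-ext (filter-partition inS (filterᵇ-unique (on σ) (allV-unique d))) ρ₀) (S-++ varL restL Ψ ρ₀) ⟩
   S varL (S restL Ψ) ρ₀
    ≡⟨ S-cong varL rest ⟩
   S varL (λ χ → ∏ offL (W χ' χ)) ρ₀ ∎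
   where
   ρ₀ : Colouring
   ρ₀ _ = zero
   Φ Ψ : Colouring → ℕ
   Φ χ = ∏ onL (λ y → 𝟙 (inS y ∨ eqc (χ y) (χ' y))) * ∏ offL (λ v → 𝟙 (wb χ' χ v (χ v)))
   Ψ χ = ∏ restL (λ y → 𝟙 (eqc (χ y) (χ' y))) * ∏ offL (W χ' χ)
   Φ-ext : Ext Φ
   Φ-ext χ χ₂ h = cong₂ _*_ (∏-cong onL λ y → cong (λ c → 𝟙 (inS y ∨ eqc c (χ' y))) (h y))
    (∏-cong offL λ v → cong 𝟙 (trans (wb-local χ' χ χ₂ v (χ v) λ i _ → h (flip v i)) (cong (wb χ' χ₂ v) (h v))))
   Ψ-ext : Ext Ψ
   Ψ-ext χ χ₂ h = cong₂ _*_ (∏-cong restL λ y → cong (λ c → 𝟙 (eqc c (χ' y))) (h y)) (∏-cong offL λ v → W-local χ' χ χ₂ v λ i _ → h (flip v i))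
   notin : ∀ {y} → on σ y ≡ true → y ∉ offL
   notin o i = absurd o (not-injective (filterᵇ-true (not ∘ on σ) (allV d) i))
   inner : ∀ χ → S offL Φ χ ≡ ∏ onL (λ y → 𝟙 (inS y ∨ eqc (χ y) (χ' y))) * ∏ offL (W χ' χ)
   inner χ = trans (S-cong-off offL λ χ₂ off → cong₂ _*_
    (∏-cong∈ onL λ {y} i → cong (λ c → 𝟙 (inS y ∨ eqc c (χ' y))) (off y (notin (filterᵇ-true (on σ) (allV d) i))))
    (∏-cong offL λ v → cong 𝟙 (wb-local χ' χ₂ χ v (χ₂ v) λ i e → off (flip v i) (notin (inS-on e)))))
    (trans (S-*ˡ (∏ onL λ y → 𝟙 (inS y ∨ eqc (χ y) (χ' y))) offL _ χ) (cong (∏ onL (λ y → 𝟙 (inS y ∨ eqc (χ y) (χ' y))) *_)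
     (S-∏ offL (filterᵇ-unique _ (allV-unique d)) (λ v c → 𝟙 (wb χ' χ v c)) χ)))
   dropS : ∀ χ → ∏ onL (λ y → 𝟙 (inS y ∨ eqc (χ y) (χ' y))) ≤ ∏ restL (λ y → 𝟙 (eqc (χ y) (χ' y)))
   dropS χ = ≡≤ (∏-split inS onL _) (≤≡ (*-mono-≤ (≤-reflexive (∏-filter-cong (not ∘ inS) onL λ y e →
    cong (λ b → 𝟙 (b ∨ eqc (χ y) (χ' y))) (not-injective e))) (∏≤1 varL _ λ y → 𝟙≤1 _)) (*-identityʳ _))
   rest : ∀ χ → S restL Ψ χ ≡ ∏ offL (W χ' χ)
   rest χ = trans (S-cong-off restL λ χ₂ off → trans (*-comm (∏ restL λ y → 𝟙 (eqc (χ₂ y) (χ' y))) _)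
    (cong (_* ∏ restL (λ y → 𝟙 (eqc (χ₂ y) (χ' y)))) (∏-cong offL λ v → W-local χ' χ₂ χ v λ i e →
     off (flip v i) λ j → absurd e (not-injective (filterᵇ-true (not ∘ inS) onL j)))))
    (trans (S-*ˡ (∏ offL (W χ' χ)) restL _ χ) (trans (cong (∏ offL (W χ' χ) *_)
     (trans (S-∏ restL (filterᵇ-unique _ (filterᵇ-unique _ (allV-unique d))) (λ y c → 𝟙 (eqc c (χ' y))) χ)
      (trans (∏-cong restL λ y → count-eqc (χ' y)) (∏-one restL)))) (*-identityʳ _)))

  sdeg : Vertex d → ℕ
  sdeg v = ∑ (fins d) λ i → 𝟙 (inS (flip v i))

  scopeL : Vertex d → List (Vertex d)
  scopeL v = filterᵇ (adj v) varL

  scopeL-length : ∀ v → length (scopeL v) ≡ sdeg v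
  scopeL-length v = trans (↭-length (unique-↭ scope-unique (map⁺ (λ {i} {j} → flip-inj v i j) (filterᵇ-unique (λ i → inS (flip v i)) (fins-unique d))) to from))
   (trans (length-map (flip v) (filterᵇ (λ i → inS (flip v i)) (fins d))) (length-filterᵇ (λ i → inS (flip v i)) (fins d)))
   where
   scope-unique : Unique (scopeL v)
   scope-unique = filterᵇ-unique _ (filterᵇ-unique _ (filterᵇ-unique _ (allV-unique d)))
   to : ∀ {y} → y ∈ scopeL v → y ∈ map (flip v) (filterᵇ (λ i → inS (flip v i)) (fins d))
   to i with ∈-filterᵇ⁻ (adj v) varL i
   ... | j , a with adj⁻ {r = v} a | filterᵇ-true inS onL j
   ...   | i , refl | s = ∈-map⁺ (flip v) (∈-filterᵇ⁺ (λ i → inS (flip v i)) (∈-fins i) s)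
   from : ∀ {y} → y ∈ map (flip v) (filterᵇ (λ i → inS (flip v i)) (fins d)) → y ∈ scopeL v
   from i with ∈-map⁻ (flip v) i
   ... | j , m , refl = ∈-filterᵇ⁺ (adj v) (∈-filterᵇ⁺ inS (∈-filterᵇ⁺ (on σ) (∈-allV _) (inS-on s)) s) (adj-flip v j)
    where
    s : inS (flip v j) ≡ true
    s = filterᵇ-true (λ i → inS (flip v i)) (fins d) m

  scopeL⁻ : ∀ {v y} → y ∈ scopeL v → inS y ≡ true × ∃ λ i → flip v i ≡ y
  scopeL⁻ {v} i with ∈-filterᵇ⁻ (adj v) varL i
  ... | j , a = filterᵇ-true inS onL j , adj⁻ a

  t₁ t₂ t₃ : Vertex d → Colouring → ℕ
  t₁ v χ = ∏ (scopeL v) λ y → 𝟙 (eqc (χ y) k)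
  t₂ v χ = ∑ cols λ c → ∏ (scopeL v) λ y → 𝟙 (not (eqc (χ y) c))
  t₃ v χ = ∑ cols λ c → ∏ (scopeL v) λ y → 2 * 𝟙 (eqc (χ y) c)

  -- The number of colours available at v is 1 if no neighbour in S deviates. Otherwise it is at most 1
  -- unless all neighbours of v lie in S and have the same colour.
  W-pointwise : ∀ χ' v χ → W χ' χ v ^ d ≤ t₁ v χ + (t₂ v χ + t₃ v χ)
  W-pointwise χ' v χ with G₁ χ v in eg
  ... | false = ≡≤ (trans (cong (_^ d) (count-eqc (χ' v))) (^-zeroˡ d)) (≡≤ (sym one) (m≤m+n _ _))
   where
   one : t₁ v χ ≡ 1
   one = ∏𝟙-one (scopeL v) (λ y → eqc (χ y) k) go
    where
    go : ∀ {y} → y ∈ scopeL v → eqc (χ y) k ≡ true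
    go {y} j with scopeL⁻ {v} j
    ... | s , i , refl with bool-cases (eqc (χ (flip v i)) k)
    ...   | inj₁ e = e
    ...   | inj₂ e = absurd (G₁⁺ χ v i (∧-true⁺ (∧-true⁺ (inS-on s) (cong not e)) s)) eg
  ... | true with G₁⁻ χ v eg
  ...   | i₀ , a₀ = go (ok (other₁ l)) refl (ok (other₂ l)) refl
   where
   l : Fin 3
   l = χ (flip v i₀)
   s₀ : inS (flip v i₀) ≡ true
   s₀ = ∧ʳ {dev σ k χ (flip v i₀)} a₀
   l≢k : l ≢ k
   l≢k = eqc-≢⁻ l k (not-injective (∧ʳ {on σ (flip v i₀)} (∧ˡ {dev σ k χ (flip v i₀)} a₀)))
   ok : Fin 3 → Bool
   ok c = allL (fins d) λ i → not (eqc c (base χ (flip v i)))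
   base-in : ∀ {y} → inS y ≡ true → base χ y ≡ χ y
   base-in {y} e = cong (λ b → if b then χ y else k) e
   base-out : ∀ {y} → inS y ≡ false → base χ y ≡ k
   base-out {y} e = cong (λ b → if b then χ y else k) e
   ok⁻ : ∀ {c} → ok c ≡ true → ∀ i → base χ (flip v i) ≢ c
   ok⁻ {c} e i z = absurd (trans (cong (eqc c) z) (eqc-refl c)) (not-injective (allL⁻ {xs = fins d} {λ i → not (eqc c (base χ (flip v i)))} e (∈-fins i)))
   okl : ok l ≡ false
   okl with bool-cases (ok l)
   ... | inj₂ e = e
   ... | inj₁ e = ⊥-elim (ok⁻ e i₀ (base-in s₀))
   W≡ : ∑ cols (𝟙 ∘ ok) ≡ 𝟙 (ok (other₁ l)) + 𝟙 (ok (other₂ l))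
   W≡ = trans (others l (𝟙 ∘ ok)) (cong (λ b → 𝟙 b + (𝟙 (ok (other₁ l)) + 𝟙 (ok (other₂ l)))) okl)
   t₂≥ : ∀ c → ok c ≡ true → 1 ≤ t₂ v χ
   t₂≥ c e = ≡≤ (sym (∏𝟙-one (scopeL v) (λ y → not (eqc (χ y) c)) sub))
    (term≤∑ (λ c → ∏ (scopeL v) λ y → 𝟙 (not (eqc (χ y) c))) (∈-cols c))
    where
    sub : ∀ {y} → y ∈ scopeL v → not (eqc (χ y) c) ≡ true
    sub j with scopeL⁻ {v} j
    ... | s , i , refl = cong not (eqc-≢ λ z → ok⁻ e i (trans (base-in s) z))
   go : ∀ b → ok (other₁ l) ≡ b → ∀ b' → ok (other₂ l) ≡ b' → ∑ cols (𝟙 ∘ ok) ^ d ≤ t₁ v χ + (t₂ v χ + t₃ v χ)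
   go false e false e' = ≡≤ (cong (_^ d) (trans W≡ (cong₂ (λ a b → 𝟙 a + 𝟙 b) e e'))) z≤n
   go true e false e' = ≡≤ (trans (cong (_^ d) (trans W≡ (cong₂ (λ a b → 𝟙 a + 𝟙 b) e e'))) (^-zeroˡ d)) (≤-trans (t₂≥ (other₁ l) e) (≤-trans (m≤m+n _ _) (m≤n+m _ (t₁ v χ))))
   go false e true e' = ≡≤ (trans (cong (_^ d) (trans W≡ (cong₂ (λ a b → 𝟙 a + 𝟙 b) e e'))) (^-zeroˡ d)) (≤-trans (t₂≥ (other₂ l) e') (≤-trans (m≤m+n _ _) (m≤n+m _ (t₁ v χ))))
   go true e true e' = ≡≤ (cong (_^ d) (trans W≡ (cong₂ (λ a b → 𝟙 a + 𝟙 b) e e'))) (≡≤ (sym prod)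
    (≤-trans (term≤∑ (λ c → ∏ (scopeL v) λ y → 2 * 𝟙 (eqc (χ y) c)) (∈-cols l)) (≤-trans (m≤n+m _ (t₂ v χ)) (m≤n+m _ (t₁ v χ)))))
    where
    all-l : ∀ i → base χ (flip v i) ≡ l
    all-l i = not-others l _ (ok⁻ {other₁ l} e i) (ok⁻ {other₂ l} e' i)
    all-in : ∀ i → inS (flip v i) ≡ true
    all-in i with bool-cases (inS (flip v i))
    ... | inj₁ s = s
    ... | inj₂ s = ⊥-elim (l≢k (trans (sym (all-l i)) (base-out s)))
    each : ∀ {y} → y ∈ scopeL v → 2 * 𝟙 (eqc (χ y) l) ≡ 2
    each j with scopeL⁻ {v} j
    ... | s , i , refl = cong (λ b → 2 * 𝟙 b) (trans (cong (λ c → eqc c l) (trans (sym (base-in s)) (all-l i))) (eqc-refl l))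
    prod : ∏ (scopeL v) (λ y → 2 * 𝟙 (eqc (χ y) l)) ≡ 2 ^ d
    prod = trans (∏-cong∈ (scopeL v) each) (trans (∏-const 2 (scopeL v)) (cong (2 ^_) (trans (scopeL-length v)
     (trans (∑-cong (fins d) λ i → 𝟙-true (all-in i)) (trans (∑-fins d 1) (*-identityʳ d))))))

  scope-unique : ∀ v → Unique (scopeL v)
  scope-unique v = filterᵇ-unique _ (filterᵇ-unique _ (filterᵇ-unique _ (allV-unique d)))

  -- With s = `sdeg v` the three terms of `W-pointwise` sum to 1, 3 · 2^s and 3 · 2^s, together at
  -- most 2^(s + 3). The extra 3 is paid only where v has a neighbour in S.
  local-sum : ∀ χ' v ρ → S (scopeL v) (λ χ → W χ' χ v ^ d) ρ ≤ 2 ^ (sdeg v + 3 * 𝟙 (NS v))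
  local-sum χ' v ρ with NS v in en
  ... | false = ≤-trans (S-mono (scopeL v) λ χ → ≤-reflexive (trans (cong (_^ d) (one χ)) (^-zeroˡ d)))
   (≡≤ (empty (scopeL v) λ {y} j → bad (scopeL⁻ {v} j)) (m^n>0 2 (sdeg v + 0)))
   where
   none : ∀ i → inS (flip v i) ≡ true → ⊥
   none i s = absurd (anyL⁺ {xs = fins d} {λ i → inS (flip v i)} (∈-fins i) s) en
   bad : ∀ {y} → inS y ≡ true × (∃ λ i → flip v i ≡ y) → ⊥
   bad (s , i , refl) = none i s
   one : ∀ χ → W χ' χ v ≡ 1
   one χ with bool-cases (G₁ χ v)
   ... | inj₁ g = ⊥-elim (none (proj₁ (G₁⁻ χ v g)) (∧ʳ {dev σ k χ (flip v (proj₁ (G₁⁻ χ v g)))} (proj₂ (G₁⁻ χ v g))))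
   ... | inj₂ g = trans (∑-cong cols λ c → cong (λ b → 𝟙 (if b then allL (fins d) (λ i → not (eqc c (base χ (flip v i)))) else eqc c (χ' v))) g) (count-eqc (χ' v))
   empty : ∀ vs → (∀ {y} → y ∈ vs → ⊥) → S vs (λ _ → 1) ρ ≡ 1
   empty [] h = refl
   empty (y ∷ vs) h = ⊥-elim (h (here refl))
  ... | true = begin
   S (scopeL v) (λ χ → W χ' χ v ^ d) ρ
    ≤⟨ S-mono (scopeL v) (W-pointwise χ' v) ⟩
   S (scopeL v) (λ χ → t₁ v χ + (t₂ v χ + t₃ v χ)) ρ
    ≡⟨ trans (S-+ (scopeL v) (t₁ v) _ ρ) (cong₂ _+_ sum₁ (trans (S-+ (scopeL v) (t₂ v) (t₃ v) ρ) (cong₂ _+_ sum₂ sum₃))) ⟩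
   1 + (3 * 2 ^ s + 3 * 2 ^ s)
    ≤⟨ +-monoˡ-≤ _ (≤-trans (m^n>0 2 s) (m≤n*m (2 ^ s) 2)) ⟩
   2 * 2 ^ s + (3 * 2 ^ s + 3 * 2 ^ s)
    ≡⟨ trans (lem (2 ^ s)) (sym (^-distribˡ-+-* 2 s 3)) ⟩
   2 ^ (s + 3 * 1) ∎
   where
   s : ℕ
   s = sdeg v
   lem : ∀ x → 2 * x + (3 * x + 3 * x) ≡ x * 8
   lem = solve-∀
   pow : ∏ (scopeL v) (λ _ → 2) ≡ 2 ^ s
   pow = trans (∏-const 2 (scopeL v)) (cong (2 ^_) (scopeL-length v))
   sum₁ : S (scopeL v) (t₁ v) ρ ≡ 1
   sum₁ = trans (S-∏ (scopeL v) (scope-unique v) (λ y c → 𝟙 (eqc c k)) ρ) (trans (∏-cong (scopeL v) λ _ → count-eqc k) (∏-one (scopeL v)))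
   sum₂ : S (scopeL v) (t₂ v) ρ ≡ 3 * 2 ^ s
   sum₂ = trans (S-∑ (scopeL v) cols (λ c χ → ∏ (scopeL v) λ y → 𝟙 (not (eqc (χ y) c))) ρ) (trans (∑-cong cols λ c →
    trans (S-∏ (scopeL v) (scope-unique v) (λ y c' → 𝟙 (not (eqc c' c))) ρ) (trans (∏-cong (scopeL v) λ _ → count-neq c) pow)) (∑-const (2 ^ s) cols))
   sum₃ : S (scopeL v) (t₃ v) ρ ≡ 3 * 2 ^ s
   sum₃ = trans (S-∑ (scopeL v) cols (λ c χ → ∏ (scopeL v) λ y → 2 * 𝟙 (eqc (χ y) c)) ρ) (trans (∑-cong cols λ c →
    trans (S-∏ (scopeL v) (scope-unique v) (λ y c' → 2 * 𝟙 (eqc c' c)) ρ) (trans (∏-cong (scopeL v) λ _ →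
     trans (∑-*ˡ 2 cols (λ c' → 𝟙 (eqc c' c))) (cong (2 *_) (count-eqc c))) pow)) (∑-const (2 ^ s) cols))

  -- Finner over the stars around the vertices off σ: each point of S lies in d of them. The
  -- exponents add up to d |S| + 3 |N(S)|, so a fibre has about 2^(|S| + 3|N(S)|/d) elements at
  -- most.
  fibre : ∀ χ' h → d * card inS + 3 * card NS ≤ d * h → S varL (λ χ → ∏ offL (W χ' χ)) (λ _ → zero) ≤ 2 ^ h
  fibre χ' h e = ^-cancelˡ-≤ d' (begin
   S varL (λ χ → ∏ offL (W χ' χ)) (λ _ → zero) ^ d
    ≤⟨ Finner.finner _≟V_ cols d' offL (λ v χ → W χ' χ v) adj (λ v χ χ₂ ag → W-local χ' χ χ₂ v λ i _ → ag (flip v i) (adj-flip v i))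
     varL (λ {y} i → off-degree σ y (filterᵇ-true (on σ) (allV d) (proj₁ (∈-filterᵇ⁻ inS onL i)))) (λ _ → zero) ⟩
   ∏ offL (λ v → S (scopeL v) (λ χ → W χ' χ v ^ d) (λ _ → zero))
    ≤⟨ ∏-mono offL (λ v → local-sum χ' v (λ _ → zero)) ⟩
   ∏ offL (λ v → 2 ^ (sdeg v + 3 * 𝟙 (NS v)))
    ≡⟨ ∏-2^ 2 offL _ ⟩
   2 ^ ∑ offL (λ v → sdeg v + 3 * 𝟙 (NS v))
    ≤⟨ ^-monoʳ-≤ 2 (≤-trans (∑-filter-≤ (not ∘ on σ) (allV d) _) (≡≤ (trans (∑-+ (allV d) sdeg _) (cong₂ _+_ degsum (∑-*ˡ 3 (allV d) _))) e)) ⟩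
   2 ^ (d * h)
    ≡⟨ trans (cong (2 ^_) (*-comm d h)) (sym (^-*-assoc 2 h d)) ⟩
   (2 ^ h) ^ d ∎)
   where
   degsum : ∑ (allV d) sdeg ≡ d * card inS
   degsum = trans (∑-swap (allV d) (fins d) λ v i → 𝟙 (inS (flip v i))) (trans (∑-cong (fins d) λ i → ∑-flip d i (𝟙 ∘ inS))
    (∑-fins d (card inS)))

 -- Double count of the pairs in `rel`: at least 2^g for each χ in the event, at most 2^h for each
 -- χ'. Hence the event is rare as soon as the freed neighbourhood exceeds |S| + 3|N(S)|/d.
 container-bound : ∀ (ev : Colouring → Bool) g h → (∀ χ → 1 ≤ proper χ → ev χ ≡ true → Closed χ × g ≤ card (G₁ χ)) →
  d * card inS + 3 * card NS ≤ d * h →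
  Tot d (λ χ → proper χ * 𝟙 (ev χ)) * 2 ^ g ≤ Tot d proper * 2 ^ h
 container-bound ev g h good-ev e = begin
  Tot d (λ χ → proper χ * 𝟙 (ev χ)) * 2 ^ g
   ≡⟨ sym (Tot-*ʳ d (2 ^ g) _) ⟩
  Tot d (λ χ → proper χ * 𝟙 (ev χ) * 2 ^ g)
   ≤⟨ Tot-mono d (λ χ → spread χ) ⟩
  Tot d (λ χ → Tot d λ χ' → proper χ * 𝟙 (ev χ) * (rel χ χ' * proper χ'))
   ≡⟨ Tot-swap cols cols zero zero d d (λ χ χ' → proper χ * 𝟙 (ev χ) * (rel χ χ' * proper χ')) ⟩
  Tot d (λ χ' → Tot d λ χ → proper χ * 𝟙 (ev χ) * (rel χ χ' * proper χ'))
   ≤⟨ Tot-mono d (λ χ' → ≤-trans (Tot-mono d (λ χ → gather χ' χ)) (≡≤ (Tot-*ˡ d (proper χ') _)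
    (*-monoʳ-≤ (proper χ') (≤-trans (reduce χ') (fibre χ' h e))))) ⟩
  Tot d (λ χ' → proper χ' * 2 ^ h)
   ≡⟨ Tot-*ʳ d (2 ^ h) proper ⟩
  Tot d proper * 2 ^ h ∎
  where
  guard : ∀ χ {x y} → (1 ≤ proper χ → ev χ ≡ true → x ≤ y) → proper χ * 𝟙 (ev χ) * x ≤ proper χ * 𝟙 (ev χ) * y
  guard χ {x} {y} f with proper χ | ev χ
  ... | zero | _ = z≤n
  ... | suc z | true = *-monoʳ-≤ (suc z * 1) (f (s≤s z≤n) refl)
  ... | suc z | false = ≤-reflexive (trans (cong (_* x) (*-zeroʳ (suc z))) (sym (cong (_* y) (*-zeroʳ (suc z)))))
  spread : ∀ χ → proper χ * 𝟙 (ev χ) * 2 ^ g ≤ Tot d λ χ' → proper χ * 𝟙 (ev χ) * (rel χ χ' * proper χ')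
  spread χ = ≤≡ (guard χ λ pr t → ≤-trans (^-monoʳ-≤ 2 (proj₂ (good-ev χ pr t))) (≡≤ (sym (rel-sum χ))
   (Tot-mono d λ χ' → pos χ' pr (proj₁ (good-ev χ pr t))))) (sym (Tot-*ˡ d (proper χ * 𝟙 (ev χ)) _))
   where
   pos : ∀ χ' → 1 ≤ proper χ → Closed χ → rel χ χ' ≤ rel χ χ' * proper χ'
   pos χ' pr cl with rel χ χ' in eq
   ... | zero = z≤n
   ... | suc z = ≤-reflexive (sym (trans (cong (suc z *_) (rel-proper χ χ' pr cl (≤≡ (s≤s z≤n) (sym eq)))) (*-identityʳ _)))
  gather : ∀ χ' χ → proper χ * 𝟙 (ev χ) * (rel χ χ' * proper χ') ≤ proper χ' * (∏ onL (λ y → 𝟙 (inS y ∨ eqc (χ y) (χ' y))) * ∏ offL (λ v → 𝟙 (wb χ' χ v (χ v))))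
  gather χ' χ = ≤-trans (guard χ λ pr t → *-monoˡ-≤ (proper χ') (dominate χ' χ pr (proj₁ (good-ev χ pr t))))
   (≤≡ (*-monoˡ-≤ _ (*-mono-≤ (proper≤1 χ) (𝟙≤1 (ev χ)))) (trans (*-identityˡ _) (*-comm _ (proper χ'))))

-- Approximating a cluster by a depth-first search.

nbr-sum : ∀ {d} (y : Vertex d) (f : Vertex d → ℕ) → ∑ (allV d) (λ v → 𝟙 (adj y v) * f v) ≡ ∑ (fins d) (f ∘ flip y)
nbr-sum {d} y f = trans (sym (∑-filter (adj y) (allV d) f)) (trans (∑-↭ f (unique-↭ (filterᵇ-unique _ (allV-unique d)) (neighbours-unique y) to from)) (∑-map (flip y) (fins d) f))
 where
 to : ∀ {v} → v ∈ filterᵇ (adj y) (allV d) → v ∈ map (flip y) (fins d)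
 to i with adj⁻ {r = y} (filterᵇ-true (adj y) (allV d) i)
 ... | j , refl = ∈-map⁺ (flip y) (∈-fins j)
 from : ∀ {v} → v ∈ map (flip y) (fins d) → v ∈ filterᵇ (adj y) (allV d)
 from i with ∈-map⁻ (flip y) i
 ... | j , _ , refl = ∈-filterᵇ⁺ (adj y) (∈-allV _) (adj-flip y j)

count-one : ∀ {d} (a : Fin d) → ∑ (fins d) (λ i → 𝟙 (does (i Fin.≟ a))) ≡ 1
count-one {d} a = ∑-𝟙-single (λ i → does (i Fin.≟ a)) (fins-unique d) (∈-fins a) yes-refl (λ {i} → only i)
 where
 yes-refl : does (a Fin.≟ a) ≡ true
 yes-refl with a Fin.≟ a
 ... | yes _ = refl
 ... | no ne = ⊥-elim (ne refl)
 only : ∀ i → does (i Fin.≟ a) ≡ true → i ≡ a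
 only i e with i Fin.≟ a
 ... | yes p = p

-- Four flips suffice: a deviation in S is within distance 2 of T, and the next deviation of its
-- cluster within distance 2 of that.
Offset : ℕ → Set
Offset d = Fin d × Fin d × Fin d × Fin d

shift : ∀ {d} → Vertex d → Offset d → Vertex d
shift t (i , j , a , b) = flip (flip (flip (flip t i) j) a) b

offsets : ∀ d → List (Offset d)
offsets d = cartesianProduct (fins d) (cartesianProduct (fins d) (cartesianProduct (fins d) (fins d)))

∈-offsets : ∀ {d} (o : Offset d) → o ∈ offsets d
∈-offsets (i , j , a , b) = ∈-cartesianProduct⁺ (∈-fins i) (∈-cartesianProduct⁺ (∈-fins j) (∈-cartesianProduct⁺ (∈-fins a) (∈-fins b)))

-- A code steers a depth-first walk: "just o" moves on to the vertex at offset o, "nothing" backtracks.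
Code : ℕ → Set
Code d = List (Maybe (Offset d))

run : ∀ {d} → Code d → List (Vertex d) → List (Vertex d) → List (Vertex d)
run [] st acc = acc
run (c ∷ cs) [] acc = acc
run (nothing ∷ cs) (t ∷ st) acc = run cs st acc
run (just o ∷ cs) (t ∷ st) acc = run cs (shift t o ∷ t ∷ st) (shift t o ∷ acc)

module Cover {d' : ℕ} (q : ℕ) (σ : Bool) where

 d : ℕ
 d = suc d'

 F : List (Vertex d) → Vertex d → Bool
 F T v = anyL T λ t → adj t v

 out : List (Vertex d) → Vertex d → ℕ
 out T y = ∑ (fins d) λ i → 𝟙 (not (F T (flip y i)))

 -- A vertex of σ that is left out would add more than d/q points to F if it were put into T. So T
 -- stays short compared with F, while the vertices of S have nearly all their neighbours in F.
 inS : List (Vertex d) → Vertex d → Bool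
 inS T y = on σ y ∧ (q * out T y ≤ᵇ d)

 F⁻ : ∀ T v → F T v ≡ true → ∃ λ t → t ∈ T × ∃ λ i → flip t i ≡ v
 F⁻ T v e with anyL⁻ T e
 ... | t , i , a = t , i , adj⁻ {r = t} a

 F⁺ : ∀ {T t} i → t ∈ T → F T (flip t i) ≡ true
 F⁺ {T} {t} i m = anyL⁺ {xs = T} {λ s → adj s (flip t i)} m (adj-flip t i)

 F-mono : ∀ {T T'} → (∀ {t} → t ∈ T → t ∈ T') → ∀ v → F T v ≡ true → F T' v ≡ true
 F-mono {T} {T'} sub v e with F⁻ T v e
 ... | t , m , i , refl = F⁺ i (sub m)

 out-mono : ∀ {T T'} → (∀ {t} → t ∈ T → t ∈ T') → ∀ y → out T' y ≤ out T y
 out-mono {T} {T'} sub y = ∑-mono (fins d) λ i → 𝟙-mono λ e → contra (F-mono {T} {T'} sub (flip y i)) e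
  where
  contra : ∀ {a b} → (a ≡ true → b ≡ true) → not b ≡ true → not a ≡ true
  contra {false} f e = refl
  contra {true} f e = absurd (f refl) (not-injective e)

 inS-on : ∀ T {y} → inS T y ≡ true → on σ y ≡ true
 inS-on T {y} e = ∧ˡ {on σ y} e

 inS⁺ : ∀ T y → on σ y ≡ true → q * out T y ≤ d → inS T y ≡ true
 inS⁺ T y o h = ∧-true⁺ o (≤-≤ᵇ h)

 inS⁻ : ∀ T y → inS T y ≡ true → q * out T y ≤ d
 inS⁻ T y e = ≤ᵇ-≤ (∧ʳ {on σ y} e)

 inS-mono : ∀ {T T'} → (∀ {t} → t ∈ T → t ∈ T') → ∀ y → inS T y ≡ true → inS T' y ≡ true
 inS-mono {T} {T'} sub y e = inS⁺ T' y (inS-on T e) (≤-trans (*-monoʳ-≤ q (out-mono {T} {T'} sub y)) (inS⁻ T y e))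

 T⊂S : ∀ {T t} → t ∈ T → on σ t ≡ true → inS T t ≡ true
 T⊂S {T} {t} m o = inS⁺ T t o (≡≤ (trans (cong (q *_) (trans (∑-cong (fins d) λ i → cong (𝟙 ∘ not) (F⁺ i m)) (∑-zero (fins d)))) (*-zeroʳ q)) z≤n)

 card-F-∷ : ∀ y T → card (F T) + out T y ≤ card (F (y ∷ T))
 card-F-∷ y T = ≡≤ (trans (cong (card (F T) +_) (sym (nbr-sum y λ v → 𝟙 (not (F T v))))) (sym (∑-+ (allV d) _ _)))
  (∑-mono (allV d) λ v → ≤≡ (lem (F T v) (adj y v)) (cong 𝟙 (form v)))
  where
  lem : ∀ a b → 𝟙 a + 𝟙 b * 𝟙 (not a) ≤ 𝟙 (b ∨ a)
  lem true true = ≤-refl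
  lem true false = ≤-refl
  lem false true = ≤-refl
  lem false false = z≤n
  deMorgan : ∀ a b → a ∨ not b ≡ not (not a ∧ b)
  deMorgan true b = refl
  deMorgan false b = refl
  form : ∀ v → adj y v ∨ F T v ≡ F (y ∷ T) v
  form v = deMorgan (adj y v) (allL T (λ t → not (adj t v)))

 out-[] : ∀ y → out [] y ≡ d
 out-[] y = trans (∑-fins d 1) (*-identityʳ d)

 card≤2^ : ∀ (P : Vertex d → Bool) → card P ≤ 2 ^ d
 card≤2^ P = ≤≡ (m≤m+n _ _) (card-not P)

 module _ (1≤q : 1 ≤ q) (A : Vertex d → Bool) (A-on : ∀ {v} → A v ≡ true → on σ v ≡ true) where

  Done : List (Vertex d) → Vertex d → Set
  Done T t = ∀ o → A (shift t o) ≡ true → inS T (shift t o) ≡ true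

  -- `len` says that every visited vertex is pushed once and popped once; from a single root the
  -- code thus has length 2|T| - 1. `big` bounds |T| by q|F|/d.
  record Explored (c : Code d) (st acc : List (Vertex d)) : Set where
   visited : List (Vertex d)
   visited = run c st acc
   field
    sub : ∀ {t} → t ∈ visited → A t ≡ true
    sup : ∀ {t} → t ∈ acc → t ∈ visited
    big : d * length visited ≤ q * card (F visited)
    done : ∀ {t} → t ∈ visited → Done visited t
    len : length c + 2 * length acc ≡ 2 * length visited + length st

  -- The search ends because `big` allows at most q 2^d visited vertices. A push lowers the
  -- remaining budget by two and lengthens the stack by one, a pop shortens the stack, so every move
  -- uses one unit of `fuel`.
  explore : ∀ fuel st acc → 2 * (q * 2 ^ d) + length st ≤ fuel + 2 * length acc →
   (∀ {t} → t ∈ acc → A t ≡ true) → d * length acc ≤ q * card (F acc) →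
   (∀ {t} → t ∈ acc → t ∈ st ⊎ Done acc t) → ∃ λ c → Explored c st acc
  explore fuel [] acc h a b dn = [] , record
   { sub = a ; sup = id ; big = b ; done = λ m → case (dn m) ; len = sym (+-identityʳ _) }
   where
   case : ∀ {t} → t ∈ [] ⊎ Done acc t → Done acc t
   case (inj₂ p) = p
  explore zero (t ∷ st) acc h a b dn = ⊥-elim (1+n≰n (≤-trans (≤≡ (m≤m+n (suc (2 * (q * 2 ^ d))) (length st)) (sym (+-suc _ _))) (≤-trans h (*-monoʳ-≤ 2 small))))
   where
   small : length acc ≤ q * 2 ^ d
   small = ≤-trans (m≤n*m (length acc) d) (≤-trans b (*-monoʳ-≤ q (card≤2^ (F acc))))
  explore (suc fuel) (t ∷ st) acc h a b dn with bool-cases (anyL (offsets d) λ o → A (shift t o) ∧ not (inS acc (shift t o)))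
  ... | inj₂ none with explore fuel st acc (≤-pred (≡≤ (sym (+-suc _ _)) h)) a b dn'
   where
   dn-t : Done acc t
   dn-t o e with bool-cases (inS acc (shift t o))
   ... | inj₁ s = s
   ... | inj₂ s = absurd (anyL⁺ {xs = offsets d} {λ o → A (shift t o) ∧ not (inS acc (shift t o))} (∈-offsets o) (∧-true⁺ e (cong not s))) none
   dn' : ∀ {u} → u ∈ acc → u ∈ st ⊎ Done acc u
   dn' m with dn m
   ... | inj₂ p = inj₂ p
   ... | inj₁ (here refl) = inj₂ dn-t
   ... | inj₁ (there j) = inj₁ j
  ...   | c , ex = nothing ∷ c , record { sub = sub ; sup = sup ; big = big ; done = done ; len = trans (cong suc len) (sym (+-suc _ _)) }
   where open Explored ex
  explore (suc fuel) (t ∷ st) acc h a b dn | inj₁ some with anyL⁻ (offsets d) some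
  ... | o , _ , e with explore fuel (shift t o ∷ t ∷ st) (shift t o ∷ acc) h' a' b' dn'
   where
   y : Vertex d
   y = shift t o
   Ay : A y ≡ true
   Ay = ∧ˡ e
   h' : 2 * (q * 2 ^ d) + suc (suc (length st)) ≤ fuel + 2 * suc (length acc)
   h' = ≡≤ (+-suc _ _) (≤≡ (s≤s h) (lem fuel (length acc)))
    where
    lem : ∀ f l → suc (suc f + 2 * l) ≡ f + 2 * suc l
    lem = solve-∀
   a' : ∀ {u} → u ∈ y ∷ acc → A u ≡ true
   a' (here refl) = Ay
   a' (there m) = a m
   notS : d ≤ q * out acc y
   notS with ≤-total d (q * out acc y)
   ... | inj₁ p = p
   ... | inj₂ p = absurd (inS⁺ acc y (A-on Ay) p) (not-injective (∧ʳ {A y} e))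
   b' : d * suc (length acc) ≤ q * card (F (y ∷ acc))
   b' = ≡≤ (*-suc d (length acc)) (≤-trans (+-mono-≤ notS b) (≡≤ (trans (+-comm (q * out acc y) _) (sym (*-distribˡ-+ q (card (F acc)) (out acc y)))) (*-monoʳ-≤ q (card-F-∷ y acc))))
   dn' : ∀ {u} → u ∈ y ∷ acc → u ∈ y ∷ t ∷ st ⊎ Done (y ∷ acc) u
   dn' (here refl) = inj₁ (here refl)
   dn' (there m) with dn m
   ... | inj₁ j = inj₁ (there j)
   ... | inj₂ p = inj₂ λ o' e' → inS-mono {acc} {y ∷ acc} there _ (p o' e')
  ...   | c , ex = just o ∷ c , record { sub = sub ; sup = sup ∘ there ; big = big ; done = done ; len = len' }
   where
   open Explored ex
   len' : suc (length c) + 2 * length acc ≡ 2 * length visited + suc (length st)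
   len' = suc-injective (trans (lem (length c) (length acc)) (trans len (+-suc _ _)))
    where
    lem : ∀ x l → suc (suc x + 2 * l) ≡ x + 2 * suc l
    lem = solve-∀

  start : ∀ y → A y ≡ true → ∃ λ c → Explored c (y ∷ []) (y ∷ [])
  start y e = explore (2 * (q * 2 ^ d) + 1) (y ∷ []) (y ∷ []) (m≤m+n _ _) (λ { (here refl) → e })
   (≡≤ (*-identityʳ d) (≤-trans (m≤n*m d q ⦃ >-nonZero 1≤q ⦄) (*-monoʳ-≤ q (≡≤ (sym (out-[] y)) (≤-trans (m≤n+m _ (card (F []))) (card-F-∷ y []))))))
   (λ { (here refl) → inj₁ (here refl) })

 module Counts (T : List (Vertex d)) (T-on : ∀ {t} → t ∈ T → on σ t ≡ true) where

  s f e o : ℕ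
  s = card (inS T)
  f = card (F T)
  e = ∑ (allV d) λ y → ∑ (fins d) λ i → 𝟙 (inS T y ∧ F T (flip y i))
  o = ∑ (allV d) λ y → ∑ (fins d) λ i → 𝟙 (inS T y ∧ not (F T (flip y i)))

  NS : Vertex d → Bool
  NS v = anyL (fins d) λ i → inS T (flip v i)

  F-off : ∀ v → F T v ≡ true → on σ v ≡ false
  F-off v h with F⁻ T v h
  ... | t , m , i , refl = trans (on-flip σ t i) (cong not (T-on m))

  e+o : e + o ≡ d * s
  e+o = trans (sym (∑-+ (allV d) _ _)) (trans (∑-cong (allV d) λ y → trans (sym (∑-+ (fins d) (λ i → 𝟙 (inS T y ∧ F T (flip y i))) λ i → 𝟙 (inS T y ∧ not (F T (flip y i)))))
   (trans (∑-cong (fins d) λ i → lem (inS T y) (F T (flip y i))) (∑-fins d (𝟙 (inS T y))))) (∑-*ˡ d (allV d) _))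
   where
   lem : ∀ a b → 𝟙 (a ∧ b) + 𝟙 (a ∧ not b) ≡ 𝟙 a
   lem true b = 𝟙-not b
   lem false b = refl

  qo≤ds : q * o ≤ d * s
  qo≤ds = ≡≤ (sym (∑-*ˡ q (allV d) _)) (≤≡ (∑-mono (allV d) row) (∑-*ˡ d (allV d) _))
   where
   row : ∀ y → q * ∑ (fins d) (λ i → 𝟙 (inS T y ∧ not (F T (flip y i)))) ≤ d * 𝟙 (inS T y)
   row y = go (inS T y) refl
    where
    go : ∀ b → inS T y ≡ b → q * ∑ (fins d) (λ i → 𝟙 (b ∧ not (F T (flip y i)))) ≤ d * 𝟙 b
    go true eq = ≤≡ (inS⁻ T y eq) (sym (*-identityʳ d))
    go false eq = ≤-reflexive (trans (cong (q *_) (∑-zero (fins d))) (trans (*-zeroʳ q) (sym (*-zeroʳ d))))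

  e≤df : e ≤ d * f
  e≤df = ≤≡ (∑-mono (allV d) λ y → ∑-mono (fins d) λ i → 𝟙-mono λ h → ∧ʳ {inS T y} h)
   (trans (∑-swap (allV d) (fins d) λ y i → 𝟙 (F T (flip y i))) (trans (∑-cong (fins d) λ i → ∑-flip d i (𝟙 ∘ F T))
    (∑-fins d f)))

  -- Edge-isoperimetry for S ∪ F: its average degree is at most L. As nearly all of the d edges at a
  -- point of S lead into F, a value of L below d forces S to be smaller than F.
  isop : ∀ L → s + f ≤ 2 ^ L → 2 * e ≤ L * (s + f)
  isop L h = ≡≤ (trans (cong (e +_) (+-identityʳ e)) (trans (cong (e +_) (∑-edges d λ y w → 𝟙 (inS T y ∧ F T w)))
   (trans (sym (∑-+ (allV d) _ _)) (∑-cong (allV d) λ y → sym (∑-+ (fins d) (λ i → 𝟙 (inS T y ∧ F T (flip y i))) (λ i → 𝟙 (inS T (flip y i) ∧ F T y)))))))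
   (≤-trans (∑-mono (allV d) λ y → ∑-mono (fins d) λ i → lem (inS T y) (F T (flip y i)) (inS T (flip y i)) (F T y) (disj y))
   (≤-trans (harper-log U L (≤-trans cardU h)) (*-monoʳ-≤ L cardU)))
   where
   U : Vertex d → Bool
   U v = inS T v ∨ F T v
   disj : ∀ y → inS T y ≡ true → F T y ≡ false
   disj y i = ¬-elim λ g → absurd (inS-on T i) (F-off y g)
    where
    ¬-elim : ∀ {b} → (b ≡ true → ⊥) → b ≡ false
    ¬-elim {true} g = ⊥-elim (g refl)
    ¬-elim {false} g = refl
   lem : ∀ a b a' b' → (a ≡ true → b' ≡ false) → 𝟙 (a ∧ b) + 𝟙 (a' ∧ b') ≤ 𝟙 ((a ∨ b') ∧ (a' ∨ b))
   lem true b true true h = absurd refl (h refl)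
   lem true b false true h = absurd refl (h refl)
   lem true true true false h = ≤-refl
   lem true false true false h = z≤n
   lem true true false false h = ≤-refl
   lem true false false false h = z≤n
   lem false b true true h = ≤-refl
   lem false b true false h = z≤n
   lem false b false b' h = z≤n
   cardU : card U ≤ s + f
   cardU = ≤≡ (∑-mono (allV d) λ v → or (inS T v) (F T v)) (∑-+ (allV d) _ _)
    where
    or : ∀ a b → 𝟙 (a ∨ b) ≤ 𝟙 a + 𝟙 b
    or true b = s≤s z≤n
    or false b = ≤-refl

  NS≤ : card NS ≤ f + o
  NS≤ = ≤≡ (∑-mono (allV d) each) (trans (∑-+ (allV d) _ _) (cong (f +_)
   (sym (∑-edges d λ y w → 𝟙 (inS T y ∧ not (F T w))))))
   where
   each : ∀ v → 𝟙 (NS v) ≤ 𝟙 (F T v) + ∑ (fins d) (λ i → 𝟙 (inS T (flip v i) ∧ not (F T v)))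
   each v = 𝟙≤ λ h → go h (bool-cases (F T v))
    where
    go : NS v ≡ true → Cases (F T v) → 1 ≤ 𝟙 (F T v) + ∑ (fins d) (λ i → 𝟙 (inS T (flip v i) ∧ not (F T v)))
    go h (inj₁ g) = ≡≤ (sym (𝟙-true g)) (m≤m+n _ _)
    go h (inj₂ g) with anyL⁻ (fins d) h
    ... | i , m , w = ≡≤ (sym (𝟙-true (∧-true⁺ w (cong not g)))) (≤-trans (term≤∑ (λ i → 𝟙 (inS T (flip v i) ∧ not (F T v))) m) (m≤n+m _ (𝟙 (F T v))))

 module Event (2≤q : 2 ≤ q) (k : Fin 3) (T : List (Vertex d)) (χ : Vertex d → Fin 3) (T⊂A : ∀ {t} → t ∈ T → dev σ k χ t ≡ true) where

  open Container {d'} σ k (inS T) (inS-on T) using (A₁; G₁; Closed) public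

  A-on : ∀ {v} → dev σ k χ v ≡ true → on σ v ≡ true
  A-on {v} e = ∧ˡ {on σ v} e

  T⊂A₁ : ∀ {t} → t ∈ T → A₁ χ t ≡ true
  T⊂A₁ m = ∧-true⁺ (T⊂A m) (T⊂S m (A-on (T⊂A m)))

  G₁⁺ : ∀ y i → A₁ χ y ≡ true → G₁ χ (flip y i) ≡ true
  G₁⁺ y i a = anyL⁺ {xs = fins d} {λ j → A₁ χ (flip (flip y i) j)} (∈-fins i) (subst (λ w → A₁ χ w ≡ true) (sym (flip-flip y i)) a)

  F≤G₁ : card (F T) ≤ card (G₁ χ)
  F≤G₁ = card-mono (F T) (G₁ χ) go
   where
   go : ∀ v → F T v ≡ true → G₁ χ v ≡ true
   go v h with F⁻ T v h
   ... | t , m , i , refl = G₁⁺ t i (T⊂A₁ m)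

  G₁≤ : card (G₁ χ) ≤ d * card (dev σ k χ)
  G₁≤ = ≤≡ (∑-mono (allV d) each) (trans (∑-swap (allV d) (fins d) λ v i → 𝟙 (dev σ k χ (flip v i)))
   (trans (∑-cong (fins d) λ i → ∑-flip d i (𝟙 ∘ dev σ k χ)) (∑-fins d (card (dev σ k χ)))))
   where
   each : ∀ v → 𝟙 (G₁ χ v) ≤ ∑ (fins d) λ i → 𝟙 (dev σ k χ (flip v i))
   each v = 𝟙≤ λ h → go h
    where
    go : G₁ χ v ≡ true → 1 ≤ ∑ (fins d) λ i → 𝟙 (dev σ k χ (flip v i))
    go h with anyL⁻ (fins d) h
    ... | i , m , w = ≡≤ (sym (𝟙-true (∧ˡ {dev σ k χ (flip v i)} w))) (term≤∑ (λ i → 𝟙 (dev σ k χ (flip v i))) m)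

  module _ (done : ∀ {t} → t ∈ T → ∀ o → dev σ k χ (shift t o) ≡ true → inS T (shift t o) ≡ true) where

   -- A vertex a of `A₁` has fewer than d neighbours outside F, hence some t in T within distance 2.
   -- A deviation two flips away from a is then four flips away from t, and `done` applies.
   closed : Closed χ
   closed a i j h e with near
    where
    out<d : out T a < d
    out<d with out T a <? d
    ... | yes p = p
    ... | no p = ⊥-elim (1+n≰n (≤-trans (≤≡ (s≤s (m≤m+n d d')) (lem d')) (≤-trans (*-mono-≤ 2≤q (≮⇒≥ p)) (inS⁻ T a (∧ʳ {dev σ k χ a} h)))))
     where
     lem : ∀ x → suc (suc x + x) ≡ 2 * suc x
     lem = solve-∀
    near : ∃ λ i → F T (flip a i) ≡ true
    near with bool-cases (allL (fins d) λ i → not (F T (flip a i)))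
    ... | inj₁ all = ⊥-elim (<⇒≱ out<d (≤-reflexive (sym (trans (∑-cong (fins d) λ i → 𝟙-true (allL⁻ {xs = fins d} {λ i → not (F T (flip a i))} all (∈-fins i))) (trans (∑-fins d 1) (*-identityʳ d))))))
    ... | inj₂ some with allL-false (fins d) some
    ...   | i , _ , w = i , not-injective w
   ... | i' , h' with F⁻ T (flip a i') h'
   ...   | t , m , j' , eq = subst (λ w → inS T (flip (flip w i) j) ≡ true) at-a
    (done m (j' , i' , i , j) (subst (λ w → dev σ k χ (flip (flip w i) j) ≡ true) (sym at-a) e))
    where
    at-a : flip (flip t j') i' ≡ a
    at-a = trans (cong (λ w → flip w i') eq) (flip-flip a i')

   -- Two distinct vertices two flips apart have at most two common neighbours, reached in the
   -- directions a and b, so their neighbourhoods together have at least 2d - 2 points.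
   pair-large : ∀ y a b → y ∈ T → flip (flip y a) b ≢ y → dev σ k χ (flip (flip y a) b) ≡ true → 2 * d ≤ card (G₁ χ) + 2
   pair-large y a b m ne e = begin
    2 * d
     ≡⟨ cong (d +_) (+-identityʳ d) ⟩
    d + d
     ≤⟨ +-mono-≤ (≤-reflexive (sym countN)) countM ⟩
    ∑ (fins d) (λ i → 1) + (∑ (fins d) (λ i → 𝟙 (not (adj y (flip y₁ i)))) + 2)
     ≡⟨ sym (+-assoc (∑ (fins d) (λ _ → 1)) _ 2) ⟩
    ∑ (fins d) (λ i → 1) + ∑ (fins d) (λ i → 𝟙 (not (adj y (flip y₁ i)))) + 2
     ≡⟨ cong (_+ 2) (trans (cong₂ _+_ (sym (nbr-sum y λ _ → 1)) (sym (nbr-sum y₁ λ v → 𝟙 (not (adj y v))))) (sym (∑-+ (allV d) _ _))) ⟩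
    ∑ (allV d) (λ v → 𝟙 (adj y v) * 1 + 𝟙 (adj y₁ v) * 𝟙 (not (adj y v))) + 2
     ≤⟨ +-monoˡ-≤ 2 (∑-mono (allV d) λ v → lem (adj y v) (adj y₁ v) (G₁ χ v) (inG y Ay v) (inG y₁ Ay₁ v)) ⟩
    card (G₁ χ) + 2 ∎
    where
    y₁ : Vertex d
    y₁ = flip (flip y a) b
    Ay : A₁ χ y ≡ true
    Ay = T⊂A₁ m
    -- Offsets always have four flips; the last two cancel.
    back : shift y (a , b , a , a) ≡ y₁
    back = flip-flip y₁ a
    Ay₁ : A₁ χ y₁ ≡ true
    Ay₁ = ∧-true⁺ e (subst (λ w → inS T w ≡ true) back (done m (a , b , a , a) (subst (λ w → dev σ k χ w ≡ true) (sym back) e)))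
    inG : ∀ z → A₁ χ z ≡ true → ∀ v → adj z v ≡ true → G₁ χ v ≡ true
    inG z az v h with adj⁻ {r = z} h
    ... | i , refl = G₁⁺ z i az
    lem : ∀ p r g → (p ≡ true → g ≡ true) → (r ≡ true → g ≡ true) → 𝟙 p * 1 + 𝟙 r * 𝟙 (not p) ≤ 𝟙 g
    lem true true g h h' = ≤-reflexive (sym (𝟙-true (h refl)))
    lem true false g h h' = ≤-reflexive (sym (𝟙-true (h refl)))
    lem false true g h h' = ≤-reflexive (sym (𝟙-true (h' refl)))
    lem false false g h h' = z≤n
    countN : ∑ (fins d) (λ i → 1) ≡ d
    countN = trans (∑-fins d 1) (*-identityʳ d)
    direction : ∀ i → adj y (flip y₁ i) ≡ true → i ≢ a → i ≢ b → ⊥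
    direction i h ia ib with adj⁻ {r = y} h
    ... | j , eq with j Fin.≟ i
    ...   | yes refl = ne (sym (flip-injᵛ i eq))
    ...   | no ji = not-¬ {lookup y i} refl (trans (sym (lookup-flip-diff y ji)) (trans (cong (λ w → lookup w i) eq)
     (trans (lookup-flip-same y₁ i) (cong not (trans (lookup-flip-diff (flip y a) (ib ∘ sym)) (lookup-flip-diff y (ia ∘ sym)))))))
    countM : d ≤ ∑ (fins d) (λ i → 𝟙 (not (adj y (flip y₁ i)))) + 2
    countM = ≡≤ (sym countN) (≤-trans (∑-mono (fins d) each) (≤-reflexive
     (trans (∑-+ (fins d) (λ i → 𝟙 (not (adj y (flip y₁ i)))) (λ i → 𝟙 (does (i Fin.≟ a)) + 𝟙 (does (i Fin.≟ b)))) (cong (∑ (fins d) (λ i → 𝟙 (not (adj y (flip y₁ i)))) +_) (trans (∑-+ (fins d) (λ i → 𝟙 (does (i Fin.≟ a))) (λ i → 𝟙 (does (i Fin.≟ b)))) (cong₂ _+_ (count-one a) (count-one b)))))))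
     where
     each : ∀ i → 1 ≤ 𝟙 (not (adj y (flip y₁ i))) + (𝟙 (does (i Fin.≟ a)) + 𝟙 (does (i Fin.≟ b)))
     each i with i Fin.≟ a | i Fin.≟ b
     ... | yes _ | _ = ≤-trans (s≤s z≤n) (m≤n+m _ (𝟙 (not (adj y (flip y₁ i)))))
     ... | no _ | yes _ = m≤n+m _ (𝟙 (not (adj y (flip y₁ i))))
     ... | no p | no p' with bool-cases (adj y (flip y₁ i))
     ...   | inj₁ h = ⊥-elim (direction i h p p')
     ...   | inj₂ h = ≡≤ (sym (cong (𝟙 ∘ not) h)) (m≤m+n _ _)

-- Enumeration of codes, and isolated deviations.

moves : ∀ d → List (Maybe (Offset d))
moves d = nothing ∷ map just (offsets d)

∈-moves : ∀ {d} (c : Maybe (Offset d)) → c ∈ moves d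
∈-moves nothing = here refl
∈-moves (just o) = there (∈-map⁺ just (∈-offsets o))

codes : ∀ d → ℕ → List (Code d)
codes d zero = [] ∷ []
codes d (suc ℓ) = concatMap (λ c → map (c ∷_) (codes d ℓ)) (moves d)

∈-codes : ∀ {d} (c : Code d) → c ∈ codes d (length c)
∈-codes [] = here refl
∈-codes {d} (x ∷ c) = go (∈-moves x)
 where
 go : ∀ {ms} → x ∈ ms → x ∷ c ∈ concatMap (λ c' → map (c' ∷_) (codes d (length c))) ms
 go (here refl) = ∈-++⁺ˡ (∈-map⁺ (x ∷_) (∈-codes c))
 go (there i) = ∈-++⁺ʳ _ (go i)

length-offsets : ∀ d → length (offsets d) ≡ d ^ 4
length-offsets d = trans (len (fins d) _) (cong₂ _*_ (length-fins d) (trans (len (fins d) _) (cong₂ _*_ (length-fins d)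
 (trans (len (fins d) (fins d)) (cong₂ _*_ (length-fins d) (trans (length-fins d) (sym (*-identityʳ d))))))))
 where
 len : ∀ {A B : Set} (xs : List A) (ys : List B) → length (cartesianProduct xs ys) ≡ length xs * length ys
 len [] ys = refl
 len (x ∷ xs) ys = trans (length-++ (map (x ,_) ys)) (cong₂ _+_ (length-map (x ,_) ys) (len xs ys))

length-codes : ∀ d ℓ → length (codes d ℓ) ≡ suc (d ^ 4) ^ ℓ
length-codes d zero = refl
length-codes d (suc ℓ) = trans (sym (trans (∑-const 1 (codes d (suc ℓ))) (*-identityʳ _))) (trans (∑-concatMap (λ c → map (c ∷_) (codes d ℓ)) (moves d) (λ _ → 1))
 (trans (∑-cong (moves d) λ c → trans (∑-const 1 (map (c ∷_) (codes d ℓ))) (trans (*-identityʳ _) (trans (length-map (c ∷_) (codes d ℓ)) (length-codes d ℓ))))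
 (trans (∑-const _ (moves d)) (cong (_* suc (d ^ 4) ^ ℓ) (cong suc (trans (length-map just (offsets d)) (length-offsets d)))))))

isolated : ∀ {d} → Bool → Fin 3 → (Vertex d → Fin 3) → Bool
isolated {d} σ k χ = allL (allV d) λ y → allL (fins d) λ a → allL (fins d) λ b →
 not ((dev σ k χ y ∧ dev σ k χ (flip (flip y a) b)) ∧ not (does (flip (flip y a) b ≟V y)))

isolated-false : ∀ {d} σ k (χ : Vertex d → Fin 3) → isolated σ k χ ≡ false →
 ∃ λ y → ∃ λ a → ∃ λ b → dev σ k χ y ≡ true × dev σ k χ (flip (flip y a) b) ≡ true × flip (flip y a) b ≢ y
isolated-false {d} σ k χ e with allL-false (allV d) e
... | y , _ , e₁ with allL-false (fins d) e₁
...   | a , _ , e₂ with allL-false (fins d) e₂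
...     | b , _ , e₃ = y , a , b , proj₁ h₁ , proj₂ h₁ , λ eq → absurd (trans (cong (λ w → does (w ≟V y)) eq) (does-refl y)) (not-injective (proj₂ h))
 where
 h : dev σ k χ y ∧ dev σ k χ (flip (flip y a) b) ≡ true × not (does (flip (flip y a) b ≟V y)) ≡ true
 h = ∧-true⁻ (not-injective e₃)
 h₁ : dev σ k χ y ≡ true × dev σ k χ (flip (flip y a) b) ≡ true
 h₁ = ∧-true⁻ (proj₁ h)

-- The gain of a recolouring in numbers.

module Numerics (d s f e o ns L : ℕ) (1≤d : 1 ≤ d) (e+o : e + o ≡ d * s) (qo : 200 * o ≤ d * s)
 (iso : 2 * e ≤ L * (s + f)) (ns≤ : ns ≤ f + o) where

 private
  199ds≤200e : 199 * (d * s) ≤ 200 * e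
  199ds≤200e = +-cancelʳ-≤ (200 * o) _ _ (begin
   199 * (d * s) + 200 * o ≤⟨ +-monoʳ-≤ (199 * (d * s)) qo ⟩
   199 * (d * s) + d * s   ≡⟨ l (d * s) ⟩
   200 * (d * s)           ≡⟨ cong (200 *_) (sym e+o) ⟩
   200 * (e + o)           ≡⟨ *-distribˡ-+ 200 e o ⟩
   200 * e + 200 * o       ∎)
   where
   l : ∀ x → 199 * x + x ≡ 200 * x
   l = solve-∀

  main : 398 * (d * s) ≤ 200 * (L * (s + f))
  main = begin
   398 * (d * s)         ≡⟨ l (d * s) ⟩
   2 * (199 * (d * s))   ≤⟨ *-monoʳ-≤ 2 199ds≤200e ⟩
   2 * (200 * e)         ≡⟨ l' e ⟩
   200 * (2 * e)         ≤⟨ *-monoʳ-≤ 200 iso ⟩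
   200 * (L * (s + f))   ∎
   where
   l : ∀ x → 398 * x ≡ 2 * (199 * x)
   l = solve-∀
   l' : ∀ x → 2 * (200 * x) ≡ 200 * (2 * x)
   l' = solve-∀

  exponent : 200 * (d * s + 3 * ns) ≤ 203 * (d * s) + 600 * f
  exponent = begin
   200 * (d * s + 3 * ns)             ≤⟨ *-monoʳ-≤ 200 (+-monoʳ-≤ (d * s) (*-monoʳ-≤ 3 ns≤)) ⟩
   200 * (d * s + 3 * (f + o))        ≡⟨ l (d * s) f o ⟩
   200 * (d * s) + 600 * f + 3 * (200 * o) ≤⟨ +-monoʳ-≤ (200 * (d * s) + 600 * f) (*-monoʳ-≤ 3 qo) ⟩
   200 * (d * s) + 600 * f + 3 * (d * s)   ≡⟨ l' (d * s) f ⟩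
   203 * (d * s) + 600 * f ∎
   where
   l : ∀ x f o → 200 * (x + 3 * (f + o)) ≡ 200 * x + 600 * f + 3 * (200 * o)
   l = solve-∀
   l' : ∀ x f → 200 * x + 600 * f + 3 * x ≡ 203 * x + 600 * f
   l' = solve-∀

  instance
   d≢0 : NonZero d
   d≢0 = >-nonZero 1≤d

 -- From 398 ds ≤ 200 L (s + f) and L ≤ d/4 follows 348 s ≤ 50 f. The corrections are 3o ≤ 3ds/200
 -- and 3f ≤ df/20, and s + 3 ns/d stays below f/5.
 sparse : 4 * L ≤ d → 60 ≤ d → ∀ h → f ≤ 5 * h → d * s + 3 * ns ≤ d * h
 sparse hL hd h hf = *-cancelˡ-≤ 1000 (begin
  1000 * (d * s + 3 * ns)              ≡⟨ l₁ (d * s + 3 * ns) ⟩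
  5 * (200 * (d * s + 3 * ns))         ≤⟨ *-monoʳ-≤ 5 exponent ⟩
  5 * (203 * (d * s) + 600 * f)        ≡⟨ l₂ (d * s) f ⟩
  1015 * (d * s) + 50 * (60 * f)       ≤⟨ +-mono-≤ (*-monoˡ-≤ (d * s) (m≤m+n 1015 29)) (*-monoʳ-≤ 50 (*-monoˡ-≤ f hd)) ⟩
  1044 * (d * s) + 50 * (d * f)        ≡⟨ cong (_+ 50 * (d * f)) (l₃ d s) ⟩
  d * (1044 * s) + 50 * (d * f)        ≤⟨ +-monoˡ-≤ _ (*-monoʳ-≤ d small) ⟩
  d * (150 * f) + 50 * (d * f)         ≡⟨ l₄ d f ⟩
  200 * (d * f)                        ≤⟨ *-monoʳ-≤ 200 (*-monoʳ-≤ d hf) ⟩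
  200 * (d * (5 * h))                  ≡⟨ l₅ d h ⟩
  1000 * (d * h)                       ∎)
  where
  l₁ : ∀ x → 1000 * x ≡ 5 * (200 * x)
  l₁ = solve-∀
  l₂ : ∀ x f → 5 * (203 * x + 600 * f) ≡ 1015 * x + 50 * (60 * f)
  l₂ = solve-∀
  l₃ : ∀ d s → 1044 * (d * s) ≡ d * (1044 * s)
  l₃ = solve-∀
  l₄ : ∀ d f → d * (150 * f) + 50 * (d * f) ≡ 200 * (d * f)
  l₄ = solve-∀
  l₅ : ∀ d h → 200 * (d * (5 * h)) ≡ 1000 * (d * h)
  l₅ = solve-∀
  small₀ : 1392 * s ≤ 200 * f
  small₀ = +-cancelʳ-≤ (200 * s) _ _ (*-cancelˡ-≤ d (begin
   d * (1392 * s + 200 * s)     ≡⟨ k₁ d s ⟩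
   4 * (398 * (d * s))          ≤⟨ *-monoʳ-≤ 4 main ⟩
   4 * (200 * (L * (s + f)))    ≡⟨ k₂ L (s + f) ⟩
   4 * L * (200 * (s + f))      ≤⟨ *-monoˡ-≤ _ hL ⟩
   d * (200 * (s + f))          ≡⟨ cong (d *_) (k₃ s f) ⟩
   d * (200 * f + 200 * s)      ∎))
   where
   k₁ : ∀ d s → d * (1392 * s + 200 * s) ≡ 4 * (398 * (d * s))
   k₁ = solve-∀
   k₂ : ∀ L x → 4 * (200 * (L * x)) ≡ 4 * L * (200 * x)
   k₂ = solve-∀
   k₃ : ∀ s f → 200 * (s + f) ≡ 200 * f + 200 * s
   k₃ = solve-∀
  small : 1044 * s ≤ 150 * f
  small = *-cancelˡ-≤ 4 (≡≤ (k₁ s) (≤≡ (*-monoʳ-≤ 3 small₀) (k₂ f)))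
   where
   k₁ : ∀ s → 4 * (1044 * s) ≡ 3 * (1392 * s)
   k₁ = solve-∀
   k₂ : ∀ f → 3 * (200 * f) ≡ 4 * (150 * f)
   k₂ = solve-∀

 -- Here L ≤ 19d/20 only gives 208 s ≤ 190 f, and s + 3 ns/d ≤ 47 f/50: the gain is still a fixed
 -- fraction of f.
 dense : 20 * L ≤ 19 * d → 600 ≤ d → ∀ h → 47 * f ≤ 50 * h → d * s + 3 * ns ≤ d * h
 dense hL hd h hf = *-cancelˡ-≤ 10400 (begin
  10400 * (d * s + 3 * ns)             ≡⟨ l₁ (d * s + 3 * ns) ⟩
  52 * (200 * (d * s + 3 * ns))        ≤⟨ *-monoʳ-≤ 52 exponent ⟩
  52 * (203 * (d * s) + 600 * f)       ≡⟨ l₂ d s f ⟩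
  d * (10556 * s) + 52 * (600 * f)     ≤⟨ +-mono-≤ (*-monoʳ-≤ d small) (*-monoʳ-≤ 52 (*-monoˡ-≤ f hd)) ⟩
  d * (9724 * f) + 52 * (d * f)        ≡⟨ l₃ d f ⟩
  208 * (d * (47 * f))                 ≤⟨ *-monoʳ-≤ 208 (*-monoʳ-≤ d hf) ⟩
  208 * (d * (50 * h))                 ≡⟨ l₄ d h ⟩
  10400 * (d * h)                      ∎)
  where
  l₁ : ∀ x → 10400 * x ≡ 52 * (200 * x)
  l₁ = solve-∀
  l₂ : ∀ d s f → 52 * (203 * (d * s) + 600 * f) ≡ d * (10556 * s) + 52 * (600 * f)
  l₂ = solve-∀
  l₃ : ∀ d f → d * (9724 * f) + 52 * (d * f) ≡ 208 * (d * (47 * f))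
  l₃ = solve-∀
  l₄ : ∀ d h → 208 * (d * (50 * h)) ≡ 10400 * (d * h)
  l₄ = solve-∀
  small₀ : 4160 * s ≤ 3800 * f
  small₀ = +-cancelʳ-≤ (3800 * s) _ _ (*-cancelˡ-≤ d (begin
   d * (4160 * s + 3800 * s)    ≡⟨ k₁ d s ⟩
   20 * (398 * (d * s))         ≤⟨ *-monoʳ-≤ 20 main ⟩
   20 * (200 * (L * (s + f)))   ≡⟨ k₂ L (s + f) ⟩
   20 * L * (200 * (s + f))     ≤⟨ *-monoˡ-≤ _ hL ⟩
   19 * d * (200 * (s + f))     ≡⟨ k₃ d s f ⟩
   d * (3800 * f + 3800 * s)    ∎))
   where
   k₁ : ∀ d s → d * (4160 * s + 3800 * s) ≡ 20 * (398 * (d * s))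
   k₁ = solve-∀
   k₂ : ∀ L x → 20 * (200 * (L * x)) ≡ 20 * L * (200 * x)
   k₂ = solve-∀
   k₃ : ∀ d s f → 19 * d * (200 * (s + f)) ≡ d * (3800 * f + 3800 * s)
   k₃ = solve-∀
  small : 10556 * s ≤ 9724 * f
  small = *-cancelˡ-≤ 80 (≡≤ (k₁ s) (≤-trans (*-monoʳ-≤ 203 small₀) (≤≡ (m≤m+n _ (6520 * f)) (k₂ f))))
   where
   k₁ : ∀ s → 80 * (10556 * s) ≡ 203 * (4160 * s)
   k₁ = solve-∀
   k₂ : ∀ f → 203 * (3800 * f) + 6520 * f ≡ 80 * (9724 * f)
   k₂ = solve-∀

-- Pure edge counting, (1 - 1/200) ds ≤ e ≤ df. It supplies the a priori bound on |S ∪ F| from which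
-- L is chosen.
s≤2f : ∀ d s f e o → 1 ≤ d → e + o ≡ d * s → 200 * o ≤ d * s → e ≤ d * f → s ≤ 2 * f
s≤2f d s f e o 1≤d e+o qo edf = *-cancelˡ-≤ d ⦃ >-nonZero 1≤d ⦄ (*-cancelˡ-≤ 199 (+-cancelʳ-≤ (200 * o) _ _ (begin
 199 * (d * s) + 200 * o       ≤⟨ +-monoʳ-≤ (199 * (d * s)) qo ⟩
 199 * (d * s) + d * s         ≡⟨ l₁ (d * s) ⟩
 200 * (d * s)                 ≡⟨ cong (200 *_) (sym e+o) ⟩
 200 * (e + o)                 ≡⟨ *-distribˡ-+ 200 e o ⟩
 200 * e + 200 * o             ≤⟨ +-monoˡ-≤ (200 * o) (≤-trans (*-monoʳ-≤ 200 edf) (≤≡ (m≤m+n _ (198 * (d * f))) (l₂ d f))) ⟩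
 199 * (d * (2 * f)) + 200 * o ∎)))
 where
 l₁ : ∀ x → 199 * x + x ≡ 200 * x
 l₁ = solve-∀
 l₂ : ∀ d f → 200 * (d * f) + 198 * (d * f) ≡ 199 * (d * (2 * f))
 l₂ = solve-∀

-- `τ` bounds the number of deviations, `J` separates short from long walks, `w` is the number of
-- bits for a code of length 2J, `r` the surplus gained on a short walk, and `L₁`, `L₂` bound log₂
-- |S ∪ F| for short and for long walks.
record Scales : Set where
 field
  d' τ w r J L₁ L₂ : ℕ
  600≤d : 600 ≤ suc d'
  1≤w : 1 ≤ w
  w≤d : 10000 * w ≤ suc d'
  2r≤d : 2 * r ≤ suc d'
  4d≤wJ : 4 * suc d' ≤ w * J
  hL₁ : 4 * L₁ ≤ suc d'
  hL₂ : 20 * L₂ ≤ 19 * suc d'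
  sparse-size : 3 * (suc d' * J) ≤ 2 ^ L₁
  dense-size : 3 * (suc d' * τ) ≤ 2 ^ L₂
  few-codes : suc (suc d' ^ 4) ^ (2 * J) ≤ 2 ^ w
  slack₁ : 4 * J * 2 ^ (2 * w) ≤ 2 ^ r
  slack₂ : 800 * 2 ^ w ≤ 2 ^ (2 * suc d')
  1≤J : 1 ≤ J

-- The union bound over walks.

module Union (S : Scales) (σ : Bool) (k : Fin 3) where
 open Scales S
 open Cover {d'} 200 σ

 Col : ℕ
 Col = Tot d proper

 1≤d : 1 ≤ d
 1≤d = s≤s z≤n

 module At (T : List (Vertex d)) where
  open Container {d'} σ k (inS T) (inS-on T) public using (G₁; Closed; container-bound)

  done? : (Vertex d → Fin 3) → Bool
  done? χ = allL T λ t → allL (offsets d) λ o → not (dev σ k χ (shift t o)) ∨ inS T (shift t o)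

  -- The conditions on χ for a fixed T; those on T alone are collected in `ok`.
  dyn : (Vertex d → Fin 3) → Bool
  dyn χ = (allL T (dev σ k χ) ∧ done? χ) ∧ ((2 * d ≤ᵇ card (G₁ χ) + 2) ∧ (card (dev σ k χ) ≤ᵇ τ))

  Term : ℕ
  Term = Tot d λ χ → proper χ * 𝟙 (dyn χ)

  module _ (χ : Vertex d → Fin 3) (t : dyn χ ≡ true) where
   dyn-A : ∀ {t} → t ∈ T → dev σ k χ t ≡ true
   dyn-A = allL⁻ (∧ˡ (∧ˡ t))

   dyn-done : ∀ {u} → u ∈ T → ∀ o → dev σ k χ (shift u o) ≡ true → inS T (shift u o) ≡ true
   dyn-done {u} m o e = imp (allL⁻ {xs = offsets d} {λ o → not (dev σ k χ (shift u o)) ∨ inS T (shift u o)}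
    (allL⁻ {xs = T} {λ t → allL (offsets d) λ o → not (dev σ k χ (shift t o)) ∨ inS T (shift t o)} (∧ʳ {allL T (dev σ k χ)} (∧ˡ t)) m) (∈-offsets o)) e
    where
    imp : ∀ {a b} → not a ∨ b ≡ true → a ≡ true → b ≡ true
    imp h refl = h

   dyn-G : 2 * d ≤ card (G₁ χ) + 2
   dyn-G = ≤ᵇ-≤ (∧ˡ (∧ʳ {allL T (dev σ k χ) ∧ done? χ} t))

   open Event (s≤s (s≤s z≤n)) k T χ dyn-A using (F≤G₁; closed)

   dyn-closed : Closed χ
   dyn-closed = closed dyn-done

   dyn-F : card (F T) ≤ card (G₁ χ)
   dyn-F = F≤G₁

  ok : Bool
  ok = allL T (on σ) ∧ (card (F T) ≤ᵇ d * τ)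

  module _ (okt : ok ≡ true) where
   T-on : ∀ {t} → t ∈ T → on σ t ≡ true
   T-on = allL⁻ (∧ˡ okt)
   open Counts T T-on

   ratio : s + f ≤ 3 * f
   ratio = ≤≡ (+-monoˡ-≤ f (s≤2f d s f e o 1≤d e+o qo≤ds e≤df)) (lem f)
    where
    lem : ∀ f → 2 * f + f ≡ 3 * f
    lem = solve-∀

   f≤dT : f ≤ d * length T
   f≤dT = ≤≡ (∑-mono (allV d) each) (trans (∑-swap (allV d) T λ v t → 𝟙 (adj t v))
    (trans (∑-cong T λ t → trans (∑-cong (allV d) λ v → sym (*-identityʳ _)) (trans (nbr-sum t λ _ → 1) (trans (∑-fins d 1) (*-identityʳ d))))
    (trans (∑-const d T) (*-comm _ d))))
    where
    each : ∀ v → 𝟙 (F T v) ≤ ∑ T λ t → 𝟙 (adj t v)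
    each v = 𝟙≤ λ h → go h
     where
     go : F T v ≡ true → 1 ≤ ∑ T λ t → 𝟙 (adj t v)
     go h with anyL⁻ T h
     ... | t , m , a = ≡≤ (sym (𝟙-true a)) (term≤∑ (λ t → 𝟙 (adj t v)) m)

   -- Here h is about f/5, against |G₁| ≥ f and |G₁| ≥ 2d - 2, the latter because the root is not
   -- isolated. This leaves a gain of d + r: the root, one of 2^d vertices, takes d of it.
   small-term : length T ≤ J → Term * 2 ^ (d + r) ≤ Col
   small-term hJ = *-cancelʳ-≤ _ _ (2 ^ h) ⦃ m^n≢0 2 h ⦄ (≡≤ (trans (*-assoc Term _ _) (cong (Term *_) (sym (^-distribˡ-+-* 2 (d + r) h))))
    (container-bound dyn (d + r + h) h (λ χ _ t → dyn-closed χ t , gbound (dyn-G χ t) (dyn-F χ t))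
     (Numerics.sparse d s f e o (card NS) L₁ 1≤d e+o qo≤ds (isop L₁ (≤-trans ratio (≤-trans (*-monoʳ-≤ 3 (≤-trans f≤dT (*-monoʳ-≤ d hJ))) sparse-size))) NS≤
      hL₁ (≤-trans (m≤m+n 60 540) 600≤d) h f≤5h)))
    where
    h : ℕ
    h = suc (f / 5)
    f≤5h : f ≤ 5 * h
    f≤5h = ≡≤ (m≡m%n+[m/n]*n f 5) (≤≡ (+-monoˡ-≤ _ (<⇒≤ (m%n<n f 5))) (lem (f / 5)))
     where
     lem : ∀ x → 5 + x * 5 ≡ 5 * suc x
     lem = solve-∀
    5h≤ : 5 * h ≤ f + 5
    5h≤ = ≡≤ (lem (f / 5)) (+-monoˡ-≤ 5 (m/n*n≤m f 5))
     where
     lem : ∀ x → 5 * suc x ≡ x * 5 + 5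
     lem = solve-∀
    gbound : ∀ {G} → 2 * d ≤ G + 2 → f ≤ G → d + r + h ≤ G
    gbound {G} h₁ h₂ = *-cancelˡ-≤ 10 (+-cancelʳ-≤ 16 _ _ (begin
     10 * (d + r + h) + 16
      ≡⟨ l₁ d r h ⟩
     10 * d + 5 * (2 * r) + 2 * (5 * h) + 16
      ≤⟨ +-monoˡ-≤ 16 (+-mono-≤ (+-monoʳ-≤ (10 * d) (*-monoʳ-≤ 5 2r≤d)) (*-monoʳ-≤ 2 (≤-trans 5h≤ (+-monoˡ-≤ 5 h₂)))) ⟩
     10 * d + 5 * d + 2 * (G + 5) + 16
      ≤⟨ m≤m+n _ 34 ⟩
     10 * d + 5 * d + 2 * (G + 5) + 16 + 34
      ≡⟨ l₂ d G ⟩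
     15 * d + 60 + 2 * G
      ≤⟨ +-monoˡ-≤ (2 * G) (≤≡ (+-monoʳ-≤ (15 * d) (≤-trans (m≤m+n 60 540) 600≤d)) (l₃ d)) ⟩
     8 * (2 * d) + 2 * G
      ≤⟨ +-monoˡ-≤ (2 * G) (*-monoʳ-≤ 8 h₁) ⟩
     8 * (G + 2) + 2 * G
      ≡⟨ l₄ G ⟩
     10 * G + 16 ∎))
     where
     l₁ : ∀ d r h → 10 * (d + r + h) + 16 ≡ 10 * d + 5 * (2 * r) + 2 * (5 * h) + 16
     l₁ = solve-∀
     l₂ : ∀ d G → 10 * d + 5 * d + 2 * (G + 5) + 16 + 34 ≡ 15 * d + 60 + 2 * G
     l₂ = solve-∀
     l₃ : ∀ d → 15 * d + d ≡ 8 * (2 * d)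
     l₃ = solve-∀
     l₄ : ∀ G → 8 * (G + 2) + 2 * G ≡ 10 * G + 16
     l₄ = solve-∀

   -- Now |G₁| ≥ f and h = f - 2wj with j = |T|, so the gain is twice the cost wj of encoding T. It
   -- fits because w ≤ d/10000 and dj ≤ 200 f give 2wj ≤ f/25, less than the 3f/50 that `dense`
   -- permits.
   large-term : d * length T ≤ 200 * f → Term * 2 ^ (2 * (w * length T)) ≤ Col
   large-term hT = *-cancelʳ-≤ _ _ (2 ^ h) ⦃ m^n≢0 2 h ⦄ (≡≤ (trans (*-assoc Term _ _) (cong (Term *_) (trans (sym (^-distribˡ-+-* 2 x h)) (cong (2 ^_) x+h))))
    (container-bound dyn f h (λ χ _ t → dyn-closed χ t , dyn-F χ t)
     (Numerics.dense d s f e o (card NS) L₂ 1≤d e+o qo≤ds (isop L₂ (≤-trans ratio (≤-trans (*-monoʳ-≤ 3 (≤ᵇ-≤ {f} {d * τ} (∧ʳ {allL T (on σ)} okt))) dense-size))) NS≤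
      hL₂ 600≤d h enough)))
    where
    j x : ℕ
    j = length T
    x = 2 * (w * j)
    50wj≤f : 50 * (w * j) ≤ f
    50wj≤f = *-cancelˡ-≤ 200 (begin
     200 * (50 * (w * j)) ≡⟨ lem w j ⟩
     10000 * w * j        ≤⟨ *-monoˡ-≤ j w≤d ⟩
     d * j                ≤⟨ hT ⟩
     200 * f              ∎)
     where
     lem : ∀ w j → 200 * (50 * (w * j)) ≡ 10000 * w * j
     lem = solve-∀
    x≤f : x ≤ f
    x≤f = ≤-trans (*-monoˡ-≤ (w * j) (m≤m+n 2 48)) 50wj≤f
    h : ℕ
    h = f ∸ x
    x+h : x + h ≡ f
    x+h = m+[n∸m]≡n x≤f
    enough : 47 * f ≤ 50 * h
    enough = +-cancelʳ-≤ (50 * x) _ _ (begin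
     47 * f + 50 * x              ≡⟨ lem₁ f (w * j) ⟩
     47 * f + 2 * (50 * (w * j))  ≤⟨ +-monoʳ-≤ (47 * f) (≤-trans (*-monoʳ-≤ 2 50wj≤f) (m≤m+n _ f)) ⟩
     47 * f + (2 * f + f)         ≡⟨ lem₂ f ⟩
     50 * f                       ≡⟨ cong (50 *_) (trans (sym x+h) (+-comm x h)) ⟩
     50 * (h + x)                 ≡⟨ *-distribˡ-+ 50 h x ⟩
     50 * h + 50 * x              ∎)
     where
     lem₁ : ∀ f z → 47 * f + 50 * (2 * z) ≡ 47 * f + 2 * (50 * z)
     lem₁ = solve-∀
     lem₂ : ∀ f → 47 * f + (2 * f + f) ≡ 50 * f
     lem₂ = solve-∀

 visit : Vertex d → Code d → List (Vertex d)
 visit y c = run c (y ∷ []) (y ∷ [])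

 okcode : Vertex d → ℕ → Code d → Bool
 okcode y ℓ c = (At.ok (visit y c) ∧ (d * length (visit y c) ≤ᵇ 200 * card (F (visit y c)))) ∧ (suc ℓ ≡ᵇ 2 * length (visit y c))

 term : Vertex d → ℕ → Code d → ℕ
 term y ℓ c = 𝟙 (okcode y ℓ c) * At.Term (visit y c)

 bad : (Vertex d → Fin 3) → Bool
 bad χ = (card (dev σ k χ) ≤ᵇ τ) ∧ not (isolated σ k χ)

 M : ℕ
 M = suc (d ^ 4)

 private
  okcode⁻ : ∀ y ℓ c → okcode y ℓ c ≡ true → At.ok (visit y c) ≡ true × d * length (visit y c) ≤ 200 * card (F (visit y c)) × suc ℓ ≡ 2 * length (visit y c)
  okcode⁻ y ℓ c e = proj₁ h , ≤ᵇ-≤ (proj₂ h) , ≡ᵇ⇒≡ (suc ℓ) (2 * length (visit y c)) (≡⇒T (∧ʳ {At.ok (visit y c) ∧ (d * length (visit y c) ≤ᵇ 200 * card (F (visit y c)))} e))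
   where
   h : At.ok (visit y c) ≡ true × (d * length (visit y c) ≤ᵇ 200 * card (F (visit y c))) ≡ true
   h = ∧-true⁻ {At.ok (visit y c)} (∧ˡ {At.ok (visit y c) ∧ (d * length (visit y c) ≤ᵇ 200 * card (F (visit y c)))} e)

  term-bound : ∀ y ℓ c x → (okcode y ℓ c ≡ true → At.Term (visit y c) * 2 ^ x ≤ Col) → term y ℓ c * 2 ^ x ≤ Col
  term-bound y ℓ c x h = go (okcode y ℓ c) refl
   where
   go : ∀ b → okcode y ℓ c ≡ b → 𝟙 b * At.Term (visit y c) * 2 ^ x ≤ Col
   go true e = ≡≤ (cong (_* 2 ^ x) (+-identityʳ (At.Term (visit y c)))) (h e)
   go false e = z≤n

  codes-sum : ∀ y ℓ x → (∀ c → term y ℓ c * 2 ^ x ≤ Col) → ∑ (codes d ℓ) (term y ℓ) * 2 ^ x ≤ M ^ ℓ * Col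
  codes-sum y ℓ x h = ≡≤ (sym (∑-*ʳ (2 ^ x) (codes d ℓ) (term y ℓ))) (≤≡ (∑-mono (codes d ℓ) h)
   (trans (∑-const Col (codes d ℓ)) (cong (_* Col) (length-codes d ℓ))))

  cancel-pow : ∀ {z C} a b → z * 2 ^ (a + b) ≤ 2 ^ a * C → z * 2 ^ b ≤ C
  cancel-pow {z} {C} a b h = *-cancelˡ-≤ (2 ^ a) ⦃ m^n≢0 2 a ⦄ (≡≤ (trans (lem (2 ^ a) z (2 ^ b)) (cong (z *_) (sym (^-distribˡ-+-* 2 a b)))) h)
   where
   lem : ∀ p z q → p * (z * q) ≡ z * (p * q)
   lem = solve-∀

  small-codes : ∀ y {ℓ} → ℓ < 2 * J → ∑ (codes d ℓ) (term y ℓ) * 2 ^ (d + r) ≤ 2 ^ w * Col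
  small-codes y {ℓ} hℓ = ≤-trans (codes-sum y ℓ (d + r) λ c → term-bound y ℓ c (d + r) λ e → let h = okcode⁻ y ℓ c e in
   At.small-term (visit y c) (proj₁ h) (*-cancelˡ-≤ 2 (≡≤ (sym (proj₂ (proj₂ h))) hℓ)))
   (*-monoˡ-≤ Col (≤-trans (^-monoʳ-≤ M (<⇒≤ hℓ)) few-codes))

  M²≤ : ∀ j → M ^ (2 * j) ≤ 2 ^ (w * j)
  M²≤ j = ≡≤ (sym (^-*-assoc M 2 j)) (≤≡ (^-monoˡ-≤ j (≤-trans (^-monoʳ-≤ M (≡≤ (sym (*-identityʳ 2)) (*-monoʳ-≤ 2 1≤J))) few-codes)) (^-*-assoc 2 w j))

  -- For ℓ = 2j - 1 there are at most 2^(wj) codes, each gaining 2^(2wj); what remains is 2^(wj) ≥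
  -- 2^(4d). Even lengths contribute nothing, since a walk from a single root has odd length.
  large-codes : ∀ y {ℓ} → 2 * J ≤ ℓ → ∑ (codes d ℓ) (term y ℓ) * 2 ^ (4 * d) ≤ Col
  large-codes y {ℓ} hℓ = go (halve (suc ℓ))
   where
   halve : ∀ x → (∃ λ j → x ≡ 2 * j) ⊎ (∀ j → x ≢ 2 * j)
   halve zero = inj₁ (0 , refl)
   halve (suc zero) = inj₂ λ { (suc j) e → 0≢1+n (trans (suc-injective e) (+-suc j (j + 0))) }
   halve (suc (suc x)) = step (halve x)
    where
    step : (∃ λ j → x ≡ 2 * j) ⊎ (∀ j → x ≢ 2 * j) → (∃ λ j → suc (suc x) ≡ 2 * j) ⊎ (∀ j → suc (suc x) ≢ 2 * j)
    step (inj₁ (j , e)) = inj₁ (suc j , trans (cong (λ t → suc (suc t)) e) (sym (*-suc 2 j)))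
    step (inj₂ ne) = inj₂ λ { (suc j) e → ne j (suc-injective (suc-injective (trans e (*-suc 2 j)))) }
   zero-term : (∀ j → suc ℓ ≢ 2 * j) → ∀ c → term y ℓ c ≡ 0
   zero-term odd c = zt (okcode y ℓ c) refl
    where
    zt : ∀ b → okcode y ℓ c ≡ b → 𝟙 b * At.Term (visit y c) ≡ 0
    zt false e = refl
    zt true e = ⊥-elim (odd (length (visit y c)) (proj₂ (proj₂ (okcode⁻ y ℓ c e))))
   go : (∃ λ j → suc ℓ ≡ 2 * j) ⊎ (∀ j → suc ℓ ≢ 2 * j) → ∑ (codes d ℓ) (term y ℓ) * 2 ^ (4 * d) ≤ Col
   go (inj₂ odd) = ≡≤ (cong (_* 2 ^ (4 * d)) (trans (∑-cong (codes d ℓ) λ c → zero-term odd c) (∑-zero (codes d ℓ)))) z≤n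
   go (inj₁ (j , ej)) = ≤-trans (*-monoʳ-≤ (∑ (codes d ℓ) (term y ℓ)) (^-monoʳ-≤ 2 4d≤wj)) (cancel-pow {∑ (codes d ℓ) (term y ℓ)} {Col} (w * j) (w * j) (≤-trans
    (codes-sum y ℓ (w * j + w * j) λ c → term-bound y ℓ c (w * j + w * j) λ e → let h = okcode⁻ y ℓ c e in
     subst (λ t → At.Term (visit y c) * 2 ^ t ≤ Col) (trans (cong (λ t → 2 * (w * t)) (*-cancelˡ-≡ (length (visit y c)) j 2 (trans (sym (proj₂ (proj₂ h))) ej))) (cong (w * j +_) (+-identityʳ _)))
      (At.large-term (visit y c) (proj₁ h) (proj₁ (proj₂ h))))
    (*-monoˡ-≤ Col (≤-trans (^-monoʳ-≤ M (≤≡ (n≤1+n ℓ) ej)) (M²≤ j)))))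
    where
    J≤j : J ≤ j
    J≤j = *-cancelˡ-≤ 2 (≤-trans hℓ (≤≡ (n≤1+n ℓ) ej))
    4d≤wj : 4 * d ≤ w * j
    4d≤wj = ≤-trans 4d≤wJ (*-monoʳ-≤ w J≤j)

  Lmax : ℕ
  -- By `big` a walk visits at most 200 · 2^d vertices.
  Lmax = 2 * (200 * 2 ^ d)

  rootSum : Vertex d → ℕ
  rootSum y = ∑ (upTo (2 * J)) (λ ℓ → ∑ (codes d ℓ) (term y ℓ)) + ∑ (upTo Lmax) (λ ℓ → 𝟙 (2 * J ≤ᵇ ℓ) * ∑ (codes d ℓ) (term y ℓ))

  record′ : Vertex d → ℕ → (Vertex d → Fin 3) → ℕ
  record′ y ℓ χ = ∑ (codes d ℓ) λ c → 𝟙 (okcode y ℓ c) * (proper χ * 𝟙 (At.dyn (visit y c) χ))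

  records : (Vertex d → Fin 3) → Vertex d → ℕ
  records χ y = ∑ (upTo (2 * J)) (λ ℓ → record′ y ℓ χ) + ∑ (upTo Lmax) (λ ℓ → 𝟙 (2 * J ≤ᵇ ℓ) * record′ y ℓ χ)

  recorded : ∀ χ y {c} → card (dev σ k χ) ≤ τ → Explored (s≤s z≤n) (dev σ k χ) (λ {v} e → ∧ˡ {on σ v} e) c (y ∷ []) (y ∷ []) →
   ∀ a b → flip (flip y a) b ≢ y → dev σ k χ (flip (flip y a) b) ≡ true → proper χ ≤ records χ y
  recorded χ y {c} small ex a b ne Ay' = place (2 * J ≤? ℓ)
   where
   open Explored ex
   ℓ : ℕ
   ℓ = length c
   okT : At.ok visited ≡ true
   okT = ∧-true⁺ (allL⁺ visited λ {t} m → ∧ˡ {on σ t} (sub m)) (≤-≤ᵇ (≤-trans E.F≤G₁ (≤-trans E.G₁≤ (*-monoʳ-≤ d small))))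
    where
    module E = Event (s≤s (s≤s z≤n)) k visited χ sub
   leneq : suc ℓ ≡ 2 * length visited
   leneq = suc-injective (trans (lem ℓ) (trans len (+-comm (2 * length visited) 1)))
    where
    lem : ∀ x → suc (suc x) ≡ x + 2 * 1
    lem = solve-∀
   okc : okcode y ℓ c ≡ true
   okc = ∧-true⁺ (∧-true⁺ okT (≤-≤ᵇ big)) (T⇒≡ (≡⇒≡ᵇ (suc ℓ) (2 * length visited) leneq))
   dn : At.dyn visited χ ≡ true
   dn = ∧-true⁺ (∧-true⁺ (allL⁺ visited sub) (allL⁺ visited λ {t} m → allL⁺ (offsets d) λ {o} _ → imp (done m o)))
    (∧-true⁺ (≤-≤ᵇ (Event.pair-large (s≤s (s≤s z≤n)) k visited χ sub done y a b (sup (here refl)) ne Ay')) (≤-≤ᵇ small))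
    where
    imp : ∀ {a b} → (a ≡ true → b ≡ true) → not a ∨ b ≡ true
    imp {false} f = refl
    imp {true} f = f refl
   this : proper χ ≤ record′ y ℓ χ
   this = ≡≤ (sym (trans (cong₂ (λ a b → 𝟙 a * (proper χ * 𝟙 b)) okc dn) (trans (*-identityˡ _) (*-identityʳ _))))
    (term≤∑ (λ c → 𝟙 (okcode y ℓ c) * (proper χ * 𝟙 (At.dyn (visit y c) χ))) (∈-codes c))
   T≤ : length visited ≤ 200 * 2 ^ d
   T≤ = ≤-trans (m≤n*m (length visited) d) (≤-trans big (*-monoʳ-≤ 200 (card≤2^ (F visited))))
   place : Dec (2 * J ≤ ℓ) → proper χ ≤ records χ y
   place (no h) = ≤-trans this (≤-trans (term≤∑ (λ ℓ → record′ y ℓ χ) (∈-upTo⁺ (≰⇒> h))) (m≤m+n _ _))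
   place (yes h) = ≤-trans this (≡≤ (sym (trans (cong (λ b → 𝟙 b * record′ y ℓ χ) (≤-≤ᵇ h)) (*-identityˡ _)))
    (≤-trans (term≤∑ (λ ℓ → 𝟙 (2 * J ≤ᵇ ℓ) * record′ y ℓ χ) (∈-upTo⁺ (≡≤ leneq (*-monoʳ-≤ 2 T≤)))) (m≤n+m _ _)))

  covering : ∀ χ → proper χ * 𝟙 (bad χ) ≤ ∑ (allV d) (records χ)
  covering χ = go (bool-cases (bad χ))
   where
   root : card (dev σ k χ) ≤ τ → (∃ λ y → ∃ λ a → ∃ λ b → dev σ k χ y ≡ true × dev σ k χ (flip (flip y a) b) ≡ true × flip (flip y a) b ≢ y) →
    proper χ ≤ ∑ (allV d) (records χ)
   root small (y , a , b , Ay , Ay' , ne) = ≤-trans (recorded χ y small (proj₂ (start (s≤s z≤n) (dev σ k χ) (λ {v} e → ∧ˡ {on σ v} e) y Ay)) a b ne Ay')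
    (term≤∑ (records χ) (∈-allV y))
   go : Cases (bad χ) → proper χ * 𝟙 (bad χ) ≤ ∑ (allV d) (records χ)
   go (inj₂ e) = ≡≤ (trans (cong (λ b → proper χ * 𝟙 b) e) (*-zeroʳ (proper χ))) z≤n
   go (inj₁ e) = ≡≤ (trans (cong (λ b → proper χ * 𝟙 b) e) (*-identityʳ (proper χ)))
    (root (≤ᵇ-≤ (∧ˡ {card (dev σ k χ) ≤ᵇ τ} e)) (isolated-false σ k χ (not-injective (∧ʳ {card (dev σ k χ) ≤ᵇ τ} e))))

  collect : Tot d (λ χ → proper χ * 𝟙 (bad χ)) ≤ ∑ (allV d) rootSum
  collect = ≤≡ (Tot-mono d covering) (trans (Tot-∑ d (allV d) (λ y χ → records χ y)) (∑-cong (allV d) λ y →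
   trans (Tot-+ d (λ χ → ∑ (upTo (2 * J)) λ ℓ → record′ y ℓ χ) (λ χ → ∑ (upTo Lmax) λ ℓ → 𝟙 (2 * J ≤ᵇ ℓ) * record′ y ℓ χ)) (cong₂ _+_
    (trans (Tot-∑ d (upTo (2 * J)) (record′ y)) (∑-cong (upTo (2 * J)) λ ℓ → inner y ℓ))
    (trans (Tot-∑ d (upTo Lmax) (λ ℓ χ → 𝟙 (2 * J ≤ᵇ ℓ) * record′ y ℓ χ)) (∑-cong (upTo Lmax) λ ℓ → trans (Tot-*ˡ d (𝟙 (2 * J ≤ᵇ ℓ)) (record′ y ℓ)) (cong (𝟙 (2 * J ≤ᵇ ℓ) *_) (inner y ℓ)))))))
   where
   inner : ∀ y ℓ → Tot d (record′ y ℓ) ≡ ∑ (codes d ℓ) (term y ℓ)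
   inner y ℓ = trans (Tot-∑ d (codes d ℓ) (λ c χ → 𝟙 (okcode y ℓ c) * (proper χ * 𝟙 (At.dyn (visit y c) χ)))) (∑-cong (codes d ℓ) λ c → Tot-*ˡ d (𝟙 (okcode y ℓ c)) (λ χ → proper χ * 𝟙 (At.dyn (visit y c) χ)))

  -- For short walks the 2J lengths and 2^w codes are paid from 2^(d + r), for long ones the `Lmax`
  -- lengths from 2^(4d). In both cases 2^(d + w) is left, of which 2^d pays for the root.
  root-bound : ∀ y → rootSum y * 2 ^ (d + w) ≤ Col
  root-bound y = *-cancelˡ-≤ 2 (≡≤ (trans (cong (2 *_) (*-distribʳ-+ (2 ^ (d + w)) part₁ part₂)) (*-distribˡ-+ 2 (part₁ * 2 ^ (d + w)) _)) (≤≡ (+-mono-≤ first second) (cong (Col +_) (sym (+-identityʳ Col)))))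
   where
   part₁ part₂ : ℕ
   part₁ = ∑ (upTo (2 * J)) (λ ℓ → ∑ (codes d ℓ) (term y ℓ))
   part₂ = ∑ (upTo Lmax) (λ ℓ → 𝟙 (2 * J ≤ᵇ ℓ) * ∑ (codes d ℓ) (term y ℓ))
   p₁ : part₁ * 2 ^ (d + r) ≤ 2 * J * (2 ^ w * Col)
   p₁ = ≡≤ (sym (∑-*ʳ (2 ^ (d + r)) (upTo (2 * J)) _)) (≤≡ (∑-mono∈ (upTo (2 * J)) λ i → small-codes y (∈-upTo⁻ i))
    (trans (∑-const _ (upTo (2 * J))) (cong (_* (2 ^ w * Col)) (length-upTo (2 * J)))))
   p₂ : part₂ * 2 ^ (4 * d) ≤ Lmax * Col
   p₂ = ≡≤ (sym (∑-*ʳ (2 ^ (4 * d)) (upTo Lmax) _)) (≤≡ (∑-mono (upTo Lmax) each)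
    (trans (∑-const _ (upTo Lmax)) (cong (_* Col) (length-upTo Lmax))))
    where
    each : ∀ ℓ → 𝟙 (2 * J ≤ᵇ ℓ) * ∑ (codes d ℓ) (term y ℓ) * 2 ^ (4 * d) ≤ Col
    each ℓ = go (2 * J ≤ᵇ ℓ) refl
     where
     go : ∀ b → (2 * J ≤ᵇ ℓ) ≡ b → 𝟙 b * ∑ (codes d ℓ) (term y ℓ) * 2 ^ (4 * d) ≤ Col
     go true e = ≡≤ (cong (_* 2 ^ (4 * d)) (*-identityˡ (∑ (codes d ℓ) (term y ℓ)))) (large-codes y (≤ᵇ-≤ e))
     go false e = z≤n
   first : 2 * (part₁ * 2 ^ (d + w)) ≤ Col
   first = *-cancelʳ-≤ _ _ (2 ^ r) ⦃ m^n≢0 2 r ⦄ (begin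
    2 * (part₁ * 2 ^ (d + w)) * 2 ^ r
     ≡⟨ cong (λ t → 2 * (part₁ * t) * 2 ^ r) (^-distribˡ-+-* 2 d w) ⟩
    2 * (part₁ * (2 ^ d * 2 ^ w)) * 2 ^ r
     ≡⟨ trans (l₁ part₁ (2 ^ d) (2 ^ w) (2 ^ r)) (cong (λ t → 2 * (2 ^ w * (part₁ * t))) (sym (^-distribˡ-+-* 2 d r))) ⟩
    2 * (2 ^ w * (part₁ * 2 ^ (d + r)))
     ≤⟨ *-monoʳ-≤ 2 (*-monoʳ-≤ (2 ^ w) p₁) ⟩
    2 * (2 ^ w * (2 * J * (2 ^ w * Col)))
     ≡⟨ trans (l₂ (2 ^ w) J Col) (cong (λ t → 4 * J * t * Col) (trans (sym (^-distribˡ-+-* 2 w w)) (cong (λ t → 2 ^ (w + t)) (sym (+-identityʳ w))))) ⟩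
    4 * J * 2 ^ (2 * w) * Col
     ≤⟨ *-monoˡ-≤ Col slack₁ ⟩
    2 ^ r * Col
     ≡⟨ *-comm (2 ^ r) Col ⟩
    Col * 2 ^ r ∎)
    where
    l₁ : ∀ a b c e → 2 * (a * (b * c)) * e ≡ 2 * (c * (a * (b * e)))
    l₁ = solve-∀
    l₂ : ∀ a J C → 2 * (a * (2 * J * (a * C))) ≡ 4 * J * (a * a) * C
    l₂ = solve-∀
   second : 2 * (part₂ * 2 ^ (d + w)) ≤ Col
   second = *-cancelʳ-≤ _ _ (2 ^ (4 * d)) ⦃ m^n≢0 2 (4 * d) ⦄ (begin
    2 * (part₂ * 2 ^ (d + w)) * 2 ^ (4 * d)
     ≡⟨ l₁ part₂ (2 ^ (d + w)) (2 ^ (4 * d)) ⟩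
    2 * (2 ^ (d + w) * (part₂ * 2 ^ (4 * d)))
     ≤⟨ *-monoʳ-≤ 2 (*-monoʳ-≤ (2 ^ (d + w)) p₂) ⟩
    2 * (2 ^ (d + w) * (Lmax * Col))
     ≡⟨ trans (cong (λ t → 2 * (t * (Lmax * Col))) (^-distribˡ-+-* 2 d w)) (l₂ (2 ^ d) (2 ^ w) Col) ⟩
    800 * 2 ^ w * (2 ^ d * 2 ^ d * Col)
     ≤⟨ *-monoˡ-≤ (2 ^ d * 2 ^ d * Col) slack₂ ⟩
    2 ^ (2 * d) * (2 ^ d * 2 ^ d * Col)
     ≡⟨ trans (l₃ (2 ^ (2 * d)) (2 ^ d) Col) (cong (Col *_) (trans (cong (2 ^ (2 * d) *_) (sym (^-distribˡ-+-* 2 d d))) (trans (sym (^-distribˡ-+-* 2 (2 * d) (d + d))) (cong (2 ^_) (l₄ d))))) ⟩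
    Col * 2 ^ (4 * d) ∎)
    where
    l₁ : ∀ a b c → 2 * (a * b) * c ≡ 2 * (b * (a * c))
    l₁ = solve-∀
    l₂ : ∀ x y C → 2 * (x * y * (2 * (200 * x) * C)) ≡ 800 * y * (x * x * C)
    l₂ = solve-∀
    l₃ : ∀ x y C → x * (y * y * C) ≡ C * (x * (y * y))
    l₃ = solve-∀
    l₄ : ∀ d → 2 * d + (d + d) ≡ 4 * d
    l₄ = solve-∀

 -- The bound is relative to the number of all proper colourings, which is not known at this point;
 -- `disordered-bound` makes it absolute.
 clusters : Tot d (λ χ → proper χ * 𝟙 (bad χ)) * 2 ^ w ≤ Col
 clusters = *-cancelʳ-≤ _ _ (2 ^ d) ⦃ m^n≢0 2 d ⦄ (begin
  Tot d (λ χ → proper χ * 𝟙 (bad χ)) * 2 ^ w * 2 ^ d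
   ≤⟨ *-monoˡ-≤ (2 ^ d) (*-monoˡ-≤ (2 ^ w) collect) ⟩
  ∑ (allV d) rootSum * 2 ^ w * 2 ^ d
   ≡⟨ trans (*-assoc (∑ (allV d) rootSum) _ _) (trans (cong (∑ (allV d) rootSum *_) (trans (*-comm (2 ^ w) (2 ^ d)) (sym (^-distribˡ-+-* 2 d w)))) (sym (∑-*ʳ (2 ^ (d + w)) (allV d) rootSum))) ⟩
  ∑ (allV d) (λ y → rootSum y * 2 ^ (d + w))
   ≤⟨ ∑-mono (allV d) root-bound ⟩
  ∑ (allV d) (λ _ → Col)
   ≡⟨ trans (∑-const Col (allV d)) (trans (cong (_* Col) (length-allV d)) (*-comm (2 ^ d) Col)) ⟩
  Col * 2 ^ d ∎)


-- Ordered colourings: integrating out the other parity class.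

bit-eq : ∀ {a b} → a ≤ 1 → b ≤ 1 → (1 ≤ a → b ≡ 1) → (1 ≤ b → a ≡ 1) → a ≡ b
bit-eq {zero} {zero} _ _ f g = refl
bit-eq {zero} {suc b} _ _ f g = absurd₀ (g (s≤s z≤n))
 where
 absurd₀ : ∀ {A : Set} → 0 ≡ 1 → A
 absurd₀ ()
bit-eq {suc zero} _ _ f g = sym (f (s≤s z≤n))
bit-eq {suc (suc a)} (s≤s ()) _ f g

isolated⁻ : ∀ {d} σ k (χ : Vertex d → Fin 3) → isolated σ k χ ≡ true →
 ∀ y a b → dev σ k χ y ≡ true → dev σ k χ (flip (flip y a) b) ≡ true → flip (flip y a) b ≡ y
isolated⁻ {d} σ k χ e y a b h h' = does-≡ (imp (allL⁻ {xs = fins d} (allL⁻ {xs = fins d} (allL⁻ {xs = allV d} e (∈-allV y)) (∈-fins a)) (∈-fins b)) h h')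
 where
 imp : ∀ {p q r} → not ((p ∧ q) ∧ not r) ≡ true → p ≡ true → q ≡ true → r ≡ true
 imp {true} {true} {true} _ _ _ = refl

count-two : ∀ k l → k ≢ l → ∑ cols (λ c → 𝟙 (not (eqc c k) ∧ not (eqc c l))) ≡ 1
count-two = from-yes (all? λ k → all? λ l → ¬? (k Fin.≟ l) →-dec (∑ cols (λ c → 𝟙 (not (eqc c k) ∧ not (eqc c l))) ≟ 1))

vertex-count : ∀ {d} (y : Vertex d) → ∑ (allV d) (λ v → 𝟙 (does (v ≟V y))) ≡ 1
vertex-count {d} y = ∑-𝟙-single (λ v → does (v ≟V y)) (allV-unique d) (∈-allV y) (does-refl y) does-≡

-- The dimension is kept abstract: the two distinct directions only say that d ≥ 2.
record CubeData : Set where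
 field
  d N h : ℕ
  i₀ i₁ : Fin d
  i₀≢i₁ : i₀ ≢ i₁
  2^d : 2 ^ d ≡ 2 * N
  N≡ : N ≡ 2 * h
  1≤h : 1 ≤ h
  side : ∀ σ → card {d} (on σ) ≡ N

module Pattern (Q : CubeData) (σ : Bool) (k : Fin 3) where
 open CubeData Q renaming (2^d to 2N)

 Colouring : Set
 Colouring = Vertex d → Fin 3

 open Colour

 onL offL : List (Vertex d)
 onL = filterᵇ (on σ) (allV d)
 offL = filterᵇ (not ∘ on σ) (allV d)

 length-onL : length onL ≡ N
 length-onL = trans (length-filterᵇ (on σ) (allV d)) (side σ)

 length-offL : length offL ≡ N
 length-offL = trans (length-filterᵇ (not ∘ on σ) (allV d)) (trans (∑-cong (allV d) λ v → cong 𝟙 (sym (on-not σ v))) (side (not σ)))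

 free : Colouring → Vertex d → Bool
 free s v = not (anyL (fins d) λ i → dev σ k s (flip v i))

 avail : Colouring → Vertex d → Fin 3 → Bool
 avail s v c = allL (fins d) λ i → not (eqc c (s (flip v i)))

 W : Colouring → Vertex d → ℕ
 W s v = ∑ cols λ c → 𝟙 (avail s v c)

 -- A deviation takes one of two available colours from each of its d neighbours, a factor 2^-d.
 -- Scaling by 2^d per vertex of σ keeps the weights integral.
 ω : Fin 3 → ℕ
 ω c = if eqc c k then 2 ^ d else 1

 private
  on-nbr : ∀ (v : Vertex d) i → on σ v ≡ false → on σ (flip v i) ≡ true
  on-nbr v i o = trans (on-flip σ v i) (cong not o)

  off-on : ∀ (v : Vertex d) i → on σ v ≡ true → on σ (flip v i) ≡ false
  off-on v i o = trans (on-flip σ v i) (cong not o)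

  off⁻ : ∀ {v : Vertex d} → v ∈ offL → on σ v ≡ false
  off⁻ i = not-injective (filterᵇ-true (not ∘ on σ) (allV d) i)

  notdev : ∀ (s : Colouring) (y : Vertex d) → on σ y ≡ true → dev σ k s y ≡ false → s y ≡ k
  notdev s y o e = eqc-≡ (not-injective (trans (cong (_∧ not (eqc (s y) k)) (sym o)) e))

  isdev : ∀ (s : Colouring) (y : Vertex d) → dev σ k s y ≡ true → s y ≢ k
  isdev s y e = eqc-≢⁻ (s y) k (not-injective (∧ʳ {on σ y} e))

  free⁻ : ∀ s v → free s v ≡ true → ∀ i → dev σ k s (flip v i) ≡ false
  free⁻ s v e i = not-injective (allL⁻ {xs = fins d} {λ i → not (dev σ k s (flip v i))} (trans (sym (not-involutive _)) e) (∈-fins i))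

  other-dir : ∀ i → ∃ λ j → j ≢ i
  other-dir i with i₀ Fin.≟ i
  ... | yes refl = i₁ , i₀≢i₁ ∘ sym
  ... | no ne = i₀ , ne

  avail-free : ∀ s v → on σ v ≡ false → free s v ≡ true → ∀ c → avail s v c ≡ not (eqc c k)
  avail-free s v o e c = ≡-from-⇔
   (λ h → trans (cong (λ z → not (eqc c z)) (sym (col i₀))) (allL⁻ {xs = fins d} {λ i → not (eqc c (s (flip v i)))} h (∈-fins i₀)))
   (λ h → allL⁺ (fins d) λ {i} _ → trans (cong (λ z → not (eqc c z)) (col i)) h)
   where
   col : ∀ i → s (flip v i) ≡ k
   col i = notdev s (flip v i) (on-nbr v i o) (free⁻ s v e i)

  module _ (s : Colouring) (is : isolated σ k s ≡ true) where

   only-dev : ∀ v i j → dev σ k s (flip v i) ≡ true → dev σ k s (flip v j) ≡ true → j ≡ i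
   only-dev v i j h h' = flip-inj v j i (trans (cong (λ w → flip w j) (sym (flip-flip v i)))
    (isolated⁻ σ k s is (flip v i) i j h (subst (λ w → dev σ k s (flip w j) ≡ true) (sym (flip-flip v i)) h')))

   avail-dev : ∀ v i → on σ v ≡ false → dev σ k s (flip v i) ≡ true → ∀ c → avail s v c ≡ not (eqc c k) ∧ not (eqc c (s (flip v i)))
   avail-dev v i o h c = ≡-from-⇔
    (λ e → let at = λ j → allL⁻ {xs = fins d} {λ i → not (eqc c (s (flip v i)))} e (∈-fins j) in
     ∧-true⁺ (trans (cong (λ z → not (eqc c z)) (sym (kcol (proj₁ (other-dir i)) (proj₂ (other-dir i))))) (at (proj₁ (other-dir i)))) (at i))
    (λ e → allL⁺ (fins d) λ {j} _ → each e j)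
    where
    kcol : ∀ j → j ≢ i → s (flip v j) ≡ k
    kcol j ne = notdev s (flip v j) (on-nbr v j o) (refute λ e → ne (only-dev v i j h e))
    each : not (eqc c k) ∧ not (eqc c (s (flip v i))) ≡ true → ∀ j → not (eqc c (s (flip v j))) ≡ true
    each e j with j Fin.≟ i
    ... | yes refl = ∧ʳ {not (eqc c k)} e
    ... | no ne = trans (cong (λ z → not (eqc c z)) (kcol j ne)) (∧ˡ e)

   nonfree-count : ∀ v → 𝟙 (not (free s v)) ≡ ∑ (fins d) λ i → 𝟙 (dev σ k s (flip v i))
   nonfree-count v = go (bool-cases (free s v))
    where
    go : Cases (free s v) → 𝟙 (not (free s v)) ≡ ∑ (fins d) λ i → 𝟙 (dev σ k s (flip v i))
    go (inj₁ e) = trans (cong (𝟙 ∘ not) e) (sym (trans (∑-cong (fins d) λ i → cong 𝟙 (free⁻ s v e i)) (∑-zero (fins d))))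
    go (inj₂ e) with anyL⁻ (fins d) {λ i → dev σ k s (flip v i)} (not-injective e)
    ... | i , _ , h = trans (cong (𝟙 ∘ not) e) (sym (∑-𝟙-single (λ i → dev σ k s (flip v i)) (fins-unique d) (∈-fins i) h λ {j} h' → only-dev v i j h h'))

 W-free : ∀ s v → on σ v ≡ false → free s v ≡ true → W s v ≡ 2
 W-free s v o e = trans (∑-cong cols λ c → cong 𝟙 (avail-free s v o e c)) (count-neq k)

 W-value : ∀ s → isolated σ k s ≡ true → ∀ v → on σ v ≡ false → W s v ≡ 2 ^ 𝟙 (free s v)
 W-value s is v o = go (bool-cases (free s v))
  where
  go : Cases (free s v) → W s v ≡ 2 ^ 𝟙 (free s v)
  go (inj₁ e) = trans (W-free s v o e) (sym (cong (λ b → 2 ^ 𝟙 b) e))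
  go (inj₂ e) with anyL⁻ (fins d) {λ i → dev σ k s (flip v i)} (not-injective e)
  ... | i , _ , h = trans (∑-cong cols λ c → cong 𝟙 (avail-dev s is v i o h c))
   (trans (count-two k (s (flip v i)) (isdev s (flip v i) h ∘ sym)) (sym (cong (λ b → 2 ^ 𝟙 b) e)))

 -- Isolated deviations have disjoint neighbourhoods, so exactly d vertices per deviation have one
 -- available colour, and all others off σ have two.
 weights : ∀ s → isolated σ k s ≡ true → ∏ offL (W s) * 2 ^ (d * N) ≡ 2 ^ N * ∏ onL (ω ∘ s)
 weights s is = trans (cong₂ _*_ prodW powdN) (trans (sym (*-assoc (2 ^ fr) _ _)) (cong₂ _*_ (trans (sym (^-distribˡ-+-* 2 fr _)) (cong (2 ^_) free+)) (sym prodω)))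
  where
  fr dv kk : ℕ
  fr = ∑ offL (𝟙 ∘ free s)
  dv = card (dev σ k s)
  kk = ∑ onL λ y → 𝟙 (eqc (s y) k)
  prodW : ∏ offL (W s) ≡ 2 ^ fr
  prodW = trans (∏-cong∈ offL λ {v} i → W-value s is v (off⁻ i)) (∏-2^ 2 offL _)
  kk+dv : kk + dv ≡ N
  kk+dv = trans (cong (kk +_) (sym (trans (∑-filter (on σ) (allV d) λ y → 𝟙 (not (eqc (s y) k))) (∑-cong (allV d) λ y → sym (𝟙-∧ (on σ y) (not (eqc (s y) k)))))))
   (trans (sym (∑-+ onL _ _)) (trans (∑-cong onL λ y → 𝟙-not (eqc (s y) k)) (trans (∑-const 1 onL) (trans (*-identityʳ _) length-onL))))
  powdN : 2 ^ (d * N) ≡ 2 ^ (d * dv) * 2 ^ (d * kk)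
  powdN = trans (cong (λ t → 2 ^ (d * t)) (trans (sym kk+dv) (+-comm kk dv))) (trans (cong (2 ^_) (*-distribˡ-+ d dv kk)) (^-distribˡ-+-* 2 (d * dv) _))
  prodω : ∏ onL (ω ∘ s) ≡ 2 ^ (d * kk)
  prodω = trans (∏-cong onL λ y → ω-pow (eqc (s y) k)) (trans (∏-2^ (2 ^ d) onL λ y → 𝟙 (eqc (s y) k)) (^-*-assoc 2 d kk))
   where
   ω-pow : ∀ b → (if b then 2 ^ d else 1) ≡ (2 ^ d) ^ 𝟙 b
   ω-pow true = sym (*-identityʳ _)
   ω-pow false = refl
  nonfree : ∑ offL (λ v → 𝟙 (not (free s v))) ≡ d * dv
  nonfree = trans (∑-filter (not ∘ on σ) (allV d) _) (trans (∑-cong (allV d) each) (trans (∑-swap (allV d) (fins d) λ v i → 𝟙 (dev σ k s (flip v i)))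
   (trans (∑-cong (fins d) λ i → ∑-flip d i (𝟙 ∘ dev σ k s)) (∑-fins d dv))))
   where
   each : ∀ v → 𝟙 (not (on σ v)) * 𝟙 (not (free s v)) ≡ ∑ (fins d) λ i → 𝟙 (dev σ k s (flip v i))
   each v = go (bool-cases (on σ v))
    where
    go : Cases (on σ v) → 𝟙 (not (on σ v)) * 𝟙 (not (free s v)) ≡ ∑ (fins d) λ i → 𝟙 (dev σ k s (flip v i))
    go (inj₁ o) = trans (cong (λ b → 𝟙 (not b) * 𝟙 (not (free s v))) o) (sym (trans (∑-cong (fins d) λ i → cong (λ b → 𝟙 (b ∧ not (eqc (s (flip v i)) k))) (off-on v i o)) (∑-zero (fins d))))
    go (inj₂ o) = trans (cong (λ b → 𝟙 (not b) * 𝟙 (not (free s v))) o) (trans (*-identityˡ _) (nonfree-count s is v))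
  free+ : fr + d * dv ≡ N
  free+ = trans (cong (fr +_) (sym nonfree)) (trans (sym (∑-+ offL _ _)) (trans (∑-cong offL λ v → 𝟙-not (free s v)) (trans (∑-const 1 offL) (trans (*-identityʳ _) length-offL))))

 proper-off : ∀ χ → proper χ ≡ ∏ offL λ v → 𝟙 (avail χ v (χ v))
 proper-off χ = bit-eq (proper≤1 χ) (∏≤1 offL _ λ v → 𝟙≤1 _)
  (λ h → ∏𝟙-one offL (λ v → avail χ v (χ v)) λ {v} _ → allL⁺ (fins d) λ {i} _ → cong not (eqc-≢ (proper⁻ χ h v i)))
  (λ h → proper⁺ χ λ v i → edge h v i (bool-cases (on σ v)))
  where
  at : 1 ≤ ∏ offL (λ v → 𝟙 (avail χ v (χ v))) → ∀ v → on σ v ≡ false → ∀ i → χ v ≢ χ (flip v i)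
  at h v o i = eqc-≢⁻ (χ v) (χ (flip v i)) (not-injective (allL⁻ {xs = fins d} {λ i → not (eqc (χ v) (χ (flip v i)))}
   (∏𝟙-true offL (λ v → avail χ v (χ v)) h (∈-filterᵇ⁺ (not ∘ on σ) (∈-allV v) (cong not o))) (∈-fins i)))
  edge : 1 ≤ ∏ offL (λ v → 𝟙 (avail χ v (χ v))) → ∀ v i → Cases (on σ v) → χ v ≢ χ (flip v i)
  edge h v i (inj₂ o) = at h v o i
  edge h v i (inj₁ o) = λ e → at h (flip v i) (off-on v i o) i (trans (sym e) (cong χ (sym (flip-flip v i))))

 isolated-local : ∀ s s' → (∀ y → on σ y ≡ true → s y ≡ s' y) → isolated σ k s ≡ isolated σ k s'
 isolated-local s s' h = allL-cong (allV d) λ y → allL-cong (fins d) λ a → allL-cong (fins d) λ b →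
  cong₂ (λ p q → not ((p ∧ q) ∧ not (does (flip (flip y a) b ≟V y)))) (dl y (bool-cases (on σ y))) (dl _ (bool-cases (on σ (flip (flip y a) b))))
  where
  dl : ∀ y → Cases (on σ y) → dev σ k s y ≡ dev σ k s' y
  dl y (inj₁ o) = cong (λ c → on σ y ∧ not (eqc c k)) (h y o)
  dl y (inj₂ o) = trans (cong (_∧ not (eqc (s y) k)) o) (sym (cong (_∧ not (eqc (s' y) k)) o))

 avail-local : ∀ s s' v c → on σ v ≡ false → (∀ y → on σ y ≡ true → s y ≡ s' y) → avail s v c ≡ avail s' v c
 avail-local s s' v c o h = allL-cong (fins d) λ i → cong (λ z → not (eqc c z)) (h (flip v i) (on-nbr v i o))

 -- `u` weighs the colours on class σ, `r` those off it; with values 0 and 1 they express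
 -- constraints.
 Count : (Vertex d → Fin 3 → ℕ) → (Vertex d → Fin 3 → ℕ) → ℕ
 Count u r = Tot d λ χ → proper χ * 𝟙 (isolated σ k χ) * (∏ onL (λ y → u y (χ y)) * ∏ offL (λ v → r v (χ v)))

 Wr : (Vertex d → Fin 3 → ℕ) → Colouring → Vertex d → ℕ
 Wr r s v = ∑ cols λ c → 𝟙 (avail s v c) * r v c

 count-split : ∀ u r → Count u r ≡ S onL (λ s → 𝟙 (isolated σ k s) * ∏ onL (λ y → u y (s y)) * ∏ offL (Wr r s)) (λ _ → zero)
 count-split u r = trans (Tot-filter (on σ) ext (λ _ → zero)) (S-cong onL inner)
  where
  Φ : Colouring → ℕ
  Φ χ = proper χ * 𝟙 (isolated σ k χ) * (∏ onL (λ y → u y (χ y)) * ∏ offL (λ v → r v (χ v)))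
  ext : Ext Φ
  ext χ χ' h = cong₂ _*_ (cong₂ _*_ (proper-ext χ χ' h) (cong 𝟙 (isolated-local χ χ' λ y _ → h y)))
   (cong₂ _*_ (∏-cong onL λ y → cong (u y) (h y)) (∏-cong offL λ v → cong (r v) (h v)))
  inner : ∀ s → S offL Φ s ≡ 𝟙 (isolated σ k s) * ∏ onL (λ y → u y (s y)) * ∏ offL (Wr r s)
  inner s = trans (S-cong-off offL λ χ off → rewrite′ χ off) (trans (S-*ˡ (𝟙 (isolated σ k s) * ∏ onL (λ y → u y (s y))) offL _ s)
   (cong (𝟙 (isolated σ k s) * ∏ onL (λ y → u y (s y)) *_) (S-∏ offL (filterᵇ-unique _ (allV-unique d)) (λ v c → 𝟙 (avail s v c) * r v c) s)))
   where
   agree : ∀ χ → Off offL s χ → ∀ y → on σ y ≡ true → χ y ≡ s y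
   agree χ off y o = off y λ i → absurd o (off⁻ i)
   lem : ∀ p i u r → p * i * (u * r) ≡ i * u * (p * r)
   lem = solve-∀
   rewrite′ : ∀ χ → Off offL s χ → Φ χ ≡ 𝟙 (isolated σ k s) * ∏ onL (λ y → u y (s y)) * ∏ offL (λ v → 𝟙 (avail s v (χ v)) * r v (χ v))
   rewrite′ χ off = trans (lem (proper χ) (𝟙 (isolated σ k χ)) (∏ onL λ y → u y (χ y)) _)
    (cong₂ _*_ (cong₂ _*_ (cong 𝟙 (isolated-local χ s (agree χ off))) (∏-cong∈ onL λ {y} i → cong (u y) (agree χ off y (filterᵇ-true (on σ) (allV d) i))))
     (trans (cong (_* ∏ offL (λ v → r v (χ v))) (trans (proper-off χ) (∏-cong∈ offL λ {v} i → cong 𝟙 (avail-local χ s v (χ v) (off⁻ i) (agree χ off)))))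
      (sym (∏-* offL _ _))))

 module _ (u : Vertex d → Fin 3 → ℕ) where

  one : Vertex d → Fin 3 → ℕ
  one _ _ = 1

  total-weight : ℕ
  total-weight = ∏ onL λ y → ∑ cols λ c → u y c * ω c

  private
   weight-sum : S onL (λ s → ∏ onL λ y → u y (s y) * ω (s y)) (λ _ → zero) ≡ total-weight
   weight-sum = S-∏ onL (filterᵇ-unique _ (allV-unique d)) (λ y c → u y c * ω c) _

   Wr-one : ∀ s → ∏ offL (Wr one s) ≡ ∏ offL (W s)
   Wr-one s = ∏-cong offL λ v → ∑-cong cols λ c → *-identityʳ (𝟙 (avail s v c))

  count-one-side : Count u one * 2 ^ (d * N) ≡ 2 ^ N * S onL (λ s → 𝟙 (isolated σ k s) * ∏ onL λ y → u y (s y) * ω (s y)) (λ _ → zero)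
  count-one-side = trans (cong (_* 2 ^ (d * N)) (count-split u one)) (trans (*-comm _ (2 ^ (d * N))) (trans (sym (S-*ˡ (2 ^ (d * N)) onL _ _))
   (trans (S-cong onL each) (S-*ˡ (2 ^ N) onL _ _))))
   where
   each : ∀ s → 2 ^ (d * N) * (𝟙 (isolated σ k s) * ∏ onL (λ y → u y (s y)) * ∏ offL (Wr one s)) ≡ 2 ^ N * (𝟙 (isolated σ k s) * ∏ onL λ y → u y (s y) * ω (s y))
   each s = go (bool-cases (isolated σ k s))
    where
    l₁ : ∀ p i u w → p * (i * u * w) ≡ i * u * (w * p)
    l₁ = solve-∀
    l₂ : ∀ i u n w → i * u * (n * w) ≡ n * (i * (u * w))
    l₂ = solve-∀
    go : Cases (isolated σ k s) → 2 ^ (d * N) * (𝟙 (isolated σ k s) * ∏ onL (λ y → u y (s y)) * ∏ offL (Wr one s)) ≡ 2 ^ N * (𝟙 (isolated σ k s) * ∏ onL λ y → u y (s y) * ω (s y))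
    go (inj₁ is) = trans (cong (λ t → 2 ^ (d * N) * (𝟙 (isolated σ k s) * ∏ onL (λ y → u y (s y)) * t)) (Wr-one s))
     (trans (l₁ (2 ^ (d * N)) (𝟙 (isolated σ k s)) (∏ onL λ y → u y (s y)) (∏ offL (W s))) (trans (cong (𝟙 (isolated σ k s) * ∏ onL (λ y → u y (s y)) *_) (weights s is))
     (trans (l₂ (𝟙 (isolated σ k s)) (∏ onL λ y → u y (s y)) (2 ^ N) _) (cong (λ t → 2 ^ N * (𝟙 (isolated σ k s) * t)) (sym (∏-* onL _ _))))))
    go (inj₂ is) = trans (cong (λ b → 2 ^ (d * N) * (𝟙 b * ∏ onL (λ y → u y (s y)) * ∏ offL (Wr one s))) is)
     (trans (*-zeroʳ (2 ^ (d * N))) (sym (trans (cong (λ b → 2 ^ N * (𝟙 b * ∏ onL λ y → u y (s y) * ω (s y))) is) (*-zeroʳ (2 ^ N)))))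

  count-upper : Count u one * 2 ^ (d * N) ≤ 2 ^ N * total-weight
  count-upper = ≡≤ count-one-side (*-monoʳ-≤ (2 ^ N) (≤≡ (S-mono onL λ s → ≤≡ (*-monoˡ-≤ _ (𝟙≤1 (isolated σ k s))) (*-identityˡ _)) weight-sum))

  count-lower : 2 ^ N * total-weight ≤ Count u one * 2 ^ (d * N) + 2 ^ N * S onL (λ s → 𝟙 (not (isolated σ k s)) * ∏ onL λ y → u y (s y) * ω (s y)) (λ _ → zero)
  count-lower = ≤-reflexive (trans (cong (2 ^ N *_) (trans (sym weight-sum) (trans (S-cong onL λ s → sym (trans (sym (*-distribʳ-+ (∏ onL λ y → u y (s y) * ω (s y)) (𝟙 (isolated σ k s)) (𝟙 (not (isolated σ k s)))))
   (trans (cong (_* ∏ onL (λ y → u y (s y) * ω (s y))) (𝟙-not (isolated σ k s))) (*-identityˡ _)))) (S-+ onL _ _ _))))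
   (trans (*-distribˡ-+ (2 ^ N) _ _) (cong (_+ 2 ^ N * S onL (λ s → 𝟙 (not (isolated σ k s)) * ∏ onL λ y → u y (s y) * ω (s y)) (λ _ → zero)) (sym count-one-side))))

  count-constrained : ∀ r h → (∀ s → 1 ≤ ∏ onL (λ y → u y (s y)) → ∏ offL (Wr r s) * 2 ^ h ≤ ∏ offL (W s)) → Count u r * 2 ^ h ≤ Count u one
  count-constrained r h hyp = ≡≤ (trans (cong (_* 2 ^ h) (count-split u r)) (trans (*-comm _ (2 ^ h)) (sym (S-*ˡ (2 ^ h) onL _ _))))
   (≤≡ (S-mono onL each) (sym (count-split u one)))
   where
   l₁ : ∀ p i u w → p * (i * u * w) ≡ i * u * (w * p)
   l₁ = solve-∀
   each : ∀ s → 2 ^ h * (𝟙 (isolated σ k s) * ∏ onL (λ y → u y (s y)) * ∏ offL (Wr r s)) ≤ 𝟙 (isolated σ k s) * ∏ onL (λ y → u y (s y)) * ∏ offL (Wr one s)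
   each s = ≡≤ (l₁ (2 ^ h) (𝟙 (isolated σ k s)) (∏ onL λ y → u y (s y)) _) (go (∏ onL λ y → u y (s y)) refl)
    where
    go : ∀ U → ∏ onL (λ y → u y (s y)) ≡ U → 𝟙 (isolated σ k s) * U * (∏ offL (Wr r s) * 2 ^ h) ≤ 𝟙 (isolated σ k s) * U * ∏ offL (Wr one s)
    go zero e = ≤-reflexive (trans (cong (_* (∏ offL (Wr r s) * 2 ^ h)) (*-zeroʳ (𝟙 (isolated σ k s)))) (sym (cong (_* ∏ offL (Wr one s)) (*-zeroʳ (𝟙 (isolated σ k s))))))
    go (suc U) e = *-monoʳ-≤ (𝟙 (isolated σ k s) * suc U) (≤≡ (hyp s (≤≡ (s≤s z≤n) (sym e))) (sym (Wr-one s)))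

 module _ (q : Fin 3 → Bool) (qk : q k ≡ true) where

  L B : ℕ
  L = 𝟙 (q (other₁ k)) + 𝟙 (q (other₂ k))
  B = 2 ^ d + L

  allow : Vertex d → Fin 3 → ℕ
  allow _ c = 𝟙 (q c)

  private
   eqc-other₁ : ∀ k → eqc (other₁ k) k ≡ false
   eqc-other₁ zero = refl
   eqc-other₁ 1F = refl
   eqc-other₁ 2F = refl
   eqc-other₂ : ∀ k → eqc (other₂ k) k ≡ false
   eqc-other₂ zero = refl
   eqc-other₂ 1F = refl
   eqc-other₂ 2F = refl

  colour-sum : ∀ (g : Fin 3 → ℕ) → ∑ cols (λ c → g c * ω c) ≡ g k * 2 ^ d + (g (other₁ k) + g (other₂ k))
  colour-sum g = trans (others k (λ c → g c * ω c)) (cong₂ _+_ (cong (λ b → g k * (if b then 2 ^ d else 1)) (eqc-refl k))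
   (cong₂ _+_ (trans (cong (λ b → g (other₁ k) * (if b then 2 ^ d else 1)) (eqc-other₁ k)) (*-identityʳ (g (other₁ k))))
    (trans (cong (λ b → g (other₂ k) * (if b then 2 ^ d else 1)) (eqc-other₂ k)) (*-identityʳ (g (other₂ k))))))

  allow-weight : total-weight allow ≡ B ^ N
  allow-weight = trans (∏-cong onL λ y → trans (colour-sum (𝟙 ∘ q)) (cong (_+ L) (trans (cong (λ b → 𝟙 b * 2 ^ d) qk) (*-identityˡ _))))
   (trans (∏-const B onL) (cong (B ^_) length-onL))

  -- On top of q, the colour k is forbidden on D. Every vertex of D must then deviate, which costs a
  -- factor L/B each.
  force : (Vertex d → Bool) → Vertex d → Fin 3 → ℕ
  force D y c = 𝟙 (q c) * 𝟙 (not (D y ∧ eqc c k))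

  force-weight : ∀ D n → ∑ onL (𝟙 ∘ D) ≡ n → total-weight (force D) * B ^ n ≡ L ^ n * B ^ N
  force-weight D n e = trans (cong (λ t → total-weight (force D) * B ^ t) (sym e)) (trans (cong (total-weight (force D) *_) (sym (∏-2^ B onL (𝟙 ∘ D))))
   (trans (sym (∏-* onL _ _)) (trans (∏-cong onL λ y → trans (cong (_* B ^ 𝟙 (D y)) (colour-sum (force D y))) (go (D y)))
    (trans (∏-* onL _ _) (cong₂ _*_ (trans (∏-2^ L onL (𝟙 ∘ D)) (cong (L ^_) e)) (trans (∏-const B onL) (cong (B ^_) length-onL)))))))
   where
   simp : ∀ c b → eqc c k ≡ false → 𝟙 (q c) * 𝟙 (not (b ∧ eqc c k)) ≡ 𝟙 (q c)
   simp c b h = trans (cong (λ t → 𝟙 (q c) * 𝟙 (not (b ∧ t))) h) (trans (cong (λ t → 𝟙 (q c) * 𝟙 (not t)) (∧-zeroʳ b)) (*-identityʳ _))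
   go : ∀ b → (𝟙 (q k) * 𝟙 (not (b ∧ eqc k k)) * 2 ^ d + (𝟙 (q (other₁ k)) * 𝟙 (not (b ∧ eqc (other₁ k) k)) + 𝟙 (q (other₂ k)) * 𝟙 (not (b ∧ eqc (other₂ k) k)))) * B ^ 𝟙 b
    ≡ L ^ 𝟙 b * B
   go true = trans (cong₂ (λ x y → (x + y) * B ^ 1) (cong (λ t → 𝟙 (q k) * 𝟙 (not t) * 2 ^ d) (eqc-refl k)) (cong₂ _+_ (simp (other₁ k) true (eqc-other₁ k)) (simp (other₂ k) true (eqc-other₂ k))))
    (trans (cong (λ t → (t * 2 ^ d + L) * B ^ 1) (*-zeroʳ (𝟙 (q k)))) (cong₂ _*_ (sym (*-identityʳ L)) (*-identityʳ B)))
   go false = trans (cong₂ (λ x y → (x * 2 ^ d + y) * 1) (trans (*-identityʳ (𝟙 (q k))) (cong 𝟙 qk)) (cong₂ _+_ (*-identityʳ (𝟙 (q (other₁ k)))) (*-identityʳ (𝟙 (q (other₂ k))))))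
    (trans (*-identityʳ _) (trans (cong (_+ L) (*-identityˡ (2 ^ d))) (sym (*-identityˡ B))))

  -- Union bound over the 2N d² choices of a vertex and two flips. Two forced deviations cost
  -- (L/B)², of order N^-2, so the non-isolated part has order d²/N.
  nonisolated-weight : S onL (λ s → 𝟙 (not (isolated σ k s)) * ∏ onL λ y → allow y (s y) * ω (s y)) (λ _ → zero) * B ^ 2 ≤ 2 * N * (d * d) * (L ^ 2 * B ^ N)
  nonisolated-weight = begin
   S onL (λ s → 𝟙 (not (isolated σ k s)) * ∏ onL λ y → allow y (s y) * ω (s y)) ρ₀ * B ^ 2
    ≤⟨ *-monoˡ-≤ (B ^ 2) (≤≡ (S-mono onL pointwise) expand) ⟩
   ∑ (allV d) (λ y → ∑ (fins d) λ a → ∑ (fins d) λ b → term y a b) * B ^ 2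
    ≡⟨ trans (sym (∑-*ʳ (B ^ 2) (allV d) _)) (∑-cong (allV d) λ y → trans (sym (∑-*ʳ (B ^ 2) (fins d) _)) (∑-cong (fins d) λ a → sym (∑-*ʳ (B ^ 2) (fins d) _))) ⟩
   ∑ (allV d) (λ y → ∑ (fins d) λ a → ∑ (fins d) λ b → term y a b * B ^ 2)
    ≤⟨ ∑-mono (allV d) (λ y → ∑-mono (fins d) λ a → ∑-mono (fins d) λ b → term-bound y a b) ⟩
   ∑ (allV d) (λ y → ∑ (fins d) λ a → ∑ (fins d) λ b → L ^ 2 * B ^ N)
    ≡⟨ trans (∑-cong (allV d) λ y → trans (∑-cong (fins d) λ a → ∑-fins d (L ^ 2 * B ^ N)) (trans (∑-const _ (fins d)) (cong (_* (d * (L ^ 2 * B ^ N))) (length-fins d))))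
     (trans (∑-const _ (allV d)) (trans (cong (_* (d * (d * (L ^ 2 * B ^ N)))) (trans (length-allV d) 2N)) (lem (2 * N) d (L ^ 2 * B ^ N)))) ⟩
   2 * N * (d * d) * (L ^ 2 * B ^ N) ∎
   where
   ρ₀ : Colouring
   ρ₀ _ = zero
   lem : ∀ x d z → x * (d * (d * z)) ≡ x * (d * d) * z
   lem = solve-∀
   pairSet : Vertex d → Fin d → Fin d → Vertex d → Bool
   pairSet y a b v = does (v ≟V y) ∨ does (v ≟V flip (flip y a) b)
   valid : Vertex d → Fin d → Fin d → Bool
   valid y a b = on σ y ∧ not (does (flip (flip y a) b ≟V y))
   term : Vertex d → Fin d → Fin d → ℕ
   term y a b = 𝟙 (valid y a b) * total-weight (force (pairSet y a b))
   forced : Vertex d → Fin d → Fin d → Colouring → ℕ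
   forced y a b s = 𝟙 (valid y a b) * ∏ onL λ v → force (pairSet y a b) v (s v) * ω (s v)
   expand : S onL (λ s → ∑ (allV d) λ y → ∑ (fins d) λ a → ∑ (fins d) λ b → forced y a b s) ρ₀ ≡ ∑ (allV d) (λ y → ∑ (fins d) λ a → ∑ (fins d) λ b → term y a b)
   expand = trans (S-∑ onL (allV d) (λ y s → ∑ (fins d) λ a → ∑ (fins d) λ b → forced y a b s) ρ₀) (∑-cong (allV d) λ y →
    trans (S-∑ onL (fins d) (λ a s → ∑ (fins d) λ b → forced y a b s) ρ₀) (∑-cong (fins d) λ a →
    trans (S-∑ onL (fins d) (λ b s → forced y a b s) ρ₀) (∑-cong (fins d) λ b →
    trans (S-*ˡ (𝟙 (valid y a b)) onL _ ρ₀) (cong (𝟙 (valid y a b) *_) (S-∏ onL (filterᵇ-unique _ (allV-unique d)) (λ v c → force (pairSet y a b) v c * ω c) ρ₀)))))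
   pointwise : ∀ s → 𝟙 (not (isolated σ k s)) * ∏ onL (λ y → allow y (s y) * ω (s y)) ≤ ∑ (allV d) λ y → ∑ (fins d) λ a → ∑ (fins d) λ b → forced y a b s
   pointwise s = go (bool-cases (isolated σ k s))
    where
    found : (∃ λ y → ∃ λ a → ∃ λ b → dev σ k s y ≡ true × dev σ k s (flip (flip y a) b) ≡ true × flip (flip y a) b ≢ y) →
     ∏ onL (λ y → allow y (s y) * ω (s y)) ≤ ∑ (allV d) λ y → ∑ (fins d) λ a → ∑ (fins d) λ b → forced y a b s
    found (y , a , b , h , h' , ne) = ≡≤ (trans (∏-cong onL λ v → cong (_* ω (s v)) (same-force v)) (sym (trans (cong (λ t → 𝟙 t * ∏ onL λ v → force (pairSet y a b) v (s v) * ω (s v)) val) (*-identityˡ _))))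
     (≤-trans (term≤∑ (λ b → forced y a b s) (∈-fins b)) (≤-trans (term≤∑ (λ a → ∑ (fins d) λ b → forced y a b s) (∈-fins a)) (term≤∑ (λ y → ∑ (fins d) λ a → ∑ (fins d) λ b → forced y a b s) (∈-allV y))))
     where
     val : valid y a b ≡ true
     val = ∧-true⁺ (∧ˡ {on σ y} h) (cong not (dne (flip (flip y a) b ≟V y)))
      where
      dne : ∀ (D : Dec (flip (flip y a) b ≡ y)) → does D ≡ false
      dne (yes e) = ⊥-elim (ne e)
      dne (no _) = refl
     same-force : ∀ v → 𝟙 (q (s v)) ≡ force (pairSet y a b) v (s v)
     same-force v = sym (trans (cong (λ t → 𝟙 (q (s v)) * 𝟙 (not t)) (nk (bool-cases (pairSet y a b v)))) (*-identityʳ _))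
      where
      nk : Cases (pairSet y a b v) → pairSet y a b v ∧ eqc (s v) k ≡ false
      nk (inj₂ e) = cong (_∧ eqc (s v) k) e
      nk (inj₁ e) with ∨-cases e
      ... | inj₁ e' = trans (cong (pairSet y a b v ∧_) (eqc-≢ (subst (λ w → s w ≢ k) (sym (does-≡ e')) (isdev s y h)))) (∧-zeroʳ _)
      ... | inj₂ e' = trans (cong (pairSet y a b v ∧_) (eqc-≢ (subst (λ w → s w ≢ k) (sym (does-≡ e')) (isdev s _ h')))) (∧-zeroʳ _)
    go : Cases (isolated σ k s) → 𝟙 (not (isolated σ k s)) * ∏ onL (λ y → allow y (s y) * ω (s y)) ≤ ∑ (allV d) λ y → ∑ (fins d) λ a → ∑ (fins d) λ b → forced y a b s
    go (inj₁ e) = ≡≤ (cong (λ t → 𝟙 (not t) * ∏ onL (λ y → allow y (s y) * ω (s y))) e) z≤n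
    go (inj₂ e) = ≡≤ (trans (cong (λ t → 𝟙 (not t) * ∏ onL (λ y → allow y (s y) * ω (s y))) e) (*-identityˡ _)) (found (isolated-false σ k s e))
   term-bound : ∀ y a b → term y a b * B ^ 2 ≤ L ^ 2 * B ^ N
   term-bound y a b = go (bool-cases (valid y a b))
    where
    go : Cases (valid y a b) → term y a b * B ^ 2 ≤ L ^ 2 * B ^ N
    go (inj₂ e) = ≡≤ (cong (λ t → 𝟙 t * total-weight (force (pairSet y a b)) * B ^ 2) e) z≤n
    go (inj₁ e) = ≤-reflexive (trans (cong (_* B ^ 2) (trans (cong (λ t → 𝟙 t * total-weight (force (pairSet y a b))) e) (*-identityˡ _))) (force-weight (pairSet y a b) 2 two))
     where
     oy : on σ y ≡ true
     oy = ∧ˡ e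
     oy' : on σ (flip (flip y a) b) ≡ true
     oy' = trans (on-flip σ (flip y a) b) (cong not (off-on y a oy))
     disj : ∀ v → 𝟙 (on σ v) * 𝟙 (pairSet y a b v) ≡ 𝟙 (does (v ≟V y)) + 𝟙 (does (v ≟V flip (flip y a) b))
     disj v with v ≟V y | v ≟V flip (flip y a) b
     ... | yes refl | yes e' = absurd (trans (cong (λ w → does (w ≟V v)) (sym e')) (does-refl v)) (not-injective (∧ʳ {on σ v} e))
     ... | yes refl | no _ = cong (λ t → 𝟙 t * 1) oy
     ... | no _ | yes refl = cong (λ t → 𝟙 t * 1) oy'
     ... | no _ | no _ = *-zeroʳ (𝟙 (on σ v))
     two : ∑ onL (𝟙 ∘ pairSet y a b) ≡ 2
     two = trans (∑-filter (on σ) (allV d) _) (trans (∑-cong (allV d) disj) (trans (∑-+ (allV d) _ _) (cong₂ _+_ (vertex-count y) (vertex-count (flip (flip y a) b)))))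

-- Bounds for ordered and for nongeneric colourings.

-- Half of the exponent at a time: `pow-ratio` with e = h gives (1 + 1/(2h))^h ≤ 2.
1+1/N-power : ∀ h → 1 ≤ h → (2 * h + 1) ^ (2 * h) ≤ 4 * (2 * h) ^ (2 * h)
1+1/N-power h 1≤h = begin
 (2 * h + 1) ^ (2 * h)           ≡⟨ square (2 * h + 1) ⟩
 (2 * h + 1) ^ h * (2 * h + 1) ^ h ≤⟨ *-mono-≤ half half ⟩
 2 * (2 * h) ^ h * (2 * (2 * h) ^ h) ≡⟨ lem ((2 * h) ^ h) ⟩
 4 * ((2 * h) ^ h * (2 * h) ^ h) ≡⟨ cong (4 *_) (sym (square (2 * h))) ⟩
 4 * (2 * h) ^ (2 * h)           ∎
 where
 lem : ∀ x → 2 * x * (2 * x) ≡ 4 * (x * x)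
 lem = solve-∀
 square : ∀ x → x ^ (2 * h) ≡ x ^ h * x ^ h
 square x = trans (cong (λ t → x ^ (h + t)) (+-identityʳ h)) (^-distribˡ-+-* x h h)
 half : (2 * h + 1) ^ h ≤ 2 * (2 * h) ^ h
 half = *-cancelʳ-≤ _ _ h ⦃ >-nonZero 1≤h ⦄ (≤≡ (pow-ratio (2 * h) 1 h h (l h)) (l' ((2 * h) ^ h) h))
  where
  l : ∀ h → 1 * h + h ≡ 2 * h
  l = solve-∀
  l' : ∀ x h → x * (2 * h) ≡ 2 * x * h
  l' = solve-∀

par-zero : ∀ d → par (zeroVertex d) ≡ false
par-zero zero = refl
par-zero (suc d) = par-zero d

module Estimates (Q : CubeData) where
 open CubeData Q

 -- One fixed vertex in each parity class, whose neighbourhood is tested for genericity.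
 root : Bool → Vertex d
 root false = zeroVertex d
 root true = flip (zeroVertex d) i₀

 root-on : ∀ σ → on σ (root σ) ≡ true
 root-on false = cong not (par-zero d)
 root-on true = trans (on-flip true (zeroVertex d) i₀) (cong (λ t → not (not (not t))) (par-zero d))

 -- All neighbours of the root but possibly one share a colour. Excluding this makes the pair (σ ,
 -- k) of an ordered colouring unique and lets both colours other than k occur off σ.
 nongeneric : Bool → (Vertex d → Fin 3) → Bool
 nongeneric σ χ = anyL cols λ a → anyL (fins d) λ i → allL (fins d) λ j → does (j Fin.≟ i) ∨ eqc (χ (flip (root σ) j)) a

 M : ℕ
 M = (2 * N) ^ N

 instance
  N≢0 : NonZero N
  N≢0 = >-nonZero (≤-trans 1≤h (≤≡ (m≤n*m h 2) (sym N≡)))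

 M≢0 : NonZero M
 M≢0 = m^n≢0 (2 * N) N ⦃ m*n≢0 2 N ⦄

 pow-d : 2 ^ (d * N) ≡ M
 pow-d = trans (sym (^-*-assoc 2 d N)) (cong (_^ N) 2^d)

 B-power : ∀ L → L ≤ 2 → (2 ^ d + L) ^ N ≤ 4 * M
 B-power L hL = begin
  (2 ^ d + L) ^ N        ≤⟨ ^-monoˡ-≤ N (≡≤ (cong (_+ L) 2^d) (≤≡ (+-monoʳ-≤ (2 * N) hL) (l N))) ⟩
  (2 * (N + 1)) ^ N      ≡⟨ ^-distrib-* N 2 (N + 1) ⟩
  2 ^ N * (N + 1) ^ N    ≤⟨ *-monoʳ-≤ (2 ^ N) (subst (λ n → (n + 1) ^ n ≤ 4 * n ^ n) (sym N≡) (1+1/N-power h 1≤h)) ⟩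
  2 ^ N * (4 * N ^ N)    ≡⟨ l' (2 ^ N) (N ^ N) ⟩
  4 * (2 ^ N * N ^ N)    ≡⟨ cong (4 *_) (sym (^-distrib-* N 2 N)) ⟩
  4 * M                  ∎
  where
  l : ∀ N → 2 * N + 2 ≡ 2 * (N + 1)
  l = solve-∀
  l' : ∀ x y → x * (4 * y) ≡ 4 * (x * y)
  l' = solve-∀

 module Side (σ : Bool) (k : Fin 3) where
  open Pattern Q σ k

  nL : (Fin 3 → Bool) → ℕ
  nL q = 𝟙 (q (other₁ k)) + 𝟙 (q (other₂ k))

  nL≤2 : ∀ q → nL q ≤ 2
  nL≤2 q = +-mono-≤ (𝟙≤1 (q (other₁ k))) (𝟙≤1 (q (other₂ k)))

  private
   ones : Vertex d → Fin 3 → ℕ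
   ones _ _ = 1
   ⊤q : Fin 3 → Bool
   ⊤q _ = true

  isoCount : (Fin 3 → Bool) → ℕ
  isoCount q = Count (λ _ c → 𝟙 (q c)) ones

  iso-upper : ∀ q → q k ≡ true → isoCount q * M ≤ 2 ^ N * (2 ^ d + nL q) ^ N
  iso-upper q qk = ≡≤ (cong (isoCount q *_) (sym pow-d)) (≤≡ (count-upper (allow q qk)) (cong (2 ^ N *_) (allow-weight q qk)))

  iso-upper₄ : ∀ q → q k ≡ true → isoCount q ≤ 4 * 2 ^ N
  iso-upper₄ q qk = *-cancelʳ-≤ _ _ M ⦃ M≢0 ⦄ (≤-trans (iso-upper q qk) (≤≡ (*-monoʳ-≤ (2 ^ N) (B-power (nL q) (nL≤2 q))) (l (2 ^ N) M)))
   where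
   l : ∀ x y → x * (4 * y) ≡ 4 * x * y
   l = solve-∀

  iso-lower : ∀ q → q k ≡ true → 2 ^ N * (2 ^ d + nL q) ^ N * N ≤ isoCount q * M * N + 2 ^ N * (8 * (d * d)) * M
  iso-lower q qk = begin
   2 ^ N * Bq ^ N * N
    ≤⟨ *-monoˡ-≤ N (≡≤ (cong (2 ^ N *_) (sym (allow-weight q qk))) (count-lower (allow q qk))) ⟩
   (isoCount q * 2 ^ (d * N) + 2 ^ N * X) * N
    ≡⟨ trans (cong (λ t → (isoCount q * t + 2 ^ N * X) * N) pow-d) (l₁ (isoCount q * M) (2 ^ N) X N) ⟩
   isoCount q * M * N + 2 ^ N * (X * N)
    ≤⟨ +-monoʳ-≤ (isoCount q * M * N) (*-monoʳ-≤ (2 ^ N) XN) ⟩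
   isoCount q * M * N + 2 ^ N * (8 * (d * d) * M)
    ≡⟨ cong (isoCount q * M * N +_) (sym (*-assoc (2 ^ N) _ M)) ⟩
   isoCount q * M * N + 2 ^ N * (8 * (d * d)) * M ∎
   where
   Bq X : ℕ
   Bq = 2 ^ d + nL q
   X = Colour.S onL (λ s → 𝟙 (not (isolated σ k s)) * ∏ onL λ y → allow q qk y (s y) * ω (s y)) (λ _ → zero)
   l₁ : ∀ a b x n → (a + b * x) * n ≡ a * n + b * (x * n)
   l₁ = solve-∀
   XN : X * N ≤ 8 * (d * d) * M
   XN = *-cancelʳ-≤ _ _ (4 * N) ⦃ m*n≢0 4 N ⦄ (begin
    X * N * (4 * N)
     ≡⟨ l₂ X N ⟩
    X * (2 * N) ^ 2
     ≤⟨ *-monoʳ-≤ X (^-monoˡ-≤ 2 (≡≤ (sym 2^d) (m≤m+n (2 ^ d) (nL q)))) ⟩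
    X * Bq ^ 2
     ≤⟨ nonisolated-weight q qk ⟩
    2 * N * (d * d) * (nL q ^ 2 * Bq ^ N)
     ≤⟨ *-monoʳ-≤ (2 * N * (d * d)) (*-mono-≤ (^-monoˡ-≤ 2 (nL≤2 q)) (B-power (nL q) (nL≤2 q))) ⟩
    2 * N * (d * d) * (4 * (4 * M))
     ≡⟨ l₃ N (d * d) M ⟩
    8 * (d * d) * M * (4 * N) ∎)
    where
    l₂ : ∀ x n → x * n * (4 * n) ≡ x * (2 * n * (2 * n * 1))
    l₂ = solve-∀
    l₃ : ∀ n e m → 2 * n * e * (4 * (4 * m)) ≡ 8 * e * m * (4 * n)
    l₃ = solve-∀

  private
   y* : Vertex d
   y* = root σ

   near : Vertex d → Bool
   near y = anyL (fins d) λ i → anyL (fins d) λ j → does (flip (flip y* i) j ≟V y)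

   near⁺ : ∀ i j → near (flip (flip y* i) j) ≡ true
   near⁺ i j = anyL⁺ (∈-fins i) (anyL⁺ (∈-fins j) (does-refl (flip (flip y* i) j)))

   near⁻ : ∀ y → near y ≡ true → ∃ λ i → ∃ λ j → flip (flip y* i) j ≡ y
   near⁻ y e with anyL⁻ (fins d) e
   ... | i , _ , e' with anyL⁻ (fins d) e'
   ...   | j , _ , e'' = i , j , does-≡ e''

   u : Vertex d → Fin 3 → ℕ
   u y c = 𝟙 (not (near y) ∨ eqc c k)

   nb : Fin d → Vertex d → Bool
   nb i v = adj y* v ∧ not (does (v ≟V flip y* i))

   r : Fin 3 → Fin d → Vertex d → Fin 3 → ℕ
   r a i v c = 𝟙 (not (nb i v) ∨ eqc c a)

   nb-count : ∀ i → suc (∑ offL (𝟙 ∘ nb i)) ≡ d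
   nb-count i = trans (sym (trans (+-comm _ 1) (cong (1 +_) (trans (∑-cong (allV d) each) (sym (∑-filter (not ∘ on σ) (allV d) _))))))
    (trans (cong (∑ (allV d) (λ v → 𝟙 (adj y* v) * 𝟙 (not (does (v ≟V flip y* i)))) +_) (sym total₁)) (trans (sym (∑-+ (allV d) _ _))
    (trans (∑-cong (allV d) λ v → trans (sym (*-distribˡ-+ (𝟙 (adj y* v)) _ _)) (trans (cong (𝟙 (adj y* v) *_) (trans (+-comm _ (𝟙 (does (v ≟V flip y* i)))) (𝟙-not (does (v ≟V flip y* i))))) refl))
    (trans (nbr-sum y* λ _ → 1) (trans (∑-fins d 1) (*-identityʳ d))))))
    where
    offside : ∀ v → adj y* v ≡ true → on σ v ≡ false
    offside v a with adj⁻ {r = y*} a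
    ... | j , refl = trans (on-flip σ y* j) (cong not (root-on σ))
    each : ∀ v → 𝟙 (adj y* v) * 𝟙 (not (does (v ≟V flip y* i))) ≡ 𝟙 (not (on σ v)) * 𝟙 (nb i v)
    each v = go (bool-cases (adj y* v))
     where
     go : Cases (adj y* v) → 𝟙 (adj y* v) * 𝟙 (not (does (v ≟V flip y* i))) ≡ 𝟙 (not (on σ v)) * 𝟙 (nb i v)
     go (inj₁ a) = trans (sym (𝟙-∧ (adj y* v) _)) (sym (trans (cong (λ t → 𝟙 (not t) * 𝟙 (nb i v)) (offside v a)) (*-identityˡ _)))
     go (inj₂ a) = trans (cong (λ t → 𝟙 t * 𝟙 (not (does (v ≟V flip y* i)))) a) (sym (trans (cong (λ t → 𝟙 (not (on σ v)) * 𝟙 (t ∧ not (does (v ≟V flip y* i)))) a) (*-zeroʳ (𝟙 (not (on σ v))))))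
    total₁ : ∑ (allV d) (λ v → 𝟙 (adj y* v) * 𝟙 (does (v ≟V flip y* i))) ≡ 1
    total₁ = trans (nbr-sum y* λ v → 𝟙 (does (v ≟V flip y* i))) (∑-𝟙-single (λ j → does (flip y* j ≟V flip y* i)) (fins-unique d) (∈-fins i) (does-refl (flip y* i)) λ {j} e → flip-inj y* j i (does-≡ e))

   u-weight : total-weight u ≤ (2 ^ d + 2) ^ N
   u-weight = ≤≡ (∏-mono onL λ y → ≤≡ (∑-mono cols λ c → *-monoˡ-≤ (ω c) (𝟙≤1 (not (near y) ∨ eqc c k))) (trans (colour-sum ⊤q refl (λ _ → 1)) (cong (_+ 2) (*-identityˡ (2 ^ d)))))
    (trans (∏-const (2 ^ d + 2) onL) (cong ((2 ^ d + 2) ^_) length-onL))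

   -- `u` forces colour k within distance 2 of the root, so each neighbour of the root has two
   -- available colours. Prescribing the colour of d - 1 of them costs 2^(d-1) = N.
   constrained : ∀ a i → Count u (r a i) * N ≤ 4 * 2 ^ N
   constrained a i = *-cancelʳ-≤ _ _ M ⦃ M≢0 ⦄ (begin
    Count u (r a i) * N * M
     ≡⟨ cong (λ t → Count u (r a i) * t * M) (sym powh) ⟩
    Count u (r a i) * 2 ^ h' * M
     ≤⟨ *-monoˡ-≤ M (count-constrained u (r a i) h' fits) ⟩
    Count u ones * M
     ≤⟨ ≡≤ (cong (Count u ones *_) (sym pow-d)) (≤-trans (count-upper u) (*-monoʳ-≤ (2 ^ N) (≤-trans u-weight (B-power 2 ≤-refl)))) ⟩
    2 ^ N * (4 * M)
     ≡⟨ l (2 ^ N) M ⟩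
    4 * 2 ^ N * M ∎)
    where
    l : ∀ x y → x * (4 * y) ≡ 4 * x * y
    l = solve-∀
    h' : ℕ
    h' = ∑ offL (𝟙 ∘ nb i)
    powh : 2 ^ h' ≡ N
    powh = *-cancelˡ-≡ _ _ 2 (trans (cong (2 ^_) (nb-count i)) 2^d)
    fits : ∀ s → 1 ≤ ∏ onL (λ y → u y (s y)) → ∏ offL (Wr (r a i) s) * 2 ^ h' ≤ ∏ offL (W s)
    fits s ok = ≡≤ (trans (cong (∏ offL (Wr (r a i) s) *_) (sym (∏-2^ 2 offL (𝟙 ∘ nb i)))) (sym (∏-* offL _ _))) (∏-mono∈ offL λ {v} m → each v (not-injective (filterᵇ-true (not ∘ on σ) (allV d) m)))
     where
     each : ∀ v → on σ v ≡ false → Wr (r a i) s v * 2 ^ 𝟙 (nb i v) ≤ W s v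
     each v o = go (bool-cases (nb i v))
      where
      go : Cases (nb i v) → Wr (r a i) s v * 2 ^ 𝟙 (nb i v) ≤ W s v
      go (inj₂ e) = ≡≤ (trans (cong (λ b → Wr (r a i) s v * 2 ^ 𝟙 b) e) (*-identityʳ _))
       (∑-mono cols {λ c → 𝟙 (avail s v c) * r a i v c} {λ c → 𝟙 (avail s v c)} λ c → ≤≡ (*-monoʳ-≤ (𝟙 (avail s v c)) (𝟙≤1 (not (nb i v) ∨ eqc c a))) (*-identityʳ (𝟙 (avail s v c))))
      go (inj₁ e) with adj⁻ {r = y*} (∧ˡ {adj y* v} e)
      ... | j , refl = ≡≤ (cong (λ b → Wr (r a i) s (flip y* j) * 2 ^ 𝟙 b) e) (≤≡ (*-monoˡ-≤ 2 atmost1) (sym (W-free s (flip y* j) o fr)))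
       where
       atmost1 : Wr (r a i) s (flip y* j) ≤ 1
       atmost1 = ≤≡ (∑-mono cols λ c → ≤≡ (*-monoˡ-≤ _ (𝟙≤1 (avail s (flip y* j) c))) (trans (*-identityˡ _) (cong (λ b → 𝟙 (not b ∨ eqc c a)) e))) (count-eqc a)
       nodev : ∀ l → dev σ k s (flip (flip y* j) l) ≡ false
       nodev l = trans (cong (on σ (flip (flip y* j) l) ∧_) (cong not (trans (cong (λ b → not b ∨ eqc (s (flip (flip y* j) l)) k) (sym (near⁺ j l)) ) (∏𝟙-true onL (λ y → not (near y) ∨ eqc (s y) k) ok
        (∈-filterᵇ⁺ (on σ) (∈-allV _) (trans (on-flip σ (flip y* j) l) (cong not o))))))) (∧-zeroʳ _)
       fr : free s (flip y* j) ≡ true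
       fr = trans (not-involutive _) (allL⁺ (fins d) λ {l} _ → cong not (nodev l))

   forced : ∀ y → on σ y ≡ true → Count (force ⊤q refl (λ v → does (v ≟V y))) ones * N ≤ 8 * 2 ^ N
   forced y o = *-cancelʳ-≤ _ _ M ⦃ M≢0 ⦄ (begin
    Count F ones * N * M
     ≡⟨ l₁ (Count F ones) N M ⟩
    Count F ones * M * N
     ≤⟨ *-monoˡ-≤ N (≡≤ (cong (Count F ones *_) (sym pow-d)) (count-upper F)) ⟩
    2 ^ N * total-weight F * N
     ≤⟨ *-monoʳ-≤ (2 ^ N * total-weight F) (≤-trans (m≤n*m N 2) (≡≤ (sym 2^d) (m≤m+n (2 ^ d) 2))) ⟩
    2 ^ N * total-weight F * (2 ^ d + 2)
     ≡⟨ trans (*-assoc (2 ^ N) _ _) (cong (λ t → 2 ^ N * (total-weight F * t)) (sym (*-identityʳ (2 ^ d + 2)))) ⟩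
    2 ^ N * (total-weight F * (2 ^ d + 2) ^ 1)
     ≡⟨ cong (2 ^ N *_) (force-weight ⊤q refl (λ v → does (v ≟V y)) 1 single) ⟩
    2 ^ N * (2 * (2 ^ d + 2) ^ N)
     ≤⟨ *-monoʳ-≤ (2 ^ N) (*-monoʳ-≤ 2 (B-power 2 ≤-refl)) ⟩
    2 ^ N * (2 * (4 * M))
     ≡⟨ l₂ (2 ^ N) M ⟩
    8 * 2 ^ N * M ∎)
    where
    F : Vertex d → Fin 3 → ℕ
    F = force ⊤q refl (λ v → does (v ≟V y))
    l₁ : ∀ x y z → x * y * z ≡ x * z * y
    l₁ = solve-∀
    l₂ : ∀ x y → x * (2 * (4 * y)) ≡ 8 * x * y
    l₂ = solve-∀
    single : ∑ onL (λ v → 𝟙 (does (v ≟V y))) ≡ 1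
    single = ∑-𝟙-single (λ v → does (v ≟V y)) (filterᵇ-unique _ (allV-unique d)) (∈-filterᵇ⁺ (on σ) (∈-allV y) o) (does-refl y) does-≡

  NG : ℕ
  NG = Tot d λ χ → proper χ * 𝟙 (isolated σ k χ ∧ nongeneric σ χ)

  -- Either one of the at most d² vertices near the root deviates, with weight at most 8/N each in
  -- units of 2^N, or none does and d - 1 neighbours share one of three colours: 3d cases with
  -- weight at most 4/N.
  NG-bound : NG * N ≤ (8 * (d * d) + 12 * d) * 2 ^ N
  NG-bound = begin
   NG * N
    ≤⟨ *-monoˡ-≤ N (≤≡ (Tot-mono d pointwise) expand) ⟩
   (∑ (fins d) (λ i → ∑ (fins d) λ j → Cf i j) + ∑ cols (λ a → ∑ (fins d) λ i → Count u (r a i))) * N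
    ≡⟨ trans (*-distribʳ-+ N (∑ (fins d) λ i → ∑ (fins d) λ j → Cf i j) _) (cong₂ _+_
     (trans (sym (∑-*ʳ N (fins d) λ i → ∑ (fins d) λ j → Cf i j)) (∑-cong (fins d) λ i → sym (∑-*ʳ N (fins d) (Cf i))))
     (trans (sym (∑-*ʳ N cols λ a → ∑ (fins d) λ i → Count u (r a i))) (∑-cong cols λ a → sym (∑-*ʳ N (fins d) λ i → Count u (r a i))))) ⟩
   ∑ (fins d) (λ i → ∑ (fins d) λ j → Cf i j * N) + ∑ cols (λ a → ∑ (fins d) λ i → Count u (r a i) * N)
    ≤⟨ +-mono-≤ (∑-mono (fins d) λ i → ∑-mono (fins d) λ j → forced (flip (flip y* i) j) (near-on i j)) (∑-mono cols λ a → ∑-mono (fins d) λ i → constrained a i) ⟩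
   ∑ (fins d) (λ i → ∑ (fins d) λ j → 8 * 2 ^ N) + ∑ cols (λ a → ∑ (fins d) λ i → 4 * 2 ^ N)
    ≡⟨ cong₂ _+_ (trans (∑-cong (fins d) λ i → ∑-fins d (8 * 2 ^ N)) (∑-fins d _)) (trans (∑-cong cols λ a → ∑-fins d (4 * 2 ^ N)) (∑-const (d * (4 * 2 ^ N)) cols)) ⟩
   d * (d * (8 * 2 ^ N)) + 3 * (d * (4 * 2 ^ N))
    ≡⟨ l d (2 ^ N) ⟩
   (8 * (d * d) + 12 * d) * 2 ^ N ∎
   where
   l : ∀ d x → d * (d * (8 * x)) + 3 * (d * (4 * x)) ≡ (8 * (d * d) + 12 * d) * x
   l = solve-∀
   near-on : ∀ i j → on σ (flip (flip y* i) j) ≡ true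
   near-on i j = trans (on-flip σ (flip y* i) j) (cong not (trans (on-flip σ y* i) (cong not (root-on σ))))
   cf : Fin d → Fin d → (Vertex d → Fin 3) → ℕ
   cf i j χ = proper χ * 𝟙 (isolated σ k χ) * (∏ onL (λ y → force ⊤q refl (λ v → does (v ≟V flip (flip y* i) j)) y (χ y)) * ∏ offL (λ v → ones v (χ v)))
   cr : Fin 3 → Fin d → (Vertex d → Fin 3) → ℕ
   cr a i χ = proper χ * 𝟙 (isolated σ k χ) * (∏ onL (λ y → u y (χ y)) * ∏ offL (λ v → r a i v (χ v)))
   Cf : Fin d → Fin d → ℕ
   Cf i j = Tot d (cf i j)
   rhs : (Vertex d → Fin 3) → ℕ
   rhs χ = ∑ (fins d) (λ i → ∑ (fins d) λ j → cf i j χ) + ∑ cols (λ a → ∑ (fins d) λ i → cr a i χ)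
   expand : Tot d rhs ≡ ∑ (fins d) (λ i → ∑ (fins d) λ j → Cf i j) + ∑ cols (λ a → ∑ (fins d) λ i → Count u (r a i))
   expand = trans (Tot-+ d (λ χ → ∑ (fins d) λ i → ∑ (fins d) λ j → cf i j χ) (λ χ → ∑ cols λ a → ∑ (fins d) λ i → cr a i χ)) (cong₂ _+_
    (trans (Tot-∑ d (fins d) λ i χ → ∑ (fins d) λ j → cf i j χ) (∑-cong (fins d) λ i → Tot-∑ d (fins d) (cf i)))
    (trans (Tot-∑ d cols λ a χ → ∑ (fins d) λ i → cr a i χ) (∑-cong cols λ a → Tot-∑ d (fins d) (cr a))))
   pointwise : ∀ χ → proper χ * 𝟙 (isolated σ k χ ∧ nongeneric σ χ) ≤ rhs χ
   pointwise χ = go (bool-cases (nongeneric σ χ))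
    where
    P : ℕ
    P = proper χ * 𝟙 (isolated σ k χ)
    drop : proper χ * 𝟙 (isolated σ k χ ∧ nongeneric σ χ) ≤ P
    drop = *-monoʳ-≤ (proper χ) (𝟙-mono λ e → ∧ˡ {isolated σ k χ} e)
    times-one : ∀ {x} → x ≡ 1 → P ≤ P * x
    times-one e = ≤-reflexive (sym (trans (cong (P *_) e) (*-identityʳ P)))
    viaDev : (∃ λ y → near y ≡ true × dev σ k χ y ≡ true) → P ≤ rhs χ
    viaDev (y , ny , dv) with near⁻ y ny
    ... | i , j , refl = ≤-trans (times-one (cong₂ _*_ (trans (∏-cong∈ onL λ {v} m → force1 v (bool-cases (does (v ≟V flip (flip y* i) j)))) (∏-one onL)) (∏-one offL)))
     (≤-trans (term≤∑ (λ j → cf i j χ) (∈-fins j)) (≤-trans (term≤∑ (λ i → ∑ (fins d) λ j → cf i j χ) (∈-fins i)) (m≤m+n (∑ (fins d) λ i → ∑ (fins d) λ j → cf i j χ) (∑ cols λ a → ∑ (fins d) λ i → cr a i χ))))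
     where
     force1 : ∀ v → Cases (does (v ≟V flip (flip y* i) j)) → force ⊤q refl (λ v → does (v ≟V flip (flip y* i) j)) v (χ v) ≡ 1
     force1 v (inj₂ e) = trans (+-identityʳ _) (cong (λ b → 𝟙 (not (b ∧ eqc (χ v) k))) e)
     force1 v (inj₁ e) = trans (+-identityʳ _) (trans (cong (λ b → 𝟙 (not (b ∧ eqc (χ v) k))) e) (cong 𝟙 (subst (λ w → not (eqc (χ w) k) ≡ true) (sym (does-≡ e)) (∧ʳ {on σ (flip (flip y* i) j)} dv))))
    viaBits : (∀ y → near y ≡ true → dev σ k χ y ≡ false) → nongeneric σ χ ≡ true → P ≤ rhs χ
    viaBits nd ng with anyL⁻ cols ng
    ... | a , ma , ng' with anyL⁻ (fins d) ng'
    ...   | i , mi , ng'' = ≤-trans (times-one (cong₂ _*_ (∏𝟙-one onL (λ y → not (near y) ∨ eqc (χ y) k) (λ {y} m → ub y (filterᵇ-true (on σ) (allV d) m) (bool-cases (near y))))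
     (∏𝟙-one offL (λ v → not (nb i v) ∨ eqc (χ v) a) (λ {v} m → rb v (bool-cases (nb i v))))))
     (≤-trans (term≤∑ (λ i → cr a i χ) mi) (≤-trans (term≤∑ (λ a → ∑ (fins d) λ i → cr a i χ) ma) (m≤n+m (∑ cols λ a → ∑ (fins d) λ i → cr a i χ) (∑ (fins d) λ i → ∑ (fins d) λ j → cf i j χ))))
     where
     ub : ∀ y → on σ y ≡ true → Cases (near y) → not (near y) ∨ eqc (χ y) k ≡ true
     ub y o (inj₂ e) = cong (λ b → not b ∨ eqc (χ y) k) e
     ub y o (inj₁ e) = trans (cong (λ b → not b ∨ eqc (χ y) k) e) (not-injective (trans (cong (_∧ not (eqc (χ y) k)) (sym o)) (nd y e)))
     rb : ∀ v → Cases (nb i v) → not (nb i v) ∨ eqc (χ v) a ≡ true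
     rb v (inj₂ e) = cong (λ b → not b ∨ eqc (χ v) a) e
     rb v (inj₁ e) with adj⁻ {r = y*} (∧ˡ {adj y* v} e)
     ... | j , refl = trans (cong (λ b → not b ∨ eqc (χ (flip y* j)) a) e) (pick (allL⁻ {xs = fins d} {λ j → does (j Fin.≟ i) ∨ eqc (χ (flip y* j)) a} ng'' (∈-fins j)) (∧ʳ {adj y* (flip y* j)} e))
      where
      pick : does (j Fin.≟ i) ∨ eqc (χ (flip y* j)) a ≡ true → not (does (flip y* j ≟V flip y* i)) ≡ true → eqc (χ (flip y* j)) a ≡ true
      pick h h' with j Fin.≟ i
      ... | yes refl = absurd (does-refl (flip y* j)) (not-injective h')
      ... | no _ = h
    cases : Cases (anyL (allV d) (λ y → near y ∧ dev σ k χ y)) → nongeneric σ χ ≡ true → P ≤ rhs χ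
    cases (inj₁ e) ng with anyL⁻ (allV d) {λ y → near y ∧ dev σ k χ y} e
    ... | y , _ , h' = viaDev (y , ∧-true⁻ h')
    cases (inj₂ e) ng = viaBits (λ y ny → refute λ t → absurd (anyL⁺ {xs = allV d} {λ y → near y ∧ dev σ k χ y} (∈-allV y) (∧-true⁺ ny t)) e) ng
    go : Cases (nongeneric σ χ) → proper χ * 𝟙 (isolated σ k χ ∧ nongeneric σ χ) ≤ rhs χ
    go (inj₂ e) = ≡≤ (trans (cong (λ b → proper χ * 𝟙 b) (trans (cong (isolated σ k χ ∧_) e) (∧-zeroʳ _))) (*-zeroʳ (proper χ))) z≤n
    go (inj₁ e) = ≤-trans drop (cases (bool-cases (anyL (allV d) λ y → near y ∧ dev σ k χ y)) e)

-- Disordered colourings: absorbing the relative bound.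

sides : List Bool
sides = false ∷ true ∷ []

∈-sides : ∀ σ → σ ∈ sides
∈-sides false = here refl
∈-sides true = there (here refl)

∑σk : (Bool → Fin 3 → ℕ) → ℕ
∑σk g = ∑ sides λ σ → ∑ cols (g σ)

∑σk-mono : ∀ {f g} → (∀ σ k → f σ k ≤ g σ k) → ∑σk f ≤ ∑σk g
∑σk-mono h = ∑-mono sides λ σ → ∑-mono cols (h σ)

∑σk-const : ∀ c → ∑σk (λ _ _ → c) ≡ 6 * c
∑σk-const = l
 where
 l : ∀ c → (c + (c + (c + 0))) + ((c + (c + (c + 0))) + 0) ≡ 6 * c
 l = solve-∀

term≤∑σk : ∀ g σ k → g σ k ≤ ∑σk g
term≤∑σk g σ k = ≤-trans (term≤∑ (g σ) (∈-cols k)) (term≤∑ (λ σ → ∑ cols (g σ)) (∈-sides σ))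

∑σk-*ʳ : ∀ c g → ∑σk (λ σ k → g σ k * c) ≡ ∑σk g * c
∑σk-*ʳ c g = trans (∑-cong sides λ σ → ∑-*ʳ c cols (g σ)) (∑-*ʳ c sides λ σ → ∑ cols (g σ))

Tot-∑σk : ∀ d (F : Bool → Fin 3 → (Vertex d → Fin 3) → ℕ) → Tot d (λ χ → ∑σk λ σ k → F σ k χ) ≡ ∑σk λ σ k → Tot d (F σ k)
Tot-∑σk d F = trans (Tot-∑ d sides λ σ χ → ∑ cols λ k → F σ k χ) (∑-cong sides λ σ → Tot-∑ d cols (F σ))

anyσk : (Bool → Fin 3 → Bool) → Bool
anyσk q = anyL sides λ σ → anyL cols λ k → q σ k

anyσk⁺ : ∀ (q : Bool → Fin 3 → Bool) σ k → q σ k ≡ true → anyσk q ≡ true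
anyσk⁺ q σ k e = anyL⁺ {xs = sides} {λ σ → anyL cols λ k → q σ k} (∈-sides σ) (anyL⁺ {xs = cols} {λ k → q σ k} (∈-cols k) e)

anyσk⁻ : ∀ (q : Bool → Fin 3 → Bool) → anyσk q ≡ true → ∃ λ σ → ∃ λ k → q σ k ≡ true
anyσk⁻ q e with anyL⁻ sides {λ σ → anyL cols λ k → q σ k} e
... | σ , _ , e' with anyL⁻ cols {λ k → q σ k} e'
...   | k , _ , e'' = σ , k , e''

ordered : ∀ {d} → (Vertex d → Fin 3) → Bool
ordered χ = anyσk λ σ k → isolated σ k χ

Disordered : ℕ → ℕ
Disordered d = Tot d λ χ → proper χ * 𝟙 (not (ordered χ))

module Disorder {d'} (B w Z : ℕ)
 (few : ∀ i → Tot (suc d') (λ χ → proper χ * 𝟙 (B ≤ᵇ sames χ i)) * (suc d' * 2 ^ w) ≤ Z)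
 (clusters : ∀ σ k → Tot (suc d') (λ χ → proper χ * 𝟙 ((card (dev σ k χ) ≤ᵇ suc d' * (suc d' * B)) ∧ not (isolated σ k χ))) * 2 ^ w ≤ Tot (suc d') proper)
 (small : 3 * (suc d' * (suc d' * B)) < 2 ^ d')
 (order : ∀ σ k → Tot (suc d') (λ χ → proper χ * 𝟙 (isolated σ k χ)) ≤ 4 * Z)
 (12≤2^w : 12 ≤ 2 ^ w) where

 private
  d : ℕ
  d = suc d'

  many : Fin d → (Vertex d → Fin 3) → ℕ
  many i χ = proper χ * 𝟙 (B ≤ᵇ sames χ i)

  bad : Bool → Fin 3 → (Vertex d → Fin 3) → ℕ
  bad σ k χ = proper χ * 𝟙 ((card (dev σ k χ) ≤ᵇ d * (d * B)) ∧ not (isolated σ k χ))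

  iso : Bool → Fin 3 → (Vertex d → Fin 3) → ℕ
  iso σ k χ = proper χ * 𝟙 (isolated σ k χ)

  Col : ℕ
  Col = Tot d proper

  pointwise : ∀ χ → proper χ * 𝟙 (not (ordered χ)) ≤ ∑ (fins d) (λ i → many i χ) + ∑σk (λ σ k → bad σ k χ)
  pointwise χ = go (bool-cases (ordered χ)) (bool-cases (anyL (fins d) λ i → B ≤ᵇ sames χ i))
   where
   R : ℕ
   R = ∑ (fins d) (λ i → many i χ) + ∑σk (λ σ k → bad σ k χ)
   times-one : ∀ {b} → b ≡ true → proper χ * 𝟙 (not (ordered χ)) ≤ proper χ * 𝟙 b
   times-one e = *-monoʳ-≤ (proper χ) (≤≡ (𝟙≤1 _) (sym (𝟙-true e)))
   go : Cases (ordered χ) → Cases ((anyL (fins d) λ i → B ≤ᵇ sames χ i)) →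
    proper χ * 𝟙 (not (ordered χ)) ≤ R
   go (inj₁ o) _ = ≡≤ (trans (cong (λ b → proper χ * 𝟙 (not b)) o) (*-zeroʳ (proper χ))) z≤n
   go (inj₂ o) (inj₁ m) with anyL⁻ (fins d) {λ i → B ≤ᵇ sames χ i} m
   ... | i , mi , e = ≤-trans (times-one e) (≤-trans (term≤∑ (λ i → many i χ) mi) (m≤m+n _ (∑σk λ σ k → bad σ k χ)))
   go (inj₂ o) (inj₂ m) with Phase.phase χ B (λ i → <⇒≤ (≰⇒> λ h → absurd (anyL⁺ {xs = fins d} {λ i → B ≤ᵇ sames χ i} (∈-fins i) (≤-≤ᵇ h)) m)) small
   ... | σ , k , h = ≤-trans (times-one (∧-true⁺ (≤-≤ᵇ h) (cong not (refute λ e → absurd (anyσk⁺ (λ σ k → isolated σ k χ) σ k e) o))))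
    (≤-trans (term≤∑σk (λ σ k → bad σ k χ) σ k) (m≤n+m _ (∑ (fins d) λ i → many i χ)))

  many-bound : ∑ (fins d) (λ i → Tot d (many i)) * 2 ^ w ≤ Z
  many-bound = *-cancelʳ-≤ _ _ d (begin
   ∑ (fins d) (λ i → Tot d (many i)) * 2 ^ w * d
    ≡⟨ trans (*-assoc (∑ (fins d) λ i → Tot d (many i)) _ _) (trans (cong (∑ (fins d) (λ i → Tot d (many i)) *_) (*-comm (2 ^ w) d)) (sym (∑-*ʳ (d * 2 ^ w) (fins d) λ i → Tot d (many i)))) ⟩
   ∑ (fins d) (λ i → Tot d (many i) * (d * 2 ^ w))
    ≤⟨ ∑-mono (fins d) few ⟩
   ∑ (fins d) (λ _ → Z)
    ≡⟨ trans (∑-const Z (fins d)) (trans (cong (_* Z) (length-fins d)) (*-comm d Z)) ⟩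
   Z * d ∎)


  -- Each of the six pairs (σ , k) accounts for at most 4 Z ordered colourings.
  Col≤ : Col ≤ Disordered d + 24 * Z
  Col≤ = ≤-trans (Tot-mono d {G = λ χ → proper χ * 𝟙 (not (ordered χ)) + ∑σk (λ σ k → iso σ k χ)} λ χ → go χ (bool-cases (ordered χ)))
   (≡≤ (trans (Tot-+ d (λ χ → proper χ * 𝟙 (not (ordered χ))) (λ χ → ∑σk λ σ k → iso σ k χ)) (cong (Disordered d +_) (Tot-∑σk d iso)))
    (+-monoʳ-≤ (Disordered d) (≤≡ (∑σk-mono order) (trans (∑σk-const (4 * Z)) (sym (*-assoc 6 4 Z))))))
   where
   go : ∀ χ → Cases (ordered χ) → proper χ ≤ proper χ * 𝟙 (not (ordered χ)) + ∑σk (λ σ k → iso σ k χ)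
   go χ (inj₂ e) = ≡≤ (sym (trans (cong (λ b → proper χ * 𝟙 (not b)) e) (*-identityʳ (proper χ)))) (m≤m+n _ (∑σk λ σ k → iso σ k χ))
   go χ (inj₁ e) with anyσk⁻ (λ σ k → isolated σ k χ) e
   ... | σ , k , h = ≡≤ (sym (trans (cong (λ b → proper χ * 𝟙 b) h) (*-identityʳ (proper χ))))
    (≤-trans (term≤∑σk (λ σ k → iso σ k χ) σ k) (m≤n+m _ (proper χ * 𝟙 (not (ordered χ)))))

 -- The cluster bound is relative to a total that contains the disordered colourings themselves.
 -- With D their number, D 2^w ≤ Z + 6 (D + 24 Z) = 145 Z + 6 D; doubling this and absorbing 12 D ≤
 -- D 2^w leaves 290 Z.
 disordered-bound : Disordered d * 2 ^ w ≤ 290 * Z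
 disordered-bound = +-cancelʳ-≤ (12 * Disordered d) _ _ (begin
  Disordered d * 2 ^ w + 12 * Disordered d
   ≤⟨ +-monoʳ-≤ (Disordered d * 2 ^ w) (≤≡ (*-monoˡ-≤ (Disordered d) 12≤2^w) (*-comm (2 ^ w) _)) ⟩
  Disordered d * 2 ^ w + Disordered d * 2 ^ w
   ≤⟨ +-mono-≤ main main ⟩
  (Z + 6 * (Disordered d + 24 * Z)) + (Z + 6 * (Disordered d + 24 * Z))
   ≡⟨ l Z (Disordered d) ⟩
  290 * Z + 12 * Disordered d ∎)
  where
  l : ∀ z n → (z + 6 * (n + 24 * z)) + (z + 6 * (n + 24 * z)) ≡ 290 * z + 12 * n
  l = solve-∀
  main : Disordered d * 2 ^ w ≤ Z + 6 * (Disordered d + 24 * Z)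
  main = begin
   Disordered d * 2 ^ w
    ≤⟨ *-monoˡ-≤ (2 ^ w) (≤≡ (Tot-mono d pointwise) (trans (Tot-+ d (λ χ → ∑ (fins d) λ i → many i χ) (λ χ → ∑σk λ σ k → bad σ k χ))
     (cong₂ _+_ (Tot-∑ d (fins d) many) (Tot-∑σk d bad)))) ⟩
   (∑ (fins d) (λ i → Tot d (many i)) + ∑σk (λ σ k → Tot d (bad σ k))) * 2 ^ w
    ≡⟨ trans (*-distribʳ-+ (2 ^ w) (∑ (fins d) λ i → Tot d (many i)) _) (cong (∑ (fins d) (λ i → Tot d (many i)) * 2 ^ w +_) (sym (∑σk-*ʳ (2 ^ w) λ σ k → Tot d (bad σ k)))) ⟩
   ∑ (fins d) (λ i → Tot d (many i)) * 2 ^ w + ∑σk (λ σ k → Tot d (bad σ k) * 2 ^ w)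
    ≤⟨ +-mono-≤ many-bound (≤≡ (∑σk-mono clusters) (∑σk-const Col)) ⟩
   Z + 6 * Col
    ≤⟨ +-monoʳ-≤ Z (*-monoʳ-≤ 6 Col≤) ⟩
   Z + 6 * (Disordered d + 24 * Z) ∎

-- Choice of the parameters.

n<2^n : ∀ n → n < 2 ^ n
n<2^n zero = s≤s z≤n
n<2^n (suc n) = ≡≤ (sym (+-comm (suc n) 1)) (+-mono-≤ (n<2^n n) (≤-trans (m^n>0 2 n) (m≤m+n _ 0)))

quadratic≤2^ : ∀ y → (5 + y) * (6 + y) ≤ 2 ^ (5 + y)
quadratic≤2^ zero = m≤m+n 30 2
quadratic≤2^ (suc y) = ≤-trans (m≤m+n _ (18 + (9 * y + y * y))) (≡≤ (l y) (*-monoʳ-≤ 2 (quadratic≤2^ y)))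
 where
 l : ∀ y → (6 + y) * (7 + y) + (18 + (9 * y + y * y)) ≡ 2 * ((5 + y) * (6 + y))
 l = solve-∀

-- x ≤ p(y+1) ≤ y(y+1) ≤ 2^y for y = ⌊x/p⌋, and the p-th power of this is the claim.
power≤2^ : ∀ p .⦃ _ : NonZero p ⦄ x → p * (p + 5) ≤ x → x ^ p ≤ 2 ^ x
power≤2^ p x hx = begin
 x ^ p          ≤⟨ ^-monoˡ-≤ p x≤2^y ⟩
 (2 ^ y) ^ p    ≡⟨ ^-*-assoc 2 y p ⟩
 2 ^ (y * p)    ≤⟨ ^-monoʳ-≤ 2 (≤≡ (m≤n+m (y * p) (x % p)) (sym (m≡m%n+[m/n]*n x p))) ⟩
 2 ^ x          ∎
 where
 y : ℕ
 y = x / p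
 x≤ : x < p * suc y
 x≤ = ≡≤ (cong suc (m≡m%n+[m/n]*n x p)) (≤≡ (+-monoˡ-≤ (y * p) (m%n<n x p)) (*-comm (suc y) p))
 p+5≤y : p + 5 ≤ y
 p+5≤y = s≤s⁻¹ (*-cancelˡ-< p (p + 5) (suc y) (≤-<-trans hx x≤))
 x≤2^y : x ≤ 2 ^ y
 x≤2^y = ≤-trans (<⇒≤ x≤) (≤-trans (*-monoˡ-≤ (suc y) (≤-trans (m≤m+n p 5) p+5≤y))
  (subst (λ y → y * suc y ≤ 2 ^ y) (m+[n∸m]≡n (≤-trans (m≤n+m 5 p) p+5≤y)) (quadratic≤2^ (y ∸ 5))))

-- Rests on 2 · 27^5 ≤ 32^5, raised to the power x.
gap : ∀ x n → 5 * x ≤ n → 2 ^ x * 27 ^ n ≤ 32 ^ n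
gap x n h = subst (λ n → 2 ^ x * 27 ^ n ≤ 32 ^ n) (m+[n∸m]≡n h) (begin
 2 ^ x * 27 ^ (5 * x + (n ∸ 5 * x))
  ≡⟨ cong (2 ^ x *_) (^-distribˡ-+-* 27 (5 * x) _) ⟩
 2 ^ x * (27 ^ (5 * x) * 27 ^ (n ∸ 5 * x))
  ≡⟨ sym (*-assoc (2 ^ x) _ _) ⟩
 2 ^ x * 27 ^ (5 * x) * 27 ^ (n ∸ 5 * x)
  ≡⟨ cong (λ t → 2 ^ x * t * 27 ^ (n ∸ 5 * x)) (sym (^-*-assoc 27 5 x)) ⟩
 2 ^ x * (27 ^ 5) ^ x * 27 ^ (n ∸ 5 * x)
  ≤⟨ *-mono-≤ (≡≤ (sym (^-distrib-* x 2 (27 ^ 5))) (^-monoˡ-≤ x (≤ᵇ⇒≤ (2 * 27 ^ 5) (32 ^ 5) tt))) (^-monoˡ-≤ (n ∸ 5 * x) (m≤m+n 27 5)) ⟩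
 (32 ^ 5) ^ x * 32 ^ (n ∸ 5 * x)
  ≡⟨ cong (_* 32 ^ (n ∸ 5 * x)) (^-*-assoc 32 5 x) ⟩
 32 ^ (5 * x) * 32 ^ (n ∸ 5 * x)
  ≡⟨ sym (^-distribˡ-+-* 32 (5 * x) _) ⟩
 32 ^ (5 * x + (n ∸ 5 * x)) ∎)


cube : ℕ → CubeData
cube d'' = record
 { d = suc (suc d'') ; N = 2 ^ suc d'' ; h = 2 ^ d'' ; i₀ = zero ; i₁ = 1F ; i₀≢i₁ = λ () ; 2^d = refl ; N≡ = refl
 ; 1≤h = m^n>0 2 d'' ; side = card-on (suc d'') }

isolated-total : ∀ Q σ k → let open CubeData Q in Tot d (λ χ → proper χ * 𝟙 (isolated σ k χ)) ≤ 4 * 2 ^ N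
isolated-total Q σ k = ≤-trans (Tot-mono d λ χ → ≤-reflexive (sym (trans (cong (proper χ * 𝟙 (isolated σ k χ) *_) (cong₂ _*_ (∏-one onL) (∏-one offL))) (*-identityʳ _))))
 (Estimates.Side.iso-upper₄ Q σ k (λ _ → true) refl)
 where
 open CubeData Q
 open Pattern Q σ k using (onL; offL)

-- Here u and t are d/48 and d/s rounded down. The choice m = 4u leaves n ≥ 44u, enough for 10 (m +
-- 4) ≤ n, which `gap` needs for K = 2^(m+4). With w = 4t the requirement 10000 w ≤ d gives s =
-- 40000, and J = 2s yields wJ ≥ 4d.
record Regime : Set where
 field
  s J t u m' k : ℕ
  s≡ : 40000 ≡ s
  J≡ : J ≡ 2 * s
  m≡ : suc m' ≡ 4 * u
  48u≤d : 48 * u ≤ suc (k + suc m')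
  d≤ : suc (k + suc m') ≤ 48 * suc u
  st≤d : s * t ≤ suc (k + suc m')
  d≤st : suc (k + suc m') ≤ s * suc t
  5000≤t : 5000 ≤ t
  2s≤t : 2 * s ≤ t
  t≤u : t ≤ u
  u-power : u ^ 9 ≤ 2 ^ u
  t-power : t ^ (9 * (2 * J)) ≤ 2 ^ t

module Parameters (P : Regime) where
 open Regime P

 private

  d' d m n w B R K : ℕ
  d' = k + suc m'
  d = suc d'
  m = suc m'
  n = suc k
  w = 4 * t
  R = 2 ^ k
  -- The threshold 24 a R of `few-sames` with a = 16m.
  B = 24 * (16 * m) * R
  K = 2 ^ (m + 4)

  5000≤u : 5000 ≤ u
  5000≤u = ≤-trans 5000≤t t≤u

  const≤ : ∀ c → T (c ≤ᵇ 5000) → c ≤ u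
  const≤ c h = ≤-trans (≤ᵇ⇒≤ c 5000 h) 5000≤u

  u≢0 : NonZero u
  u≢0 = >-nonZero (const≤ 1 tt)

  1≤t : 1 ≤ t
  1≤t = ≤-trans (≤ᵇ⇒≤ 1 5000 tt) 5000≤t

  J≤t : J ≤ t
  J≤t = ≡≤ J≡ 2s≤t

  1≤s : 1 ≤ s
  1≤s = ≤≡ (≤ᵇ⇒≤ 1 40000 tt) s≡

  n+4u : n + 4 * u ≡ d
  n+4u = cong (n +_) (sym m≡)

  44u≤n : 44 * u ≤ n
  44u≤n = +-cancelʳ-≤ (4 * u) _ _ (≡≤ (l u) (≤≡ 48u≤d (sym n+4u)))
   where
   l : ∀ u → 44 * u + 4 * u ≡ 48 * u
   l = solve-∀

  k≤ : k ≤ 44 * u + 47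
  k≤ = s≤s⁻¹ (+-cancelʳ-≤ (4 * u) _ _ (≡≤ n+4u (≤≡ d≤ (l u))))
   where
   l : ∀ u → 48 * suc u ≡ suc (44 * u + 47) + 4 * u
   l = solve-∀

  d≤uu : d ≤ u * u
  d≤uu = ≤-trans d≤ (≤-trans (*-monoʳ-≤ 48 (≤≡ (+-monoˡ-≤ u (const≤ 1 tt)) (sym (cong (u +_) (+-identityʳ u))))) (≡≤ (sym (*-assoc 48 2 u)) (*-monoˡ-≤ u (const≤ 96 tt))))

  d≤tt : d ≤ t * t
  d≤tt = ≤-trans d≤st (≤-trans (*-monoʳ-≤ s (≤≡ (+-monoˡ-≤ t (1≤t)) (sym (cong (t +_) (+-identityʳ t)))))
   (≡≤ (l s t) (*-monoˡ-≤ t 2s≤t)))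
   where
   l : ∀ s t → s * (2 * t) ≡ 2 * s * t
   l = solve-∀

  d≤tJ : d ≤ t * J
  d≤tJ = ≤-trans d≤st (≤≡ (*-monoʳ-≤ s (≤≡ (+-monoˡ-≤ t (1≤t)) (sym (cong (t +_) (+-identityʳ t)))))
   (trans (l s t) (cong (t *_) (sym J≡))))
   where
   l : ∀ s t → s * (2 * t) ≡ t * (2 * s)
   l = solve-∀

  poly : ∀ x → x ≤ u ^ 9 → x ≤ 2 ^ u
  poly x h = ≤-trans h u-power

  u^ : ∀ {i j} → i ≤ j → u ^ i ≤ u ^ j
  u^ = ^-monoʳ-≤ u ⦃ u≢0 ⦄

  -- 4608 = 3 · 24 · 16 · 4 is the constant of 3 d τ with τ = d² B and m = 4u; since B has only the
  -- exponential factor 2^k, u further bits absorb the rest.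
  4608d³u : 4608 * (d * (d * (d * u))) ≤ 2 ^ u
  4608d³u = poly _ (≤-trans (*-mono-≤ (const≤ 4608 tt) (*-mono-≤ d≤uu (*-mono-≤ d≤uu (*-monoˡ-≤ u d≤uu)))) (≡≤ (l u) (u^ {8} {9} (n≤1+n 8))))
   where
   l : ∀ u → u * (u * u * (u * u * (u * u * u))) ≡ u * (u * (u * (u * (u * (u * (u * (u * 1)))))))
   l = solve-∀

  τ≡ : d * (d * B) ≡ 1536 * (d * (d * u)) * R
  τ≡ = trans (cong (λ m → d * (d * (24 * (16 * m) * R))) m≡) (l d u R)
   where
   l : ∀ d u R → d * (d * (24 * (16 * (4 * u)) * R)) ≡ 1536 * (d * (d * u)) * R
   l = solve-∀

  few-sames-total : ∀ i → Tot d (λ χ → proper χ * 𝟙 (B ≤ᵇ sames χ i)) * (d * 2 ^ w) ≤ 2 ^ (2 ^ d')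
  few-sames-total i = subst (λ X → X * (d * 2 ^ w) ≤ 2 ^ (2 ^ d')) (few-sames-direction {d} B (n Fin.↑ʳ zero {m'}) i)
   (*-cancelˡ-≤ 2 (begin
    2 * (X * (d * 2 ^ w))
     ≡⟨ l X d (2 ^ w) ⟩
    X * (2 * (d * 2 ^ w))
     ≤⟨ *-monoʳ-≤ X room ⟩
    X * 4 ^ R
     ≤⟨ Markov.few-sames m' k K (m^n>0 2 (m + 4)) gap' (≤≡ (*-mono-≤ (m≤m+n 10 6) (treeSize≤2^ m)) (trans (*-comm 16 (2 ^ m)) (sym (^-distribˡ-+-* 2 m 4)))) small ⟩
    2 * (4 ^ (2 ^ m')) ^ R
     ≡⟨ cong (2 *_) total ⟩
    2 * 2 ^ (2 ^ d') ∎))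
   where
   X : ℕ
   X = Tot d (λ χ → proper χ * 𝟙 (B ≤ᵇ sames χ (n Fin.↑ʳ zero {m'})))
   l : ∀ x d z → 2 * (x * (d * z)) ≡ x * (2 * (d * z))
   l = solve-∀
   total : (4 ^ (2 ^ m')) ^ R ≡ 2 ^ (2 ^ d')
   total = trans (^-*-assoc 4 (2 ^ m') R) (trans (^-*-assoc 2 2 (2 ^ m' * R)) (cong (2 ^_) (trans (sym (*-assoc 2 (2 ^ m') R)) (trans (*-comm (2 ^ m) R) (sym (^-distribˡ-+-* 2 k m))))))
   gap' : K * K * 27 ^ n ≤ 32 ^ n
   gap' = ≡≤ (cong (_* 27 ^ n) (sym (^-distribˡ-+-* 2 (m + 4) (m + 4)))) (gap ((m + 4) + (m + 4)) n
    (≡≤ (trans (cong (λ m → 5 * ((m + 4) + (m + 4))) m≡) (l' u)) (≤-trans (+-monoʳ-≤ (40 * u) (*-monoʳ-≤ 4 (const≤ 10 tt))) (≡≤ (l'' u) 44u≤n))))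
    where
    l' : ∀ u → 5 * ((4 * u + 4) + (4 * u + 4)) ≡ 40 * u + 4 * 10
    l' = solve-∀
    l'' : ∀ u → 40 * u + 4 * u ≡ 44 * u
    l'' = solve-∀
   small : 12 * 2 ^ m ≤ 2 ^ n
   small = ≤-trans (*-monoˡ-≤ (2 ^ m) (m≤m+n 12 4)) (≡≤ (sym (^-distribˡ-+-* 2 4 m)) (^-monoʳ-≤ 2 (≡≤ (cong (4 +_) m≡) (≤-trans (+-monoˡ-≤ (4 * u) (const≤ 4 tt)) (≤-trans (*-monoˡ-≤ u (m≤m+n 5 39)) 44u≤n)))))
   room : 2 * (d * 2 ^ w) ≤ 4 ^ R
   room = begin
    2 * (d * 2 ^ w)
     ≤⟨ *-monoʳ-≤ 2 (*-monoˡ-≤ (2 ^ w) (<⇒≤ (n<2^n d))) ⟩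
    2 * (2 ^ d * 2 ^ w)
     ≡⟨ cong (2 *_) (sym (^-distribˡ-+-* 2 d w)) ⟩
    2 ^ suc (d + w)
     ≤⟨ ^-monoʳ-≤ 2 exponent ⟩
    2 ^ (2 * R)
     ≡⟨ sym (^-*-assoc 2 2 R) ⟩
    4 ^ R ∎
    where
    l' : ∀ u → suc (48 * suc u + 4 * u) ≡ 52 * u + 49
    l' = solve-∀
    l'' : ∀ u → 53 * u + 35 * u ≡ 2 * (44 * u)
    l'' = solve-∀
    exponent : suc (d + w) ≤ 2 * R
    exponent = ≤-trans (s≤s (+-mono-≤ d≤ (*-monoʳ-≤ 4 t≤u))) (≡≤ (l' u) (≤-trans (+-monoʳ-≤ (52 * u) (const≤ 49 tt)) (≡≤ (+-comm (52 * u) u)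
     (≤-trans (m≤m+n (53 * u) (35 * u)) (≡≤ (l'' u) (*-monoʳ-≤ 2 (≤-trans 44u≤n (n<2^n k))))))))

  3τ<2^d' : 3 * (d * (d * B)) < 2 ^ d'
  3τ<2^d' = begin-strict
   3 * (d * (d * B))
    ≡⟨ trans (cong (3 *_) τ≡) (l (d * (d * u)) R) ⟩
   4608 * (d * (d * u)) * R
    <⟨ *-monoˡ-< R ⦃ m^n≢0 2 k ⦄ (≤-<-trans (≤-trans (*-monoʳ-≤ 4608 (m≤n*m (d * (d * u)) d)) 4608d³u) (^-monoʳ-< 2 (s≤s (s≤s z≤n)) u<m)) ⟩
   2 ^ m * R
    ≡⟨ trans (*-comm (2 ^ m) R) (sym (^-distribˡ-+-* 2 k m)) ⟩
   2 ^ d' ∎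
   where
   l : ∀ x R → 3 * (1536 * x * R) ≡ 4608 * x * R
   l = solve-∀
   u<m : u < m
   u<m = ≤≡ (≤-trans (+-monoˡ-≤ u (const≤ 1 tt)) (+-monoʳ-≤ u (m≤m+n u _))) (sym m≡)

  dense : 3 * (d * (d * (d * B))) ≤ 2 ^ (k + u)
  dense = ≡≤ (trans (cong (λ x → 3 * (d * x)) τ≡) (l d u R)) (≤≡ (*-monoʳ-≤ R 4608d³u) (sym (^-distribˡ-+-* 2 k u)))
   where
   l : ∀ d u R → 3 * (d * (1536 * (d * (d * u)) * R)) ≡ R * (4608 * (d * (d * (d * u))))
   l = solve-∀

  sparse : 3 * (d * J) ≤ 2 ^ (12 * u)
  sparse = ≤-trans (poly _ (≤-trans (*-mono-≤ (const≤ 3 tt) (*-mono-≤ d≤uu (≤-trans J≤t t≤u))) (≡≤ (l u) (u^ {4} {9} (m≤m+n 4 5))))) (^-monoʳ-≤ 2 (m≤n*m u 12))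
   where
   l : ∀ u → u * (u * u * u) ≡ u * (u * (u * (u * 1)))
   l = solve-∀

  -- k + u = d - 1 - 3u, and 3u is about d/16, more than the d/20 to be spared.
  20L₂ : 20 * (k + u) ≤ 19 * d
  20L₂ = begin
   20 * (k + u)
    ≡⟨ l₁ k u ⟩
   19 * k + (k + 20 * u)
    ≤⟨ +-monoʳ-≤ (19 * k) (+-monoˡ-≤ (20 * u) (≤-trans k≤ (+-monoʳ-≤ (44 * u) (const≤ 47 tt)))) ⟩
   19 * k + ((44 * u + u) + 20 * u)
    ≤⟨ m≤m+n _ (19 + 11 * u) ⟩
   19 * k + ((44 * u + u) + 20 * u) + (19 + 11 * u)
    ≡⟨ l₂ k u ⟩
   19 * (suc k + 4 * u)
    ≡⟨ cong (19 *_) n+4u ⟩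
   19 * d ∎
   where
   l₁ : ∀ k u → 20 * (k + u) ≡ 19 * k + (k + 20 * u)
   l₁ = solve-∀
   l₂ : ∀ k u → 19 * k + ((44 * u + u) + 20 * u) + (19 + 11 * u) ≡ 19 * (suc k + 4 * u)
   l₂ = solve-∀

  codes-few : suc (d ^ 4) ^ (2 * J) ≤ 2 ^ w
  codes-few = ≤-trans (^-monoˡ-≤ (2 * J) one-code) (≡≤ (^-*-assoc t 9 (2 * J)) (≤-trans t-power (^-monoʳ-≤ 2 (m≤n*m t 4))))
   where
   2≤t : 2 ≤ t
   2≤t = ≤-trans (≤ᵇ⇒≤ 2 5000 tt) 5000≤t
   l : ∀ t → (t * t) * ((t * t) * ((t * t) * ((t * t) * 1))) ≡ t * (t * (t * (t * (t * (t * (t * (t * 1)))))))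
   l = solve-∀
   one-code : suc (d ^ 4) ≤ t ^ 9
   one-code = begin
    suc (d ^ 4)
     ≤⟨ s≤s (≤≡ (^-monoˡ-≤ 4 d≤tt) (l t)) ⟩
    1 + t ^ 8
     ≤⟨ +-monoˡ-≤ (t ^ 8) (m^n>0 t ⦃ >-nonZero 1≤t ⦄ 8) ⟩
    t ^ 8 + t ^ 8
     ≡⟨ cong (t ^ 8 +_) (sym (+-identityʳ (t ^ 8))) ⟩
    2 * t ^ 8
     ≤⟨ *-monoˡ-≤ (t ^ 8) 2≤t ⟩
    t ^ 9 ∎

  slack₁ : 4 * J * 2 ^ (2 * w) ≤ 2 ^ (24 * u)
  slack₁ = ≤-trans (*-monoˡ-≤ (2 ^ (2 * w)) (≤-trans (*-mono-≤ {4} (const≤ 4 tt) (≤-trans J≤t t≤u)) (poly _ (≡≤ (cong (u *_) (sym (*-identityʳ u))) (u^ {2} {9} (m≤m+n 2 7))))))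
   (≡≤ (sym (^-distribˡ-+-* 2 u (2 * w))) (^-monoʳ-≤ 2 (≤-trans (+-monoʳ-≤ u (*-monoʳ-≤ 2 (*-monoʳ-≤ 4 t≤u))) (≤≡ (m≤m+n _ (15 * u)) (l u)))))
   where
   l : ∀ u → u + 2 * (4 * u) + 15 * u ≡ 24 * u
   l = solve-∀

  slack₂ : 800 * 2 ^ w ≤ 2 ^ (2 * d)
  slack₂ = ≤-trans (*-monoˡ-≤ (2 ^ w) (≤ᵇ⇒≤ 800 (2 ^ 10) tt)) (≡≤ (sym (^-distribˡ-+-* 2 10 w)) (^-monoʳ-≤ 2
   (≤-trans (+-mono-≤ (const≤ 10 tt) (*-monoʳ-≤ 4 t≤u)) (≤-trans (m≤m+n _ (43 * u)) (≡≤ (l u) (≤-trans 48u≤d (m≤n*m d 2)))))))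
   where
   l : ∀ u → u + 4 * u + 43 * u ≡ 48 * u
   l = solve-∀

  12≤2^w : 12 ≤ 2 ^ w
  12≤2^w = ≤-trans (m≤m+n 12 4) (^-monoʳ-≤ 2 {4} (*-monoʳ-≤ 4 (1≤t)))

  clusters-total : ∀ σ c → Tot d (λ χ → proper χ * 𝟙 ((card (dev σ c χ) ≤ᵇ d * (d * B)) ∧ not (isolated σ c χ))) * 2 ^ w ≤ Tot d proper
  clusters-total σ c = Union.clusters (record
   { d' = d' ; τ = d * (d * B) ; w = w ; r = 24 * u ; J = J ; L₁ = 12 * u ; L₂ = k + u
   ; 600≤d = ≤-trans (const≤ 600 tt) (≤-trans (m≤n*m u 48) 48u≤d)
   ; 1≤w = *-mono-≤ {1} {4} (s≤s z≤n) (1≤t)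
   ; w≤d = subst (_≤ d) (trans (cong (_* t) (sym s≡)) (*-assoc 10000 4 t)) st≤d
   ; 2r≤d = ≡≤ (sym (*-assoc 2 24 u)) 48u≤d
   ; 4d≤wJ = ≤≡ (*-monoʳ-≤ 4 d≤tJ) (sym (*-assoc 4 t J))
   ; hL₁ = ≡≤ (sym (*-assoc 4 12 u)) 48u≤d
   ; hL₂ = 20L₂ ; sparse-size = sparse ; dense-size = dense ; few-codes = codes-few ; slack₁ = slack₁ ; slack₂ = slack₂
   ; 1≤J = ≤-trans 1≤s (≤≡ (m≤n*m s 2) (sym J≡)) }) σ c

 disordered : (∀ σ c → Tot d (λ χ → proper χ * 𝟙 (isolated σ c χ)) ≤ 4 * 2 ^ (2 ^ d')) → Disordered d * 2 ^ (4 * t) ≤ 290 * 2 ^ (2 ^ d')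
 disordered order = Disorder.disordered-bound {d'} B w (2 ^ (2 ^ d')) few-sames-total clusters-total 3τ<2^d' order 12≤2^w

disordered-decay : ∀ s → 40000 ≡ s → ∃ λ t₀ → ∀ t d'' → t₀ ≤ t → s * t ≤ suc (suc d'') → suc (suc d'') ≤ s * suc t →
 Disordered (suc (suc d'')) * 2 ^ (4 * t) ≤ 290 * 2 ^ (2 ^ suc d'')
-- The first two summands are the thresholds of `power≤2^`: exponent p = 9 · 2J for the number of
-- codes, and exponent 9 for the polynomials in u. The last one covers the `Regime` bounds 5000 ≤ t
-- and 2s ≤ t.
disordered-decay s s≡ = p * (p + 5) + (9 * 14 + (5000 + 2 * s)) , λ t d'' h st d≤ →
 let
  d = suc (suc d'')
  u = d / 48
  48u≤d : 48 * u ≤ d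
  48u≤d = ≡≤ (*-comm 48 u) (≤≡ (m≤n+m (u * 48) (d % 48)) (sym (m≡m%n+[m/n]*n d 48)))
  d≤48 : d ≤ 48 * suc u
  d≤48 = ≡≤ (m≡m%n+[m/n]*n d 48) (≤≡ (+-monoˡ-≤ (u * 48) (<⇒≤ (m%n<n d 48))) (*-comm (suc u) 48))
  h₁ = ≤-trans (m≤m+n (p * (p + 5)) _) h
  h₂ = ≤-trans (m≤n+m (9 * 14 + (5000 + 2 * s)) (p * (p + 5))) h
  h₃ = ≤-trans (m≤n+m (5000 + 2 * s) (9 * 14)) h₂
  5000≤t = ≤-trans (m≤m+n 5000 (2 * s)) h₃
  t≤u : t ≤ u
  t≤u = s≤s⁻¹ (*-cancelˡ-< 48 t (suc u) (≤-trans (s≤s (*-monoˡ-≤ t (≤≡ (≤ᵇ⇒≤ 48 40000 tt) s≡))) (≤-trans (s≤s st) (strict d))))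
  1≤u = ≤-trans (≤ᵇ⇒≤ 1 5000 tt) (≤-trans 5000≤t t≤u)
  m' = pred (4 * u)
  m≡ : suc m' ≡ 4 * u
  m≡ = suc-pred (4 * u) ⦃ >-nonZero (*-mono-≤ {1} {4} (s≤s z≤n) 1≤u) ⦄
  4u<d : suc m' < d
  4u<d = ≤-trans (s≤s (≤-reflexive m≡)) (≤-trans (+-monoˡ-≤ (4 * u) 1≤u) (≤-trans (*-monoˡ-≤ u (m≤m+n 5 43)) 48u≤d))
  k = d ∸ suc (suc m')
  d≡ : suc (k + suc m') ≡ d
  d≡ = trans (sym (+-suc k (suc m'))) (m∸n+n≡m 4u<d)
 in subst (λ d' → (∀ σ c → Tot (suc d') (λ χ → proper χ * 𝟙 (isolated σ c χ)) ≤ 4 * 2 ^ (2 ^ d')) → Disordered (suc d') * 2 ^ (4 * t) ≤ 290 * 2 ^ (2 ^ d')) (suc-injective d≡)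
  (Parameters.disordered (record { s = s ; J = 2 * s ; t = t ; u = u ; m' = m' ; k = k ; s≡ = s≡ ; J≡ = refl ; m≡ = m≡
   ; 48u≤d = subst (48 * u ≤_) (sym d≡) 48u≤d ; d≤ = subst (_≤ 48 * suc u) (sym d≡) d≤48 ; st≤d = subst (s * t ≤_) (sym d≡) st ; d≤st = subst (_≤ s * suc t) (sym d≡) d≤
   ; 5000≤t = 5000≤t ; 2s≤t = ≤-trans (m≤n+m (2 * s) 5000) h₃ ; t≤u = t≤u
   ; u-power = power≤2^ 9 u (≤-trans (≤-trans (m≤m+n (9 * 14) _) h₂) t≤u) ; t-power = power≤2^ p ⦃ p≢0 ⦄ t h₁ }))
  (isolated-total (cube d''))
 where
 p : ℕ
 p = 9 * (2 * (2 * s))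
 p≢0 : NonZero p
 p≢0 = m*n≢0 9 (2 * (2 * s)) ⦃ _ ⦄ ⦃ m*n≢0 2 (2 * s) ⦃ _ ⦄ ⦃ m*n≢0 2 s ⦃ _ ⦄ ⦃ subst NonZero s≡ _ ⦄ ⦄ ⦄
 strict : ∀ d → d < 48 * suc (d / 48)
 strict d = ≤-trans (s≤s (≤-reflexive (m≡m%n+[m/n]*n d 48))) (≤≡ (+-monoˡ-≤ (d / 48 * 48) (m%n<n d 48)) (*-comm (suc (d / 48)) 48))

-- Partial sums of the exponential series.

-- The partial sum Σ_{k≤m} (p/D)^k/k! of the exponential series is series p m / scaleᴰ m.
module Series (D : ℕ) where

 scaleᴰ : ℕ → ℕ
 scaleᴰ zero = 1
 scaleᴰ (suc m) = suc m * D * scaleᴰ m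

 series : ℕ → ℕ → ℕ
 series p zero = 1
 series p (suc m) = suc m * D * series p m + p ^ suc m

 series-zero : ∀ m → series 0 m ≡ scaleᴰ m
 series-zero zero = refl
 series-zero (suc m) = trans (+-identityʳ _) (cong (suc m * D *_) (series-zero m))

 power-below : ∀ a y k → a ^ suc k + suc k * y * a ^ k ≤ (a + y) ^ suc k
 power-below a y zero = ≤-reflexive (l a y)
  where
  l : ∀ a y → a * 1 + 1 * y * 1 ≡ (a + y) * 1
  l = solve-∀
 power-below a y (suc k) = begin
  a * (a * a ^ k) + suc (suc k) * y * (a * a ^ k)  ≤⟨ m≤m+n _ (suc k * y * y * a ^ k) ⟩
  a * (a * a ^ k) + suc (suc k) * y * (a * a ^ k) + suc k * y * y * a ^ k  ≡⟨ l a y k (a ^ k) ⟩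
  (a + y) * (a * a ^ k + suc k * y * a ^ k)        ≤⟨ *-monoʳ-≤ (a + y) (power-below a y k) ⟩
  (a + y) ^ suc (suc k)                            ∎
  where
  l : ∀ a y k x → a * (a * x) + (2 + k) * y * (a * x) + (1 + k) * y * y * x ≡ (a + y) * (a * x + (1 + k) * y * x)
  l = solve-∀

 power-above : ∀ a y k → (a + y) ^ suc k ≤ a ^ suc k + suc k * y * (a + y) ^ k
 power-above a y zero = ≤-reflexive (l a y)
  where
  l : ∀ a y → (a + y) * 1 ≡ a * 1 + 1 * y * 1
  l = solve-∀
 power-above a y (suc k) = begin
  (a + y) * (a + y) ^ suc k
   ≡⟨ *-distribʳ-+ ((a + y) ^ suc k) a y ⟩
  a * (a + y) ^ suc k + y * (a + y) ^ suc k
   ≤⟨ +-monoˡ-≤ (y * (a + y) ^ suc k) (*-monoʳ-≤ a (power-above a y k)) ⟩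
  a * (a ^ suc k + suc k * y * (a + y) ^ k) + y * (a + y) ^ suc k
   ≤⟨ m≤m+n _ (suc k * y * y * (a + y) ^ k) ⟩
  a * (a ^ suc k + suc k * y * (a + y) ^ k) + y * ((a + y) * (a + y) ^ k) + suc k * y * y * (a + y) ^ k
   ≡⟨ l a y k (a ^ suc k) ((a + y) ^ k) ⟩
  a * a ^ suc k + suc (suc k) * y * ((a + y) * (a + y) ^ k) ∎
  where
  l : ∀ a y k A x → a * (A + (1 + k) * y * x) + y * ((a + y) * x) + (1 + k) * y * y * x ≡ a * A + (2 + k) * y * ((a + y) * x)
  l = solve-∀

 -- With e_m the partial sum of order m, this is e_(m+1)(x + h) ≥ e_(m+1)(x) + h e_m(x) for x = a/D
 -- and h = y/D: the derivative of e_(m+1) is e_m, which increases. `series-above` takes e_m at the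
 -- other end.
 series-below : ∀ a y m → series a (suc m) + suc m * y * series a m ≤ series (a + y) (suc m)
 series-below a y zero = ≤-reflexive (l a y D)
  where
  l : ∀ a y D → 1 * D * 1 + a * 1 + 1 * y * 1 ≡ 1 * D * 1 + (a + y) * 1
  l = solve-∀
 series-below a y (suc m) = begin
  suc (suc m) * D * u + a ^ suc (suc m) + suc (suc m) * y * (suc m * D * v + a ^ suc m)
   ≡⟨ l D y m u v (a ^ suc (suc m)) (a ^ suc m) ⟩
  suc (suc m) * D * (u + suc m * y * v) + (a ^ suc (suc m) + suc (suc m) * y * a ^ suc m)
   ≤⟨ +-mono-≤ (*-monoʳ-≤ (suc (suc m) * D) (series-below a y m)) (power-below a y (suc m)) ⟩
  series (a + y) (suc (suc m)) ∎
  where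
  u v : ℕ
  u = series a (suc m)
  v = series a m
  l : ∀ D y m u v A B → (2 + m) * D * u + A + (2 + m) * y * ((1 + m) * D * v + B) ≡ (2 + m) * D * (u + (1 + m) * y * v) + (A + (2 + m) * y * B)
  l = solve-∀

 series-above : ∀ a y m → series (a + y) (suc m) ≤ series a (suc m) + suc m * y * series (a + y) m
 series-above a y zero = ≤-reflexive (l a y D)
  where
  l : ∀ a y D → 1 * D * 1 + (a + y) * 1 ≡ 1 * D * 1 + a * 1 + 1 * y * 1
  l = solve-∀
 series-above a y (suc m) = begin
  suc (suc m) * D * series (a + y) (suc m) + (a + y) ^ suc (suc m)
   ≤⟨ +-mono-≤ (*-monoʳ-≤ (suc (suc m) * D) (series-above a y m)) (power-above a y (suc m)) ⟩
  suc (suc m) * D * (series a (suc m) + suc m * y * v) + (a ^ suc (suc m) + suc (suc m) * y * (a + y) ^ suc m)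
   ≡⟨ l D y m (series a (suc m)) v (a ^ suc (suc m)) ((a + y) ^ suc m) ⟩
  suc (suc m) * D * series a (suc m) + a ^ suc (suc m) + suc (suc m) * y * (suc m * D * v + (a + y) ^ suc m) ∎
  where
  v : ℕ
  v = series (a + y) m
  l : ∀ D y m u v A B → (2 + m) * D * (u + (1 + m) * y * v) + (A + (2 + m) * y * B) ≡ (2 + m) * D * u + A + (2 + m) * y * ((1 + m) * D * v + B)
  l = solve-∀

 -- From `series-above` and e_m ≤ e_(m+1) at the right end. Iterated, it becomes (1 - y/D)^j
 -- e_(m+1)(jy/D) ≤ 1.
 shrink : ∀ c y → D ≡ c + y → ∀ m a → c * series (a + y) (suc m) ≤ D * series a (suc m)
 shrink c y e m a = +-cancelʳ-≤ (y * u) _ _ (begin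
  c * u + y * u
   ≡⟨ trans (sym (*-distribʳ-+ u c y)) (cong (_* u) (sym e)) ⟩
  D * u
   ≤⟨ *-monoʳ-≤ D (series-above a y m) ⟩
  D * (series a (suc m) + suc m * y * series (a + y) m)
   ≡⟨ l D y m (series a (suc m)) (series (a + y) m) ⟩
  D * series a (suc m) + y * (suc m * D * series (a + y) m)
   ≤⟨ +-monoʳ-≤ (D * series a (suc m)) (*-monoʳ-≤ y (m≤m+n _ ((a + y) ^ suc m))) ⟩
  D * series a (suc m) + y * u ∎)
  where
  u : ℕ
  u = series (a + y) (suc m)
  l : ∀ D y m u v → D * (u + (1 + m) * y * v) ≡ D * u + y * ((1 + m) * D * v)
  l = solve-∀

 shrink-power : ∀ c y → D ≡ c + y → ∀ m j → c ^ j * series (j * y) (suc m) ≤ D ^ j * scaleᴰ (suc m)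
 shrink-power c y e m zero = ≤-reflexive (cong (1 *_) (series-zero (suc m)))
 shrink-power c y e m (suc j) = begin
  c * c ^ j * series (y + j * y) (suc m)
   ≡⟨ cong (λ p → c * c ^ j * series p (suc m)) (+-comm y (j * y)) ⟩
  c * c ^ j * series (j * y + y) (suc m)
   ≡⟨ l c (c ^ j) _ ⟩
  c ^ j * (c * series (j * y + y) (suc m))
   ≤⟨ *-monoʳ-≤ (c ^ j) (shrink c y e m (j * y)) ⟩
  c ^ j * (D * series (j * y) (suc m))
   ≡⟨ l′ (c ^ j) D _ ⟩
  D * (c ^ j * series (j * y) (suc m))
   ≤⟨ *-monoʳ-≤ D (shrink-power c y e m j) ⟩
  D * (D ^ j * scaleᴰ (suc m))
   ≡⟨ sym (*-assoc D _ _) ⟩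
  D ^ suc j * scaleᴰ (suc m) ∎
  where
  l : ∀ a b c → a * b * c ≡ b * (a * c)
  l = solve-∀
  l′ : ∀ a b c → a * (b * c) ≡ b * (a * c)
  l′ = solve-∀

 -- The counterpart of `shrink` from `series-below`: e_m falls short of e_(m+1) by the last term,
 -- which is the error y X. Iterated, it bounds (1 + y/D)^j by e_(m+1)(jy/D) plus accumulated
 -- errors.
 grow : ∀ y m a X → a ^ suc m ≤ X → (D + y) * series a (suc m) ≤ D * series (a + y) (suc m) + y * X
 grow y m a X h = begin
  (D + y) * (suc m * D * v + a ^ suc m)
   ≡⟨ l D y m v (a ^ suc m) ⟩
  D * (suc m * D * v + a ^ suc m + suc m * y * v) + y * a ^ suc m
   ≤⟨ +-mono-≤ (*-monoʳ-≤ D (series-below a y m)) (*-monoʳ-≤ y h) ⟩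
  D * series (a + y) (suc m) + y * X ∎
  where
  v : ℕ
  v = series a m
  l : ∀ D y m v A → (D + y) * ((1 + m) * D * v + A) ≡ D * ((1 + m) * D * v + A + (1 + m) * y * v) + y * A
  l = solve-∀

 grow-power : ∀ y m X j → (j * y) ^ suc m ≤ X → (D + y) ^ j * scaleᴰ (suc m) * D ≤ D * (D ^ j * series (j * y) (suc m)) + j * y * X * (D + y) ^ j
 grow-power y m X zero h = ≤-reflexive (trans (cong (λ t → 1 * t * D) (sym (series-zero (suc m)))) (l (series 0 (suc m)) D))
  where
  l : ∀ u D → 1 * u * D ≡ D * (1 * u) + 0
  l = solve-∀
 grow-power y m X (suc j) h = begin
  (D + y) * (D + y) ^ j * scaleᴰ (suc m) * D
   ≡⟨ l₁ (D + y) ((D + y) ^ j) (scaleᴰ (suc m)) D ⟩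
  (D + y) * ((D + y) ^ j * scaleᴰ (suc m) * D)
   ≤⟨ *-monoʳ-≤ (D + y) (grow-power y m X j hj) ⟩
  (D + y) * (D * (D ^ j * series (j * y) (suc m)) + j * y * X * (D + y) ^ j)
   ≡⟨ l₂ (D + y) D (D ^ j) (series (j * y) (suc m)) (j * y * X) ((D + y) ^ j) ⟩
  D * D ^ j * ((D + y) * series (j * y) (suc m)) + j * y * X * (D + y) ^ suc j
   ≤⟨ +-monoˡ-≤ _ (*-monoʳ-≤ (D ^ suc j) (grow y m (j * y) X hj)) ⟩
  D ^ suc j * (D * series (j * y + y) (suc m) + y * X) + j * y * X * (D + y) ^ suc j
   ≡⟨ l₃ (D ^ suc j) D (series (j * y + y) (suc m)) (y * X) (j * y * X * (D + y) ^ suc j) ⟩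
  D * (D ^ suc j * series (j * y + y) (suc m)) + (D ^ suc j * (y * X) + j * y * X * (D + y) ^ suc j)
   ≤⟨ +-monoʳ-≤ (D * (D ^ suc j * series (j * y + y) (suc m))) (+-monoˡ-≤ _ (*-monoˡ-≤ (y * X) (^-monoˡ-≤ (suc j) (m≤m+n D y)))) ⟩
  D * (D ^ suc j * series (j * y + y) (suc m)) + ((D + y) ^ suc j * (y * X) + j * y * X * (D + y) ^ suc j)
   ≡⟨ cong₂ _+_ (cong (λ p → D * (D ^ suc j * series p (suc m))) (+-comm (j * y) y)) (l₄ ((D + y) ^ suc j) y X j) ⟩
  D * (D ^ suc j * series (y + j * y) (suc m)) + (y + j * y) * X * (D + y) ^ suc j ∎
  where
  hj : (j * y) ^ suc m ≤ X
  hj = ≤-trans (^-monoˡ-≤ (suc m) (m≤n+m (j * y) y)) h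
  l₁ : ∀ a b c e → a * b * c * e ≡ a * (b * c * e)
  l₁ = solve-∀
  l₂ : ∀ a D x s z b → a * (D * (x * s) + z * b) ≡ D * x * (a * s) + z * (a * b)
  l₂ = solve-∀
  l₃ : ∀ x D s z e → x * (D * s + z) + e ≡ D * (x * s) + (x * z + e)
  l₃ = solve-∀
  l₄ : ∀ b y X j → b * (y * X) + j * y * X * b ≡ (y + j * y) * X * b
  l₄ = solve-∀

-- Comparing (1 + L/2N)^N with the exponential series.

module Exponential (D : CubeData) (n : ℕ) where
 open CubeData D
 open Estimates D
 open Series (2 * N)

 f Z : ℕ
 f = scaleᴰ (suc n)
 Z = 2 ^ N

 E : ℕ → ℕ
 E L = series (N * L) (suc n)

 -- (n + 1)! ≥ n + 1 is all that is kept of the factorial: errors of order 1/(n + 1) are allowed by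
 -- the precision of the constants.
 scale-large : suc n * (2 * N) ^ suc n ≤ f
 scale-large = go n
  where
  go : ∀ n → suc n * (2 * N) ^ suc n ≤ scaleᴰ (suc n)
  go zero = ≤-reflexive (l (2 * N))
   where
   l : ∀ D → 1 * (D * 1) ≡ 1 * D * 1
   l = solve-∀
  go (suc n) = ≤-trans (≤≡ (*-monoʳ-≤ (suc (suc n)) (*-monoʳ-≤ (2 * N) (m≤n*m ((2 * N) ^ suc n) (suc n)))) (sym (*-assoc (suc (suc n)) (2 * N) _)))
   (*-monoʳ-≤ (suc (suc n) * (2 * N)) (go n))

 private
  B : ℕ → ℕ
  B L = (2 ^ d + L) ^ N

  B≡ : ∀ L → B L ≡ (2 * N + L) ^ N
  B≡ L = cong (λ t → (t + L) ^ N) 2^d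

  square≤ : ∀ L → L ≤ 2 → L * L ≤ 4
  square≤ L h = *-mono-≤ h h

  -- With x = L/2N, `shrink-power` says (1 - x)^N E ≤ f. Multiply by (1 + x)^N and use (1 - x²)^N ≥
  -- 1 - 1/N, which holds since L² ≤ 4.
  E-lower : ∀ L → L ≤ 2 → M * N * E L ≤ f * B L * N + 8 * M * f
  E-lower L L≤2 = begin
   M * N * E L
    ≡⟨ cong (λ t → M * t * E L) (sym 1+N-1) ⟩
   M * suc (pred N) * E L
    ≡⟨ l₁ M (pred N) (E L) ⟩
   M * pred N * E L + M * E L
    ≤⟨ +-mono-≤ core (≤≡ (*-monoʳ-≤ M E≤8f) (l₂ M f)) ⟩
   f * B L * N + 8 * M * f ∎
   where
   1+N-1 : suc (pred N) ≡ N
   1+N-1 = suc-pred N ⦃ N≢0 ⦄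
   2≤N : 2 ≤ N
   2≤N = ≤≡ (*-monoʳ-≤ 2 1≤h) (sym N≡)
   l₁ : ∀ M p e → M * (1 + p) * e ≡ M * p * e + M * e
   l₁ = solve-∀
   l₂ : ∀ M f → M * (8 * f) ≡ 8 * M * f
   l₂ = solve-∀
   c : ℕ
   c = 2 * N ∸ L
   c+L : 2 * N ≡ c + L
   c+L = sym (m∸n+n≡m (≤-trans L≤2 (≤-trans 2≤N (m≤n*m N 2))))
   Q : ℕ
   Q = c * (2 * N + L)
   Q+LL : Q + L * L ≡ 2 * N * (2 * N)
   Q+LL = trans (cong (λ t → c * (t + L) + L * L) c+L) (trans (l c L) (sym (cong₂ _*_ c+L c+L)))
    where
    l : ∀ c L → c * ((c + L) + L) + L * L ≡ (c + L) * (c + L)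
    l = solve-∀
   -- Bernoulli's inequality for (1 - L²/4N²)^N
   bern : M * M * pred N ≤ Q ^ N * N
   bern = *-cancelʳ-≤ _ _ (4 * N) ⦃ m*n≢0 4 N ⦄ (+-cancelʳ-≤ (M * M * (4 * N)) _ _ (begin
    M * M * pred N * (4 * N) + M * M * (4 * N)
     ≡⟨ trans (l (M * M) (pred N) N) (cong (λ t → M * M * t * (4 * N)) 1+N-1) ⟩
    M * M * N * (4 * N)
     ≡⟨ l′ (M * M) N ⟩
    M * M * (2 * N * (2 * N))
     ≡⟨ cong (_* (2 * N * (2 * N))) MM ⟩
    (2 * N * (2 * N)) ^ N * (2 * N * (2 * N))
     ≤⟨ *-monoˡ-≤ (2 * N * (2 * N)) step ⟩
    (Q ^ N + N * (L * L) * (2 * N * (2 * N)) ^ pred N) * (2 * N * (2 * N))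
     ≡⟨ l″ (Q ^ N) N (L * L) ((2 * N * (2 * N)) ^ pred N) ⟩
    Q ^ N * N * (4 * N) + N * (L * L) * (2 * N * (2 * N) * (2 * N * (2 * N)) ^ pred N)
     ≤⟨ +-monoʳ-≤ (Q ^ N * N * (4 * N)) (≤≡ (*-mono-≤ (*-monoʳ-≤ N (square≤ L L≤2)) (≤-reflexive (trans (cong ((2 * N * (2 * N)) ^_) 1+N-1) (sym MM)))) (l‴ N (M * M))) ⟩
    Q ^ N * N * (4 * N) + M * M * (4 * N) ∎))
    where
    MM : M * M ≡ (2 * N * (2 * N)) ^ N
    MM = sym (^-distrib-* N (2 * N) (2 * N))
    step : (2 * N * (2 * N)) ^ N ≤ Q ^ N + N * (L * L) * (2 * N * (2 * N)) ^ pred N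
    step = subst₂ (λ s t → s ^ t ≤ Q ^ t + t * (L * L) * s ^ pred N) Q+LL 1+N-1 (power-above Q (L * L) (pred N))
    l : ∀ m p n → m * p * (4 * n) + m * (4 * n) ≡ m * (1 + p) * (4 * n)
    l = solve-∀
    l′ : ∀ m n → m * n * (4 * n) ≡ m * (2 * n * (2 * n))
    l′ = solve-∀
    l″ : ∀ q n e x → (q + n * e * x) * (2 * n * (2 * n)) ≡ q * n * (4 * n) + n * e * (2 * n * (2 * n) * x)
    l″ = solve-∀
    l‴ : ∀ n m → n * 4 * m ≡ m * (4 * n)
    l‴ = solve-∀
   core : M * pred N * E L ≤ f * B L * N
   core = *-cancelˡ-≤ M ⦃ M≢0 ⦄ (begin
    M * (M * pred N * E L)
     ≡⟨ l M (pred N) (E L) ⟩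
    M * M * pred N * E L
     ≤⟨ *-monoˡ-≤ (E L) bern ⟩
    Q ^ N * N * E L
     ≡⟨ cong (λ t → t * N * E L) (^-distrib-* N c (2 * N + L)) ⟩
    c ^ N * (2 * N + L) ^ N * N * E L
     ≡⟨ l′ (c ^ N) ((2 * N + L) ^ N) N (E L) ⟩
    c ^ N * E L * ((2 * N + L) ^ N * N)
     ≤⟨ *-mono-≤ (shrink-power c L c+L n N) (≤-reflexive (cong (_* N) (sym (B≡ L)))) ⟩
    M * f * (B L * N)
     ≡⟨ l″ M f (B L) N ⟩
    M * (f * B L * N) ∎)
    where
    l : ∀ m p e → m * (m * p * e) ≡ m * m * p * e
    l = solve-∀
    l′ : ∀ a b n e → a * b * n * e ≡ a * e * (b * n)
    l′ = solve-∀
    l″ : ∀ m f b n → m * f * (b * n) ≡ m * (f * b * n)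
    l″ = solve-∀
   E≤8f : E L ≤ 8 * f
   E≤8f = *-cancelˡ-≤ (M * N) ⦃ m*n≢0 M N ⦃ M≢0 ⦄ ⦄ (begin
    M * N * E L
     ≤⟨ *-monoˡ-≤ (E L) (*-monoʳ-≤ M N≤) ⟩
    M * (2 * pred N) * E L
     ≡⟨ l M (pred N) (E L) ⟩
    2 * (M * pred N * E L)
     ≤⟨ *-monoʳ-≤ 2 (≤-trans core (*-monoˡ-≤ N (*-monoʳ-≤ f (B-power L L≤2)))) ⟩
    2 * (f * (4 * M) * N)
     ≡⟨ l′ f M N ⟩
    M * N * (8 * f) ∎)
    where
    N≤ : N ≤ 2 * pred N
    N≤ = +-cancelʳ-≤ 2 _ _ (≤≡ (+-monoʳ-≤ N 2≤N) (trans (cong₂ _+_ (sym 1+N-1) (sym 1+N-1)) (l″ (pred N))))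
     where
     l″ : ∀ p → (1 + p) + (1 + p) ≡ 2 * p + 2
     l″ = solve-∀
    l : ∀ m p e → m * (2 * p) * e ≡ 2 * (m * p * e)
    l = solve-∀
    l′ : ∀ f m n → 2 * (f * (4 * m) * n) ≡ m * n * (8 * f)
    l′ = solve-∀

  -- `grow-power` with N steps of size L; `scale-large` bounds the accumulated error N L (2N)^(n+1)
  -- by N L f/(n + 1).
  E-upper : ∀ L → L ≤ 2 → suc n * (B L * f) ≤ suc n * (M * E L) + 2 * L * (f * M)
  E-upper L L≤2 = *-cancelʳ-≤ _ _ (2 * N) ⦃ m*n≢0 2 N ⦄ (begin
   suc n * (B L * f) * (2 * N)
    ≡⟨ trans (l₁ (suc n) (B L) f (2 * N)) (cong (λ b → suc n * (b * f * (2 * N))) (B≡ L)) ⟩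
   suc n * ((2 * N + L) ^ N * f * (2 * N))
    ≤⟨ *-monoʳ-≤ (suc n) (grow-power L n ((2 * N) ^ suc n) N (^-monoˡ-≤ (suc n) (≤≡ (*-monoʳ-≤ N L≤2) (*-comm N 2)))) ⟩
   suc n * (2 * N * (M * E L) + N * L * (2 * N) ^ suc n * (2 * N + L) ^ N)
    ≡⟨ l₂ (suc n) N (M * E L) L ((2 * N) ^ suc n) ((2 * N + L) ^ N) ⟩
   suc n * (M * E L) * (2 * N) + N * L * (suc n * (2 * N) ^ suc n) * (2 * N + L) ^ N
    ≤⟨ +-monoʳ-≤ (suc n * (M * E L) * (2 * N)) (*-mono-≤ (*-monoʳ-≤ (N * L) scale-large) (≡≤ (sym (B≡ L)) (B-power L L≤2))) ⟩
   suc n * (M * E L) * (2 * N) + N * L * f * (4 * M)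
    ≡⟨ l₃ (suc n * (M * E L)) N L f M ⟩
   (suc n * (M * E L) + 2 * L * (f * M)) * (2 * N) ∎)
   where
   l₁ : ∀ a b c e → a * (b * c) * e ≡ a * (b * c * e)
   l₁ = solve-∀
   l₂ : ∀ a N x L y b → a * (2 * N * x + N * L * y * b) ≡ a * x * (2 * N) + N * L * (a * y) * b
   l₂ = solve-∀
   l₃ : ∀ x N L f M → x * (2 * N) + N * L * f * (4 * M) ≡ (x + 2 * L * (f * M)) * (2 * N)
   l₃ = solve-∀

 module _ (σ : Bool) (k : Fin 3) (q : Fin 3 → Bool) (qk : q k ≡ true) where
  open Side σ k

  private
   C L : ℕ
   C = isoCount q
   L = nL q

  count-above : suc n * (C * f) ≤ suc n * (Z * E L) + 2 * L * (f * Z)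
  count-above = *-cancelʳ-≤ _ _ M ⦃ M≢0 ⦄ (begin
   suc n * (C * f) * M
    ≡⟨ l₁ (suc n) C f M ⟩
   suc n * (C * M * f)
    ≤⟨ *-monoʳ-≤ (suc n) (*-monoˡ-≤ f (iso-upper q qk)) ⟩
   suc n * (Z * B L * f)
    ≡⟨ l₂ (suc n) Z (B L) f ⟩
   Z * (suc n * (B L * f))
    ≤⟨ *-monoʳ-≤ Z (E-upper L (nL≤2 q)) ⟩
   Z * (suc n * (M * E L) + 2 * L * (f * M))
    ≡⟨ l₃ Z (suc n) M (E L) L f ⟩
   (suc n * (Z * E L) + 2 * L * (f * Z)) * M ∎)
   where
   l₁ : ∀ a c f m → a * (c * f) * m ≡ a * (c * m * f)
   l₁ = solve-∀
   l₂ : ∀ a z b f → a * (z * b * f) ≡ z * (a * (b * f))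
   l₂ = solve-∀
   l₃ : ∀ z a m e L f → z * (a * (m * e) + 2 * L * (f * m)) ≡ (a * (z * e) + 2 * L * (f * z)) * m
   l₃ = solve-∀

  -- Two losses of order 1/N enter, 8d² from non-isolated configurations and 8 from `E-lower`; the
  -- hypothesis on V bounds them together by 1/V.
  count-below : ∀ V → (8 * (d * d) + 8) * V ≤ N → V * (Z * E L) ≤ V * (f * C) + f * Z
  count-below V hV = *-cancelʳ-≤ _ _ (M * N) ⦃ m*n≢0 M N ⦃ M≢0 ⦄ ⦄ (begin
   V * (Z * E L) * (M * N)
    ≡⟨ l₁ V Z (E L) M N ⟩
   V * (Z * (M * N * E L))
    ≤⟨ *-monoʳ-≤ V (*-monoʳ-≤ Z (E-lower L (nL≤2 q))) ⟩
   V * (Z * (f * B L * N + 8 * M * f))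
    ≡⟨ l₂ V Z f (B L) N M ⟩
   V * (f * (Z * B L * N)) + V * (8 * (M * (f * Z)))
    ≤⟨ +-monoˡ-≤ (V * (8 * (M * (f * Z)))) (*-monoʳ-≤ V (*-monoʳ-≤ f (iso-lower q qk))) ⟩
   V * (f * (C * M * N + Z * (8 * (d * d)) * M)) + V * (8 * (M * (f * Z)))
    ≡⟨ l₃ V f C M N Z (8 * (d * d)) ⟩
   V * (f * C) * (M * N) + (8 * (d * d) + 8) * V * (f * Z * M)
    ≤⟨ +-monoʳ-≤ (V * (f * C) * (M * N)) (*-monoˡ-≤ (f * Z * M) hV) ⟩
   V * (f * C) * (M * N) + N * (f * Z * M)
    ≡⟨ l₄ (V * (f * C)) M N (f * Z) ⟩
   (V * (f * C) + f * Z) * (M * N) ∎)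
   where
   l₁ : ∀ v z e m n → v * (z * e) * (m * n) ≡ v * (z * (m * n * e))
   l₁ = solve-∀
   l₂ : ∀ v z f b n m → v * (z * (f * b * n + 8 * m * f)) ≡ v * (f * (z * b * n)) + v * (8 * (m * (f * z)))
   l₂ = solve-∀
   l₃ : ∀ v f c m n z e → v * (f * (c * m * n + z * e * m)) + v * (8 * (m * (f * z))) ≡ v * (f * c) * (m * n) + (e + 8) * v * (f * z * m)
   l₃ = solve-∀
   l₄ : ∀ x m n y → x * (m * n) + n * (y * m) ≡ (x + y) * (m * n)
   l₄ = solve-∀

-- Sizes of setoids by enumeration.

module _ (A : Setoid 0ℓ 0ℓ) where
 open Setoid A using (Carrier; _≈_) renaming (refl to ≈-refl; sym to ≈-sym; trans to ≈-trans)

 size-of-enumeration : (xs : List Carrier) → AllPairs (λ a b → ¬ a ≈ b) xs → (∀ a → Any (a ≈_) xs) → HasSize A (length xs)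
 size-of-enumeration xs distinct cover = record
  { to = Data.List.lookup xs
  ; from = λ a → Any.index (cover a)
  ; to-cong = λ { refl → ≈-refl }
  ; from-cong = λ {a} {b} e → inj distinct _ _ (≈-trans (≈-sym (lookup-index (cover a))) (≈-trans e (lookup-index (cover b))))
  ; inverse = (λ { {a} refl → ≈-sym (lookup-index (cover a)) })
   , λ {i} {a} e → inj distinct _ i (≈-trans (≈-sym (lookup-index (cover a))) e)
  }
  where
  inj : ∀ {xs} → AllPairs (λ a b → ¬ a ≈ b) xs → ∀ i j → Data.List.lookup xs i ≈ Data.List.lookup xs j → i ≡ j
  inj (ps ∷ pss) zero zero e = refl
  inj (ps ∷ pss) zero (suc j) e = ⊥-elim (All.lookup ps (∈-lookup j) e)
  inj (ps ∷ pss) (suc i) zero e = ⊥-elim (All.lookup ps (∈-lookup i) (≈-sym e))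
  inj (ps ∷ pss) (suc i) (suc j) e = cong suc (inj pss i j e)

 size-unique : ∀ {m n} → HasSize A m → HasSize A n → m ≡ n
 size-unique h h' = ↔⇒≡ (Compose.inverse h (Symmetry.inverse h'))

 -- `R` is apartness of the enumerated objects. The enumeration picks its own proof of `p x`, so a
 -- has to agree with `make x e` for every e.
 size-of-selection : ∀ {X : Set} {R : X → X → Set} (p : X → Bool) (make : ∀ x → p x ≡ true → Carrier) →
  (∀ {x y} → R x y → ∀ e e' → ¬ make x e ≈ make y e') → (xs : List X) → AllPairs R xs →
  (∀ a → ∃ λ x → x ∈ xs × ∃ λ (e : p x ≡ true) → ∀ e → a ≈ make x e) → HasSize A (∑ xs (𝟙 ∘ p))
 size-of-selection {X} {R} p make sep xs distinct cover = subst (HasSize A) (len xs) (size-of-enumeration (select xs) (pairs distinct)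
  λ a → let x , i , e , h = cover a in found a i e h)
  where
  pick : ∀ x → Cases (p x) → List Carrier → List Carrier
  pick x (inj₁ e) cs = make x e ∷ cs
  pick x (inj₂ e) cs = cs
  select : List X → List Carrier
  select [] = []
  select (x ∷ xs) = pick x (bool-cases (p x)) (select xs)
  len : ∀ xs → length (select xs) ≡ ∑ xs (𝟙 ∘ p)
  len [] = refl
  len (x ∷ xs) = go (bool-cases (p x))
   where
   go : ∀ c → length (pick x c (select xs)) ≡ 𝟙 (p x) + ∑ xs (𝟙 ∘ p)
   go (inj₁ e) = cong₂ _+_ (sym (cong 𝟙 e)) (len xs)
   go (inj₂ e) = trans (len xs) (cong (λ b → 𝟙 b + ∑ xs (𝟙 ∘ p)) (sym e))
  all-sep : ∀ {x e ys} → All (R x) ys → All (λ c → ¬ make x e ≈ c) (select ys)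
  all-sep [] = []
  all-sep {x} {e} {y ∷ ys} (r ∷ rs) = go (bool-cases (p y))
   where
   go : ∀ c → All (λ c → ¬ make x e ≈ c) (pick y c (select ys))
   go (inj₁ e') = sep r e e' ∷ all-sep rs
   go (inj₂ _) = all-sep rs
  pairs : ∀ {ys} → AllPairs R ys → AllPairs (λ a b → ¬ a ≈ b) (select ys)
  pairs [] = []
  pairs {y ∷ ys} (r ∷ rs) = go (bool-cases (p y))
   where
   go : ∀ c → AllPairs (λ a b → ¬ a ≈ b) (pick y c (select ys))
   go (inj₁ e) = all-sep r ∷ pairs rs
   go (inj₂ _) = pairs rs
  found : ∀ a {x ys} → x ∈ ys → p x ≡ true → (∀ e → a ≈ make x e) → Any (a ≈_) (select ys)
  found a {x} {y ∷ ys} (here refl) e h = go (bool-cases (p x))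
   where
   go : ∀ c → Any (a ≈_) (pick x c (select ys))
   go (inj₁ e') = here (h e')
   go (inj₂ e') = absurd e e'
  found a {x} {y ∷ ys} (there i) e h = go (bool-cases (p y))
   where
   go : ∀ c → Any (a ≈_) (pick y c (select ys))
   go (inj₁ _) = there (found a i e h)
   go (inj₂ _) = found a i e h

module _ {d : ℕ} where
 open FunctionSum (_≟V_ {d}) cols

 funs-off : ∀ vs ρ {f} → f ∈ Colour.funs vs ρ → ∀ v → v ∉ vs → f v ≡ ρ v
 funs-off [] ρ (here refl) v h = refl
 funs-off (w ∷ vs) ρ {f} i v h with find (∈-concatMap⁻ (λ x → Colour.funs vs (upd ρ w x)) {xs = cols} i)
 ... | x , _ , j = trans (funs-off vs (upd ρ w x) j v (h ∘ there)) (upd-diff ρ {w} {v} x λ { refl → h (here refl) })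

 funs-distinct : ∀ {vs} → Unique vs → ∀ ρ → AllPairs (λ f g → ∃ λ v → f v ≢ g v) (Colour.funs vs ρ)
 funs-distinct [] ρ = [] ∷ []
 funs-distinct {v ∷ vs} u@(_ ∷ uvs) ρ = concat⁺ (part zero ∷ part 1F ∷ part 2F ∷ [])
  ((apart (λ ()) ∷ apart (λ ()) ∷ []) ∷ (apart (λ ()) ∷ []) ∷ [] ∷ [])
  where
  part : ∀ x → AllPairs (λ f g → ∃ λ v → f v ≢ g v) (Colour.funs vs (upd ρ v x))
  part x = funs-distinct uvs (upd ρ v x)
  at : ∀ {x f} → f ∈ Colour.funs vs (upd ρ v x) → f v ≡ x
  at {x} i = trans (funs-off vs (upd ρ v x) i v (Unique[x∷xs]⇒x∉xs u)) (upd-same ρ v x)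
  apart : ∀ {x y} → x ≢ y → All (λ f → All (λ g → ∃ λ v → f v ≢ g v) (Colour.funs vs (upd ρ v y))) (Colour.funs vs (upd ρ v x))
  apart ne = All.tabulate λ i → All.tabulate λ j → v , λ e → ne (trans (sym (at i)) (trans e (at j)))

 funs-complete : ∀ {vs} → Unique vs → ∀ ρ (χ : Vertex d → Fin 3) → ∃ λ f → f ∈ Colour.funs vs ρ × (∀ v → v ∈ vs → f v ≡ χ v)
 funs-complete [] ρ χ = ρ , here refl , λ _ ()
 funs-complete {w ∷ vs} u@(_ ∷ uvs) ρ χ with funs-complete uvs (upd ρ w (χ w)) χ
 ... | f , i , h = f , ∈-concatMap⁺ (λ x → Colour.funs vs (upd ρ w x)) (lose (∈-cols (χ w)) i) , λ
  { v (here refl) → trans (funs-off vs (upd ρ w (χ w)) i w (Unique[x∷xs]⇒x∉xs u)) (upd-same ρ w (χ w))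
  ; v (there m) → h v m }

-- Lifting 3-colourings to ℤ and reducing mod 3.

differ-refl : ∀ b → differ b b ≡ 0
differ-refl false = refl
differ-refl true = refl

hamming-refl : ∀ {d} (v : Vertex d) → hamming v v ≡ 0
hamming-refl [] = refl
hamming-refl (b ∷ v) = cong₂ _+_ (differ-refl b) (hamming-refl v)

hamming-zero : ∀ {d} (u v : Vertex d) → hamming u v ≡ 0 → v ≡ u
hamming-zero [] [] e = refl
hamming-zero (false ∷ u) (false ∷ v) e = cong (false ∷_) (hamming-zero u v e)
hamming-zero (true ∷ u) (true ∷ v) e = cong (true ∷_) (hamming-zero u v e)

adjacent-flip : ∀ {d} (v : Vertex d) i → Adjacent v (flip v i)
adjacent-flip (false ∷ v) zero = cong suc (hamming-refl v)
adjacent-flip (true ∷ v) zero = cong suc (hamming-refl v)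
adjacent-flip (b ∷ v) (suc i) = cong₂ _+_ (differ-refl b) (adjacent-flip v i)

adjacent⁻ : ∀ {d} (u v : Vertex d) → Adjacent u v → ∃ λ i → v ≡ flip u i
adjacent⁻ [] [] ()
adjacent⁻ (false ∷ u) (false ∷ v) e = let i , e' = adjacent⁻ u v e in suc i , cong (false ∷_) e'
adjacent⁻ (true ∷ u) (true ∷ v) e = let i , e' = adjacent⁻ u v e in suc i , cong (true ∷_) e'
adjacent⁻ (false ∷ u) (true ∷ v) e = zero , cong (true ∷_) (hamming-zero u v (suc-injective e))
adjacent⁻ (true ∷ u) (false ∷ v) e = zero , cong (false ∷_) (hamming-zero u v (suc-injective e))

rot rot⁻¹ : Fin 3 → Fin 3
rot zero = 1F
rot 1F = 2F
rot 2F = zero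
rot⁻¹ c = rot (rot c)

rot-rot⁻¹ : ∀ c → rot (rot⁻¹ c) ≡ c
rot-rot⁻¹ = from-yes (all? λ c → rot (rot⁻¹ c) Fin.≟ c)

eqc-rot : ∀ a b → eqc (rot a) (rot b) ≡ eqc a b
eqc-rot = from-yes (all? λ a → all? λ b → eqc (rot a) (rot b) Bool.≟ eqc a b)

-- The step of the lift along an edge. The value for equal colours is a default that never occurs
-- along an edge of a proper colouring.
δ : Fin 3 → Fin 3 → ℤ
δ a b = if eqc b (rot a) then 1ℤ else if eqc b (rot⁻¹ a) then -1ℤ else 0ℤ

δ-rot : ∀ a b → δ (rot a) (rot b) ≡ δ a b
δ-rot = from-yes (all? λ a → all? λ b → δ (rot a) (rot b) ℤ.≟ δ a b)

δ-up : ∀ a → δ a (rot a) ≡ 1ℤ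
δ-up = from-yes (all? λ a → δ a (rot a) ℤ.≟ 1ℤ)

δ-down : ∀ a → δ a (rot⁻¹ a) ≡ -1ℤ
δ-down = from-yes (all? λ a → δ a (rot⁻¹ a) ℤ.≟ -1ℤ)

δ-back : ∀ a b → δ a b ℤ.+ δ b a ≡ 0ℤ
δ-back = from-yes (all? λ a → all? λ b → (δ a b ℤ.+ δ b a) ℤ.≟ 0ℤ)

δ-size : ∀ a b → a ≢ b → ℤ.∣ δ a b ∣ ≡ 1
δ-size = from-yes (all? λ a → all? λ b → ¬? (a Fin.≟ b) →-dec (ℤ.∣ δ a b ∣ ≟ 1))

-- the winding number of a 4-cycle is divisible by 3 and at most 4/3 in absolute value
δ-square : ∀ a a' b b' → a ≢ a' → a' ≢ b' → a ≢ b → b ≢ b' → δ a a' ℤ.+ δ a' b' ≡ δ a b ℤ.+ δ b b'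
δ-square = from-yes (all? λ a → all? λ a' → all? λ b → all? λ b' → ¬? (a Fin.≟ a') →-dec (¬? (a' Fin.≟ b') →-dec
 (¬? (a Fin.≟ b) →-dec (¬? (b Fin.≟ b') →-dec ((δ a a' ℤ.+ δ a' b') ℤ.≟ (δ a b ℤ.+ δ b b'))))))

-- Sums the steps along the path from 0 that raises the coordinates from the last to the first;
-- `lift-flip` is the independence of the path.
lift : ∀ {d} → (Vertex d → Fin 3) → Vertex d → ℤ
lift χ [] = 0ℤ
lift χ (false ∷ v) = lift (χ ∘ (false ∷_)) v
lift χ (true ∷ v) = lift (χ ∘ (false ∷_)) v ℤ.+ δ (χ (false ∷ v)) (χ (true ∷ v))

lift-ext : ∀ {d} {χ χ' : Vertex d → Fin 3} → (∀ v → χ v ≡ χ' v) → ∀ v → lift χ v ≡ lift χ' v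
lift-ext h [] = refl
lift-ext h (false ∷ v) = lift-ext (h ∘ (false ∷_)) v
lift-ext h (true ∷ v) = cong₂ ℤ._+_ (lift-ext (h ∘ (false ∷_)) v) (cong₂ δ (h (false ∷ v)) (h (true ∷ v)))

lift-rot : ∀ {d} (χ : Vertex d → Fin 3) v → lift (rot ∘ χ) v ≡ lift χ v
lift-rot χ [] = refl
lift-rot χ (false ∷ v) = lift-rot (χ ∘ (false ∷_)) v
lift-rot χ (true ∷ v) = cong₂ ℤ._+_ (lift-rot (χ ∘ (false ∷_)) v) (δ-rot (χ (false ∷ v)) (χ (true ∷ v)))

lift-zero : ∀ {d} (χ : Vertex d → Fin 3) → lift χ (zeroVertex d) ≡ 0ℤ
lift-zero {zero} χ = refl
lift-zero {suc d} χ = lift-zero (χ ∘ (false ∷_))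

-- The only case beyond the recursion is a later flip under a raised first coordinate, where the two
-- ways round a 4-cycle are compared by `δ-square`.
lift-flip : ∀ {d} (χ : Vertex d → Fin 3) → (∀ v i → χ v ≢ χ (flip v i)) → ∀ v i → lift χ (flip v i) ≡ lift χ v ℤ.+ δ (χ v) (χ (flip v i))
lift-flip χ pr (false ∷ v) zero = refl
lift-flip χ pr (true ∷ v) zero = sym (trans (ℤ.+-assoc (lift (χ ∘ (false ∷_)) v) _ _) (trans (cong (λ x → lift (χ ∘ (false ∷_)) v ℤ.+ x) (δ-back (χ (false ∷ v)) (χ (true ∷ v)))) (ℤ.+-identityʳ _)))
lift-flip χ pr (false ∷ v) (suc i) = lift-flip (χ ∘ (false ∷_)) (λ v i → pr (false ∷ v) (suc i)) v i
lift-flip χ pr (true ∷ v) (suc i) = trans (cong (ℤ._+ δ (χ (false ∷ flip v i)) (χ (true ∷ flip v i))) (lift-flip (χ ∘ (false ∷_)) (λ v i → pr (false ∷ v) (suc i)) v i))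
 (trans (ℤ.+-assoc (lift (χ ∘ (false ∷_)) v) _ _) (trans (cong (λ x → lift (χ ∘ (false ∷_)) v ℤ.+ x)
  (δ-square _ _ _ _ (pr (false ∷ v) (suc i)) (pr (false ∷ flip v i) zero) (pr (false ∷ v) zero) (pr (true ∷ v) (suc i))))
 (sym (ℤ.+-assoc (lift (χ ∘ (false ∷_)) v) _ _))))

mod₃ : ℤ → Fin 3
mod₃ (ℤ.+ zero) = zero
mod₃ (ℤ.+ suc n) = rot (mod₃ (ℤ.+ n))
mod₃ -[1+ zero ] = rot⁻¹ zero
mod₃ -[1+ suc n ] = rot⁻¹ (mod₃ -[1+ n ])

mod₃-up : ∀ z → mod₃ (z ℤ.+ 1ℤ) ≡ rot (mod₃ z)
mod₃-up (ℤ.+ n) = cong (λ n → mod₃ (ℤ.+ n)) (+-comm n 1)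
mod₃-up -[1+ zero ] = refl
mod₃-up -[1+ suc n ] = sym (rot-rot⁻¹ _)

mod₃-down : ∀ z → mod₃ (z ℤ.+ -1ℤ) ≡ rot⁻¹ (mod₃ z)
mod₃-down (ℤ.+ zero) = refl
mod₃-down (ℤ.+ suc n) = sym (rot-rot⁻¹ _)
mod₃-down -[1+ n ] = cong (λ n → rot⁻¹ (mod₃ -[1+ n ])) (+-identityʳ n)

mod₃-δ : ∀ z b → mod₃ (z ℤ.+ δ (mod₃ z) b) ≡ b
mod₃-δ z b = go (mod₃ z) b refl
 where
 third : ∀ a b → b ≢ rot a → b ≢ rot⁻¹ a → a ≡ b
 third = from-yes (all? λ a → all? λ b → ¬? (b Fin.≟ rot a) →-dec (¬? (b Fin.≟ rot⁻¹ a) →-dec (a Fin.≟ b)))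
 go : ∀ a b → mod₃ z ≡ a → mod₃ (z ℤ.+ δ a b) ≡ b
 go a b e with b Fin.≟ rot a
 ... | yes refl = trans (mod₃-up z) (cong rot e)
 ... | no ne with b Fin.≟ rot⁻¹ a
 ...   | yes refl = trans (mod₃-down z) (cong rot⁻¹ e)
 ...   | no ne' = trans (cong mod₃ (ℤ.+-identityʳ z)) (trans e (third a b ne ne'))

mod₃-lift : ∀ {d} (χ : Vertex d → Fin 3) → χ (zeroVertex d) ≡ zero → ∀ v → mod₃ (lift χ v) ≡ χ v
mod₃-lift χ e [] = sym e
mod₃-lift χ e (false ∷ v) = mod₃-lift (χ ∘ (false ∷_)) e v
mod₃-lift χ e (true ∷ v) = trans (cong (λ a → mod₃ (lift (χ ∘ (false ∷_)) v ℤ.+ δ a (χ (true ∷ v)))) (sym (mod₃-lift (χ ∘ (false ∷_)) e v)))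
 (mod₃-δ (lift (χ ∘ (false ∷_)) v) (χ (true ∷ v)))

Steps : ∀ {d} → (Vertex d → ℤ) → Set
Steps {d} f = ∀ (v : Vertex d) i → f (flip v i) ≡ f v ℤ.+ δ (mod₃ (f v)) (mod₃ (f (flip v i))) × mod₃ (f v) ≢ mod₃ (f (flip v i))

hom-steps : ∀ {d} {f : Vertex d → ℤ} → IsHom d f → Steps f
hom-steps {d} {f} (_ , hom) v i = step (f v) (f (flip v i)) (f v ℤ.- f (flip v i)) refl (hom v (flip v i) (adjacent-flip v i))
 where
 rot≢ : ∀ a → a ≢ rot a
 rot≢ = from-yes (all? λ a → ¬? (a Fin.≟ rot a))
 rot⁻¹≢ : ∀ a → a ≢ rot⁻¹ a
 rot⁻¹≢ = from-yes (all? λ a → ¬? (a Fin.≟ rot⁻¹ a))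
 l : ∀ a b → b ≡ a ℤ.+ ℤ.- (a ℤ.- b)
 l = ℤ-solve-∀
 step : ∀ a b x → a ℤ.- b ≡ x → ℤ.∣ x ∣ ≡ 1 → b ≡ a ℤ.+ δ (mod₃ a) (mod₃ b) × mod₃ a ≢ mod₃ b
 step a b (ℤ.+ .1) e refl = trans b≡ (cong (λ x → a ℤ.+ x) (sym (trans (cong (δ (mod₃ a)) m) (δ-down (mod₃ a))))) , λ e' → rot⁻¹≢ (mod₃ a) (trans e' m)
  where
  b≡ : b ≡ a ℤ.+ -1ℤ
  b≡ = trans (l a b) (cong (λ x → a ℤ.+ ℤ.- x) e)
  m : mod₃ b ≡ rot⁻¹ (mod₃ a)
  m = trans (cong mod₃ b≡) (mod₃-down a)
 step a b -[1+ .0 ] e refl = trans b≡ (cong (λ x → a ℤ.+ x) (sym (trans (cong (δ (mod₃ a)) m) (δ-up (mod₃ a))))) , λ e' → rot≢ (mod₃ a) (trans e' m)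
  where
  b≡ : b ≡ a ℤ.+ 1ℤ
  b≡ = trans (l a b) (cong (λ x → a ℤ.+ ℤ.- x) e)
  m : mod₃ b ≡ rot (mod₃ a)
  m = trans (cong mod₃ b≡) (mod₃-up a)

lift-mod₃ : ∀ {d} (f : Vertex d → ℤ) → f (zeroVertex d) ≡ 0ℤ → Steps f → ∀ v → lift (mod₃ ∘ f) v ≡ f v
lift-mod₃ f e st [] = sym e
lift-mod₃ f e st (false ∷ v) = lift-mod₃ (f ∘ (false ∷_)) e (λ v i → st (false ∷ v) (suc i)) v
lift-mod₃ f e st (true ∷ v) = trans (cong (ℤ._+ δ (mod₃ (f (false ∷ v))) (mod₃ (f (true ∷ v)))) (lift-mod₃ (f ∘ (false ∷_)) e (λ v i → st (false ∷ v) (suc i)) v))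
 (sym (proj₁ (st (false ∷ v) zero)))

lift-hom : ∀ {d} (χ : Vertex d → Fin 3) → 1 ≤ proper χ → IsHom d (lift χ)
lift-hom {d} χ h = lift-zero χ , hom
 where
 pr : ∀ v i → χ v ≢ χ (flip v i)
 pr = proper⁻ χ h
 l : ∀ a x → a ℤ.- (a ℤ.+ x) ≡ ℤ.- x
 l = ℤ-solve-∀
 hom : ∀ u v → Adjacent u v → ℤ.∣ lift χ u ℤ.- lift χ v ∣ ≡ 1
 hom u v adj with adjacent⁻ u v adj
 ... | i , refl = trans (cong (λ x → ℤ.∣ lift χ u ℤ.- x ∣) (lift-flip χ pr u i)) (trans (cong ℤ.∣_∣ (l (lift χ u) (δ (χ u) (χ (flip u i)))))
  (trans (ℤ.∣-i∣≡∣i∣ (δ (χ u) (χ (flip u i)))) (δ-size _ _ (pr u i))))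

module _ {d : ℕ} (P : (Vertex d → ℤ) → Set) (p : (Vertex d → ℤ) → Bool) (p-ext : ∀ {f g} → (∀ v → f v ≡ g v) → p f ≡ p g)
 (sound : ∀ f → p f ≡ true → P f) (complete : ∀ f → P f → p f ≡ true) where

 private
  g : (Vertex d → Fin 3) → Bool
  g χ = (1 ≤ᵇ proper χ) ∧ (eqc (χ (zeroVertex d)) zero ∧ p (lift χ))

  g⁻ : ∀ χ → g χ ≡ true → 1 ≤ proper χ × χ (zeroVertex d) ≡ zero × p (lift χ) ≡ true
  g⁻ χ e = ≤ᵇ-≤ (∧ˡ {1 ≤ᵇ proper χ} e) , eqc-≡ (proj₁ h) , proj₂ h
   where
   h : eqc (χ (zeroVertex d)) zero ≡ true × p (lift χ) ≡ true
   h = ∧-true⁻ (∧ʳ {1 ≤ᵇ proper χ} e)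

  make : ∀ χ → g χ ≡ true → Setoid.Carrier (FSetoid d P)
  make χ e = lift χ , lift-hom χ (proj₁ (g⁻ χ e)) , sound (lift χ) (proj₂ (proj₂ (g⁻ χ e)))

 size-of-homs : HasSize (FSetoid d P) (Tot d λ χ → proper χ * 𝟙 (eqc (χ (zeroVertex d)) zero) * 𝟙 (p (lift χ)))
 size-of-homs = subst (HasSize (FSetoid d P)) (trans (Colour.∑-allF d (𝟙 ∘ g)) (Tot-cong d bits))
  (size-of-selection (FSetoid d P) g make separate (Colour.allF d) (funs-distinct (allV-unique d) (λ _ → zero)) cover)
  where
  bits : ∀ χ → 𝟙 (g χ) ≡ proper χ * 𝟙 (eqc (χ (zeroVertex d)) zero) * 𝟙 (p (lift χ))
  bits χ = trans (𝟙-∧ (1 ≤ᵇ proper χ) _) (trans (cong₂ _*_ (bit (proper≤1 χ)) (𝟙-∧ (eqc (χ (zeroVertex d)) zero) _)) (sym (*-assoc (proper χ) _ _)))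
   where
   bit : ∀ {n} → n ≤ 1 → 𝟙 (1 ≤ᵇ n) ≡ n
   bit {zero} h = refl
   bit {suc zero} h = refl
   bit {suc (suc n)} (s≤s ())
  separate : ∀ {χ χ'} → (∃ λ v → χ v ≢ χ' v) → ∀ e e' → ¬ (∀ v → lift χ v ≡ lift χ' v)
  separate {χ} {χ'} (v , ne) e e' h = ne (trans (sym (mod₃-lift χ (proj₁ (proj₂ (g⁻ χ e))) v)) (trans (cong mod₃ (h v)) (mod₃-lift χ' (proj₁ (proj₂ (g⁻ χ' e'))) v)))
  cover : ∀ a → ∃ λ χ → χ ∈ Colour.allF d × ∃ λ (e : g χ ≡ true) → ∀ e → ∀ v → proj₁ a v ≡ lift χ v
  cover (f , hom@(f0 , _) , Pf) with funs-complete (allV-unique d) (λ _ → zero) (mod₃ ∘ f)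
  ... | χ , i , h = χ , i , ∧-true⁺ (≤-≤ᵇ (≤-reflexive (sym (proper⁺ χ pr)))) (∧-true⁺ (trans (cong (λ c → eqc c zero) (trans (χ≡ _) (cong mod₃ f0))) refl)
   (trans (p-ext (λ v → sym (f≡ v))) (complete f Pf))) , λ _ → f≡
   where
   χ≡ : ∀ v → χ v ≡ mod₃ (f v)
   χ≡ v = h v (∈-allV v)
   st : Steps f
   st = hom-steps {f = f} hom
   f≡ : ∀ v → f v ≡ lift χ v
   f≡ v = sym (trans (lift-ext χ≡ v) (lift-mod₃ f f0 st v))
   pr : ∀ v i → χ v ≢ χ (flip v i)
   pr v i e = proj₂ (st v i) (trans (sym (χ≡ v)) (trans e (χ≡ (flip v i))))

-- Rotating the colours.

Tot-rot : ∀ d {F : (Vertex d → Fin 3) → ℕ} → Colour.Ext F → Tot d (λ χ → F (rot ∘ χ)) ≡ Tot d F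
Tot-rot d {F} ext = trans (go (allV d) (λ _ → zero)) (Tot-base ext _)
 where
 open FunctionSum (_≟V_ {d}) cols
 reindex : ∀ (h : Fin 3 → ℕ) → ∑ cols (h ∘ rot) ≡ ∑ cols h
 reindex h = l (h zero) (h 1F) (h 2F)
  where
  l : ∀ a b c → b + (c + (a + 0)) ≡ a + (b + (c + 0))
  l = solve-∀
 upd-rot : ∀ ρ v x w → rot (upd ρ v x w) ≡ upd (rot ∘ ρ) v (rot x) w
 upd-rot ρ v x w with v ≟V w
 ... | yes _ = refl
 ... | no _ = refl
 go : ∀ vs ρ → S vs (λ χ → F (rot ∘ χ)) ρ ≡ S vs F (rot ∘ ρ)
 go [] ρ = refl
 go (v ∷ vs) ρ = trans (∑-cong cols λ x → trans (go vs (upd ρ v x)) (S-ext vs ext _ _ (upd-rot ρ v x)))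
  (reindex λ x → S vs F (upd (rot ∘ ρ) v x))

proper-rot : ∀ {d} (χ : Vertex d → Fin 3) → proper (rot ∘ χ) ≡ proper χ
proper-rot {d} χ = ∏-cong (allV d) λ v → ∏-cong (fins d) λ i → cong (𝟙 ∘ not) (eqc-rot (χ v) (χ (flip v i)))

-- Rotation permutes the three possible colours at 0 cyclically and preserves F, so each of them
-- accounts for one third.
rooted-third : ∀ {d} (F : (Vertex d → Fin 3) → ℕ) → Colour.Ext F → (∀ χ → F (rot ∘ χ) ≡ F χ) →
 3 * Tot d (λ χ → proper χ * 𝟙 (eqc (χ (zeroVertex d)) zero) * F χ) ≡ Tot d (λ χ → proper χ * F χ)
rooted-third {d} F ext inv = begin-equality
 3 * R zero
  ≡⟨ cong₂ (λ a b → R zero + (a + (b + 0))) (sym (turn zero)) (sym (trans (turn 1F) (turn zero))) ⟩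
 ∑ cols R
  ≡⟨ sym (Tot-∑ d cols G) ⟩
 Tot d (λ χ → ∑ cols λ c → G c χ)
  ≡⟨ Tot-cong d (λ χ → trans (∑-*ʳ (F χ) cols λ c → proper χ * 𝟙 (eqc (χ 0v) c)) (cong (_* F χ) (trans (∑-*ˡ (proper χ) cols λ c → 𝟙 (eqc (χ 0v) c))
   (trans (cong (proper χ *_) (trans (∑-cong cols λ c → cong 𝟙 (eqc-sym (χ 0v) c)) (count-eqc (χ 0v)))) (*-identityʳ (proper χ)))))) ⟩
 Tot d (λ χ → proper χ * F χ) ∎
 where
 0v : Vertex d
 0v = zeroVertex d
 G : Fin 3 → (Vertex d → Fin 3) → ℕ
 G c χ = proper χ * 𝟙 (eqc (χ 0v) c) * F χ
 R : Fin 3 → ℕ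
 R c = Tot d (G c)
 turn : ∀ c → R (rot c) ≡ R c
 turn c = trans (sym (Tot-rot d {G (rot c)} λ χ χ' h → cong₂ _*_ (cong₂ _*_ (proper-ext χ χ' h) (cong (λ x → 𝟙 (eqc x (rot c))) (h 0v))) (ext χ χ' h)))
  (Tot-cong d λ χ → cong₂ _*_ (cong₂ _*_ (proper-rot χ) (cong 𝟙 (eqc-rot (χ 0v) c))) (inv χ))

-- Sizes of ranges.

module _ {d : ℕ} (f : Vertex d → ℤ) where

 size-of-range : ∀ {L} → Unique L → (∀ v → f v ∈ L) → All (λ z → ∃ λ v → f v ≡ z) L → HasSize (Image f) (length L)
 size-of-range {L} u inside attained = subst (HasSize (Image f)) (len attained) (size-of-enumeration (Image f) (attach attained) (distinct u attained)
  λ { (z , v , refl) → cover (inside v) attained })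
  where
  Value : Set
  Value = Σ ℤ λ z → ∃ λ (v : Vertex d) → f v ≡ z
  attach : ∀ {L} → All (λ z → ∃ λ v → f v ≡ z) L → List Value
  attach [] = []
  attach {z ∷ L} (p ∷ ps) = (z , p) ∷ attach ps
  len : ∀ {L} (ps : All (λ z → ∃ λ v → f v ≡ z) L) → length (attach ps) ≡ length L
  len [] = refl
  len (p ∷ ps) = cong suc (len ps)
  apart : ∀ {z L} → All (z ≢_) L → (ps : All (λ z → ∃ λ v → f v ≡ z) L) → All (λ (b : Value) → z ≢ proj₁ b) (attach ps)
  apart [] [] = []
  apart (n ∷ ns) (p ∷ ps) = n ∷ apart ns ps
  distinct : ∀ {L} → Unique L → (ps : All (λ z → ∃ λ v → f v ≡ z) L) → AllPairs (λ (a b : Value) → proj₁ a ≢ proj₁ b) (attach ps)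
  distinct [] [] = []
  distinct (n ∷ u) (p ∷ ps) = apart n ps ∷ distinct u ps
  cover : ∀ {z L} → z ∈ L → (ps : All (λ z → ∃ λ v → f v ≡ z) L) → Any (λ (b : Value) → z ≡ proj₁ b) (attach ps)
  cover (here e) (p ∷ ps) = here e
  cover (there i) (p ∷ ps) = there (cover i ps)

 rangeSize : ℕ
 rangeSize = length (deduplicate ℤ._≟_ (map f (allV d)))

 has-rangeSize : HasSize (Image f) rangeSize
 has-rangeSize = size-of-range (deduplicate-! (map f (allV d))) (λ v → ∈-deduplicate⁺ ℤ._≟_ (∈-map⁺ f (∈-allV v)))
  (All.tabulate λ i → let v , _ , e = ∈-map⁻ f (∈-deduplicate⁻ ℤ._≟_ (map f (allV d)) i) in v , sym e)

rangeSize-ext : ∀ {d} {f g : Vertex d → ℤ} → (∀ v → f v ≡ g v) → rangeSize f ≡ rangeSize g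
rangeSize-ext {d} h = cong (length ∘ deduplicate ℤ._≟_) (map-cong h (allV d))

flip-invariant : ∀ {d} {A : Set} (F : Vertex d → A) → (∀ v i → F (flip v i) ≡ F v) → ∀ v → F v ≡ F (zeroVertex d)
flip-invariant F h [] = refl
flip-invariant F h (false ∷ v) = flip-invariant (F ∘ (false ∷_)) (λ v i → h (false ∷ v) (suc i)) v
flip-invariant F h (true ∷ v) = trans (h (false ∷ v) zero) (flip-invariant (F ∘ (false ∷_)) (λ v i → h (false ∷ v) (suc i)) v)

-- The range of an ordered colouring.

-- The height profile of an ordered colouring, relative to the points of colour k on the ordered side;
-- the Boolean tells whether the point lies on that side.
profile : Bool → Fin 3 → Fin 3 → ℤ
profile true k c = if eqc c (rot k) then -[1+ 1 ] else if eqc c (rot⁻¹ k) then ℤ.+ 2 else 0ℤ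
profile false k c = if eqc c (rot k) then 1ℤ else -1ℤ

profile-up : ∀ k a b → a ≢ b → b ≢ k → profile false k b ≡ profile true k a ℤ.+ δ a b
profile-up = from-yes (all? λ k → all? λ a → all? λ b → ¬? (a Fin.≟ b) →-dec (¬? (b Fin.≟ k) →-dec (profile false k b ℤ.≟ (profile true k a ℤ.+ δ a b))))

profile-down : ∀ k a b → a ≢ b → b ≢ k → profile true k a ≡ profile false k b ℤ.+ δ b a
profile-down = from-yes (all? λ k → all? λ a → all? λ b → ¬? (a Fin.≟ b) →-dec (¬? (b Fin.≟ k) →-dec (profile true k a ℤ.≟ (profile false k b ℤ.+ δ b a))))

profile-k : ∀ k → profile true k k ≡ 0ℤ
profile-k = from-yes (all? λ k → profile true k k ℤ.≟ 0ℤ)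

profile-on-rot : ∀ k → profile true k (rot k) ≡ -[1+ 1 ]
profile-on-rot = from-yes (all? λ k → profile true k (rot k) ℤ.≟ -[1+ 1 ])

profile-on-rot⁻¹ : ∀ k → profile true k (rot⁻¹ k) ≡ ℤ.+ 2
profile-on-rot⁻¹ = from-yes (all? λ k → profile true k (rot⁻¹ k) ℤ.≟ ℤ.+ 2)

profile-off-rot : ∀ k → profile false k (rot k) ≡ 1ℤ
profile-off-rot = from-yes (all? λ k → profile false k (rot k) ℤ.≟ 1ℤ)

profile-off-rot⁻¹ : ∀ k → profile false k (rot⁻¹ k) ≡ -1ℤ
profile-off-rot⁻¹ = from-yes (all? λ k → profile false k (rot⁻¹ k) ℤ.≟ -1ℤ)

three-colours : ∀ k c → c ≡ k ⊎ (c ≡ rot k ⊎ c ≡ rot⁻¹ k)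
three-colours k c with c Fin.≟ k | c Fin.≟ rot k | c Fin.≟ rot⁻¹ k
... | yes e | _ | _ = inj₁ e
... | no _ | yes e | _ = inj₂ (inj₁ e)
... | no _ | no _ | yes e = inj₂ (inj₂ e)
... | no n₁ | no n₂ | no n₃ = ⊥-elim (from-yes (all? λ k → all? λ c → ¬? (c Fin.≟ k) →-dec (¬? (c Fin.≟ rot k) →-dec (¬? (¬? (c Fin.≟ rot⁻¹ k))))) k c n₁ n₂ n₃)

-- The Booleans tell whether `rot k` and `rot⁻¹ k` are absent from class σ. A vertex of σ with
-- colour `rot k` has only neighbours of colour `rot⁻¹ k`, at height -1, and so lies at -2;
-- symmetrically `rot⁻¹ k` lies at 2.
values : Bool → Bool → List ℤ
values p p' = 0ℤ ∷ 1ℤ ∷ -1ℤ ∷ extra p p'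
 where
 extra : Bool → Bool → List ℤ
 extra true true = []
 extra false true = -[1+ 1 ] ∷ []
 extra true false = ℤ.+ 2 ∷ []
 extra false false = -[1+ 1 ] ∷ ℤ.+ 2 ∷ []

values-unique : ∀ p p' → Unique (values p p')
values-unique true true = from-yes (unique? (values true true))
values-unique false true = from-yes (unique? (values false true))
values-unique true false = from-yes (unique? (values true false))
values-unique false false = from-yes (unique? (values false false))

-2∈values : ∀ {p} p' → p ≡ false → -[1+ 1 ] ∈ values p p'
-2∈values true refl = there (there (there (here refl)))
-2∈values false refl = there (there (there (here refl)))

2∈values : ∀ p {p'} → p' ≡ false → ℤ.+ 2 ∈ values p p'
2∈values true refl = there (there (there (here refl)))
2∈values false refl = there (there (there (there (here refl))))

all-values : ∀ {P : ℤ → Set} p p' → P 0ℤ → P 1ℤ → P -1ℤ → (p ≡ false → P -[1+ 1 ]) → (p' ≡ false → P (ℤ.+ 2)) → All P (values p p')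
all-values true true a b c x y = a ∷ b ∷ c ∷ []
all-values false true a b c x y = a ∷ b ∷ c ∷ x refl ∷ []
all-values true false a b c x y = a ∷ b ∷ c ∷ y refl ∷ []
all-values false false a b c x y = a ∷ b ∷ c ∷ x refl ∷ y refl ∷ []

length-values : ∀ p p' → length (values p p') ≡ 3 + (𝟙 (not p) + 𝟙 (not p'))
length-values true true = refl
length-values false true = refl
length-values true false = refl
length-values false false = refl

absent : ∀ {d} → Bool → (Vertex d → Fin 3) → Fin 3 → Bool
absent {d} σ χ c = allL (filterᵇ (on σ) (allV d)) λ y → not (eqc (χ y) c)

module Ordered (Q : CubeData) (χ : Vertex (CubeData.d Q) → Fin 3) (pr : ∀ v i → χ v ≢ χ (flip v i)) where
 open CubeData Q
 open Estimates Q using (root; root-on; nongeneric)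

 -- There are two directions, and two deviating neighbours would violate isolation.
 k-neighbour : ∀ σ k → isolated σ k χ ≡ true → ∀ v → on σ v ≡ false → ∃ λ i → χ (flip v i) ≡ k
 k-neighbour σ k iso v off with χ (flip v i₀) Fin.≟ k | χ (flip v i₁) Fin.≟ k
 ... | yes e | _ = i₀ , e
 ... | _ | yes e = i₁ , e
 ... | no n₀ | no n₁ = ⊥-elim (i₀≢i₁ (sym (flip-inj v i₁ i₀ (trans (sym (cong (λ w → flip w i₁) (flip-flip v i₀)))
  (isolated⁻ σ k χ iso (flip v i₀) i₀ i₁ (flaw i₀ n₀) (subst (λ w → dev σ k χ (flip w i₁) ≡ true) (sym (flip-flip v i₀)) (flaw i₁ n₁)))))))
  where
  flaw : ∀ i → χ (flip v i) ≢ k → dev σ k χ (flip v i) ≡ true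
  flaw i n = ∧-true⁺ (trans (on-flip σ v i) (cong not off)) (cong not (eqc-≢ n))

 off≢k : ∀ σ k → isolated σ k χ ≡ true → ∀ v → on σ v ≡ false → χ v ≢ k
 off≢k σ k iso v off e = let i , e' = k-neighbour σ k iso v off in pr v i (trans e (sym e'))

 generic⁻ : ∀ σ → nongeneric σ χ ≡ false → ∀ a i → ∃ λ j → j ≢ i × χ (flip (root σ) j) ≢ a
 generic⁻ σ g a i with allL-false (fins d) {λ j → does (j Fin.≟ i) ∨ eqc (χ (flip (root σ) j)) a} (refute λ e → absurd (anyL⁺ {xs = cols} {λ a → anyL (fins d) λ i → allL (fins d) λ j → does (j Fin.≟ i) ∨ eqc (χ (flip (root σ) j)) a} (∈-cols a)
  (anyL⁺ {xs = fins d} {λ i → allL (fins d) λ j → does (j Fin.≟ i) ∨ eqc (χ (flip (root σ) j)) a} (∈-fins i) e)) g)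
 ... | j , _ , e = j , (λ { refl → absurd (cong (_∨ eqc (χ (flip (root σ) j)) a) (does-fin j)) e }) , eqc-≢⁻ _ a (∨-falseʳ {does (j Fin.≟ i)} e)
  where
  ∨-falseʳ : ∀ {a b} → a ∨ b ≡ false → b ≡ false
  ∨-falseʳ {false} e = e
  does-fin : ∀ (j : Fin d) → does (j Fin.≟ j) ≡ true
  does-fin j with j Fin.≟ j
  ... | yes _ = refl
  ... | no n = ⊥-elim (n refl)

 off-root : ∀ σ i → on σ (flip (root σ) i) ≡ false
 off-root σ i = trans (on-flip σ (root σ) i) (cong not (root-on σ))

 -- For equal classes, all vertices off σ avoid both k and k' and would share the third colour,
 -- against genericity. For different classes, genericity gives two neighbours of `root σ` whose
 -- colour is not k': deviations of (σ' , k') with a common neighbour.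
 order-unique : ∀ {σ k σ' k'} → isolated σ k χ ≡ true → nongeneric σ χ ≡ false → isolated σ' k' χ ≡ true → σ' ≡ σ × k' ≡ k
 order-unique {σ} {k} {σ'} {k'} iso g iso' with σ' Bool.≟ σ | k' Fin.≟ k
 ... | yes e | yes e' = e , e'
 ... | yes refl | no n = ⊥-elim (clash (three-colours k k'))
  where
  clash : k' ≡ k ⊎ (k' ≡ rot k ⊎ k' ≡ rot⁻¹ k) → ⊥
  clash (inj₁ e) = n e
  clash (inj₂ e) = let j , _ , ne = generic⁻ σ g (third e) i₀ in
   only e (three-colours k (χ (flip (root σ) j))) (off≢k σ k iso _ (off-root σ j)) (off≢k σ k' iso' _ (off-root σ j)) ne
   where
   third : k' ≡ rot k ⊎ k' ≡ rot⁻¹ k → Fin 3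
   third (inj₁ _) = rot⁻¹ k
   third (inj₂ _) = rot k
   only : ∀ e {c} → c ≡ k ⊎ (c ≡ rot k ⊎ c ≡ rot⁻¹ k) → c ≢ k → c ≢ k' → c ≢ third e → ⊥
   only e (inj₁ x) n₁ n₂ n₃ = n₁ x
   only (inj₁ e) (inj₂ (inj₁ x)) n₁ n₂ n₃ = n₂ (trans x (sym e))
   only (inj₁ e) (inj₂ (inj₂ x)) n₁ n₂ n₃ = n₃ x
   only (inj₂ e) (inj₂ (inj₁ x)) n₁ n₂ n₃ = n₃ x
   only (inj₂ e) (inj₂ (inj₂ x)) n₁ n₂ n₃ = n₂ (trans x (sym e))
 ... | no n | _ with generic⁻ σ g k' i₀
 ...   | j , _ , ne with generic⁻ σ g k' j
 ...     | j' , j'≢j , ne' = ⊥-elim (j'≢j (flip-inj (root σ) j' j (trans (sym (cong (λ w → flip w j') (flip-flip (root σ) j)))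
  (isolated⁻ σ' k' χ iso' (flip (root σ) j) j j' (flaw j ne) (subst (λ w → dev σ' k' χ (flip w j') ≡ true) (sym (flip-flip (root σ) j)) (flaw j' ne'))))))
  where
  other : ∀ a b → a ≢ b → a ≡ not b
  other false false n = ⊥-elim (n refl)
  other false true n = refl
  other true false n = refl
  other true true n = ⊥-elim (n refl)
  flaw : ∀ i → χ (flip (root σ) i) ≢ k' → dev σ' k' χ (flip (root σ) i) ≡ true
  flaw i ne = ∧-true⁺ (trans (cong (λ s → on s (flip (root σ) i)) (other σ' σ n)) (trans (on-not σ (flip (root σ) i)) (cong not (off-root σ i)))) (cong not (eqc-≢ ne))

 module _ (σ : Bool) (k : Fin 3) (iso : isolated σ k χ ≡ true) (g : nongeneric σ χ ≡ false) where
  private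
   p p' : Bool
   p = absent σ χ (rot k)
   p' = absent σ χ (rot⁻¹ k)

   η : Vertex d → ℤ
   η v = profile (on σ v) k (χ v)

   η-flip : ∀ v i → η (flip v i) ≡ η v ℤ.+ δ (χ v) (χ (flip v i))
   η-flip v i = go (bool-cases (on σ v))
    where
    go : Cases (on σ v) → η (flip v i) ≡ η v ℤ.+ δ (χ v) (χ (flip v i))
    go (inj₁ o) = trans (cong (λ b → profile b k (χ (flip v i))) o') (trans (profile-up k _ _ (pr v i) (off≢k σ k iso (flip v i) o'))
     (cong (λ b → profile b k (χ v) ℤ.+ δ (χ v) (χ (flip v i))) (sym o)))
     where
     o' : on σ (flip v i) ≡ false
     o' = trans (on-flip σ v i) (cong not o)
    go (inj₂ o) = trans (cong (λ b → profile b k (χ (flip v i))) (trans (on-flip σ v i) (cong not o))) (trans (profile-down k _ _ (pr v i ∘ sym) (off≢k σ k iso v o))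
     (cong (λ b → profile b k (χ v) ℤ.+ δ (χ v) (χ (flip v i))) (sym o)))

   base : ℤ
   base = lift χ (zeroVertex d) ℤ.- η (zeroVertex d)

   -- By `η-flip` the profile and the lift have the same increments, so they differ by a constant.
   height : ∀ v → lift χ v ≡ base ℤ.+ η v
   height v = trans (l (lift χ v) (η v)) (cong (ℤ._+ η v) (flip-invariant (λ v → lift χ v ℤ.- η v)
    (λ v i → trans (cong₂ ℤ._-_ (lift-flip χ pr v i) (η-flip v i)) (l' (lift χ v) (η v) (δ (χ v) (χ (flip v i))))) v))
    where
    l : ∀ a b → a ≡ (a ℤ.- b) ℤ.+ b
    l = ℤ-solve-∀
    l' : ∀ a b x → (a ℤ.+ x) ℤ.- (b ℤ.+ x) ≡ a ℤ.- b
    l' = ℤ-solve-∀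

   present : ∀ c → absent σ χ c ≡ false → ∃ λ y → on σ y ≡ true × χ y ≡ c
   present c e with allL-false (filterᵇ (on σ) (allV d)) e
   ... | y , m , e' = y , filterᵇ-true (on σ) (allV d) m , eqc-≡ (not-injective e')

   absent-false : ∀ {c} v → on σ v ≡ true → χ v ≡ c → absent σ χ c ≡ false
   absent-false {c} v o e = refute λ t → absurd (trans (cong (λ x → eqc x c) e) (eqc-refl c)) (not-injective (allL⁻ t (∈-filterᵇ⁺ (on σ) (∈-allV v) o)))

   inside : ∀ v → η v ∈ values p p'
   inside v = go (bool-cases (on σ v)) (three-colours k (χ v))
    where
    val : ∀ b c z → on σ v ≡ b → χ v ≡ c → profile b k c ≡ z → z ∈ values p p' → η v ∈ values p p'
    val b c z o e pz m = subst (_∈ values p p') (sym (trans (cong₂ (λ b c → profile b k c) o e) pz)) m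
    go : Cases (on σ v) → χ v ≡ k ⊎ (χ v ≡ rot k ⊎ χ v ≡ rot⁻¹ k) → η v ∈ values p p'
    go (inj₁ o) (inj₁ e) = val true k 0ℤ o e (profile-k k) (here refl)
    go (inj₁ o) (inj₂ (inj₁ e)) = val true (rot k) -[1+ 1 ] o e (profile-on-rot k) (-2∈values p' (absent-false v o e))
    go (inj₁ o) (inj₂ (inj₂ e)) = val true (rot⁻¹ k) (ℤ.+ 2) o e (profile-on-rot⁻¹ k) (2∈values p (absent-false v o e))
    go (inj₂ o) (inj₁ e) = ⊥-elim (off≢k σ k iso v o e)
    go (inj₂ o) (inj₂ (inj₁ e)) = val false (rot k) 1ℤ o e (profile-off-rot k) (there (here refl))
    go (inj₂ o) (inj₂ (inj₂ e)) = val false (rot⁻¹ k) -1ℤ o e (profile-off-rot⁻¹ k) (there (there (here refl)))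

   -- Height 0 comes from a k-coloured vertex at distance two flips from the root; genericity
   -- provides both other colours among the neighbours of the root, hence 1 and -1.
   attained : All (λ z → ∃ λ v → η v ≡ z) (values p p')
   attained = all-values p p'
    (flip (flip (root σ) i₀) (proj₁ kn) , at true k o-kn (proj₂ kn) (profile-k k))
    (let j , e = off-colour (rot k) (rot⁻¹ k) (λ { (inj₁ e) ne → e ; (inj₂ e) ne → ⊥-elim (ne e) }) in flip (root σ) j , at false (rot k) (off-root σ j) e (profile-off-rot k))
    (let j , e = off-colour (rot⁻¹ k) (rot k) (λ { (inj₂ e) ne → e ; (inj₁ e) ne → ⊥-elim (ne e) }) in flip (root σ) j , at false (rot⁻¹ k) (off-root σ j) e (profile-off-rot⁻¹ k))
    (λ e → let y , o , c = present (rot k) e in y , at true (rot k) o c (profile-on-rot k))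
    (λ e → let y , o , c = present (rot⁻¹ k) e in y , at true (rot⁻¹ k) o c (profile-on-rot⁻¹ k))
    where
    at : ∀ {v z} b c → on σ v ≡ b → χ v ≡ c → profile b k c ≡ z → η v ≡ z
    at b c o e pz = trans (cong₂ (λ b c → profile b k c) o e) pz
    kn : ∃ λ i → χ (flip (flip (root σ) i₀) i) ≡ k
    kn = k-neighbour σ k iso (flip (root σ) i₀) (off-root σ i₀)
    o-kn : on σ (flip (flip (root σ) i₀) (proj₁ kn)) ≡ true
    o-kn = trans (on-flip σ (flip (root σ) i₀) (proj₁ kn)) (cong not (off-root σ i₀))
    off-colour : ∀ c c' → (∀ {x} → x ≡ rot k ⊎ x ≡ rot⁻¹ k → x ≢ c' → x ≡ c) → ∃ λ j → χ (flip (root σ) j) ≡ c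
    off-colour c c' pick with generic⁻ σ g c' i₀
    ... | j , _ , ne with three-colours k (χ (flip (root σ) j))
    ...   | inj₁ e = ⊥-elim (off≢k σ k iso _ (off-root σ j) e)
    ...   | inj₂ e = j , pick e ne

  range-ordered : rangeSize (lift χ) ≡ 3 + (𝟙 (not p) + 𝟙 (not p'))
  range-ordered = trans (size-unique (Image (lift χ)) (has-rangeSize (lift χ)) (size-of-range (lift χ)
   (map⁺ (λ {a} {b} e → trans (cancel base a) (trans (cong (ℤ._- base) e) (sym (cancel base b)))) (values-unique p p'))
   (λ v → subst (_∈ map (λ z → base ℤ.+ z) (values p p')) (sym (height v)) (∈-map⁺ (λ z → base ℤ.+ z) (inside v)))
   (All-map attained)))
   (trans (length-map (λ z → base ℤ.+ z) (values p p')) (length-values p p'))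
   where
   cancel : ∀ c a → a ≡ (c ℤ.+ a) ℤ.- c
   cancel = ℤ-solve-∀
   All-map : ∀ {L} → All (λ z → ∃ λ v → η v ≡ z) L → All (λ z → ∃ λ v → lift χ v ≡ z) (map (λ z → base ℤ.+ z) L)
   All-map [] = []
   All-map ((v , e) ∷ ps) = (v , trans (height v) (cong (λ z → base ℤ.+ z) e)) ∷ All-map ps

-- Inclusion-exclusion over the six pairs.

homs : ℕ → ℕ
homs d = Tot d λ χ → proper χ * 𝟙 (eqc (χ (zeroVertex d)) zero) * 1

homs-of-size : ℕ → ℕ → ℕ
homs-of-size i d = Tot d λ χ → proper χ * 𝟙 (eqc (χ (zeroVertex d)) zero) * 𝟙 (does (rangeSize (lift χ) ≟ i))

∏-𝟙 : ∀ {A : Set} (xs : List A) (q : A → Bool) → ∏ xs (𝟙 ∘ q) ≡ 𝟙 (allL xs q)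
∏-𝟙 [] q = refl
∏-𝟙 (x ∷ xs) q = trans (cong (𝟙 (q x) *_) (∏-𝟙 xs q)) (sym (𝟙-∧ (q x) _))

∑σk-+ : ∀ f g → ∑σk (λ σ k → f σ k + g σ k) ≡ ∑σk f + ∑σk g
∑σk-+ f g = trans (∑-cong sides λ σ → ∑-+ cols (f σ) (g σ)) (∑-+ sides (λ σ → ∑ cols (f σ)) (λ σ → ∑ cols (g σ)))

∑σk-cong : ∀ {f g} → (∀ σ k → f σ k ≡ g σ k) → ∑σk f ≡ ∑σk g
∑σk-cong h = ∑-cong sides λ σ → ∑-cong cols (h σ)

∑σk-*ˡ : ∀ c g → ∑σk (λ σ k → c * g σ k) ≡ c * ∑σk g
∑σk-*ˡ c g = trans (∑-cong sides λ σ → ∑-*ˡ c cols (g σ)) (∑-*ˡ c sides λ σ → ∑ cols (g σ))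

∑σk-single : ∀ X σ k → ∑σk (λ σ' k' → X * 𝟙 (does (σ' Bool.≟ σ) ∧ eqc k' k)) ≡ X
∑σk-single X σ k = trans (∑σk-*ˡ X λ σ' k' → 𝟙 (does (σ' Bool.≟ σ) ∧ eqc k' k)) (trans (cong (X *_) (one σ k)) (*-identityʳ X))
 where
 one : ∀ σ k → ∑σk (λ σ' k' → 𝟙 (does (σ' Bool.≟ σ) ∧ eqc k' k)) ≡ 1
 one false zero = refl
 one false 1F = refl
 one false 2F = refl
 one true zero = refl
 one true 1F = refl
 one true 2F = refl

module Counting (Q : CubeData) where
 open CubeData Q
 open Estimates Q
 private
  module O = Ordered Q
  module X = Exponential Q

  Colouring : Set
  Colouring = Vertex d → Fin 3

 W : (Colouring → ℕ) → Bool → Fin 3 → ℕ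
 W b σ k = Tot d λ χ → proper χ * 𝟙 (isolated σ k χ) * b χ

 NGs : ℕ
 NGs = ∑σk Side.NG

 module _ (b : Colouring → Bool) (c : Bool → Fin 3 → Colouring → Bool)
  (agree : ∀ χ → (∀ v i → χ v ≢ χ (flip v i)) → ∀ σ k → isolated σ k χ ≡ true → nongeneric σ χ ≡ false → b χ ≡ c σ k χ) where

  private
   iso ng : Bool → Fin 3 → Colouring → ℕ
   iso σ k χ = proper χ * 𝟙 (isolated σ k χ) * 𝟙 (c σ k χ)
   ng σ k χ = proper χ * 𝟙 (isolated σ k χ ∧ nongeneric σ χ)

   agree′ : ∀ χ σ k → isolated σ k χ ≡ true → nongeneric σ χ ≡ false → proper χ * 𝟙 (b χ) ≡ proper χ * 𝟙 (c σ k χ)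
   agree′ χ σ k is g = go (proper χ) refl
    where
    go : ∀ x → proper χ ≡ x → x * 𝟙 (b χ) ≡ x * 𝟙 (c σ k χ)
    go zero e = refl
    go (suc x) e = cong (λ t → suc x * 𝟙 t) (agree χ (proper⁻ χ (≤≡ (s≤s z≤n) (sym e))) σ k is g)

   iso-value : ∀ χ σ k → isolated σ k χ ≡ true → iso σ k χ ≡ proper χ * 𝟙 (c σ k χ)
   iso-value χ σ k is = cong (_* 𝟙 (c σ k χ)) (trans (cong (λ t → proper χ * 𝟙 t) is) (*-identityʳ (proper χ)))

   above : ∀ χ → proper χ * 𝟙 (b χ) ≤ ∑σk (λ σ k → iso σ k χ) + (proper χ * 𝟙 (not (ordered χ)) + ∑σk (λ σ k → ng σ k χ))
   above χ = go (bool-cases (ordered χ))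
    where
    A B C : ℕ
    A = ∑σk (λ σ k → iso σ k χ)
    B = proper χ * 𝟙 (not (ordered χ))
    C = ∑σk (λ σ k → ng σ k χ)
    atmost : ∀ {t} → t ≡ true → proper χ * 𝟙 (b χ) ≤ proper χ * 𝟙 t
    atmost e = *-monoʳ-≤ (proper χ) (≤≡ (𝟙≤1 (b χ)) (sym (𝟙-true e)))
    go : Cases (ordered χ) → proper χ * 𝟙 (b χ) ≤ A + (B + C)
    go (inj₂ e) = ≤-trans (atmost (cong not e)) (≤-trans (m≤m+n B C) (m≤n+m (B + C) A))
    go (inj₁ e) with anyσk⁻ (λ σ k → isolated σ k χ) e
    ... | σ , k , is = go′ (bool-cases (nongeneric σ χ))
     where
     go′ : Cases (nongeneric σ χ) → proper χ * 𝟙 (b χ) ≤ A + (B + C)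
     go′ (inj₁ g) = ≤-trans (atmost (∧-true⁺ is g)) (≤-trans (term≤∑σk (λ σ k → ng σ k χ) σ k) (≤-trans (m≤n+m C B) (m≤n+m (B + C) A)))
     go′ (inj₂ g) = ≡≤ (trans (agree′ χ σ k is g) (sym (iso-value χ σ k is))) (≤-trans (term≤∑σk (λ σ k → iso σ k χ) σ k) (m≤m+n A (B + C)))

   below : ∀ χ → ∑σk (λ σ k → iso σ k χ) ≤ proper χ * 𝟙 (b χ) + ∑σk (λ σ k → ng σ k χ)
   below χ = go (bool-cases (anyσk q))
    where
    q : Bool → Fin 3 → Bool
    q σ k = isolated σ k χ ∧ not (nongeneric σ χ)
    B C : ℕ
    B = proper χ * 𝟙 (b χ)
    C = ∑σk (λ σ k → ng σ k χ)
    iso≤ : ∀ σ k {t} → (isolated σ k χ ≡ true → t ≡ true) → iso σ k χ ≤ proper χ * 𝟙 t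
    iso≤ σ k f = ≤-trans (*-monoʳ-≤ (proper χ * 𝟙 (isolated σ k χ)) (𝟙≤1 (c σ k χ))) (≡≤ (*-identityʳ _) (*-monoʳ-≤ (proper χ) (𝟙-mono f)))
    go : Cases (anyσk q) → ∑σk (λ σ k → iso σ k χ) ≤ B + C
    go (inj₂ e) = ≤-trans (∑σk-mono λ σ k → iso≤ σ k λ is → ∧-true⁺ is (nongen σ k is (bool-cases (nongeneric σ χ)))) (m≤n+m C B)
     where
     nongen : ∀ σ k → isolated σ k χ ≡ true → Cases (nongeneric σ χ) → nongeneric σ χ ≡ true
     nongen σ k is (inj₁ g) = g
     nongen σ k is (inj₂ g) = absurd (anyσk⁺ q σ k (∧-true⁺ is (cong not g))) e
    go (inj₁ e) with anyσk⁻ q e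
    ... | σ , k , is,g = ≤-trans (≤≡ (∑σk-mono λ σ' k' → term σ' k' (proper χ) refl) (∑σk-single B σ k)) (m≤m+n B C)
     where
     is : isolated σ k χ ≡ true
     is = ∧ˡ is,g
     g : nongeneric σ χ ≡ false
     g = not-injective (∧ʳ {isolated σ k χ} is,g)
     term : ∀ σ' k' x → proper χ ≡ x → iso σ' k' χ ≤ B * 𝟙 (does (σ' Bool.≟ σ) ∧ eqc k' k)
     term σ' k' zero p0 = ≡≤ (cong (λ x → x * 𝟙 (isolated σ' k' χ) * 𝟙 (c σ' k' χ)) p0) z≤n
     term σ' k' (suc x) p1 = go″ (bool-cases (isolated σ' k' χ))
      where
      go″ : Cases (isolated σ' k' χ) → iso σ' k' χ ≤ B * 𝟙 (does (σ' Bool.≟ σ) ∧ eqc k' k)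
      go″ (inj₂ f) = ≡≤ (trans (cong (λ t → proper χ * 𝟙 t * 𝟙 (c σ' k' χ)) f) (cong (_* 𝟙 (c σ' k' χ)) (*-zeroʳ (proper χ)))) z≤n
      go″ (inj₁ is') with O.order-unique χ (proper⁻ χ (≤≡ (s≤s z≤n) (sym p1))) {σ} {k} {σ'} {k'} is g is'
      ... | refl , refl = ≤-reflexive (trans (iso-value χ σ k is) (trans (sym (agree′ χ σ k is g)) (sym (trans (cong (λ t → B * 𝟙 t) (∧-true⁺ (bool-refl σ) (eqc-refl k))) (*-identityʳ B)))))
       where
       bool-refl : ∀ (s : Bool) → does (s Bool.≟ s) ≡ true
       bool-refl false = refl
       bool-refl true = refl

   Tot-W : Tot d (λ χ → ∑σk λ σ k → iso σ k χ) ≡ ∑σk (λ σ k → W (λ χ → 𝟙 (c σ k χ)) σ k)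
   Tot-W = Tot-∑σk d iso

  -- A generic ordered colouring has exactly one pair (σ , k), so the sum over pairs counts it once.
  -- Disordered and nongeneric colourings are charged to the error here and in `total-below`.
  total-above : Tot d (λ χ → proper χ * 𝟙 (b χ)) ≤ ∑σk (λ σ k → W (λ χ → 𝟙 (c σ k χ)) σ k) + (Disordered d + NGs)
  total-above = ≤≡ (Tot-mono d above) (trans (Tot-+ d (λ χ → ∑σk λ σ k → iso σ k χ) (λ χ → proper χ * 𝟙 (not (ordered χ)) + ∑σk λ σ k → ng σ k χ))
   (cong₂ _+_ Tot-W (trans (Tot-+ d (λ χ → proper χ * 𝟙 (not (ordered χ))) (λ χ → ∑σk λ σ k → ng σ k χ)) (cong (Disordered d +_) (Tot-∑σk d ng)))))

  total-below : ∑σk (λ σ k → W (λ χ → 𝟙 (c σ k χ)) σ k) ≤ Tot d (λ χ → proper χ * 𝟙 (b χ)) + (Disordered d + NGs)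
  total-below = ≡≤ (sym Tot-W) (≤-trans (Tot-mono d below) (≡≤ (trans (Tot-+ d (λ χ → proper χ * 𝟙 (b χ)) (λ χ → ∑σk λ σ k → ng σ k χ))
   (cong (Tot d (λ χ → proper χ * 𝟙 (b χ)) +_) (Tot-∑σk d ng))) (+-monoʳ-≤ (Tot d (λ χ → proper χ * 𝟙 (b χ))) (m≤n+m NGs (Disordered d)))))

 q⊤ : Fin 3 → Fin 3 → Bool
 q⊤ k c = true
 q₊ q₋ q₀ : Fin 3 → Fin 3 → Bool
 q₊ k c = not (eqc c (rot k))
 q₋ k c = not (eqc c (rot⁻¹ k))
 q₀ k c = q₊ k c ∧ q₋ k c

 C : (Fin 3 → Fin 3 → Bool) → Bool → Fin 3 → ℕ
 C q σ k = Side.isoCount σ k (q k)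

 private
  P P' : Bool → Fin 3 → Colouring → Bool
  P σ k χ = absent σ χ (rot k)
  P' σ k χ = absent σ χ (rot⁻¹ k)

  W-cong : ∀ {b b'} σ k → (∀ χ → b χ ≡ b' χ) → W b σ k ≡ W b' σ k
  W-cong σ k h = Tot-cong d λ χ → cong (proper χ * 𝟙 (isolated σ k χ) *_) (h χ)

  W-+ : ∀ b b' σ k → W (λ χ → b χ + b' χ) σ k ≡ W b σ k + W b' σ k
  W-+ b b' σ k = trans (Tot-cong d λ χ → *-distribˡ-+ (proper χ * 𝟙 (isolated σ k χ)) (b χ) (b' χ)) (Tot-+ d _ _)

  C≡W : ∀ q σ k → C q σ k ≡ W (λ χ → 𝟙 (allL (filterᵇ (on σ) (allV d)) (λ y → q k (χ y)))) σ k
  C≡W q σ k = W-cong σ k λ χ → trans (cong₂ _*_ (∏-𝟙 (filterᵇ (on σ) (allV d)) (λ y → q k (χ y))) (∏-one (filterᵇ (not ∘ on σ) (allV d)))) (*-identityʳ _)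

  C⊤≡ : ∀ σ k → C q⊤ σ k ≡ W (λ _ → 1) σ k
  C⊤≡ σ k = trans (C≡W q⊤ σ k) (W-cong σ k λ χ → 𝟙-true (allL⁺ (filterᵇ (on σ) (allV d)) λ _ → refl))

  C₀≡ : ∀ σ k → C q₀ σ k ≡ W (λ χ → 𝟙 (P σ k χ) * 𝟙 (P' σ k χ)) σ k
  C₀≡ σ k = trans (C≡W q₀ σ k) (W-cong σ k λ χ → trans (sym (∏-𝟙 (filterᵇ (on σ) (allV d)) _)) (trans (∏-cong (filterᵇ (on σ) (allV d)) λ y → 𝟙-∧ (q₊ k (χ y)) (q₋ k (χ y)))
   (trans (∏-* (filterᵇ (on σ) (allV d)) (λ y → 𝟙 (q₊ k (χ y))) (λ y → 𝟙 (q₋ k (χ y)))) (cong₂ _*_ (∏-𝟙 (filterᵇ (on σ) (allV d)) λ y → q₊ k (χ y)) (∏-𝟙 (filterᵇ (on σ) (allV d)) λ y → q₋ k (χ y))))))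

 sized : ℕ → Bool → Fin 3 → Colouring → Bool
 sized i σ k χ = does (3 + (𝟙 (not (P σ k χ)) + 𝟙 (not (P' σ k χ))) ≟ i)

 Sized : ℕ → ℕ
 Sized i = ∑σk λ σ k → W (λ χ → 𝟙 (sized i σ k χ)) σ k

 S⊤ S₁ S₀ : ℕ
 S⊤ = ∑σk (C q⊤)
 S₁ = ∑σk (C q₊) + ∑σk (C q₋)
 S₀ = ∑σk (C q₀)

 Sized⊤ : ∑σk (λ σ k → W (λ _ → 1) σ k) ≡ S⊤
 Sized⊤ = ∑σk-cong λ σ k → sym (C⊤≡ σ k)

 Sized₃ : Sized 3 ≡ S₀
 Sized₃ = ∑σk-cong λ σ k → trans (W-cong σ k λ χ → bits (P σ k χ) (P' σ k χ)) (sym (C₀≡ σ k))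
  where
  bits : ∀ p p' → 𝟙 (does (3 + (𝟙 (not p) + 𝟙 (not p')) ≟ 3)) ≡ 𝟙 p * 𝟙 p'
  bits false false = refl
  bits false true = refl
  bits true false = refl
  bits true true = refl

 -- Range 4 means that exactly one of the two colours is absent, |P| + |P'| - 2 |P ∩ P'|, with the
 -- subtraction moved to the other side; `Sized₅` is the count with neither absent.
 Sized₄ : Sized 4 + (S₀ + S₀) ≡ S₁
 Sized₄ = trans (cong (Sized 4 +_) (sym (∑σk-+ (C q₀) (C q₀)))) (trans (sym (∑σk-+ (λ σ k → W (λ χ → 𝟙 (sized 4 σ k χ)) σ k) (λ σ k → C q₀ σ k + C q₀ σ k)))
  (trans (∑σk-cong each) (∑σk-+ (C q₊) (C q₋))))
  where
  bits : ∀ p p' → 𝟙 (does (3 + (𝟙 (not p) + 𝟙 (not p')) ≟ 4)) + (𝟙 p * 𝟙 p' + 𝟙 p * 𝟙 p') ≡ 𝟙 p + 𝟙 p'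
  bits false false = refl
  bits false true = refl
  bits true false = refl
  bits true true = refl
  each : ∀ σ k → W (λ χ → 𝟙 (sized 4 σ k χ)) σ k + (C q₀ σ k + C q₀ σ k) ≡ C q₊ σ k + C q₋ σ k
  each σ k = trans (cong (W (λ χ → 𝟙 (sized 4 σ k χ)) σ k +_) (trans (cong₂ _+_ (C₀≡ σ k) (C₀≡ σ k)) (sym (W-+ w w σ k))))
   (trans (sym (W-+ (λ χ → 𝟙 (sized 4 σ k χ)) (λ χ → w χ + w χ) σ k)) (trans (W-cong σ k λ χ → bits (P σ k χ) (P' σ k χ))
   (trans (W-+ (λ χ → 𝟙 (P σ k χ)) (λ χ → 𝟙 (P' σ k χ)) σ k) (sym (cong₂ _+_ (C≡W q₊ σ k) (C≡W q₋ σ k))))))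
   where
   w : Colouring → ℕ
   w χ = 𝟙 (P σ k χ) * 𝟙 (P' σ k χ)

 Sized₅ : Sized 5 + S₁ ≡ S⊤ + S₀
 Sized₅ = trans (cong (Sized 5 +_) (sym (∑σk-+ (C q₊) (C q₋)))) (trans (sym (∑σk-+ (λ σ k → W (λ χ → 𝟙 (sized 5 σ k χ)) σ k) (λ σ k → C q₊ σ k + C q₋ σ k)))
  (trans (∑σk-cong each) (∑σk-+ (C q⊤) (C q₀))))
  where
  bits : ∀ p p' → 𝟙 (does (3 + (𝟙 (not p) + 𝟙 (not p')) ≟ 5)) + (𝟙 p + 𝟙 p') ≡ 1 + 𝟙 p * 𝟙 p'
  bits false false = refl
  bits false true = refl
  bits true false = refl
  bits true true = refl
  each : ∀ σ k → W (λ χ → 𝟙 (sized 5 σ k χ)) σ k + (C q₊ σ k + C q₋ σ k) ≡ C q⊤ σ k + C q₀ σ k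
  each σ k = trans (cong (W (λ χ → 𝟙 (sized 5 σ k χ)) σ k +_) (trans (cong₂ _+_ (C≡W q₊ σ k) (C≡W q₋ σ k)) (sym (W-+ (λ χ → 𝟙 (P σ k χ)) (λ χ → 𝟙 (P' σ k χ)) σ k))))
   (trans (sym (W-+ (λ χ → 𝟙 (sized 5 σ k χ)) (λ χ → 𝟙 (P σ k χ) + 𝟙 (P' σ k χ)) σ k)) (trans (W-cong σ k λ χ → bits (P σ k χ) (P' σ k χ))
   (trans (W-+ (λ _ → 1) (λ χ → 𝟙 (P σ k χ) * 𝟙 (P' σ k χ)) σ k) (sym (cong₂ _+_ (C⊤≡ σ k) (C₀≡ σ k))))))

 -- Error bookkeeping for the four constants.

 module Limits (V : ℕ) (hV : (8 * (d * d) + 12 * d + 8) * V ≤ N) (disordered : V * Disordered d ≤ 2 ^ N) (n : ℕ) where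
  open X n using (f; Z; E; count-above; count-below)

  private
   n' : ℕ
   n' = suc n

  -- S = (s/f) Z up to α/(n+1) above and β/V below, in units of Z. The first error comes from
  -- truncating the series, the second from finite N.
  record Approx (S s α β : ℕ) : Set where
   constructor _,_
   field
    upper : V * n' * (f * S) ≤ V * n' * (s * Z) + α * (V * (f * Z))
    lower : V * n' * (s * Z) ≤ V * n' * (f * S) + β * (n' * (f * Z))

  -- X = ((a - b)/f) Z up to (7/V + 8/(n+1)) Z; the 8 is the precision built into `CloseTo`.
  record Close (X a b : ℕ) : Set where
   constructor _,_
   field
    upper : V * n' * (f * X + b * Z) ≤ V * n' * (a * Z) + (7 * n' + 8 * V) * (f * Z)
    lower : V * n' * (a * Z) ≤ V * n' * (f * X + b * Z) + (7 * n' + 8 * V) * (f * Z)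

  Approx-+ : ∀ {S s α β S' s' α' β'} → Approx S s α β → Approx S' s' α' β' → Approx (S + S') (s + s') (α + α') (β + β')
  Approx-+ {S} {s} {α} {β} {S'} {s'} {α'} {β'} (u , l) (u' , l') =
   ≡≤ (d₁ (V * n') f S S') (≤≡ (+-mono-≤ u u') (d₂ (V * n') Z s s' α α' (V * (f * Z)))) ,
   ≡≤ (d₃ (V * n') Z s s') (≤≡ (+-mono-≤ l l') (d₄ (V * n') f S S' β β' (n' * (f * Z))))
   where
   d₁ : ∀ v f S S' → v * (f * (S + S')) ≡ v * (f * S) + v * (f * S')
   d₁ = solve-∀
   d₂ : ∀ v Z s s' α α' e → v * (s * Z) + α * e + (v * (s' * Z) + α' * e) ≡ v * ((s + s') * Z) + (α + α') * e
   d₂ = solve-∀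
   d₃ : ∀ v Z s s' → v * ((s + s') * Z) ≡ v * (s * Z) + v * (s' * Z)
   d₃ = solve-∀
   d₄ : ∀ v f S S' β β' e → v * (f * S) + β * e + (v * (f * S') + β' * e) ≡ v * (f * (S + S')) + (β + β') * e
   d₄ = solve-∀

  Approx-0 : Approx 0 0 0 0
  Approx-0 = ≤-reflexive (z (V * n') f) , ≤-reflexive (sym (z′ (V * n') f))
   where
   z : ∀ v f → v * (f * 0) ≡ v * 0 + 0
   z = solve-∀
   z′ : ∀ v f → v * (f * 0) + 0 ≡ v * 0
   z′ = solve-∀

  Approx-∑σk : ∀ {g : Bool → Fin 3 → ℕ} {s α β} → (∀ σ k → Approx (g σ k) s α β) → Approx (∑σk g) (6 * s) (6 * α) (6 * β)
  Approx-∑σk {g} {s} {α} {β} h = subst (λ x → Approx (∑σk g) x (6 * α) (6 * β)) (l s) (subst (λ x → Approx (∑σk g) (side-sum s + (side-sum s + 0)) x (6 * β)) (l α)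
   (subst (λ x → Approx (∑σk g) (side-sum s + (side-sum s + 0)) (side-sum α + (side-sum α + 0)) x) (l β) (Approx-+ (one false) (Approx-+ (one true) Approx-0))))
   where
   side-sum : ℕ → ℕ
   side-sum x = x + (x + (x + 0))
   l : ∀ x → (x + (x + (x + 0))) + ((x + (x + (x + 0))) + 0) ≡ 6 * x
   l = solve-∀
   one : ∀ σ → Approx (∑ cols (g σ)) (side-sum s) (side-sum α) (side-sum β)
   one σ = Approx-+ (h σ zero) (Approx-+ (h σ 1F) (Approx-+ (h σ 2F) Approx-0))

  count-approx : ∀ q L → (∀ k → q k k ≡ true) → (∀ σ k → Side.nL σ k (q k) ≡ L) → ∀ σ k → Approx (C q σ k) (E L) (2 * L) 1
  count-approx q L qk nL σ k =
   ≡≤ (d₁ V n' f (C q σ k)) (≤≡ (*-monoʳ-≤ V (subst (λ L → n' * (C q σ k * f) ≤ n' * (Z * E L) + 2 * L * (f * Z)) (nL σ k) (count-above σ k (q k) (qk k))))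
    (d₂ V n' Z (E L) (2 * L) (f * Z))) ,
   ≡≤ (d₃ V n' (E L) Z) (≤≡ (*-monoʳ-≤ n' (subst (λ L → V * (Z * E L) ≤ V * (f * C q σ k) + f * Z) (nL σ k) (count-below σ k (q k) (qk k) V
    (≤-trans (*-monoˡ-≤ V (+-monoˡ-≤ 8 (m≤m+n (8 * (d * d)) (12 * d)))) hV)))) (d₄ n' V (f * C q σ k) (f * Z)))
   where
   d₁ : ∀ v n f c → v * n * (f * c) ≡ v * (n * (c * f))
   d₁ = solve-∀
   d₂ : ∀ v n z e l x → v * (n * (z * e) + l * x) ≡ v * n * (e * z) + l * (v * x)
   d₂ = solve-∀
   d₃ : ∀ v n e z → v * n * (e * z) ≡ n * (v * (z * e))
   d₃ = solve-∀
   d₄ : ∀ n v x y → n * (v * x + y) ≡ v * n * x + 1 * (n * y)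
   d₄ = solve-∀

  E₀ : E 0 ≡ f
  E₀ = trans (cong (λ p → Series.series (2 * N) p (suc n)) (*-zeroʳ N)) (Series.series-zero (2 * N) (suc n))

  S⊤-approx : Approx S⊤ (6 * E 2) 24 6
  S⊤-approx = Approx-∑σk (count-approx q⊤ 2 (λ _ → refl) (λ _ _ → refl))

  S₁-approx : Approx S₁ (6 * E 1 + 6 * E 1) 24 12
  S₁-approx = Approx-+ (Approx-∑σk (count-approx q₊ 1 (from-yes (all? λ k → q₊ k k Bool.≟ true)) (λ σ → from-yes (all? λ k → Side.nL σ k (q₊ k) ≟ 1))))
   (Approx-∑σk (count-approx q₋ 1 (from-yes (all? λ k → q₋ k k Bool.≟ true)) (λ σ → from-yes (all? λ k → Side.nL σ k (q₋ k) ≟ 1))))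

  S₀-approx : Approx S₀ (6 * f) 0 6
  S₀-approx = subst (λ x → Approx S₀ (6 * x) 0 6) E₀ (Approx-∑σk (count-approx q₀ 0 (from-yes (all? λ k → q₀ k k Bool.≟ true)) (λ σ → from-yes (all? λ k → Side.nL σ k (q₀ k) ≟ 0))))

  Err : ℕ
  Err = Disordered d + NGs

  -- One Z for the disordered colourings and one for each of the six pairs.
  V*Err : V * Err ≤ 7 * Z
  V*Err = ≡≤ (*-distribˡ-+ V (Disordered d) NGs) (+-mono-≤ disordered (≡≤ (trans (*-comm V NGs) (sym (∑σk-*ʳ V Side.NG))) (≤≡ (∑σk-mono ng) (∑σk-const Z))))
   where
   ng : ∀ σ k → Side.NG σ k * V ≤ Z
   ng σ k = *-cancelʳ-≤ _ _ N ⦃ N≢0 ⦄ (≡≤ (l (Side.NG σ k) V N) (≤-trans (*-monoʳ-≤ V (Side.NG-bound σ k)) (≡≤ (sym (l′ (8 * (d * d) + 12 * d) V Z))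
    (≤-trans (*-monoʳ-≤ Z (≤-trans (*-monoˡ-≤ V (m≤m+n (8 * (d * d) + 12 * d) 8)) hV)) ≤-refl))))
    where
    l : ∀ x v n → x * v * n ≡ v * (x * n)
    l = solve-∀
    l′ : ∀ x v z → z * (x * v) ≡ v * (x * z)
    l′ = solve-∀

  -- The factor 3 for the colour at 0 turns 24/(n+1) into 8/(n+1) and (14 + 7)/V into 7/V, where the
  -- second 7 is that of `V*Err`.
  close : ∀ {X P Q a b αP βP αQ βQ} → Approx P (3 * b) αP βP → Approx Q (3 * a) αQ βQ → αP ≤ 24 → βP ≤ 14 → αQ ≤ 24 → βQ ≤ 14 →
   3 * X + P ≤ Q + Err → Q ≤ 3 * X + P + Err → Close X a b
  close {X} {P} {Q} {a} {b} {αP} {βP} {αQ} {βQ} (uP , lP) (uQ , lQ) hαP hβP hαQ hβQ ≤Q Q≤ =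
   *-cancelˡ-≤ 3 (begin
    3 * (v * (f * X + b * Z))
     ≡⟨ e₁ v f X b Z ⟩
    v * (f * (3 * X)) + v * (3 * b * Z)
     ≤⟨ +-monoʳ-≤ (v * (f * (3 * X))) lP ⟩
    v * (f * (3 * X)) + (v * (f * P) + βP * (n' * (f * Z)))
     ≡⟨ e₂ v f (3 * X) P (βP * (n' * (f * Z))) ⟩
    v * (f * (3 * X + P)) + βP * (n' * (f * Z))
     ≤⟨ +-mono-≤ (*-monoʳ-≤ v (*-monoʳ-≤ f ≤Q)) (*-monoˡ-≤ (n' * (f * Z)) hβP) ⟩
    v * (f * (Q + Err)) + 14 * (n' * (f * Z))
     ≤⟨ split Q ⟩
    v * (f * Q) + 21 * (n' * (f * Z))
     ≤⟨ +-monoˡ-≤ (21 * (n' * (f * Z))) (≤-trans uQ (+-monoʳ-≤ (v * (3 * a * Z)) (*-monoˡ-≤ (V * (f * Z)) hαQ))) ⟩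
    v * (3 * a * Z) + 24 * (V * (f * Z)) + 21 * (n' * (f * Z))
     ≡⟨ e₃ v a Z V n' f ⟩
    3 * (v * (a * Z) + (7 * n' + 8 * V) * (f * Z)) ∎) ,
   *-cancelˡ-≤ 3 (begin
    3 * (v * (a * Z))
     ≡⟨ e₄ v a Z ⟩
    v * (3 * a * Z)
     ≤⟨ lQ ⟩
    v * (f * Q) + βQ * (n' * (f * Z))
     ≤⟨ +-mono-≤ (*-monoʳ-≤ v (*-monoʳ-≤ f Q≤)) (*-monoˡ-≤ (n' * (f * Z)) hβQ) ⟩
    v * (f * (3 * X + P + Err)) + 14 * (n' * (f * Z))
     ≤⟨ split (3 * X + P) ⟩
    v * (f * (3 * X + P)) + 21 * (n' * (f * Z))
     ≡⟨ cong (_+ 21 * (n' * (f * Z))) (e₅ v f (3 * X) P) ⟩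
    v * (f * (3 * X)) + v * (f * P) + 21 * (n' * (f * Z))
     ≤⟨ +-monoˡ-≤ (21 * (n' * (f * Z))) (+-monoʳ-≤ (v * (f * (3 * X))) (≤-trans uP (+-monoʳ-≤ (v * (3 * b * Z)) (*-monoˡ-≤ (V * (f * Z)) hαP)))) ⟩
    v * (f * (3 * X)) + (v * (3 * b * Z) + 24 * (V * (f * Z))) + 21 * (n' * (f * Z))
     ≡⟨ e₆ v f X b Z V n' ⟩
    3 * (v * (f * X + b * Z) + (7 * n' + 8 * V) * (f * Z)) ∎)
   where
   v : ℕ
   v = V * n'
   split : ∀ R → v * (f * (R + Err)) + 14 * (n' * (f * Z)) ≤ v * (f * R) + 21 * (n' * (f * Z))
   split R = ≡≤ (s₁ V n' f R Err Z) (≤≡ (+-monoʳ-≤ (V * n' * (f * R)) (+-monoˡ-≤ (14 * (n' * (f * Z))) (*-monoʳ-≤ (n' * f) V*Err))) (s₂ (V * n' * (f * R)) n' f Z))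
    where
    s₁ : ∀ V n f R e Z → V * n * (f * (R + e)) + 14 * (n * (f * Z)) ≡ V * n * (f * R) + (n * f * (V * e) + 14 * (n * (f * Z)))
    s₁ = solve-∀
    s₂ : ∀ x n f Z → x + (n * f * (7 * Z) + 14 * (n * (f * Z))) ≡ x + 21 * (n * (f * Z))
    s₂ = solve-∀
   e₁ : ∀ v f X b Z → 3 * (v * (f * X + b * Z)) ≡ v * (f * (3 * X)) + v * (3 * b * Z)
   e₁ = solve-∀
   e₂ : ∀ v f X P e → v * (f * X) + (v * (f * P) + e) ≡ v * (f * (X + P)) + e
   e₂ = solve-∀
   e₃ : ∀ v a Z V n f → v * (3 * a * Z) + 24 * (V * (f * Z)) + 21 * (n * (f * Z)) ≡ 3 * (v * (a * Z) + (7 * n + 8 * V) * (f * Z))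
   e₃ = solve-∀
   e₄ : ∀ v a Z → 3 * (v * (a * Z)) ≡ v * (3 * a * Z)
   e₄ = solve-∀
   e₅ : ∀ v f X P → v * (f * (X + P)) ≡ v * (f * X) + v * (f * P)
   e₅ = solve-∀
   e₆ : ∀ v f X b Z V n → v * (f * (3 * X)) + (v * (3 * b * Z) + 24 * (V * (f * Z))) + 21 * (n * (f * Z)) ≡ 3 * (v * (f * X + b * Z) + (7 * n + 8 * V) * (f * Z))
   e₆ = solve-∀

  private
   sized-agree : ∀ i χ → (∀ v i → χ v ≢ χ (flip v i)) → ∀ σ k → isolated σ k χ ≡ true → nongeneric σ χ ≡ false → does (rangeSize (lift χ) ≟ i) ≡ sized i σ k χ
   sized-agree i χ pr σ k iso g = cong (λ m → does (m ≟ i)) (O.range-ordered χ pr σ k iso g)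

   third : ∀ i → 3 * homs-of-size i d ≡ Tot d (λ χ → proper χ * 𝟙 (does (rangeSize (lift χ) ≟ i)))
   third i = rooted-third {d} (λ χ → 𝟙 (does (rangeSize (lift χ) ≟ i))) (λ χ χ' h → cong (λ m → 𝟙 (does (m ≟ i))) (rangeSize-ext (lift-ext h)))
    (λ χ → cong (λ m → 𝟙 (does (m ≟ i))) (rangeSize-ext (lift-rot χ)))

   above : ∀ i → 3 * homs-of-size i d ≤ Sized i + Err
   above i = ≡≤ (third i) (total-above (λ χ → does (rangeSize (lift χ) ≟ i)) (sized i) (sized-agree i))

   below : ∀ i → Sized i ≤ 3 * homs-of-size i d + Err
   below i = ≤-trans (total-below (λ χ → does (rangeSize (lift χ) ≟ i)) (sized i) (sized-agree i)) (+-monoˡ-≤ Err (≤-reflexive (sym (third i))))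

   add : ∀ x y p → x ≤ y + Err → x + p ≤ y + p + Err
   add x y p h = ≤≡ (+-monoˡ-≤ p h) (l y Err p)
    where
    l : ∀ y e p → y + e + p ≡ y + p + e
    l = solve-∀

   via : ∀ i {P Q} → Sized i + P ≡ Q → (3 * homs-of-size i d + P ≤ Q + Err) × (Q ≤ 3 * homs-of-size i d + P + Err)
   via i {P} e = ≤≡ (add (3 * homs-of-size i d) (Sized i) P (above i)) (cong (_+ Err) e) , ≡≤ (sym e) (add (Sized i) (3 * homs-of-size i d) P (below i))

   third-all : 3 * homs d ≡ Tot d (λ χ → proper χ * 1)
   third-all = rooted-third {d} (λ _ → 1) (λ _ _ _ → refl) (λ _ → refl)

   relax : ∀ {S s s' α β} → s ≡ s' → Approx S s α β → Approx S s' α β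
   relax refl h = h

  close⊤ : Close (homs d) (2 * E 2) 0
  close⊤ = close Approx-0 (relax (*-assoc 3 2 (E 2)) S⊤-approx) z≤n z≤n ≤-refl (m≤m+n 6 8)
   (≡≤ (trans (+-identityʳ _) third-all) (≤≡ (total-above (λ _ → true) (λ _ _ _ → true) (λ _ _ _ _ _ _ → refl)) (cong (_+ Err) Sized⊤)))
   (≡≤ (sym Sized⊤) (≤-trans (total-below (λ _ → true) (λ _ _ _ → true) (λ _ _ _ _ _ _ → refl)) (+-monoˡ-≤ Err (≤-reflexive (trans (sym third-all) (sym (+-identityʳ _)))))))

  close₃ : Close (homs-of-size 3 d) (2 * f) 0
  close₃ = close Approx-0 (relax (*-assoc 3 2 f) S₀-approx) z≤n z≤n z≤n (m≤m+n 6 8) (proj₁ ineqs) (proj₂ ineqs)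
   where ineqs = via 3 (trans (+-identityʳ (Sized 3)) Sized₃)

  close₄ : Close (homs-of-size 4 d) (4 * E 1) (4 * f)
  close₄ = close (relax (l f) (Approx-+ S₀-approx S₀-approx)) (relax (l (E 1)) S₁-approx) z≤n (m≤m+n 12 2) ≤-refl (m≤m+n 12 2) (proj₁ ineqs) (proj₂ ineqs)
   where
   ineqs = via 4 Sized₄
   l : ∀ x → 6 * x + 6 * x ≡ 3 * (4 * x)
   l = solve-∀

  close₅ : Close (homs-of-size 5 d) (2 * E 2 + 2 * f) (4 * E 1)
  close₅ = close (relax (l (E 1)) S₁-approx) (relax (l′ (E 2) f) (Approx-+ S⊤-approx S₀-approx)) ≤-refl (m≤m+n 12 2) ≤-refl (m≤m+n 12 2) (proj₁ ineqs) (proj₂ ineqs)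
   where
   ineqs = via 5 Sized₅
   l : ∀ x → 6 * x + 6 * x ≡ 3 * (4 * x)
   l = solve-∀
   l′ : ∀ x y → 6 * x + 6 * y ≡ 3 * (2 * x + 2 * y)
   l′ = solve-∀

-- From inequalities in ℕ to rational numbers.

frac : ℕ → ℕ → ℚ
frac j k = (ℤ.+ j) ℚ./ suc k

ℕ→ℚ-+ : ∀ m n → ℕ→ℚ (m + n) ≡ ℕ→ℚ m ℚ.+ ℕ→ℚ n
ℕ→ℚ-+ m n = ℚ.toℚᵘ-injective (ℚᵘ.≃-trans (ℚ.toℚᵘ-fromℚᵘ (mkℚᵘ (ℤ.+ (m + n)) 0)) (ℚᵘ.≃-trans (*≡* (l (ℤ.+ m) (ℤ.+ n)))
 (ℚᵘ.≃-sym (ℚᵘ.≃-trans (ℚ.toℚᵘ-homo-+ (ℕ→ℚ m) (ℕ→ℚ n)) (ℚᵘ.+-cong (ℚ.toℚᵘ-fromℚᵘ (mkℚᵘ (ℤ.+ m) 0)) (ℚ.toℚᵘ-fromℚᵘ (mkℚᵘ (ℤ.+ n) 0)))))))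
 where
 l : ∀ a b → (a ℤ.+ b) ℤ.* 1ℤ ≡ (a ℤ.* 1ℤ ℤ.+ b ℤ.* 1ℤ) ℤ.* 1ℤ
 l = ℤ-solve-∀

ℕ→ℚ-* : ∀ m n → ℕ→ℚ (m * n) ≡ ℕ→ℚ m ℚ.* ℕ→ℚ n
ℕ→ℚ-* m n = ℚ.toℚᵘ-injective (ℚᵘ.≃-trans (ℚ.toℚᵘ-fromℚᵘ (mkℚᵘ (ℤ.+ (m * n)) 0)) (ℚᵘ.≃-trans (*≡* (cong (ℤ._* 1ℤ) (ℤ.pos-* m n)))
 (ℚᵘ.≃-sym (ℚᵘ.≃-trans (ℚ.toℚᵘ-homo-* (ℕ→ℚ m) (ℕ→ℚ n)) (ℚᵘ.*-cong (ℚ.toℚᵘ-fromℚᵘ (mkℚᵘ (ℤ.+ m) 0)) (ℚ.toℚᵘ-fromℚᵘ (mkℚᵘ (ℤ.+ n) 0)))))))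

frac-* : ∀ j k → frac j k ℚ.* ℕ→ℚ (suc k) ≡ ℕ→ℚ j
frac-* j k = ℚ.toℚᵘ-injective (ℚᵘ.≃-trans (ℚᵘ.≃-trans (ℚ.toℚᵘ-homo-* (frac j k) (ℕ→ℚ (suc k))) (ℚᵘ.*-cong (ℚ.toℚᵘ-fromℚᵘ (mkℚᵘ (ℤ.+ j) k)) (ℚ.toℚᵘ-fromℚᵘ (mkℚᵘ (ℤ.+ suc k) 0))))
 (ℚᵘ.≃-trans (*≡* (trans (l (ℤ.+ j) (ℤ.+ suc k)) (cong (λ x → ℤ.+ j ℤ.* ℤ.+ suc x) (sym (*-identityʳ k))))) (ℚᵘ.≃-sym (ℚ.toℚᵘ-fromℚᵘ (mkℚᵘ (ℤ.+ j) 0)))))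
 where
 l : ∀ a b → (a ℤ.* b) ℤ.* 1ℤ ≡ a ℤ.* b
 l = ℤ-solve-∀

ℕ→ℚ-nonNeg : ∀ n → NonNegative (ℕ→ℚ n)
ℕ→ℚ-nonNeg n = ℚ.normalize-nonNeg n 1

ℕ→ℚ-pos : ∀ {n} → 1 ≤ n → Positive (ℕ→ℚ n)
ℕ→ℚ-pos {suc n} _ = ℚ.normalize-pos (suc n) 1

ℕ→ℚ-mono : ∀ {m n} → m ≤ n → ℕ→ℚ m ℚ.≤ ℕ→ℚ n
ℕ→ℚ-mono {m} {n} h = subst₂ ℚ._≤_ (ℚ.+-identityʳ (ℕ→ℚ m)) (trans (sym (ℕ→ℚ-+ m (n ∸ m))) (cong ℕ→ℚ (m+[n∸m]≡n h)))
 (ℚ.+-monoʳ-≤ (ℕ→ℚ m) (ℚ.nonNegative⁻¹ (ℕ→ℚ (n ∸ m)) ⦃ ℕ→ℚ-nonNeg (n ∸ m) ⦄))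

ℕ→ℚ-^ : ∀ n d → ℕ→ℚ (n ^ d) ≡ ℕ→ℚ n ^ℚ d
ℕ→ℚ-^ n zero = refl
ℕ→ℚ-^ n (suc d) = trans (ℕ→ℚ-* n (n ^ d)) (cong (ℕ→ℚ n ℚ.*_) (ℕ→ℚ-^ n d))

^ℚ-distrib-* : ∀ p q d → (p ℚ.* q) ^ℚ d ≡ p ^ℚ d ℚ.* q ^ℚ d
^ℚ-distrib-* p q zero = refl
^ℚ-distrib-* p q (suc d) = trans (cong (p ℚ.* q ℚ.*_) (^ℚ-distrib-* p q d)) (l p q (p ^ℚ d) (q ^ℚ d))
 where
 l : ∀ a b c e → a ℚ.* b ℚ.* (c ℚ.* e) ≡ a ℚ.* c ℚ.* (b ℚ.* e)
 l = solve 4 (λ a b c e → a :* b :* (c :* e) := a :* c :* (b :* e)) refl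

module _ (x : ℚ) (p D : ℕ) (x≡ : x ℚ.* ℕ→ℚ D ≡ ℕ→ℚ p) where
 open Series D

 expTerm-scale : ∀ k → expTerm x k ℚ.* ℕ→ℚ (scaleᴰ k) ≡ ℕ→ℚ (p ^ k)
 expTerm-scale zero = refl
 expTerm-scale (suc k) = trans (cong (expTerm x k ℚ.* x ℚ.* frac 1 k ℚ.*_) (trans (ℕ→ℚ-* (suc k * D) (scaleᴰ k)) (cong (ℚ._* ℕ→ℚ (scaleᴰ k)) (ℕ→ℚ-* (suc k) D))))
  (trans (l (expTerm x k) x (frac 1 k) (ℕ→ℚ (suc k)) (ℕ→ℚ D) (ℕ→ℚ (scaleᴰ k)))
  (trans (cong₂ ℚ._*_ (frac-* 1 k) (cong₂ ℚ._*_ x≡ (expTerm-scale k))) (trans (ℚ.*-identityˡ _) (sym (ℕ→ℚ-* p (p ^ k))))))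
  where
  l : ∀ e x g a b s → e ℚ.* x ℚ.* g ℚ.* (a ℚ.* b ℚ.* s) ≡ (g ℚ.* a) ℚ.* ((x ℚ.* b) ℚ.* (e ℚ.* s))
  l = solve 6 (λ e x g a b s → e :* x :* g :* (a :* b :* s) := (g :* a) :* ((x :* b) :* (e :* s))) refl

 expPartial-scale : ∀ m → expPartial x m ℚ.* ℕ→ℚ (scaleᴰ m) ≡ ℕ→ℚ (series p m)
 expPartial-scale zero = refl
 expPartial-scale (suc m) = trans (ℚ.*-distribʳ-+ (ℕ→ℚ (scaleᴰ (suc m))) (expPartial x m) (expTerm x (suc m)))
  (trans (cong₂ ℚ._+_ (trans (cong (expPartial x m ℚ.*_) (ℕ→ℚ-* (suc m * D) (scaleᴰ m))) (trans (l (expPartial x m) (ℕ→ℚ (suc m * D)) (ℕ→ℚ (scaleᴰ m)))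
   (trans (cong (ℕ→ℚ (suc m * D) ℚ.*_) (expPartial-scale m)) (sym (ℕ→ℚ-* (suc m * D) (series p m)))))) (expTerm-scale (suc m))) (sym (ℕ→ℚ-+ (suc m * D * series p m) (p ^ suc m))))
  where
  l : ∀ a b c → a ℚ.* (b ℚ.* c) ≡ b ℚ.* (a ℚ.* c)
  l = solve 3 (λ a b c → a :* (b :* c) := b :* (a :* c)) refl

∣∣-≤ : ∀ {x y} → x ℚ.≤ y → ℚ.- x ℚ.≤ y → ℚ.∣ x ∣ ℚ.≤ y
∣∣-≤ {x} h h' with ℚ.∣p∣≡p∨∣p∣≡-p x
... | inj₁ e = subst (ℚ._≤ _) (sym e) h
... | inj₂ e = subst (ℚ._≤ _) (sym e) h'

-- the two inequalities in ℕ are the two halves of |X - c Z| ≤ (7/V + 8/(n+1)) Z, where c = (a - b)/f, multiplied by V (n+1) f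
module _ (X Z V n f a b : ℕ) (c ε : ℚ) (1≤V : 1 ≤ V) (1≤f : 1 ≤ f) (c≡ : c ℚ.* ℕ→ℚ f ≡ ℕ→ℚ a ℚ.- ℕ→ℚ b) (ε≥ : ℕ→ℚ 7 ℚ.≤ ε ℚ.* ℕ→ℚ V)
 (upper : V * suc n * (f * X + b * Z) ≤ V * suc n * (a * Z) + (7 * suc n + 8 * V) * (f * Z))
 (lower : V * suc n * (a * Z) ≤ V * suc n * (f * X + b * Z) + (7 * suc n + 8 * V) * (f * Z)) where
 private
  v' n' f' X' Z' a' b' K R : ℚ
  v' = ℕ→ℚ V
  n' = ℕ→ℚ (suc n)
  f' = ℕ→ℚ f
  X' = ℕ→ℚ X
  Z' = ℕ→ℚ Z
  a' = ℕ→ℚ a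
  b' = ℕ→ℚ b
  K = v' ℚ.* n' ℚ.* f'
  R = (ℕ→ℚ 7 ℚ.* n' ℚ.+ ℕ→ℚ 8 ℚ.* v') ℚ.* (f' ℚ.* Z')

  K-pos : Positive K
  K-pos = ℚ.pos*pos⇒pos (v' ℚ.* n') ⦃ ℚ.pos*pos⇒pos v' ⦃ ℕ→ℚ-pos 1≤V ⦄ n' ⦃ ℕ→ℚ-pos {suc n} (s≤s z≤n) ⦄ ⦄ f' ⦃ ℕ→ℚ-pos 1≤f ⦄

  P≡ : ℕ→ℚ (V * suc n * (f * X + b * Z)) ≡ v' ℚ.* n' ℚ.* (f' ℚ.* X' ℚ.+ b' ℚ.* Z')
  P≡ = trans (ℕ→ℚ-* (V * suc n) _) (cong₂ ℚ._*_ (ℕ→ℚ-* V (suc n)) (trans (ℕ→ℚ-+ (f * X) (b * Z)) (cong₂ ℚ._+_ (ℕ→ℚ-* f X) (ℕ→ℚ-* b Z))))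

  Q≡ : ℕ→ℚ (V * suc n * (a * Z)) ≡ v' ℚ.* n' ℚ.* (a' ℚ.* Z')
  Q≡ = trans (ℕ→ℚ-* (V * suc n) _) (cong₂ ℚ._*_ (ℕ→ℚ-* V (suc n)) (ℕ→ℚ-* a Z))

  R≡ : ℕ→ℚ ((7 * suc n + 8 * V) * (f * Z)) ≡ R
  R≡ = trans (ℕ→ℚ-* (7 * suc n + 8 * V) (f * Z)) (cong₂ ℚ._*_ (trans (ℕ→ℚ-+ (7 * suc n) (8 * V)) (cong₂ ℚ._+_ (ℕ→ℚ-* 7 (suc n)) (ℕ→ℚ-* 8 V))) (ℕ→ℚ-* f Z))

  upper′ : v' ℚ.* n' ℚ.* (f' ℚ.* X' ℚ.+ b' ℚ.* Z') ℚ.≤ v' ℚ.* n' ℚ.* (a' ℚ.* Z') ℚ.+ R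
  upper′ = subst₂ ℚ._≤_ P≡ (trans (ℕ→ℚ-+ (V * suc n * (a * Z)) ((7 * suc n + 8 * V) * (f * Z))) (cong₂ ℚ._+_ Q≡ R≡)) (ℕ→ℚ-mono upper)

  lower′ : v' ℚ.* n' ℚ.* (a' ℚ.* Z') ℚ.≤ v' ℚ.* n' ℚ.* (f' ℚ.* X' ℚ.+ b' ℚ.* Z') ℚ.+ R
  lower′ = subst₂ ℚ._≤_ Q≡ (trans (ℕ→ℚ-+ (V * suc n * (f * X + b * Z)) ((7 * suc n + 8 * V) * (f * Z))) (cong₂ ℚ._+_ P≡ R≡)) (ℕ→ℚ-mono lower)

  K*diff : K ℚ.* (X' ℚ.- c ℚ.* Z') ≡ v' ℚ.* n' ℚ.* (f' ℚ.* X' ℚ.+ b' ℚ.* Z') ℚ.- v' ℚ.* n' ℚ.* (a' ℚ.* Z')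
  K*diff = trans (l₁ v' n' f' X' c Z') (trans (cong (λ t → v' ℚ.* n' ℚ.* (f' ℚ.* X') ℚ.- v' ℚ.* n' ℚ.* (t ℚ.* Z')) c≡) (l₂ v' n' f' X' Z' a' b'))
   where
   l₁ : ∀ v n f X c Z → v ℚ.* n ℚ.* f ℚ.* (X ℚ.- c ℚ.* Z) ≡ v ℚ.* n ℚ.* (f ℚ.* X) ℚ.- v ℚ.* n ℚ.* (c ℚ.* f ℚ.* Z)
   l₁ = solve 6 (λ v n f X c Z → v :* n :* f :* (X :- c :* Z) := v :* n :* (f :* X) :- v :* n :* (c :* f :* Z)) refl
   l₂ : ∀ v n f X Z a b → v ℚ.* n ℚ.* (f ℚ.* X) ℚ.- v ℚ.* n ℚ.* ((a ℚ.- b) ℚ.* Z) ≡ v ℚ.* n ℚ.* (f ℚ.* X ℚ.+ b ℚ.* Z) ℚ.- v ℚ.* n ℚ.* (a ℚ.* Z)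
   l₂ = solve 7 (λ v n f X Z a b → v :* n :* (f :* X) :- v :* n :* ((a :- b) :* Z) := v :* n :* (f :* X :+ b :* Z) :- v :* n :* (a :* Z)) refl

  R≤ : R ℚ.≤ K ℚ.* ((ε ℚ.+ frac 8 n) ℚ.* Z')
  R≤ = ℚ.≤-trans (ℚ.*-monoʳ-≤-nonNeg (f' ℚ.* Z') ⦃ ℚ.nonNeg*nonNeg⇒nonNeg f' ⦃ ℕ→ℚ-nonNeg f ⦄ Z' ⦃ ℕ→ℚ-nonNeg Z ⦄ ⦄
   (ℚ.+-monoˡ-≤ (ℕ→ℚ 8 ℚ.* v') (ℚ.*-monoʳ-≤-nonNeg n' ⦃ ℕ→ℚ-nonNeg (suc n) ⦄ ε≥)))
   (ℚ.≤-reflexive (trans (cong (λ t → (ε ℚ.* v' ℚ.* n' ℚ.+ t ℚ.* v') ℚ.* (f' ℚ.* Z')) (sym (frac-* 8 n))) (l ε v' n' f' Z' (frac 8 n))))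
   where
   l : ∀ ε v n f Z g → (ε ℚ.* v ℚ.* n ℚ.+ g ℚ.* n ℚ.* v) ℚ.* (f ℚ.* Z) ≡ v ℚ.* n ℚ.* f ℚ.* ((ε ℚ.+ g) ℚ.* Z)
   l = solve 6 (λ ε v n f Z g → (ε :* v :* n :+ g :* n :* v) :* (f :* Z) := v :* n :* f :* ((ε :+ g) :* Z)) refl

  difference : ∀ {p q r} → p ℚ.≤ q ℚ.+ r → p ℚ.- q ℚ.≤ r
  difference {p} {q} {r} h = subst (p ℚ.- q ℚ.≤_) (l q r) (ℚ.+-monoˡ-≤ (ℚ.- q) h)
   where
   l : ∀ q r → q ℚ.+ r ℚ.- q ≡ r
   l = solve 2 (λ q r → q :+ r :- q := r) refl

 closeTo : ℚ.∣ X' ℚ.- c ℚ.* Z' ∣ ℚ.≤ (ε ℚ.+ frac 8 n) ℚ.* Z'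
 closeTo = ∣∣-≤
  (ℚ.*-cancelˡ-≤-pos K ⦃ K-pos ⦄ (ℚ.≤-trans (ℚ.≤-reflexive K*diff) (ℚ.≤-trans (difference upper′) R≤)))
  (ℚ.*-cancelˡ-≤-pos K ⦃ K-pos ⦄ (ℚ.≤-trans (ℚ.≤-reflexive (trans (sym (ℚ.neg-distribʳ-* K _)) (trans (cong ℚ.-_ K*diff) (l (v' ℚ.* n' ℚ.* (f' ℚ.* X' ℚ.+ b' ℚ.* Z')) (v' ℚ.* n' ℚ.* (a' ℚ.* Z'))))))
   (ℚ.≤-trans (difference lower′) R≤)))
  where
  l : ∀ p q → ℚ.- (p ℚ.- q) ≡ q ℚ.- p
  l = solve 2 (λ p q → :- (p :- q) := q :- p) refl

-- Exponentially small errors.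

-- For s = 2h the power (1 + 1/s)^d is at most ((1 + 1/s)^s)^(t+1), and (1 + 1/s)^s ≤ 4.
ratio-power : ∀ h t d → 1 ≤ h → d ≤ 2 * h * suc t → suc (2 * h) ^ d ≤ 4 ^ suc t * (2 * h) ^ d
ratio-power h t d 1≤h d≤ = *-cancelʳ-≤ _ _ (s ^ e) ⦃ m^n≢0 s e ⦃ s≢0 ⦄ ⦄ (begin
 suc s ^ d * s ^ e           ≤⟨ *-monoʳ-≤ (suc s ^ d) (^-monoˡ-≤ e (n≤1+n s)) ⟩
 suc s ^ d * suc s ^ e       ≡⟨ trans (sym (^-distribˡ-+-* (suc s) d e)) (cong (suc s ^_) (m+[n∸m]≡n d≤)) ⟩
 suc s ^ (s * suc t)         ≡⟨ sym (^-*-assoc (suc s) s (suc t)) ⟩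
 (suc s ^ s) ^ suc t         ≤⟨ ^-monoˡ-≤ (suc t) (subst (λ x → x ^ s ≤ 4 * s ^ s) (+-comm s 1) (1+1/N-power h 1≤h)) ⟩
 (4 * s ^ s) ^ suc t         ≡⟨ trans (^-distrib-* (suc t) 4 (s ^ s)) (cong (4 ^ suc t *_) (^-*-assoc s s (suc t))) ⟩
 4 ^ suc t * s ^ (s * suc t) ≡⟨ cong (4 ^ suc t *_) (trans (cong (s ^_) (sym (m+[n∸m]≡n d≤))) (^-distribˡ-+-* s d e)) ⟩
 4 ^ suc t * (s ^ d * s ^ e) ≡⟨ sym (*-assoc (4 ^ suc t) _ _) ⟩
 4 ^ suc t * s ^ d * s ^ e   ∎)
 where
 s e : ℕ
 s = 2 * h
 e = s * suc t ∸ d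
 s≢0 : NonZero s
 s≢0 = >-nonZero (*-mono-≤ {1} {2} (s≤s z≤n) 1≤h)

Bounded : ℚ → (x V n Z : ℕ) → Set
Bounded c x V n Z = ∃ λ f → ∃ λ a → ∃ λ b → 1 ≤ f × c ℚ.* ℕ→ℚ f ≡ ℕ→ℚ a ℚ.- ℕ→ℚ b
 × V * suc n * (f * x + b * Z) ≤ V * suc n * (a * Z) + (7 * suc n + 8 * V) * (f * Z)
 × V * suc n * (a * Z) ≤ V * suc n * (f * x + b * Z) + (7 * suc n + 8 * V) * (f * Z)

-- q = s/(s+1), where (1 + 1/s)^s ≤ 4
module _ (h : ℕ) (s≡ : 40000 ≡ 2 * h) (S : ℕ → Setoid 0ℓ 0ℓ) (c : ℕ → ℚ) (X : ℕ → ℕ) (size : ∀ d → HasSize (S d) (X d)) where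
 private
  s : ℕ
  s = 2 * h

  1≤s : 1 ≤ s
  1≤s = ≤≡ (≤ᵇ⇒≤ 1 40000 tt) s≡

  1≤h : 1 ≤ h
  1≤h = positive h 1≤s
   where
   positive : ∀ h → 1 ≤ 2 * h → 1 ≤ h
   positive (suc h) _ = s≤s z≤n

  q : ℚ
  q = frac s s

  q-pos : Positive q
  q-pos = ℚ.normalize-pos s (suc s) ⦃ _ ⦄ ⦃ >-nonZero 1≤s ⦄

  q<1 : q ℚ.< 1ℚ
  q<1 = ℚ.*-cancelʳ-<-nonNeg (ℕ→ℚ (suc s)) ⦃ ℕ→ℚ-nonNeg (suc s) ⦄ (subst₂ ℚ._<_ (sym (frac-* s s)) (trans (sym (ℕ→ℚ-+ s 1)) (trans (cong ℕ→ℚ (+-comm s 1)) (sym (ℚ.*-identityˡ _))))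
   (subst (ℚ._< ℕ→ℚ s ℚ.+ ℕ→ℚ 1) (ℚ.+-identityʳ (ℕ→ℚ s)) (ℚ.+-monoʳ-< (ℕ→ℚ s) (ℚ.positive⁻¹ (ℕ→ℚ 1) ⦃ ℕ→ℚ-pos {1} (s≤s z≤n) ⦄))))

  V : ℕ → ℕ
  -- Then 7/V = 4^-(t+1) ≤ q^d by `ratio-power`, while the disordered colourings, a fraction
  -- 290/16^t at most, stay below 1/V.
  V t = 28 * 4 ^ t

  ε≥ : ∀ d t → d ≤ s * suc t → ℕ→ℚ 7 ℚ.≤ q ^ℚ d ℚ.* ℕ→ℚ (V t)
  ε≥ d t d≤ = ℚ.*-cancelʳ-≤-pos (ℕ→ℚ (suc s ^ d)) ⦃ ℕ→ℚ-pos (m^n>0 (suc s) d) ⦄ (subst₂ ℚ._≤_ (ℕ→ℚ-* 7 (suc s ^ d)) eq (ℕ→ℚ-mono bound))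
   where
   bound : 7 * suc s ^ d ≤ V t * s ^ d
   bound = ≤≡ (*-monoʳ-≤ 7 (ratio-power h t d 1≤h d≤)) (l (4 ^ t) (s ^ d))
    where
    l : ∀ x y → 7 * (4 * x * y) ≡ 28 * x * y
    l = solve-∀
   qs : q ^ℚ d ℚ.* ℕ→ℚ (suc s ^ d) ≡ ℕ→ℚ (s ^ d)
   qs = trans (cong (q ^ℚ d ℚ.*_) (ℕ→ℚ-^ (suc s) d)) (trans (sym (^ℚ-distrib-* q (ℕ→ℚ (suc s)) d)) (trans (cong (_^ℚ d) (frac-* s s)) (sym (ℕ→ℚ-^ s d))))
   eq : ℕ→ℚ (V t * s ^ d) ≡ q ^ℚ d ℚ.* ℕ→ℚ (V t) ℚ.* ℕ→ℚ (suc s ^ d)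
   eq = trans (ℕ→ℚ-* (V t) (s ^ d)) (trans (cong (ℕ→ℚ (V t) ℚ.*_) (sym qs)) (l (ℕ→ℚ (V t)) (q ^ℚ d) (ℕ→ℚ (suc s ^ d))))
    where
    l : ∀ a b c → a ℚ.* (b ℚ.* c) ≡ b ℚ.* a ℚ.* c
    l = solve 3 (λ a b c → a :* (b :* c) := b :* a :* c) refl

 asymptotics : (∀ d'' V → let d = suc (suc d'') in (8 * (d * d) + 12 * d + 8) * V ≤ 2 ^ suc d'' → V * Disordered d ≤ 2 ^ (2 ^ suc d'') → ∀ n → Bounded (c n) (X d) V n (2 ^ (2 ^ suc d''))) →
  SizeAsymp S c scale
 asymptotics bounded = q , ℚ.positive⁻¹ q ⦃ q-pos ⦄ , q<1 , s * t₁ , λ d hd → X d , size d , go d hd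
  where
  decay = disordered-decay s s≡
  t₀ t₁ : ℕ
  t₀ = proj₁ decay
  -- 36 = 4 · (4 + 5) is the threshold of `power≤2^ 4`, and 2s ≤ t gives d ≤ t².
  t₁ = t₀ + (36 + (11 + 2 * s))
  instance
   s≢0 : NonZero s
   s≢0 = >-nonZero 1≤s

  at : ∀ t d'' → let d = suc (suc d'') in t₁ ≤ t → s * t ≤ d → d ≤ s * suc t → CloseTo (X d) c (q ^ℚ d) (scale d)
  at t d'' t₁≤t st≤d d≤st n = let f , a , b , 1≤f , c≡ , up , lo = bounded d'' (V t) large disordered n in
   closeTo (X d) (2 ^ (2 ^ suc d'')) (V t) n f a b (c n) (q ^ℚ d) (*-mono-≤ {1} {28} (s≤s z≤n) (m^n>0 4 t)) 1≤f c≡ (ε≥ d t d≤st) up lo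
   where
   d Z : ℕ
   d = suc (suc d'')
   Z = 2 ^ (2 ^ suc d'')
   rest : 36 + (11 + 2 * s) ≤ t
   rest = ≤-trans (m≤n+m _ t₀) t₁≤t
   36≤t : 36 ≤ t
   36≤t = ≤-trans (m≤m+n 36 _) rest
   1≤t : 1 ≤ t
   1≤t = ≤-trans (m≤m+n 1 35) 36≤t
   4^t : 4 ^ t ≡ 2 ^ (2 * t)
   4^t = ^-*-assoc 2 2 t
   d≤tt : d ≤ t * t
   d≤tt = begin
    d            ≤⟨ d≤st ⟩
    s * (1 + t)  ≤⟨ *-monoʳ-≤ s (+-monoˡ-≤ t 1≤t) ⟩
    s * (t + t)  ≡⟨ l s t ⟩
    2 * s * t    ≤⟨ *-monoˡ-≤ t (≤-trans (m≤n+m (2 * s) 47) (≡≤ (+-assoc 36 11 (2 * s)) rest)) ⟩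
    t * t        ∎
    where
    l : ∀ s t → s * (t + t) ≡ 2 * s * t
    l = solve-∀
   large : (8 * (d * d) + 12 * d + 8) * V t ≤ 2 ^ suc d''
   large = begin
    (8 * (d * d) + 12 * d + 8) * V t
     ≤⟨ *-monoˡ-≤ (V t) (+-mono-≤ (+-monoʳ-≤ (8 * (d * d)) (*-monoʳ-≤ 12 (m≤n*m d d))) (*-monoʳ-≤ 8 {1} {d * d} (s≤s z≤n))) ⟩
    (8 * (d * d) + 12 * (d * d) + 8 * (d * d)) * (28 * 4 ^ t)
     ≡⟨ l (d * d) (4 ^ t) ⟩
    784 * (d * d * 4 ^ t)
     ≤⟨ *-mono-≤ (≤ᵇ⇒≤ 784 (2 ^ 10) tt) (*-mono-≤ (≤-trans (*-mono-≤ d≤tt d≤tt) (≡≤ (l′ t) (power≤2^ 4 t 36≤t))) (≤-reflexive 4^t)) ⟩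
    2 ^ 10 * (2 ^ t * 2 ^ (2 * t))
     ≡⟨ trans (cong (2 ^ 10 *_) (sym (^-distribˡ-+-* 2 t (2 * t)))) (sym (^-distribˡ-+-* 2 10 (t + 2 * t))) ⟩
    2 ^ (10 + (t + 2 * t))
     ≤⟨ ^-monoʳ-≤ 2 (s≤s⁻¹ exponent) ⟩
    2 ^ suc d'' ∎
    where
    l : ∀ x y → (8 * x + 12 * x + 8 * x) * (28 * y) ≡ 784 * (x * y)
    l = solve-∀
    l′ : ∀ t → t * t * (t * t) ≡ t * (t * (t * (t * 1)))
    l′ = solve-∀
    l″ : ∀ t → t + (t + 2 * t) ≡ 4 * t
    l″ = solve-∀
    exponent : 11 + (t + 2 * t) ≤ d
    exponent = ≤-trans (+-monoˡ-≤ (t + 2 * t) (≤-trans (m≤m+n 11 25) 36≤t)) (≡≤ (l″ t) (≤-trans (*-monoˡ-≤ t (≤≡ (≤ᵇ⇒≤ 4 40000 tt) s≡)) st≤d))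
   disordered : V t * Disordered d ≤ Z
   disordered = *-cancelʳ-≤ _ _ (2 ^ (4 * t)) ⦃ m^n≢0 2 (4 * t) ⦄ (begin
    V t * Disordered d * 2 ^ (4 * t)
     ≡⟨ *-assoc (V t) _ _ ⟩
    V t * (Disordered d * 2 ^ (4 * t))
     ≤⟨ *-monoʳ-≤ (V t) (proj₂ decay t d'' (≤-trans (m≤m+n t₀ _) t₁≤t) st≤d d≤st) ⟩
    28 * 4 ^ t * (290 * Z)
     ≡⟨ l (4 ^ t) Z ⟩
    Z * (8120 * 4 ^ t)
     ≤⟨ *-monoʳ-≤ Z (*-mono-≤ (≤-trans (≤ᵇ⇒≤ 8120 (2 ^ 13) tt) (^-monoʳ-≤ 2 (≤-trans (m≤m+n 13 23) (≤-trans 36≤t (m≤n*m t 2))))) (≤-reflexive 4^t)) ⟩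
    Z * (2 ^ (2 * t) * 2 ^ (2 * t))
     ≡⟨ cong (Z *_) (trans (sym (^-distribˡ-+-* 2 (2 * t) (2 * t))) (cong (2 ^_) (l′ t))) ⟩
    Z * 2 ^ (4 * t) ∎)
    where
    l : ∀ x z → 28 * x * (290 * z) ≡ z * (8120 * x)
    l = solve-∀
    l′ : ∀ t → 2 * t + 2 * t ≡ 4 * t
    l′ = solve-∀

  go : ∀ d → s * t₁ ≤ d → CloseTo (X d) c (q ^ℚ d) (scale d)
  go d hd = start d 2≤d (d / s) t₁≤t (≡≤ (*-comm s _) (≤≡ (m≤n+m (d / s * s) (d % s)) (sym (m≡m%n+[m/n]*n d s)))) (<⇒≤ d<)
   where
   d< : d < s * suc (d / s)
   d< = ≤-trans (s≤s (≤-reflexive (m≡m%n+[m/n]*n d s))) (≤≡ (+-monoˡ-≤ (d / s * s) (m%n<n d s)) (*-comm (suc (d / s)) s))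
   t₁≤t : t₁ ≤ d / s
   t₁≤t = s≤s⁻¹ (*-cancelˡ-< s t₁ (suc (d / s)) (≤-<-trans hd d<))
   2≤d : 2 ≤ d
   2≤d = ≤-trans (*-mono-≤ {1} {s} {2} {t₁} 1≤s (≤-trans (m≤m+n 2 (34 + (11 + 2 * s))) (m≤n+m _ t₀))) hd
   start : ∀ d → 2 ≤ d → ∀ t → t₁ ≤ t → s * t ≤ d → d ≤ s * suc t → CloseTo (X d) c (q ^ℚ d) (scale d)
   start (suc (suc d'')) _ t h₁ h₂ h₃ = at t d'' h₁ h₂ h₃
   start (suc zero) (s≤s ()) t h₁ h₂ h₃

-- The sizes of the families and their constants.

private
 size-𝓕 : ∀ d → HasSize (𝓕 d) (homs d)
 size-𝓕 d = size-of-homs (λ _ → ⊤) (λ _ → true) (λ _ → refl) (λ _ _ → tt) (λ _ _ → refl)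

 size-𝓕[_] : ∀ i d → HasSize (𝓕[ i ] d) (homs-of-size i d)
 size-𝓕[ i ] d = size-of-homs (λ f → HasSize (Image f) i) (λ f → does (rangeSize f ≟ i)) (λ h → cong (λ m → does (m ≟ i)) (rangeSize-ext h))
  (λ f e → subst (HasSize (Image f)) (does⁻ (rangeSize f) e) (has-rangeSize f)) (λ f h → does⁺ (size-unique (Image f) (has-rangeSize f) h))
  where
  does⁻ : ∀ m → does (m ≟ i) ≡ true → m ≡ i
  does⁻ m e = ≡ᵇ⇒≡ m i (subst T (sym e) tt)
  does⁺ : ∀ {m} → m ≡ i → does (m ≟ i) ≡ true
  does⁺ {m} e = T⇒≡ (≡⇒≡ᵇ m i e)

 module Constants (d'' n : ℕ) where
  N : ℕ
  N = 2 ^ suc d''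
  open Series (2 * N)

  f E₁ E₂ : ℕ
  f = scaleᴰ (suc n)
  E₁ = series (N * 1) (suc n)
  E₂ = series (N * 2) (suc n)

  1≤f : 1 ≤ f
  1≤f = go (suc n)
   where
   go : ∀ m → 1 ≤ scaleᴰ m
   go zero = s≤s z≤n
   go (suc m) = *-mono-≤ {1} {suc m * (2 * N)} (*-mono-≤ {1} {suc m} (s≤s z≤n) (*-mono-≤ {1} {2} (s≤s z≤n) (m^n>0 2 (suc d'')))) (go m)

  e-scale : eApprox n ℚ.* ℕ→ℚ f ≡ ℕ→ℚ E₂
  e-scale = expPartial-scale 1ℚ (N * 2) (2 * N) (trans (ℚ.*-identityˡ _) (cong ℕ→ℚ (*-comm 2 N))) (suc n)

  √e-scale : sqrteApprox n ℚ.* ℕ→ℚ f ≡ ℕ→ℚ E₁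
  √e-scale = expPartial-scale (frac 1 1) (N * 1) (2 * N)
   (trans (cong (frac 1 1 ℚ.*_) (ℕ→ℚ-* 2 N)) (trans (sym (ℚ.*-assoc (frac 1 1) (ℕ→ℚ 2) (ℕ→ℚ N))) (trans (cong (ℚ._* ℕ→ℚ N) (frac-* 1 1)) (trans (ℚ.*-identityˡ _) (cong ℕ→ℚ (sym (*-identityʳ N))))))) (suc n)

  times : ∀ k x y → x ℚ.* ℕ→ℚ f ≡ ℕ→ℚ y → ℕ→ℚ k ℚ.* x ℚ.* ℕ→ℚ f ≡ ℕ→ℚ (k * y)
  times k x y h = trans (ℚ.*-assoc (ℕ→ℚ k) x (ℕ→ℚ f)) (trans (cong (ℕ→ℚ k ℚ.*_) h) (sym (ℕ→ℚ-* k y)))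

  minus-zero : ∀ {x y} → x ≡ y → x ≡ y ℚ.- ℕ→ℚ 0
  minus-zero {x} refl = sym (ℚ.+-identityʳ x)

  c₃-scale : c𝓕₃ n ℚ.* ℕ→ℚ f ≡ ℕ→ℚ (2 * f) ℚ.- ℕ→ℚ 0
  c₃-scale = minus-zero (sym (ℕ→ℚ-* 2 f))

  c-scale : c𝓕 n ℚ.* ℕ→ℚ f ≡ ℕ→ℚ (2 * E₂) ℚ.- ℕ→ℚ 0
  c-scale = minus-zero (times 2 (eApprox n) E₂ e-scale)

  c₄-scale : c𝓕₄ n ℚ.* ℕ→ℚ f ≡ ℕ→ℚ (4 * E₁) ℚ.- ℕ→ℚ (4 * f)
  c₄-scale = trans (l (ℕ→ℚ 4 ℚ.* sqrteApprox n) (ℕ→ℚ 4) (ℕ→ℚ f)) (cong₂ ℚ._-_ (times 4 (sqrteApprox n) E₁ √e-scale) (sym (ℕ→ℚ-* 4 f)))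
   where
   l : ∀ a b f → (a ℚ.- b) ℚ.* f ≡ a ℚ.* f ℚ.- b ℚ.* f
   l = solve 3 (λ a b f → (a :- b) :* f := a :* f :- b :* f) refl

  c₅-scale : c𝓕₅ n ℚ.* ℕ→ℚ f ≡ ℕ→ℚ (2 * E₂ + 2 * f) ℚ.- ℕ→ℚ (4 * E₁)
  c₅-scale = trans (l (ℕ→ℚ 2 ℚ.* eApprox n) (ℕ→ℚ 4 ℚ.* sqrteApprox n) (ℕ→ℚ 2) (ℕ→ℚ f))
   (cong₂ ℚ._-_ (trans (cong₂ ℚ._+_ (times 2 (eApprox n) E₂ e-scale) (sym (ℕ→ℚ-* 2 f))) (sym (ℕ→ℚ-+ (2 * E₂) (2 * f)))) (times 4 (sqrteApprox n) E₁ √e-scale))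
   where
   l : ∀ a b c f → (a ℚ.- b ℚ.+ c) ℚ.* f ≡ (a ℚ.* f ℚ.+ c ℚ.* f) ℚ.- b ℚ.* f
   l = solve 4 (λ a b c f → (a :- b :+ c) :* f := (a :* f :+ c :* f) :- b :* f) refl

 module At (d'' V : ℕ) (large : (8 * (suc (suc d'') * suc (suc d'')) + 12 * suc (suc d'') + 8) * V ≤ 2 ^ suc d'')
  (disordered : V * Disordered (suc (suc d'')) ≤ 2 ^ (2 ^ suc d'')) (n : ℕ) where
  open Constants d'' n
  open Counting.Limits (cube d'') V large disordered n
  open Close

  d Z : ℕ
  d = suc (suc d'')
  Z = 2 ^ (2 ^ suc d'')

  bounded : Bounded (c𝓕 n) (homs d) V n Z
  bounded = f , 2 * E₂ , 0 , 1≤f , c-scale , upper close⊤ , lower close⊤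

  bounded₃ : Bounded (c𝓕₃ n) (homs-of-size 3 d) V n Z
  bounded₃ = f , 2 * f , 0 , 1≤f , c₃-scale , upper close₃ , lower close₃

  bounded₄ : Bounded (c𝓕₄ n) (homs-of-size 4 d) V n Z
  bounded₄ = f , 4 * E₁ , 4 * f , 1≤f , c₄-scale , upper close₄ , lower close₄

  bounded₅ : Bounded (c𝓕₅ n) (homs-of-size 5 d) V n Z
  bounded₅ = f , 2 * E₂ + 2 * f , 4 * E₁ , 1≤f , c₅-scale , upper close₅ , lower close₅

theorem1p4 : SizeAsymp 𝓕 c𝓕 scale
 × SizeAsymp 𝓕[ 3 ] c𝓕₃ scale
 × SizeAsymp 𝓕[ 4 ] c𝓕₄ scale
 × SizeAsymp 𝓕[ 5 ] c𝓕₅ scale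
theorem1p4 =
 asymptotics 20000 refl 𝓕 c𝓕 homs size-𝓕 At.bounded
 , asymptotics 20000 refl 𝓕[ 3 ] c𝓕₃ (homs-of-size 3) size-𝓕[ 3 ] At.bounded₃
 , asymptotics 20000 refl 𝓕[ 4 ] c𝓕₄ (homs-of-size 4) size-𝓕[ 4 ] At.bounded₄
 , asymptotics 20000 refl 𝓕[ 5 ] c𝓕₅ (homs-of-size 5) size-𝓕[ 5 ] At.bounded₅
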